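{- Fix a root system $\Phi$ of finite or affine type with Weyl group $W$. The assignment $(c,\alpha,\beta)\mapsto(\alpha\|\beta)_c$, where $c$ ranges over Coxeter elements of $W$ and $\alpha,\beta\in\Phi_c$, is the unique function $f$ satisfying: (P1) $f(c,-\alpha_i,\beta)=[\beta:\alpha_i]$ for every simple root $\alpha_i$ and every $\beta\in\Phi_c$; (P2) $f(c,\beta,-\alpha_i)=[\beta^\vee:\alpha_i^\vee]$ for every simple root $\alpha_i$ and every $\beta\in\Phi_c$; (P3) if $\Phi$ is affine, $f(c,\alpha,\beta)=(\alpha\|\beta)^\circ_c$ for all $\alpha,\beta\in\Phi_c^{T,\mathrm{re}}$; (P4) if $\Phi$ is affine, $f(c,\delta,\alpha)=f(c,\alpha,\delta)=0$ for all $\alpha\in\Phi_c^{T,\mathrm{re}}\cup\{\delta\}$; (P5) $f(c,\alpha,\beta)=f(scs,\sigma_s\alpha,\sigma_s\beta)$ for all $\alpha,\beta\in\Phi_c$ and every simple reflection $s$ that is initial or final in $c$.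
   Context: Setup. $A=(a_{ij})$ is a symmetrizable Cartan matrix ($d_ia_{ij}=d_ja_{ji}$, $d_i>0$); $V$ real vector space with basis $\Pi=\{\alpha_1,\dots,\alpha_n\}$; $\alpha_i^\vee=d_i^{ -1}\alpha_i$; $[v:\alpha_i]$, $[v:\alpha_i^\vee]$ are coordinates in the bases of simple roots and simple co-roots; $[x]_+=\max(x,0)$. $K$ symmetric bilinear form with $K(\alpha_i^\vee,\alpha_j)=a_{ij}$; $s_i(v)=v-K(\alpha_i^\vee,v)\alpha_i$; $W=\langle s_i\rangle$; $\Phi$ root system, $\Phi^+$ positive roots; for real $\beta$, $\beta^\vee=2\beta/K(\beta,\beta)$. Finite type: $K$ positive definite. Affine type: $K$ positive semidefinite, not definite, positive definite on spans of proper subsets of $\Pi$; then imaginary roots are nonzero multiples of $\delta$ (positive imaginary root closest to $0$, spanning $\ker K$, $W$-fixed), and $\delta^\vee$ denotes the positive imaginary root closest to $0$ of the root system of $A^T$ realized in $V$ with simple roots $\alpha_i^\vee$ (a positive multiple of $\delta$). A Coxeter element is a product of all simple reflections in some order; write $c=s_1\cdots s_n$ after reindexing. $s$ is initial (final) in $c$ if some reduced word for $c$ begins (ends) with $s$. For a simple reflection $s$ with simple root $\alpha_s$, $\sigma_s$ is the map on $-\Pi\cup\Phi^+$ with $\sigma_s(\alpha)=\alpha$ if $\alpha\in-\Pi\setminus\{ -\alpha_s\}$ and $\sigma_s(\alpha)=s(\alpha)$ otherwise. In finite type, $\Phi_c=\Phi^+\cup-\Pi$ for every $c$. In affine type: choose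 $\gamma$ with $(c-1)\gamma=\delta$ and let $U_c=\{v:K(\gamma,v)=0\}$ (independent of choice); $\Upsilon_c=\Phi\cap U_c$; $\Pi_c$ the unique minimal subset of $\Upsilon_c\cap\Phi^+$ whose nonnegative span contains $\Upsilon_c\cap\Phi^+$. $\Upsilon_c$ is a union of irreducible components, each an affine type A root system with simple roots the elements of $\Pi_c$ in it; each real root $\beta\in\Upsilon_c$ lies in one component and its tube support $\mathrm{Supp}_{\Pi_c}(\beta)$ is the set of elements of $\Pi_c$ with nonzero coefficient in its unique expansion in that component's simple roots (union for sets); component-full means containing all simple roots of some component. $\Phi_c^{T,\mathrm{re}}$ = positive real roots of $\Upsilon_c$ with non-component-full tube support; $\Phi_c=-\Pi\cup(\Phi^+\setminus U_c)\cup\Phi_c^{T,\mathrm{re}}\cup\{\delta\}$. Compatibility degree. For real $\alpha\in\Upsilon_c$, $\beta_j\in\Pi_c$ is adjacent to $\alpha$ if $\beta_j\in\mathrm{Supp}_{\Pi_c}(c\alpha)\cup\mathrm{Supp}_{\Pi_c}(c^{ -1}\alpha)$ but $\beta_j\notin\mathrm{Supp}_{\Pi_c}(\alpha)$; $\mathrm{adj}(\alpha,\beta)$ is the number of elements of $\Pi_c$ adjacent to $\alpha$ and in $\mathrm{Supp}_{\Pi_c}(\beta)$. For $\alpha,\beta\in\Phi_c^{T,\mathrm{re}}$: $(\alpha\|\beta)^\circ_c=-1$ if $\alpha=\beta$; $=0$ if one of $\mathrm{Supp}_{\Pi_c}(\alpha),\mathrm{Supp}_{\Pi_c}(\beta)$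 is properly contained in the other; $=\mathrm{adj}(\alpha,\beta)$ otherwise. For $\alpha,\beta\in\Phi_c$ (with $\alpha^\vee=\delta^\vee$ if $\alpha=\delta$) let $(\alpha\|\beta)_c^{\to}=-\sum_i[\alpha^\vee:\alpha_i^\vee][\beta:\alpha_i]-\sum_{1\le j<i\le n}a_{ij}[\alpha^\vee:\alpha_i^\vee]_+[\beta:\alpha_j]_+$ and $(\alpha\|\beta)_c^{\leftarrow}$ the same with the second sum over $1\le i<j\le n$. Then $(\alpha\|\beta)_c=\mathrm{adj}(\alpha,\beta)$ if (affine and) $\alpha,\beta\in\Phi_c^{T,\mathrm{re}}$ with $\mathrm{Supp}_{\Pi_c}(\{\alpha,\beta\})$ component-full, and $(\alpha\|\beta)_c=\max[(\alpha\|\beta)_c^{\to},(\alpha\|\beta)_c^{\leftarrow}]$ otherwise.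
   Formalization: The symmetrizing numbers d_i, the coordinates of the vectors of V (in particular of γ) and the values of the function f are taken to be rational rather than real. -}

module Defs where

open import Data.Nat as ℕ using (ℕ; zero; suc)
open import Data.Nat.Divisibility as ℕD using ()
open import Data.Integer as ℤ using (ℤ)
open import Data.Rational using (ℚ; 0ℚ; 1ℚ; _+_; _*_; _-_; -_; _÷_; _⊔_; _≤_; _<_; _/_; ≢-nonZero)
open import Data.Rational.Properties using () renaming (_≟_ to _≟ℚ_)
open import Data.Fin as Fin using (Fin)
open import Data.Fin.Properties using (any?)
open import Data.Vec as Vec using (Vec; lookup; tabulate; zipWith)
open import Data.Vec.Properties using (≡-dec)
open import Data.List as List using (List; []; _∷_; _++_; length; allFin; reverse)
open import Data.List.Relation.Binary.Permutation.Propositional using (_↭_)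
open import Data.Fin.Subset as Sub using (Subset; _∪_; _∩_; ∁; ∣_∣; _⊂_; ⊤)
open import Data.Product using (Σ; ∃; _×_; _,_)
open import Data.Sum using (_⊎_)
open import Data.Bool using (if_then_else_)
open import Data.Empty using (⊥)
open import Relation.Nullary using (¬_; Dec; yes; no; ¬?)
open import Relation.Nullary.Decidable using (⌊_⌋; _×-dec_)
open import Relation.Binary.PropositionalEquality using (_≡_; _≢_)
open import Relation.Binary.Construct.Closure.ReflexiveTransitive using (Star)

CartanMatrix : ℕ → Set
CartanMatrix n = Fin n → Fin n → ℤ

IsCartan : ∀ {n} → CartanMatrix n → Set
IsCartan {n} A =
  (∀ i → A i i ≡ ℤ.+ 2) ×
  (∀ i j → i ≢ j → A i j ℤ.≤ ℤ.+ 0) ×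
  (∀ i j → A i j ≡ ℤ.+ 0 → A j i ≡ ℤ.+ 0)

toℚ : ℤ → ℚ
toℚ z = z / 1

IsSymmetrizer : ∀ {n} → CartanMatrix n → (Fin n → ℚ) → Set
IsSymmetrizer A d =
  (∀ i → 0ℚ < d i) × (∀ i j → d i * toℚ (A i j) ≡ d j * toℚ (A j i))

sumQ : ∀ {k} → (Fin k → ℚ) → ℚ
sumQ {zero}  f = 0ℚ
sumQ {suc k} f = f Fin.zero + sumQ (λ i → f (Fin.suc i))

-- vectors of V, in coordinates w.r.t. the simple roots α_1..α_n
V : ℕ → Set
V n = Vec ℚ n

0ᵥ : ∀ {n} → V n
0ᵥ = Vec.replicate _ 0ℚ

_+ᵥ_ : ∀ {n} → V n → V n → V n
_+ᵥ_ = zipWith _+_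

_-ᵥ_ : ∀ {n} → V n → V n → V n
_-ᵥ_ = zipWith _-_

_·ᵥ_ : ∀ {n} → ℚ → V n → V n
q ·ᵥ v = Vec.map (q *_) v

sumV : ∀ {n k} → (Fin k → V n) → V n
sumV {n} {zero}  f = 0ᵥ
sumV {n} {suc k} f = f Fin.zero +ᵥ sumV (λ i → f (Fin.suc i))

e : ∀ {n} → Fin n → V n
e i = tabulate (λ j → if ⌊ i Fin.≟ j ⌋ then 1ℚ else 0ℚ)

negSimple : ∀ {n} → Fin n → V n
negSimple i = Vec.map -_ (e i)

[_]₊ : ℚ → ℚ
[ x ]₊ = x ⊔ 0ℚ

-- positive definiteness conditions are over ℚ (equivalent to ℝ for a rational form)
-- Everything depending on the (fixed) Cartan matrix and symmetrizer

module Roots {n : ℕ} (A : CartanMatrix n) (d : Fin n → ℚ) where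

  a : Fin n → Fin n → ℚ
  a i j = toℚ (A i j)

  K : V n → V n → ℚ
  K u v = sumQ (λ i → sumQ (λ j → lookup u i * lookup v j * (d i * a i j)))

  -- K(α_i^∨, v)
  Kc : Fin n → V n → ℚ
  Kc i v = sumQ (λ j → a i j * lookup v j)

  s : Fin n → V n → V n
  s i v = v -ᵥ (Kc i v ·ᵥ e i)

  actW : List (Fin n) → V n → V n
  actW []      v = v
  actW (i ∷ w) v = s i (actW w v)

  -- elements of W are represented faithfully by their matrices on V:
  -- row j = image of α_j
  Mat : Set
  Mat = Vec (V n) n

  matOf : List (Fin n) → Mat
  matOf w = tabulate (λ j → actW w (e j))

  apply : Mat → V n → V n
  apply M v = sumV (λ j → lookup v j ·ᵥ lookup M j)

  compose : Mat → Mat → Mat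
  compose M N = tabulate (λ j → apply M (lookup N j))

  conj : Fin n → Mat → Mat
  conj i M = compose (matOf (i ∷ [])) (compose M (matOf (i ∷ [])))

  ReducedFor : Mat → List (Fin n) → Set
  ReducedFor M w = matOf w ≡ M × (∀ w' → matOf w' ≡ M → length w ℕ.≤ length w')

  Initial : Fin n → Mat → Set
  Initial i M = ∃ λ w → ReducedFor M (i ∷ w)

  Final : Fin n → Mat → Set
  Final i M = ∃ λ w → ReducedFor M (w ++ (i ∷ []))

  IsOrdering : List (Fin n) → Set
  IsOrdering w = w ↭ allFin n

  cox : List (Fin n) → Mat
  cox w = matOf w

  RealRoot : V n → Set
  RealRoot v = Σ (List (Fin n)) λ w → Σ (Fin n) λ i → actW w (e i) ≡ v

  Pos : V n → Set
  Pos v = ∀ i → 0ℚ ≤ lookup v i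

  σ : Fin n → V n → V n
  σ i v with any? (λ j → ¬? (j Fin.≟ i) ×-dec ≡-dec _≟ℚ_ v (negSimple j))
  ... | yes _ = v
  ... | no  _ = s i v

  -- [β^∨ : α_i^∨] for a real root β (β^∨ = 2β/K(β,β)); junk value 0 if K(β,β)=0
  corootCoordRe : V n → Fin n → ℚ
  corootCoordRe v i with K v v ≟ℚ 0ℚ
  ... | yes _ = 0ℚ
  ... | no  p = ((toℚ (ℤ.+ 2) * d i) * lookup v i) ÷ K v v
    where instance _ = ≢-nonZero p

  arrowTo : (Fin n → ℚ) → V n → List (Fin n) → ℚ
  arrowTo cα β []       = 0ℚ
  arrowTo cα β (x ∷ xs) =
    List.foldr (λ y acc → a y x * [ cα y ]₊ * [ lookup β x ]₊ + acc) 0ℚ xs + arrowTo cα β xs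

  arrowFrom : (Fin n → ℚ) → V n → List (Fin n) → ℚ
  arrowFrom cα β []       = 0ℚ
  arrowFrom cα β (x ∷ xs) =
    List.foldr (λ y acc → a x y * [ cα x ]₊ * [ lookup β y ]₊ + acc) 0ℚ xs + arrowFrom cα β xs

  -- (α‖β)^→ and (α‖β)^← given the coroot coordinates cα of α
  compTo : (Fin n → ℚ) → V n → List (Fin n) → ℚ
  compTo cα β w = - sumQ (λ i → cα i * lookup β i) - arrowTo cα β w

  compFrom : (Fin n → ℚ) → V n → List (Fin n) → ℚ
  compFrom cα β w = - sumQ (λ i → cα i * lookup β i) - arrowFrom cα β w

  compMax : (Fin n → ℚ) → V n → List (Fin n) → ℚ
  compMax cα β w = compTo cα β w ⊔ compFrom cα β w

  FiniteType : Set
  FiniteType = ∀ v → v ≢ 0ᵥ → 0ℚ < K v v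

  AffineType : Set
  AffineType =
    (∀ v → 0ℚ ≤ K v v) ×
    (Σ (V n) λ v → v ≢ 0ᵥ × K v v ≤ 0ℚ) ×
    (∀ i v → lookup v i ≡ 0ℚ → v ≢ 0ᵥ → 0ℚ < K v v)

  -- δ: positive imaginary root closest to 0 = primitive positive integral vector in ker K
  IsDelta : Vec ℕ n → Set
  IsDelta δ =
    (∀ i → 0 ℕ.< lookup δ i) ×
    (∀ i → sumQ (λ j → a i j * toℚ (ℤ.+ lookup δ j)) ≡ 0ℚ) ×
    (∀ k → 2 ℕ.≤ k → ¬ (∀ i → k ℕD.∣ lookup δ i))

  -- δ^∨ in coordinates w.r.t. simple co-roots: the same for A^T
  IsDeltaVee : Vec ℕ n → Set
  IsDeltaVee m =
    (∀ i → 0 ℕ.< lookup m i) ×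
    (∀ i → sumQ (λ j → a j i * toℚ (ℤ.+ lookup m j)) ≡ 0ℚ) ×
    (∀ k → 2 ℕ.≤ k → ¬ (∀ i → k ℕD.∣ lookup m i))

  module FiniteCase where

    Root : V n → Set
    Root = RealRoot

    corootCoord : V n → Fin n → ℚ
    corootCoord = corootCoordRe

    PhiC : List (Fin n) → V n → Set
    PhiC w v = (∃ λ i → v ≡ negSimple i) ⊎ (Root v × Pos v)

    CompatIs : List (Fin n) → V n → V n → ℚ → Set
    CompatIs w α β q = q ≡ compMax (corootCoord α) β w

    Props : (Mat → V n → V n → ℚ) → Set
    Props f =
      (∀ w → IsOrdering w → ∀ i β → PhiC w β →
        f (cox w) (negSimple i) β ≡ lookup β i) ×
      (∀ w → IsOrdering w → ∀ i β → PhiC w β →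
        f (cox w) β (negSimple i) ≡ corootCoord β i) ×
      (∀ w → IsOrdering w → ∀ i → Initial i (cox w) ⊎ Final i (cox w) →
        ∀ α β → PhiC w α → PhiC w β →
        f (cox w) α β ≡ f (conj i (cox w)) (σ i α) (σ i β))

    Conclusion : Set
    Conclusion =
      (Σ (Mat → V n → V n → ℚ) Props) ×
      (∀ f → Props f → ∀ w → IsOrdering w → ∀ α β → PhiC w α → PhiC w β →
        CompatIs w α β (f (cox w) α β))

  -- Affine type, with δ and δ^∨ (coroot coordinates m)
  module AffineCase (δ m : Vec ℕ n) where

    δQ : V n
    δQ = Vec.map (λ k → toℚ (ℤ.+ k)) δ

    Imag : V n → Set
    Imag v = Σ ℤ λ k → k ≢ ℤ.+ 0 × v ≡ toℚ k ·ᵥ δQ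

    Root : V n → Set
    Root v = RealRoot v ⊎ Imag v

    corootCoord : V n → Fin n → ℚ
    corootCoord v i with ≡-dec _≟ℚ_ v δQ
    ... | yes _ = toℚ (ℤ.+ lookup m i)
    ... | no  _ = corootCoordRe v i

    module _ (γ : V n) where
      -- positive roots in Υ_c = Φ ∩ U_c
      UpsPos : V n → Set
      UpsPos v = Root v × Pos v × K γ v ≡ 0ℚ

      NonnegSpan : ∀ {k} → Vec (V n) k → Subset k → V n → Set
      NonnegSpan {k} P S v = Σ (Vec ℚ k) λ co →
        (∀ j → 0ℚ ≤ lookup co j) × (∀ j → lookup co j ≢ 0ℚ → j Sub.∈ S) ×
        sumV (λ j → lookup co j ·ᵥ lookup P j) ≡ v

      IsPiC : ∀ {k} → Vec (V n) k → Set
      IsPiC {k} P =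
        (∀ j → UpsPos (lookup P j)) ×
        (∀ i j → lookup P i ≡ lookup P j → i ≡ j) ×
        (∀ v → UpsPos v → NonnegSpan P ⊤ v) ×
        (∀ S → S ≢ ⊤ → ¬ (∀ v → UpsPos v → NonnegSpan P S v))

    -- irreducible components of Υ_c: connected components of the graph on Π_c
    Edge : ∀ {k} → Vec (V n) k → Fin k → Fin k → Set
    Edge P i j = K (lookup P i) (lookup P j) ≢ 0ℚ

    Conn : ∀ {k} → Vec (V n) k → Fin k → Fin k → Set
    Conn P = Star (Edge P)

    CompFull : ∀ {k} → Vec (V n) k → Subset k → Set
    CompFull P S = Σ _ λ j₀ → ∀ j → Conn P j₀ j → j Sub.∈ S

    SuppSpec : ∀ {k} → V n → Vec (V n) k → (V n → Subset k) → Set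
    SuppSpec {k} γ P supp = ∀ β → RealRoot β → K γ β ≡ 0ℚ →
      Σ (Vec ℚ k) λ co →
        (sumV (λ j → lookup co j ·ᵥ lookup P j) ≡ β) ×
        (Σ (Fin k) λ j₀ → ∀ j → lookup co j ≢ 0ℚ → Conn P j₀ j) ×
        (∀ j → (j Sub.∈ supp β → lookup co j ≢ 0ℚ) × (lookup co j ≢ 0ℚ → j Sub.∈ supp β))

    record AffData (w : List (Fin n)) : Set where
      field
        γ        : V n
        γ-eq     : actW w γ -ᵥ γ ≡ δQ
        k        : ℕ
        P        : Vec (V n) k
        P-spec   : IsPiC γ P
        supp     : V n → Subset k
        supp-spec : SuppSpec γ P supp

      TRe : V n → Set
      TRe v = RealRoot v × Pos v × K γ v ≡ 0ℚ × ¬ CompFull P (supp v)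

      PhiC : V n → Set
      PhiC v = (∃ λ i → v ≡ negSimple i) ⊎ (Root v × Pos v × K γ v ≢ 0ℚ) ⊎ TRe v ⊎ v ≡ δQ

      adjSet : V n → Subset k
      adjSet α = (supp (actW w α) ∪ supp (actW (reverse w) α)) ∩ ∁ (supp α)

      adj : V n → V n → ℚ
      adj α β = toℚ (ℤ.+ ∣ adjSet α ∩ supp β ∣)

      CircIs : V n → V n → ℚ → Set
      CircIs α β q =
        (α ≡ β → q ≡ - 1ℚ) ×
        (α ≢ β → (supp α ⊂ supp β ⊎ supp β ⊂ supp α) → q ≡ 0ℚ) ×
        (α ≢ β → ¬ (supp α ⊂ supp β ⊎ supp β ⊂ supp α) → q ≡ adj α β)

      CompatIs : V n → V n → ℚ → Set
      CompatIs α β q =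
        (TRe α × TRe β × CompFull P (supp α ∪ supp β) → q ≡ adj α β) ×
        (¬ (TRe α × TRe β × CompFull P (supp α ∪ supp β)) → q ≡ compMax (corootCoord α) β w)

    open AffData

    Props : (Mat → V n → V n → ℚ) → Set
    Props f =
      (∀ w → IsOrdering w → (D : AffData w) → ∀ i β → PhiC D β →
        f (cox w) (negSimple i) β ≡ lookup β i) ×
      (∀ w → IsOrdering w → (D : AffData w) → ∀ i β → PhiC D β →
        f (cox w) β (negSimple i) ≡ corootCoord β i) ×
      (∀ w → IsOrdering w → (D : AffData w) → ∀ α β → TRe D α → TRe D β →
        CircIs D α β (f (cox w) α β)) ×
      (∀ w → IsOrdering w → (D : AffData w) → ∀ α → TRe D α ⊎ α ≡ δQ →
        f (cox w) δQ α ≡ 0ℚ × f (cox w) α δQ ≡ 0ℚ) ×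
      (∀ w → IsOrdering w → (D : AffData w) → ∀ i → Initial i (cox w) ⊎ Final i (cox w) →
        ∀ α β → PhiC D α → PhiC D β →
        f (cox w) α β ≡ f (conj i (cox w)) (σ i α) (σ i β))

    Conclusion : Set
    Conclusion =
      (Σ (Mat → V n → V n → ℚ) Props) ×
      (∀ f → Props f → ∀ w → IsOrdering w → (D : AffData w) → ∀ α β → PhiC D α → PhiC D β →
        CompatIs D α β (f (cox w) α β))

-- For a word w of a Coxeter element c let E_w be its Euler form: the matrix of K made triangular along w.
-- Moving the first letter s of w to the end and applying s to both arguments preserves E_w, and on
-- nonnegative vectors the two arrow expressions are multiples of -E_w(α,β) and -E_w(β,α); hence (P5) for
-- their maximum. A root outside U_c reaches -Π by initial or by final moves, because its c-orbit drifts
-- along δ. So (P1), (P2) and (P5) determine f except on pairs from the tubes and δ, where (P3) and (P4)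
-- prescribe it.
--
-- In affine type K(γ,v) = E_w(v,δ). The inverse τ of c permutes Π_c, with one cycle for each component, and
-- E_w restricts to each component as the Euler form of an oriented cycle. A tube root that is not
-- component-full is therefore an arc of a cycle, and both (α‖β)° and the maximum of the arrow expressions
-- are read off from the ends of the two arcs. For f to depend on c alone, component-fullness is tested
-- without reference to Π_c, by the coordinate at one special simple root along a τ-orbit.
module Submission where
open import Defs
open import Data.Nat as ℕ using (ℕ; zero; suc)
import Data.Nat.Properties as ℕP
open import Data.Integer as ℤ using (ℤ)
import Data.Integer.Properties as ℤP
open import Data.Rational using (ℚ; mkℚ; 0ℚ; 1ℚ; _+_; _*_; _-_; -_; _⊔_; _≤_; _<_; _/_; 1/_; ≢-nonZero; positive; nonNegative; toℚᵘ)
import Data.Rational.Properties as ℚP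
open import Data.Nat.Coprimality as Coprimality using (1-coprimeTo)
open import Data.Rational.Unnormalised as ℚᵘ using (mkℚᵘ; *≡*; *≤*; *<*)
import Data.Rational.Unnormalised.Properties as ℚᵘP
open import Data.Rational.Solver
open +-*-Solver using (solve; _:=_; _:+_; _:*_; _:-_; :-_; con)
open import Data.Fin as Fin using (Fin)
import Data.Fin.Properties as FinP
open import Data.Vec as Vec using (Vec; lookup; tabulate)
import Data.Vec.Properties as VecP
open import Data.List as List using (List; []; _∷_; _++_; length; allFin; reverse)
import Data.List.Properties as ListP
open import Data.List.Membership.Propositional using (_∈_; _∉_; find; lose)
import Data.List.Membership.Propositional.Properties as MemP
open import Data.List.Relation.Unary.Any as Any using (here; there)
open import Data.List.Relation.Unary.All as All using (All; []; _∷_)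
open import Data.List.Relation.Unary.AllPairs using ([]; _∷_)
open import Data.List.Relation.Unary.Unique.Propositional using (Unique)
import Data.List.Relation.Unary.Unique.Propositional.Properties as UniqueP
open import Data.List.Relation.Binary.Permutation.Propositional as Perm using (_↭_; ↭-sym; ↭-trans; ↭-refl)
import Data.List.Relation.Binary.Permutation.Propositional.Properties as PermP
open import Data.Fin.Subset as Sub using (Subset; _∪_; _∩_; ∁; ∣_∣; _⊂_; ⊤)
import Data.Fin.Subset.Properties as SubP
open import Data.Product using (Σ; ∃; ∃₂; _×_; _,_; proj₁; proj₂)
open import Data.Sum using (_⊎_; inj₁; inj₂)
open import Data.Bool using (if_then_else_)
open import Data.Empty using (⊥; ⊥-elim)
open import Relation.Nullary using (¬_; Dec; yes; no; ¬?)
open import Relation.Nullary.Decidable using (⌊_⌋; _×-dec_; _⊎-dec_; map′; decidable-stable)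
open import Relation.Binary.Definitions using (Tri; tri<; tri≈; tri>)
open import Relation.Binary.PropositionalEquality
open import Relation.Binary.PropositionalEquality using () renaming (trans to infixr 5 _∙_)
open import Data.Vec using () renaming (lookup to infixl 21 _!_)
open import Relation.Binary.Construct.Closure.ReflexiveTransitive using (ε; _◅_; _◅◅_)
open import Function using (_∘_; case_of_)
import Algebra.Properties.CommutativeMonoid.Sum ℚP.+-0-commutativeMonoid as SumP
open import Data.Fin.Permutation using (permutation)
import Data.List.Membership.DecPropositional
import Data.Nat.Divisibility as ℕD

-- The obstacle is that `f` receives only the matrix of c, while supports and fullness are given
-- through `AffData`. All tests used by the function must be decidable from a word alone. Hence
-- roots are replaced by the arithmetic condition `IsRt`, and orbits of `τ` are searched over a
-- fixed range: Cartan integers lie between -4 and 4, so among `9 ^ n` + 1 translates of a root two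
-- have the same ones and agree modulo the radical of K.
--
-- No classification of affine types is used. The structure of the tubes comes from one special
-- simple root α_i. With w = p i q and ζ = p α_i, some root ξ supported away from i is congruent to
-- a multiple of ζ modulo δ. The parabolic subsystem without α_i is of finite type, so ξ can be made
-- simple there, and c becomes modulo δ a product of n - 2 reflections in roots of U_c. This ties
-- the components of Π_c to the cycles of τ. That such an α_i exists follows, by a Euclidean descent
-- on roots, from the coprimality of the coordinates of δ and of δ^∨.

module Rationals where
  2ℚ : ℚ
  2ℚ = toℚ (ℤ.+ 2)

  toℚ-u : ∀ z → toℚᵘ (toℚ z) ℚᵘ.≃ mkℚᵘ z 0
  toℚ-u z = ℚP.toℚᵘ-fromℚᵘ (mkℚᵘ z 0)

  toℚ-+ : ∀ a b → toℚ (a ℤ.+ b) ≡ toℚ a + toℚ b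
  toℚ-+ a b = ℚP.toℚᵘ-injective (ℚᵘP.≃-trans (toℚ-u (a ℤ.+ b)) (ℚᵘP.≃-trans
    (*≡* (cong (ℤ._* (ℤ.+ 1)) (sym (cong₂ ℤ._+_ (ℤP.*-identityʳ a) (ℤP.*-identityʳ b)))))
    (ℚᵘP.≃-sym (ℚᵘP.≃-trans (ℚP.toℚᵘ-homo-+ (toℚ a) (toℚ b)) (ℚᵘP.+-cong (toℚ-u a) (toℚ-u b))))))

  toℚ-* : ∀ a b → toℚ (a ℤ.* b) ≡ toℚ a * toℚ b
  toℚ-* a b = ℚP.toℚᵘ-injective (ℚᵘP.≃-trans (toℚ-u (a ℤ.* b))
    (ℚᵘP.≃-sym (ℚᵘP.≃-trans (ℚP.toℚᵘ-homo-* (toℚ a) (toℚ b)) (ℚᵘP.*-cong (toℚ-u a) (toℚ-u b)))))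

  toℚ-neg : ∀ a → toℚ (ℤ.- a) ≡ - toℚ a
  toℚ-neg a = ℚP.toℚᵘ-injective (ℚᵘP.≃-trans (toℚ-u (ℤ.- a))
    (ℚᵘP.≃-sym (ℚᵘP.≃-trans (ℚP.toℚᵘ-homo‿- (toℚ a)) (ℚᵘP.-‿cong (toℚ-u a)))))

  toℚ-mono : ∀ {a b} → a ℤ.≤ b → toℚ a ≤ toℚ b
  toℚ-mono {a} {b} p = ℚP.toℚᵘ-cancel-≤ (ℚᵘP.≤-respˡ-≃ (ℚᵘP.≃-sym (toℚ-u a)) (ℚᵘP.≤-respʳ-≃ (ℚᵘP.≃-sym (toℚ-u b))
    (*≤* (subst₂ ℤ._≤_ (sym (ℤP.*-identityʳ a)) (sym (ℤP.*-identityʳ b)) p))))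

  toℚ-cancel-< : ∀ {a b} → toℚ a < toℚ b → a ℤ.< b
  toℚ-cancel-< {a} {b} p with ℚᵘP.<-respˡ-≃ (toℚ-u a) (ℚᵘP.<-respʳ-≃ (toℚ-u b) (ℚP.toℚᵘ-mono-< p))
  ... | *<* q = subst₂ ℤ._<_ (ℤP.*-identityʳ a) (ℤP.*-identityʳ b) q

  toℚ-injective : ∀ {a b} → toℚ a ≡ toℚ b → a ≡ b
  toℚ-injective {a} {b} p with ℚᵘP.≃-trans (ℚᵘP.≃-sym (toℚ-u a)) (ℚᵘP.≃-trans (ℚP.toℚᵘ-cong p) (toℚ-u b))
  ... | *≡* h = subst₂ _≡_ (ℤP.*-identityʳ a) (ℤP.*-identityʳ b) h

  abstract
    0≤+ : ∀ {a b} → 0ℚ ≤ a → 0ℚ ≤ b → 0ℚ ≤ a + b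
    0≤+ p q = ℚP.+-mono-≤ p q

    0<+ : ∀ {a b} → 0ℚ < a → 0ℚ ≤ b → 0ℚ < a + b
    0<+ p q = ℚP.+-mono-<-≤ p q

    0≤* : ∀ {a b} → 0ℚ ≤ a → 0ℚ ≤ b → 0ℚ ≤ a * b
    0≤* {a} {b} p q = subst (_≤ a * b) (ℚP.*-zeroʳ a) (ℚP.*-monoˡ-≤-nonNeg a {{nonNegative p}} q)

    0<* : ∀ {a b} → 0ℚ < a → 0ℚ < b → 0ℚ < a * b
    0<* {a} {b} p q = subst (_< a * b) (ℚP.*-zeroʳ a) (ℚP.*-monoʳ-<-pos a {{positive p}} q)

    sub≥ : ∀ {a b} → 0ℚ ≤ b - a → a ≤ b
    sub≥ {a} {b} p = subst₂ _≤_ (ℚP.+-identityʳ a) (solve 2 (λ a b → a :+ (b :- a) := b) refl a b) (ℚP.+-monoʳ-≤ a p)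

    ≥sub : ∀ {a b} → a ≤ b → 0ℚ ≤ b - a
    ≥sub {a} {b} p = subst (_≤ b - a) (ℚP.+-inverseʳ a) (ℚP.+-monoˡ-≤ (- a) p)

    sub> : ∀ {a b} → 0ℚ < b - a → a < b
    sub> {a} {b} p = subst₂ _<_ (ℚP.+-identityʳ a) (solve 2 (λ a b → a :+ (b :- a) := b) refl a b) (ℚP.+-monoʳ-< a p)

    >sub : ∀ {a b} → a < b → 0ℚ < b - a
    >sub {a} {b} p = subst (_< b - a) (ℚP.+-inverseʳ a) (ℚP.+-monoˡ-< (- a) p)

    -- Inequalities are proved by exhibiting the difference of the two sides.
    by≤ : ∀ {a b} r → 0ℚ ≤ r → b - a ≡ r → a ≤ b
    by≤ r p e = sub≥ (subst (0ℚ ≤_) (sym e) p)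

    by< : ∀ {a b} r → 0ℚ < r → b - a ≡ r → a < b
    by< r p e = sub> (subst (0ℚ <_) (sym e) p)

    ≤0⇒ : ∀ {a} → a ≤ 0ℚ → 0ℚ ≤ - a
    ≤0⇒ = ℚP.neg-antimono-≤

    <0⇒ : ∀ {a} → a < 0ℚ → 0ℚ < - a
    <0⇒ = ℚP.neg-antimono-<

    0≤- : ∀ {a} → 0ℚ ≤ - a → a ≤ 0ℚ
    0≤- {a} p = by≤ (- a) p (solve 1 (λ a → con 0ℚ :- a := :- a) refl a)

    0≤sq : ∀ a → 0ℚ ≤ a * a
    0≤sq a with ℚP.≤-total 0ℚ a
    ... | inj₁ p = 0≤* p p
    ... | inj₂ p = subst (0ℚ ≤_) (solve 1 (λ a → (:- a) :* (:- a) := a :* a) refl a) (0≤* (≤0⇒ p) (≤0⇒ p))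

    ≢⇒<⊎> : ∀ {a} → a ≢ 0ℚ → a < 0ℚ ⊎ 0ℚ < a
    ≢⇒<⊎> {a} p with ℚP.<-cmp a 0ℚ
    ... | tri< q _ _ = inj₁ q
    ... | tri≈ _ q _ = ⊥-elim (p q)
    ... | tri> _ _ q = inj₂ q

    0<sq : ∀ {a} → a ≢ 0ℚ → 0ℚ < a * a
    0<sq {a} h with ≢⇒<⊎> h
    ... | inj₂ p = 0<* p p
    ... | inj₁ p = subst (0ℚ <_) (solve 1 (λ a → (:- a) :* (:- a) := a :* a) refl a) (0<* (<0⇒ p) (<0⇒ p))

    <⇒≱ : ∀ {a b} → a < b → ¬ (b ≤ a)
    <⇒≱ p q = ℚP.<-irrefl refl (ℚP.<-≤-trans p q)

    >⇒≢ : ∀ {a} → 0ℚ < a → a ≢ 0ℚ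
    >⇒≢ p e = ℚP.<-irrefl (sym e) p

    ≤⇒<⊎≡ : ∀ {a b} → a ≤ b → a < b ⊎ a ≡ b
    ≤⇒<⊎≡ {a} {b} p with ℚP.<-cmp a b
    ... | tri< q _ _ = inj₁ q
    ... | tri≈ _ q _ = inj₂ q
    ... | tri> _ _ q = ⊥-elim (<⇒≱ q p)

    pos-cancel : ∀ {a b} → 0ℚ < a → 0ℚ < a * b → 0ℚ < b
    pos-cancel {a} {b} p q = ℚP.*-cancelˡ-<-nonNeg a {{nonNegative (ℚP.<⇒≤ p)}} (subst (_< a * b) (sym (ℚP.*-zeroʳ a)) q)

    nonneg-cancel : ∀ {a b} → 0ℚ < a → 0ℚ ≤ a * b → 0ℚ ≤ b
    nonneg-cancel {a} {b} p q = ℚP.*-cancelˡ-≤-pos a {{positive p}} (subst (_≤ a * b) (sym (ℚP.*-zeroʳ a)) q)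

  inv : ∀ {a} → a ≢ 0ℚ → ℚ
  inv {a} p = (1/ a) {{≢-nonZero p}}

  abstract
    inv-r : ∀ {a} (p : a ≢ 0ℚ) → a * inv p ≡ 1ℚ
    inv-r {a} p = ℚP.*-inverseʳ a {{≢-nonZero p}}

    *-cancelˡ : ∀ {a b c} → a ≢ 0ℚ → a * b ≡ a * c → b ≡ c
    *-cancelˡ {a} {b} {c} p e = begin
      b                ≡⟨ lem b ⟩
      inv p * (a * b)  ≡⟨ cong (inv p *_) e ⟩
      inv p * (a * c)  ≡⟨ lem c ⟨
      c                ∎
      where
      open ≡-Reasoning
      lem : ∀ x → x ≡ inv p * (a * x)
      lem x = sym (ℚP.*-identityˡ x) ∙ cong (_* x) (sym (inv-r p)) ∙
        solve 3 (λ a i x → a :* i :* x := i :* (a :* x)) refl a (inv p) x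

    *≡0 : ∀ {a b} → a ≢ 0ℚ → a * b ≡ 0ℚ → b ≡ 0ℚ
    *≡0 {a} p e = *-cancelˡ p (e ∙ sym (ℚP.*-zeroʳ a))

    inv-pos : ∀ {a} (p : 0ℚ < a) → 0ℚ < inv (>⇒≢ p)
    inv-pos p = pos-cancel p (subst (0ℚ <_) (sym (inv-r (>⇒≢ p))) (ℚP.positive⁻¹ 1ℚ))

    0<1 : 0ℚ < 1ℚ
    0<1 = ℚP.positive⁻¹ 1ℚ

    0<2 : 0ℚ < 2ℚ
    0<2 = ℚP.positive⁻¹ 2ℚ

    0≤1 : 0ℚ ≤ 1ℚ
    0≤1 = ℚP.nonNegative⁻¹ 1ℚ

    sum≡0ˡ : ∀ {a b} → 0ℚ ≤ a → 0ℚ ≤ b → a + b ≡ 0ℚ → a ≡ 0ℚ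
    sum≡0ˡ {a} {b} p q e = ℚP.≤-antisym (by≤ b q (cong (_- a) (sym e) ∙ solve 2 (λ a b → a :+ b :- a := b) refl a b)) p

    sum≡0ʳ : ∀ {a b} → 0ℚ ≤ a → 0ℚ ≤ b → a + b ≡ 0ℚ → b ≡ 0ℚ
    sum≡0ʳ {a} {b} p q e = sum≡0ˡ q p (ℚP.+-comm b a ∙ e)

  Int : ℚ → Set
  Int q = Σ ℤ λ z → q ≡ toℚ z

  abstract
    int-+ : ∀ {a b} → Int a → Int b → Int (a + b)
    int-+ (x , refl) (y , refl) = x ℤ.+ y , sym (toℚ-+ x y)

    int-* : ∀ {a b} → Int a → Int b → Int (a * b)
    int-* (x , refl) (y , refl) = x ℤ.* y , sym (toℚ-* x y)

    int-neg : ∀ {a} → Int a → Int (- a)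
    int-neg (x , refl) = ℤ.- x , sym (toℚ-neg x)

    int-sub : ∀ {a b} → Int a → Int b → Int (a - b)
    int-sub p q = int-+ p (int-neg q)

    int-0 : Int 0ℚ
    int-0 = ℤ.+ 0 , refl

    int-1 : Int 1ℚ
    int-1 = ℤ.+ 1 , refl

    int-toℚ : ∀ z → Int (toℚ z)
    int-toℚ z = z , refl {x = toℚ z}

    int≥1 : ∀ {a} → Int a → 0ℚ < a → 1ℚ ≤ a
    int≥1 (x , refl) p = toℚ-mono {ℤ.+ 1} {x} (ℤP.i<j⇒suc[i]≤j {ℤ.+ 0} (toℚ-cancel-< {ℤ.+ 0} {x} p))

    int-ℕ : ∀ {a} → Int a → 0ℚ ≤ a → Σ ℕ λ m → a ≡ toℚ (ℤ.+ m)
    int-ℕ (ℤ.+ m , refl) p = m , refl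
    int-ℕ (ℤ.-[1+ m ] , refl) p = ⊥-elim (<⇒≱ (ℚP.≤-<-trans (toℚ-mono {ℤ.-[1+ m ]} {ℤ.-[1+ 0 ]} (ℤ.-≤- ℕ.z≤n)) (ℚP.negative⁻¹ (- 1ℚ))) p)

    int? : ∀ q → Dec (Int q)
    int? q = map′ (λ e → ℚ.numerator q , sym e) (λ { (z , refl) → cong toℚ (↥-toℚ z) }) (toℚ (ℚ.numerator q) ℚP.≟ q)
      where
      ↥-toℚ : ∀ z → ℚ.numerator (toℚ z) ≡ z
      ↥-toℚ z = cong ℚ.numerator (ℚP.fromℚᵘ-toℚᵘ (mkℚ z 0 (Coprimality.sym (1-coprimeTo ℤ.∣ z ∣))))

  -- Finite sums of rationals, the Kronecker delta and coordinates.

  abstract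
    sumQ-cong : ∀ {k} {f g : Fin k → ℚ} → (∀ i → f i ≡ g i) → sumQ f ≡ sumQ g
    sumQ-cong {zero}  h = refl
    sumQ-cong {suc k} h = cong₂ _+_ (h Fin.zero) (sumQ-cong (h ∘ Fin.suc))

    sumQ-0 : ∀ k → sumQ {k} (λ _ → 0ℚ) ≡ 0ℚ
    sumQ-0 zero    = refl
    sumQ-0 (suc k) = ℚP.+-identityˡ _ ∙ sumQ-0 k

    sumQ-+ : ∀ {k} (f g : Fin k → ℚ) → sumQ (λ i → f i + g i) ≡ sumQ f + sumQ g
    sumQ-+ {zero}  f g = refl
    sumQ-+ {suc k} f g = cong (f Fin.zero + g Fin.zero +_) (sumQ-+ (f ∘ Fin.suc) (g ∘ Fin.suc)) ∙
      solve 4 (λ a b c d → a :+ b :+ (c :+ d) := a :+ c :+ (b :+ d)) refl (f Fin.zero) (g Fin.zero) (sumQ (f ∘ Fin.suc)) (sumQ (g ∘ Fin.suc))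

    sumQ-* : ∀ {k} c (f : Fin k → ℚ) → sumQ (λ i → c * f i) ≡ c * sumQ f
    sumQ-* {zero}  c f = sym (ℚP.*-zeroʳ c)
    sumQ-* {suc k} c f = cong (c * f Fin.zero +_) (sumQ-* c (f ∘ Fin.suc)) ∙ sym (ℚP.*-distribˡ-+ c _ _)

    sumQ-swap : ∀ {k l} (f : Fin k → Fin l → ℚ) → sumQ (λ i → sumQ (λ j → f i j)) ≡ sumQ (λ j → sumQ (λ i → f i j))
    sumQ-swap {zero}  {l} f = sym (sumQ-0 l)
    sumQ-swap {suc k} {l} f = cong (sumQ (f Fin.zero) +_) (sumQ-swap (f ∘ Fin.suc)) ∙ sym (sumQ-+ (f Fin.zero) (λ j → sumQ (λ i → f (Fin.suc i) j)))

    sumQ-≥0 : ∀ {k} {f : Fin k → ℚ} → (∀ i → 0ℚ ≤ f i) → 0ℚ ≤ sumQ f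
    sumQ-≥0 {zero}  h = ℚP.≤-refl
    sumQ-≥0 {suc k} h = 0≤+ (h Fin.zero) (sumQ-≥0 (h ∘ Fin.suc))

    sumQ≡0 : ∀ {k} {f : Fin k → ℚ} → (∀ i → 0ℚ ≤ f i) → sumQ f ≡ 0ℚ → ∀ i → f i ≡ 0ℚ
    sumQ≡0 {suc k} h e Fin.zero    = sum≡0ˡ (h Fin.zero) (sumQ-≥0 (h ∘ Fin.suc)) e
    sumQ≡0 {suc k} h e (Fin.suc i) = sumQ≡0 (h ∘ Fin.suc) (sum≡0ʳ (h Fin.zero) (sumQ-≥0 (h ∘ Fin.suc)) e) i

    sumQ-≥1 : ∀ {k} {f : Fin k → ℚ} → (∀ i → 0ℚ ≤ f i) → ∀ i → f i ≤ sumQ f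
    sumQ-≥1 {suc k} {f} h Fin.zero    = by≤ _ (sumQ-≥0 (h ∘ Fin.suc)) (solve 2 (λ a b → a :+ b :- a := b) refl (f Fin.zero) (sumQ (f ∘ Fin.suc)))
    sumQ-≥1 {suc k} {f} h (Fin.suc i) = ℚP.≤-trans (sumQ-≥1 (h ∘ Fin.suc) i) (by≤ _ (h Fin.zero) (solve 2 (λ a b → a :+ b :- b := a) refl (f Fin.zero) (sumQ (f ∘ Fin.suc))))

    sumQ≢0 : ∀ {k} {f : Fin k → ℚ} → sumQ f ≢ 0ℚ → ∃ λ i → f i ≢ 0ℚ
    sumQ≢0 {k} {f} h with FinP.any? (λ i → ¬? (f i ℚP.≟ 0ℚ))
    ... | yes p = p
    ... | no p = ⊥-elim (h (sumQ-cong (λ i → decidable-stable (f i ℚP.≟ 0ℚ) (λ q → p (i , q))) ∙ sumQ-0 k))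

    sumQ>0 : ∀ {k} {f : Fin k → ℚ} → 0ℚ < sumQ f → ∃ λ i → 0ℚ < f i
    sumQ>0 {zero} h = ⊥-elim (ℚP.<-irrefl refl h)
    sumQ>0 {suc k} {f} h = go (0ℚ ℚP.<? f Fin.zero)
      where
      le : ¬ (0ℚ < f Fin.zero) → f Fin.zero + sumQ (f ∘ Fin.suc) ≤ sumQ (f ∘ Fin.suc)
      le p = by≤ {f Fin.zero + sumQ (f ∘ Fin.suc)} {sumQ (f ∘ Fin.suc)} (- f Fin.zero) (≤0⇒ (ℚP.≮⇒≥ p))
        (solve 2 (λ a b → b :- (a :+ b) := :- a) refl (f Fin.zero) (sumQ (f ∘ Fin.suc)))
      go : Dec (0ℚ < f Fin.zero) → ∃ λ i → 0ℚ < f i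
      go (yes p) = Fin.zero , p
      go (no p) = Fin.suc (proj₁ r) , proj₂ r
        where
        r : ∃ λ i → 0ℚ < f (Fin.suc i)
        r = sumQ>0 {k} {f ∘ Fin.suc} (ℚP.<-≤-trans {0ℚ} {f Fin.zero + sumQ (f ∘ Fin.suc)} {sumQ (f ∘ Fin.suc)} h (le p))

    sumQ-int : ∀ {k} {f : Fin k → ℚ} → (∀ i → Int (f i)) → Int (sumQ f)
    sumQ-int {zero}  h = int-0
    sumQ-int {suc k} h = int-+ (h Fin.zero) (sumQ-int (h ∘ Fin.suc))

    sumQ≡sum : ∀ {k} (f : Fin k → ℚ) → sumQ f ≡ SumP.sum f
    sumQ≡sum {zero}  f = refl
    sumQ≡sum {suc k} f = cong (f Fin.zero +_) (sumQ≡sum (f ∘ Fin.suc))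

    sumQ-permute : ∀ {k} (π π⁻ : Fin k → Fin k) → (∀ i → π (π⁻ i) ≡ i) → (∀ i → π⁻ (π i) ≡ i) →
      ∀ f → sumQ (λ i → f (π i)) ≡ sumQ f
    sumQ-permute π π⁻ p q f = sumQ≡sum (λ i → f (π i)) ∙ sym (SumP.sum-permute f (permutation π π⁻ p q)) ∙ sym (sumQ≡sum f)

  δδ : ∀ {k} → Fin k → Fin k → ℚ
  δδ i j = if ⌊ i Fin.≟ j ⌋ then 1ℚ else 0ℚ

  abstract
    δδ-refl : ∀ {k} (i : Fin k) → δδ i i ≡ 1ℚ
    δδ-refl i with i Fin.≟ i
    ... | yes _ = refl
    ... | no p  = ⊥-elim (p refl)

    δδ-≢ : ∀ {k} {i j : Fin k} → i ≢ j → δδ i j ≡ 0ℚ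
    δδ-≢ {i = i} {j} h with i Fin.≟ j
    ... | yes p = ⊥-elim (h p)
    ... | no _  = refl

    δδ-suc : ∀ {k} (i j : Fin k) → δδ (Fin.suc i) (Fin.suc j) ≡ δδ i j
    δδ-suc i j = go (i Fin.≟ j)
      where
      go : Dec (i ≡ j) → δδ (Fin.suc i) (Fin.suc j) ≡ δδ i j
      go (yes refl) = δδ-refl (Fin.suc i) ∙ sym (δδ-refl i)
      go (no p) = δδ-≢ (λ e → p (FinP.suc-injective e)) ∙ sym (δδ-≢ p)

    δδ-sym : ∀ {k} (i j : Fin k) → δδ i j ≡ δδ j i
    δδ-sym i j = go (i Fin.≟ j)
      where
      go : Dec (i ≡ j) → δδ i j ≡ δδ j i
      go (yes refl) = refl
      go (no p) = δδ-≢ p ∙ sym (δδ-≢ (p ∘ sym))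

    sumQ-δ : ∀ {k} (i : Fin k) (f : Fin k → ℚ) → sumQ (λ j → δδ i j * f j) ≡ f i
    sumQ-δ {suc k} Fin.zero f = cong₂ _+_ (ℚP.*-identityˡ (f Fin.zero))
      (sumQ-cong (λ j → ℚP.*-zeroˡ (f (Fin.suc j))) ∙ sumQ-0 k) ∙ ℚP.+-identityʳ _
    sumQ-δ {suc k} (Fin.suc i) f = trans (cong₂ _+_ (ℚP.*-zeroˡ (f Fin.zero))
      (sumQ-cong (λ j → cong (_* f (Fin.suc j)) (δδ-suc i j)) ∙ sumQ-δ i (f ∘ Fin.suc))) (ℚP.+-identityˡ _)

  abstract
    vec-ext : ∀ {k} {X : Set} {u v : Vec X k} → (∀ j → u ! j ≡ v ! j) → u ≡ v
    vec-ext {u = u} {v} h = sym (VecP.tabulate∘lookup u) ∙ VecP.tabulate-cong h ∙ VecP.tabulate∘lookup v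

    lk-+ : ∀ {k} (u v : V k) j → (u +ᵥ v) ! j ≡ u ! j + v ! j
    lk-+ u v j = VecP.lookup-zipWith _+_ j u v

    lk-- : ∀ {k} (u v : V k) j → (u -ᵥ v) ! j ≡ u ! j - v ! j
    lk-- u v j = VecP.lookup-zipWith _-_ j u v

    lk-· : ∀ {k} q (v : V k) j → (q ·ᵥ v) ! j ≡ q * v ! j
    lk-· q v j = VecP.lookup-map j (q *_) v

    lk-0 : ∀ {k} (j : Fin k) → 0ᵥ {k} ! j ≡ 0ℚ
    lk-0 j = VecP.lookup-replicate j 0ℚ

    lk-e : ∀ {k} (i j : Fin k) → e i ! j ≡ δδ i j
    lk-e i j = VecP.lookup∘tabulate _ j

    lk-neg : ∀ {k} (i j : Fin k) → negSimple i ! j ≡ - δδ i j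
    lk-neg i j = VecP.lookup-map j -_ (e i) ∙ cong -_ (lk-e i j)

    lk-sumV : ∀ {n k} (f : Fin k → V n) j → sumV f ! j ≡ sumQ (λ l → f l ! j)
    lk-sumV {k = zero}  f j = lk-0 j
    lk-sumV {k = suc k} f j = lk-+ (f Fin.zero) _ j ∙ cong (lookup (f Fin.zero) j +_) (lk-sumV (f ∘ Fin.suc) j)

    ≢0ᵥ : ∀ {k} {v : V k} → v ≢ 0ᵥ → ∃ λ j → v ! j ≢ 0ℚ
    ≢0ᵥ {v = v} h with FinP.any? (λ i → ¬? (v ! i ℚP.≟ 0ℚ))
    ... | yes p = p
    ... | no p = ⊥-elim (h (vec-ext λ j → decidable-stable (v ! j ℚP.≟ 0ℚ) (λ q → p (j , q)) ∙ sym (lk-0 j)))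

    _≟ᵥ_ : ∀ {k} (u v : V k) → Dec (u ≡ v)
    _≟ᵥ_ = VecP.≡-dec ℚP._≟_

open Rationals

-- Linear maps, linear functionals and linear combinations.

module Vectors where
  abstract
    sub-as : ∀ {k} (u v : V k) → u -ᵥ v ≡ u +ᵥ ((- 1ℚ) ·ᵥ v)
    sub-as u v = vec-ext λ j → lk-- u v j ∙ solve 2 (λ a b → a :- b := a :+ (:- con 1ℚ) :* b) refl (u ! j) (v ! j) ∙
      sym (lk-+ u _ j ∙ cong (lookup u j +_) (lk-· (- 1ℚ) v j))

    +ᵥ-0 : ∀ {k} (u : V k) → u +ᵥ 0ᵥ ≡ u
    +ᵥ-0 u = vec-ext λ j → lk-+ u 0ᵥ j ∙ cong (lookup u j +_) (lk-0 j) ∙ ℚP.+-identityʳ (u ! j)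

    0-+ᵥ : ∀ {k} (u : V k) → 0ᵥ +ᵥ u ≡ u
    0-+ᵥ u = vec-ext λ j → lk-+ 0ᵥ u j ∙ cong (_+ lookup u j) (lk-0 j) ∙ ℚP.+-identityˡ (u ! j)

    -ᵥ-self : ∀ {k} (u : V k) → u -ᵥ u ≡ 0ᵥ
    -ᵥ-self u = vec-ext λ j → lk-- u u j ∙ ℚP.+-inverseʳ (u ! j) ∙ sym (lk-0 j)

    sub-add : ∀ {k} (u v : V k) → u ≡ v +ᵥ (u -ᵥ v)
    sub-add u v = vec-ext λ j → sym (lk-+ v (u -ᵥ v) j ∙ cong (lookup v j +_) (lk-- u v j) ∙
      solve 2 (λ a b → b :+ (a :- b) := a) refl (u ! j) (v ! j))

    -ᵥ≡0 : ∀ {k} {u v : V k} → u -ᵥ v ≡ 0ᵥ → u ≡ v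
    -ᵥ≡0 {u = u} {v} p = sub-add u v ∙ cong (v +ᵥ_) p ∙ +ᵥ-0 v

    ·ᵥ-0ᵥ : ∀ {k} q → q ·ᵥ 0ᵥ {k} ≡ 0ᵥ
    ·ᵥ-0ᵥ q = vec-ext λ j → lk-· q 0ᵥ j ∙ cong (q *_) (lk-0 j) ∙ ℚP.*-zeroʳ q ∙ sym (lk-0 j)

    0·ᵥ : ∀ {k} (u : V k) → 0ℚ ·ᵥ u ≡ 0ᵥ
    0·ᵥ u = vec-ext λ j → lk-· 0ℚ u j ∙ ℚP.*-zeroˡ (u ! j) ∙ sym (lk-0 j)

    1·ᵥ : ∀ {k} (u : V k) → 1ℚ ·ᵥ u ≡ u
    1·ᵥ u = vec-ext λ j → lk-· 1ℚ u j ∙ ℚP.*-identityˡ (u ! j)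

  record Linear {k l : ℕ} (f : V k → V l) : Set where
    constructor lin
    field
      add   : ∀ u v → f (u +ᵥ v) ≡ f u +ᵥ f v
      scale : ∀ q v → f (q ·ᵥ v) ≡ q ·ᵥ f v

    sub : ∀ u v → f (u -ᵥ v) ≡ f u -ᵥ f v
    sub u v = cong f (sub-as u v) ∙ add u _ ∙ cong (f u +ᵥ_) (scale (- 1ℚ) v) ∙ sym (sub-as (f u) (f v))

    zer : f 0ᵥ ≡ 0ᵥ
    zer = cong f (sym (0·ᵥ 0ᵥ)) ∙ scale 0ℚ 0ᵥ ∙ 0·ᵥ (f 0ᵥ)

    sum : ∀ {m} (g : Fin m → V k) → f (sumV g) ≡ sumV (λ j → f (g j))
    sum {zero}  g = zer
    sum {suc m} g = add (g Fin.zero) _ ∙ cong (f (g Fin.zero) +ᵥ_) (sum (g ∘ Fin.suc))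

  record Functional {k : ℕ} (f : V k → ℚ) : Set where
    constructor functional
    field
      add   : ∀ u v → f (u +ᵥ v) ≡ f u + f v
      scale : ∀ q v → f (q ·ᵥ v) ≡ q * f v

    sub : ∀ u v → f (u -ᵥ v) ≡ f u - f v
    sub u v = cong f (sub-as u v) ∙ add u ((- 1ℚ) ·ᵥ v) ∙ cong (f u +_) (scale (- 1ℚ) v) ∙
      solve 2 (λ a b → a :+ (:- con 1ℚ) :* b := a :- b) refl (f u) (f v)

    neg : ∀ v → f ((- 1ℚ) ·ᵥ v) ≡ - f v
    neg v = scale (- 1ℚ) v ∙ solve 1 (λ b → (:- con 1ℚ) :* b := :- b) refl (f v)

    zer : f 0ᵥ ≡ 0ℚ
    zer = cong f (sym (0·ᵥ 0ᵥ)) ∙ scale 0ℚ 0ᵥ ∙ ℚP.*-zeroˡ (f 0ᵥ)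

    sum : ∀ {m} (g : Fin m → V k) → f (sumV g) ≡ sumQ (λ j → f (g j))
    sum {zero}  g = zer
    sum {suc m} g = add (g Fin.zero) (sumV (g ∘ Fin.suc)) ∙ cong (f (g Fin.zero) +_) (sum (g ∘ Fin.suc))

    comb : ∀ {m} (c : Fin m → ℚ) (g : Fin m → V k) → f (sumV (λ j → c j ·ᵥ g j)) ≡ sumQ (λ j → c j * f (g j))
    comb c g = sum (λ j → c j ·ᵥ g j) ∙ sumQ-cong (λ j → scale (c j) (g j))

  abstract
    sumV-cong : ∀ {n k} {f g : Fin k → V n} → (∀ i → f i ≡ g i) → sumV f ≡ sumV g
    sumV-cong {k = zero}  h = refl
    sumV-cong {k = suc k} h = cong₂ _+ᵥ_ (h Fin.zero) (sumV-cong (h ∘ Fin.suc))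

    lookup-lin : ∀ {k} (j : Fin k) → Functional (λ v → v ! j)
    lookup-lin j = functional (λ u v → lk-+ u v j) (λ q v → lk-· q v j)

    lk-comb : ∀ {n k} (c : Fin k → ℚ) (g : Fin k → V n) j → sumV (λ l → c l ·ᵥ g l) ! j ≡ sumQ (λ l → c l * g l ! j)
    lk-comb c g j = Functional.comb (lookup-lin j) c g

    e-expand : ∀ {n} (v : V n) → sumV (λ j → v ! j ·ᵥ e j) ≡ v
    e-expand v = vec-ext λ i → lk-comb (lookup v) e i ∙
      sumQ-cong (λ j → cong (lookup v j *_) (lk-e j i ∙ δδ-sym j i) ∙ ℚP.*-comm (v ! j) (δδ i j)) ∙
      sumQ-δ i (lookup v)

    combine-comb : ∀ {n k} (f g : Fin k → ℚ) (q : ℚ) (p : Fin k → V n) →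
      sumV (λ l → (f l + q * g l) ·ᵥ p l) ≡ sumV (λ l → f l ·ᵥ p l) +ᵥ (q ·ᵥ sumV (λ l → g l ·ᵥ p l))
    combine-comb f g q p = vec-ext λ j → begin
      lookup (sumV (λ l → (f l + q * g l) ·ᵥ p l)) j ≡⟨ lk-comb (λ l → f l + q * g l) p j ⟩
      sumQ (λ l → (f l + q * g l) * p l ! j)
        ≡⟨ sumQ-cong (λ l → solve 4 (λ a b c x → (a :+ b :* c) :* x := a :* x :+ b :* (c :* x)) refl (f l) q (g l) (p l ! j)) ⟩
      sumQ (λ l → f l * p l ! j + q * (g l * p l ! j)) ≡⟨ sumQ-+ (λ l → f l * p l ! j) (λ l → q * (g l * p l ! j)) ⟩
      sumQ (λ l → f l * p l ! j) + sumQ (λ l → q * (g l * p l ! j))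
        ≡⟨ cong₂ _+_ (sym (lk-comb f p j)) (sumQ-* q (λ l → g l * p l ! j) ∙ cong (q *_) (sym (lk-comb g p j))) ⟩
      sumV (λ l → f l ·ᵥ p l) ! j + q * sumV (λ l → g l ·ᵥ p l) ! j
        ≡⟨ sym (lk-+ (sumV (λ l → f l ·ᵥ p l)) (q ·ᵥ sumV (λ l → g l ·ᵥ p l)) j ∙ cong (lookup (sumV (λ l → f l ·ᵥ p l)) j +_) (lk-· q (sumV (λ l → g l ·ᵥ p l)) j)) ⟩
      (sumV (λ l → f l ·ᵥ p l) +ᵥ (q ·ᵥ sumV (λ l → g l ·ᵥ p l))) ! j ∎
      where open ≡-Reasoning

    δδ-comb : ∀ {n k} (i : Fin k) (p : Fin k → V n) → sumV (λ l → δδ i l ·ᵥ p l) ≡ p i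
    δδ-comb i p = vec-ext λ j → lk-comb (δδ i) p j ∙ sumQ-δ i (λ l → p l ! j)

  abstract
    neg-simple : ∀ {k} (i : Fin k) → negSimple i ≡ (- 1ℚ) ·ᵥ e i
    neg-simple i = vec-ext λ j → lk-neg i j ∙ solve 1 (λ x → :- x := (:- con 1ℚ) :* x) refl (δδ i j) ∙
      sym (lk-· (- 1ℚ) (e i) j ∙ cong ((- 1ℚ) *_) (lk-e i j))

open Vectors

-- Sums over words, and words that use every letter once.

module Words where
  abstract
    -- Written as the very fold that occurs in `arrowTo` and `arrowFrom`, so that these can be
    -- rewritten through `lsum-def`.
    lsum : {X : Set} → List X → (X → ℚ) → ℚ
    lsum u f = List.foldr (λ k acc → f k + acc) 0ℚ u

    lsum-def : {X : Set} (u : List X) (f : X → ℚ) → lsum u f ≡ List.foldr (λ k acc → f k + acc) 0ℚ u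
    lsum-def u f = refl

    lsum-[] : {X : Set} (f : X → ℚ) → lsum [] f ≡ 0ℚ
    lsum-[] f = refl

    lsum-∷ : {X : Set} (x : X) (u : List X) (f : X → ℚ) → lsum (x ∷ u) f ≡ f x + lsum u f
    lsum-∷ x u f = refl

    lsum-cong : {X : Set} (u : List X) {f g : X → ℚ} → (∀ x → x ∈ u → f x ≡ g x) → lsum u f ≡ lsum u g
    lsum-cong []      h = refl
    lsum-cong (x ∷ u) h = cong₂ _+_ (h x (here refl)) (lsum-cong u (λ y p → h y (there p)))

    lsum-+ : {X : Set} (u : List X) (f g : X → ℚ) → lsum u (λ x → f x + g x) ≡ lsum u f + lsum u g
    lsum-+ []      f g = refl
    lsum-+ (x ∷ u) f g = cong (f x + g x +_) (lsum-+ u f g) ∙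
      solve 4 (λ a b c d → a :+ b :+ (c :+ d) := a :+ c :+ (b :+ d)) refl (f x) (g x) (lsum u f) (lsum u g)

    lsum-* : {X : Set} (u : List X) (c : ℚ) (f : X → ℚ) → lsum u (λ x → c * f x) ≡ c * lsum u f
    lsum-* []      c f = sym (ℚP.*-zeroʳ c)
    lsum-* (x ∷ u) c f = cong (c * f x +_) (lsum-* u c f) ∙ sym (ℚP.*-distribˡ-+ c (f x) (lsum u f))

    lsum-mid : {X : Set} (p : List X) (x : X) (q : List X) (f : X → ℚ) → lsum (p ++ x ∷ q) f ≡ f x + lsum (p ++ q) f
    lsum-mid []      x q f = refl
    lsum-mid (y ∷ p) x q f = cong (f y +_) (lsum-mid p x q f) ∙
      solve 3 (λ a b c → a :+ (b :+ c) := b :+ (a :+ c)) refl (f y) (f x) (lsum (p ++ q) f)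

    lsum-sumQ : ∀ {k} (w : List (Fin k)) → Unique w → (f : Fin k → ℚ) → (∀ j → j ∉ w → f j ≡ 0ℚ) → lsum w f ≡ sumQ f
    lsum-sumQ {k} [] _ f h = sym (sumQ-cong (λ j → h j (λ ())) ∙ sumQ-0 k)
    lsum-sumQ {k} (i ∷ w) (i∉ ∷ uq) f h = begin
      f i + lsum w f ≡⟨ cong (f i +_) (lsum-cong w (λ j p → sym (f'-≢ j (All.lookup i∉ p)))) ⟩
      f i + lsum w f' ≡⟨ cong (f i +_) (lsum-sumQ w uq f' h') ⟩
      f i + sumQ f' ≡⟨ cong (_+ sumQ f') (sym (sumQ-δ i f)) ⟩
      sumQ (λ j → δδ i j * f j) + sumQ f' ≡⟨ sumQ-+ (λ j → δδ i j * f j) f' ⟨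
      sumQ (λ j → δδ i j * f j + f' j) ≡⟨ sumQ-cong (λ j → solve 2 (λ x y → x :+ (y :- x) := y) refl (δδ i j * f j) (f j)) ⟩
      sumQ f ∎
      where
      open ≡-Reasoning
      f' : Fin k → ℚ
      f' j = f j - δδ i j * f j
      f'-≢ : ∀ j → i ≢ j → f' j ≡ f j
      f'-≢ j p = cong (λ t → f j - t * f j) (δδ-≢ p) ∙ solve 1 (λ x → x :- con 0ℚ :* x := x) refl (f j)
      h' : ∀ j → j ∉ w → f' j ≡ 0ℚ
      h' j p = go (i Fin.≟ j)
        where
        go : Dec (i ≡ j) → f' j ≡ 0ℚ
        go (yes refl) = cong (λ t → f i - t * f i) (δδ-refl i) ∙ solve 1 (λ x → x :- con 1ℚ :* x := con 0ℚ) refl (f i)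
        go (no q) = trans (f'-≢ j q) (h j λ { (here r) → q (sym r) ; (there r) → p r })

  private
    module Mem {k : ℕ} = Data.List.Membership.DecPropositional (Fin._≟_ {k})

  _∈ₗ?_ : ∀ {k} (j : Fin k) w → Dec (j ∈ w)
  _∈ₗ?_ = Mem._∈?_

  head∉ : ∀ {X : Set} {i : X} {u} → Unique (i ∷ u) → i ∉ u
  head∉ (h ∷ _) p = All.lookup h p refl

  uq-↭ : ∀ {X : Set} {u w : List X} → u ↭ w → Unique u → Unique w
  uq-↭ Perm.refl u = u
  uq-↭ (Perm.prep x p) (h ∷ u) = PermP.All-resp-↭ p h ∷ uq-↭ p u
  uq-↭ (Perm.swap x y p) ((x≢y ∷ hx) ∷ (hy ∷ u)) = ((x≢y ∘ sym) ∷ PermP.All-resp-↭ p hy) ∷ (PermP.All-resp-↭ p hx ∷ uq-↭ p u)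
  uq-↭ (Perm.trans p q) u = uq-↭ q (uq-↭ p u)

  snoc↭ : ∀ {X : Set} (i : X) u → i ∷ u ↭ u ++ i ∷ []
  snoc↭ i u = PermP.++-comm (i ∷ []) u

  uq-mid : ∀ {X : Set} (p : List X) {x q} → Unique (p ++ x ∷ q) → x ∉ p × x ∉ q × Unique (p ++ q)
  uq-mid p {x} {q} u with uq-↭ (PermP.shift x p q) u
  ... | h ∷ v = (λ m → All.lookup h (MemP.∈-++⁺ˡ m) refl) , (λ m → All.lookup h (MemP.∈-++⁺ʳ p m) refl) , v

  covers : ∀ {X : Set} {xs ys : List X} → Unique xs → (∀ x → x ∈ xs → x ∈ ys) → ∃ λ zs → ys ↭ xs ++ zs
  covers {xs = []} {ys} _ h = ys , ↭-refl
  covers {xs = x ∷ xs} (x∉ ∷ u) h with MemP.∈-∃++ (h x (here refl))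
  ... | p , q , refl with covers {xs = xs} {p ++ q} u sub
    where
    sub : ∀ y → y ∈ xs → y ∈ p ++ q
    sub y m with PermP.∈-resp-↭ (PermP.shift x p q) (h y (there m))
    ... | here r  = ⊥-elim (All.lookup x∉ m (sym r))
    ... | there r = r
  ... | zs , r = zs , ↭-trans (PermP.shift x p q) (Perm.prep x r)

  Cox : ∀ {n} → List (Fin n) → Set
  Cox {n} w = Unique w × (∀ j → j ∈ w)

  cox-ordering : ∀ {n} {w : List (Fin n)} → w ↭ allFin n → Cox w
  cox-ordering {n} p = uq-↭ (↭-sym p) (UniqueP.allFin⁺ n) , λ j → PermP.∈-resp-↭ (↭-sym p) (MemP.∈-allFin j)

  -- Covering `allFin n` leaves a remainder whose length is the excess of the length of w over n;
  -- length at most n forces it to be empty.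
  all-length : ∀ {n} {w : List (Fin n)} → (∀ j → j ∈ w) → n ℕ.≤ length w × (length w ℕ.≤ n → w ↭ allFin n)
  all-length {n} {w} h with covers (UniqueP.allFin⁺ n) (λ j _ → h j)
  ... | zs , p = subst (n ℕ.≤_) (sym len) (ℕP.m≤m+n n (length zs)) , λ le → shrink zs p (ℕP.n≤0⇒n≡0 (ℕP.+-cancelˡ-≤ n (length zs) 0
        (ℕP.≤-trans (ℕP.≤-reflexive (sym len)) (ℕP.≤-trans le (ℕP.≤-reflexive (sym (ℕP.+-identityʳ n)))))))
    where
    len : length w ≡ n ℕ.+ length zs
    len = PermP.↭-length p ∙ ListP.length-++ (allFin n) ∙ cong (ℕ._+ length zs) (ListP.length-tabulate (λ i → i))
    shrink : ∀ zs → w ↭ allFin n ++ zs → length zs ≡ 0 → w ↭ allFin n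
    shrink [] p _ = subst (w ↭_) (ListP.++-identityʳ (allFin n)) p

  ordering-cox : ∀ {n} {w : List (Fin n)} → Cox w → w ↭ allFin n
  ordering-cox {n} {w} (u , h) = proj₂ (all-length h) (subst (length w ℕ.≤_) (ListP.length-tabulate (λ i → i))
      (le (covers u (λ j _ → MemP.∈-allFin j))))
    where
    le : (∃ λ zs → allFin n ↭ w ++ zs) → length w ℕ.≤ length (allFin n)
    le (zs , p) = subst (length w ℕ.≤_) (sym (ListP.length-++ w) ∙ sym (PermP.↭-length p)) (ℕP.m≤m+n (length w) (length zs))

  cox-↭ : ∀ {n} {w w' : List (Fin n)} → w ↭ w' → Cox w → Cox w'
  cox-↭ p (u , h) = uq-↭ p u , λ j → PermP.∈-resp-↭ p (h j)

  words : ∀ {X : Set} → List X → ℕ → List (List X)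
  words xs zero    = [] ∷ []
  words xs (suc k) = List.cartesianProductWith _∷_ xs (words xs k)

  ∈-words : ∀ {k} (w : List (Fin k)) → w ∈ words (allFin k) (length w)
  ∈-words []      = here refl
  ∈-words (i ∷ w) = MemP.∈-cartesianProductWith⁺ _∷_ (MemP.∈-allFin i) (∈-words w)

open Words

-- Positive parts, and divisibility of rationals with an integral quotient.

module Multiples where
  []₊-nonneg : ∀ x → 0ℚ ≤ [ x ]₊
  []₊-nonneg x = ℚP.p≤q⊔p x 0ℚ

  []₊-cases : ∀ x → ([ x ]₊ ≡ x × 0ℚ ≤ x) ⊎ ([ x ]₊ ≡ 0ℚ × x ≤ 0ℚ)
  []₊-cases x = go (ℚP.≤-total 0ℚ x)
    where
    go : 0ℚ ≤ x ⊎ x ≤ 0ℚ → ([ x ]₊ ≡ x × 0ℚ ≤ x) ⊎ ([ x ]₊ ≡ 0ℚ × x ≤ 0ℚ)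
    go (inj₁ p) = inj₁ (ℚP.p≥q⇒p⊔q≡p p , p)
    go (inj₂ p) = inj₂ (ℚP.p≤q⇒p⊔q≡q p , p)

  -- The divisor may be any rational: it will be half the norm of a root, which depends on the
  -- scaling of the symmetrizer, and x / N is then a coroot coordinate or a Cartan integer.
  record _∣ᵢ_ (N x : ℚ) : Set where
    constructor dv
    field
      quo     : ℚ
      quo-int : Int quo
      quo-eq  : x ≡ N * quo
  open _∣ᵢ_ public

  abstract
    div-+ : ∀ {N x y} → N ∣ᵢ x → N ∣ᵢ y → N ∣ᵢ (x + y)
    div-+ {N} (dv q iq refl) (dv r ir refl) = dv (q + r) (int-+ iq ir) (sym (ℚP.*-distribˡ-+ N q r))

    div-* : ∀ {N x y} → N ∣ᵢ x → Int y → N ∣ᵢ (x * y)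
    div-* {N} {y = y} (dv q iq refl) iy = dv (q * y) (int-* iq iy) (ℚP.*-assoc N q y)

    div-*ˡ : ∀ {N x y} → Int y → N ∣ᵢ x → N ∣ᵢ (y * x)
    div-*ˡ {N} {y = y} iy (dv q iq refl) = dv (q * y) (int-* iq iy) (solve 3 (λ n q y → y :* (n :* q) := n :* (q :* y)) refl N q y)

    div-neg : ∀ {N x} → N ∣ᵢ x → N ∣ᵢ (- x)
    div-neg {N} (dv q iq refl) = dv (- q) (int-neg iq) (solve 2 (λ n q → :- (n :* q) := n :* (:- q)) refl N q)

    div-0 : ∀ {N} → N ∣ᵢ 0ℚ
    div-0 {N} = dv 0ℚ int-0 (sym (ℚP.*-zeroʳ N))

    div-sum : ∀ {N k} {f : Fin k → ℚ} → (∀ i → N ∣ᵢ f i) → N ∣ᵢ sumQ f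
    div-sum {k = zero}  h = div-0
    div-sum {k = suc k} h = div-+ (h Fin.zero) (div-sum (h ∘ Fin.suc))

    div-lsum : ∀ {X : Set} {N} (u : List X) {f : X → ℚ} → (∀ i → N ∣ᵢ f i) → N ∣ᵢ lsum u f
    div-lsum {N = N} [] {f} h = subst (N ∣ᵢ_) (sym (lsum-[] f)) div-0
    div-lsum {N = N} (x ∷ u) {f} h = subst (N ∣ᵢ_) (sym (lsum-∷ x u f)) (div-+ (h x) (div-lsum u h))

    div≥ : ∀ {N x} → 0ℚ < N → N ∣ᵢ x → 0ℚ < x → N ≤ x
    div≥ {N} N>0 (dv q iq refl) p = by≤ (N * (q - 1ℚ)) (0≤* (ℚP.<⇒≤ N>0) (≥sub (int≥1 iq (pos-cancel N>0 p))))
      (solve 2 (λ n q → n :* q :- n := n :* (q :- con 1ℚ)) refl N q)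

    int-δδ : ∀ {k} (i j : Fin k) → Int (δδ i j)
    int-δδ i j = go (i Fin.≟ j)
      where
      go : Dec (i ≡ j) → Int (δδ i j)
      go (yes refl) = subst Int (sym (δδ-refl i)) int-1
      go (no p) = subst Int (sym (δδ-≢ p)) int-0

    unit : ∀ {m q} → Int m → Int q → 0ℚ ≤ m → m * q ≡ 1ℚ → m ≡ 1ℚ
    unit {m} {q} im iq h e = ℚP.≤-antisym (by≤ (m * (q - 1ℚ)) (0≤* h (≥sub (int≥1 iq q>0)))
        (cong (_- m) (sym e) ∙ solve 2 (λ m q → m :* q :- m := m :* (q :- con 1ℚ)) refl m q)) (int≥1 im m>0)
      where
      m>0 : 0ℚ < m
      m>0 = go (≤⇒<⊎≡ h)
        where
        go : 0ℚ < m ⊎ 0ℚ ≡ m → 0ℚ < m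
        go (inj₁ p) = p
        go (inj₂ refl) = ⊥-elim (>⇒≢ 0<1 (sym e ∙ ℚP.*-zeroˡ q))
      q>0 : 0ℚ < q
      q>0 = pos-cancel m>0 (subst (0ℚ <_) (sym e) 0<1)

open Multiples

-- An encoding of the integers from -4 to 4.

module SmallIntegers where
  -- The values to be encoded are Cartan integers, which are bounded by 4 in absolute value. The
  -- catch-all clauses merge larger values with 4 and smaller ones with -4; `decode-code` claims an
  -- inverse only within the range.
  code : ℤ → Fin 9
  code (ℤ.+ 0) = Fin.zero
  code (ℤ.+ 1) = Fin.suc Fin.zero
  code (ℤ.+ 2) = Fin.suc (Fin.suc Fin.zero)
  code (ℤ.+ 3) = Fin.suc (Fin.suc (Fin.suc Fin.zero))
  code (ℤ.+ _) = Fin.suc (Fin.suc (Fin.suc (Fin.suc Fin.zero)))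
  code ℤ.-[1+ 0 ] = Fin.suc (Fin.suc (Fin.suc (Fin.suc (Fin.suc Fin.zero))))
  code ℤ.-[1+ 1 ] = Fin.suc (Fin.suc (Fin.suc (Fin.suc (Fin.suc (Fin.suc Fin.zero)))))
  code ℤ.-[1+ 2 ] = Fin.suc (Fin.suc (Fin.suc (Fin.suc (Fin.suc (Fin.suc (Fin.suc Fin.zero))))))
  code ℤ.-[1+ _ ] = Fin.suc (Fin.suc (Fin.suc (Fin.suc (Fin.suc (Fin.suc (Fin.suc (Fin.suc Fin.zero)))))))

  decode : Fin 9 → ℤ
  decode j with Fin.toℕ j
  ... | 5 = ℤ.-[1+ 0 ]
  ... | 6 = ℤ.-[1+ 1 ]
  ... | 7 = ℤ.-[1+ 2 ]
  ... | 8 = ℤ.-[1+ 3 ]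
  ... | m = ℤ.+ m

  decode-code : ∀ z → z ℤ.≤ ℤ.+ 4 → ℤ.- z ℤ.≤ ℤ.+ 4 → decode (code z) ≡ z
  decode-code (ℤ.+ 0) _ _ = refl
  decode-code (ℤ.+ 1) _ _ = refl
  decode-code (ℤ.+ 2) _ _ = refl
  decode-code (ℤ.+ 3) _ _ = refl
  decode-code (ℤ.+ 4) _ _ = refl
  decode-code (ℤ.+ suc (suc (suc (suc (suc m))))) (ℤ.+≤+ (ℕ.s≤s (ℕ.s≤s (ℕ.s≤s (ℕ.s≤s ()))))) _
  decode-code ℤ.-[1+ 0 ] _ _ = refl
  decode-code ℤ.-[1+ 1 ] _ _ = refl
  decode-code ℤ.-[1+ 2 ] _ _ = refl
  decode-code ℤ.-[1+ 3 ] _ _ = refl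
  decode-code ℤ.-[1+ suc (suc (suc (suc m))) ] _ (ℤ.+≤+ (ℕ.s≤s (ℕ.s≤s (ℕ.s≤s (ℕ.s≤s ())))))

open SmallIntegers

-- Minima, a total inverse and small Cartan integers.

module Divisors where
  argmin : ∀ {k} (f : Fin k → ℕ) → Fin k → ∃ λ i → ∀ j → f i ℕ.≤ f j
  argmin {suc zero} f _ = Fin.zero , λ { Fin.zero → ℕP.≤-refl }
  argmin {suc (suc k)} f _ with argmin (f ∘ Fin.suc) Fin.zero
  ... | i , h with ℕP.≤-total (f Fin.zero) (f (Fin.suc i))
  ...   | inj₁ p = Fin.zero , λ { Fin.zero → ℕP.≤-refl ; (Fin.suc j) → ℕP.≤-trans p (h j) }
  ...   | inj₂ p = Fin.suc i , λ { Fin.zero → p ; (Fin.suc j) → h j }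

  -- Set to 0 at 0, so that it can be applied to a half norm N before N is known to be nonzero, as
  -- in the function minimised in `δ-one`.
  recip : ℚ → ℚ
  recip x = go (x ℚP.≟ 0ℚ)
    where
    go : Dec (x ≡ 0ℚ) → ℚ
    go (yes _) = 0ℚ
    go (no p)  = inv p

  abstract
    recip-r : ∀ {x} → x ≢ 0ℚ → x * recip x ≡ 1ℚ
    recip-r {x} h with x ℚP.≟ 0ℚ
    ... | yes p = ⊥-elim (h p)
    ... | no p  = inv-r p

    int≥2 : ∀ {k} → Int k → 1ℚ ≤ k → k ≢ 1ℚ → 2ℚ ≤ k
    int≥2 {k} ik h ne = go (≤⇒<⊎≡ h)
      where
      go : 1ℚ < k ⊎ 1ℚ ≡ k → 2ℚ ≤ k
      go (inj₂ p) = ⊥-elim (ne (sym p))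
      go (inj₁ p) = by≤ (k - 1ℚ - 1ℚ) (≥sub (int≥1 (int-sub ik int-1) (>sub p))) (solve 1 (λ k → k :- con 2ℚ := k :- con 1ℚ :- con 1ℚ) refl k)

    two-two : ∀ {k k'} → 2ℚ ≤ k → 2ℚ ≤ k' → k * k' ≤ toℚ (ℤ.+ 4) → k ≡ 2ℚ
    two-two {k} {k'} h h' b = ℚP.≤-antisym (ℚP.*-cancelˡ-≤-pos 2ℚ (ℚP.≤-trans (by≤ (k * (k' - 2ℚ)) (0≤* (ℚP.≤-trans (ℚP.<⇒≤ 0<2) h) (≥sub h')) (solve 2 (λ k l → k :* l :- con 2ℚ :* k := k :* (l :- con 2ℚ)) refl k k')) b)) h

    toℚ-∸ : ∀ {h b} → b ℕ.≤ h → toℚ (ℤ.+ h) - toℚ (ℤ.+ b) ≡ toℚ (ℤ.+ (h ℕ.∸ b))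
    toℚ-∸ {h} {b} le = cong (λ s → toℚ (ℤ.+ s) - toℚ (ℤ.+ b)) (sym (ℕP.m∸n+n≡m le)) ∙ cong (_- toℚ (ℤ.+ b)) (toℚ-+ (ℤ.+ (h ℕ.∸ b)) (ℤ.+ b)) ∙
      solve 2 (λ x y → x :+ y :- y := x) refl (toℚ (ℤ.+ (h ℕ.∸ b))) (toℚ (ℤ.+ b))

open Divisors

-- Sums of nonnegative terms in which two terms are singled out.

module UnitCoefficients where
  abstract
    drop-at : ∀ {k} (f : Fin k → ℚ) i → sumQ (λ j → f j - δδ i j * f j) ≡ sumQ f - f i
    drop-at f i = sumQ-cong (λ j → solve 2 (λ a b → a :- b := a :+ (:- con 1ℚ) :* b) refl (f j) (δδ i j * f j)) ∙ sumQ-+ f (λ j → (- 1ℚ) * (δδ i j * f j)) ∙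
      cong (sumQ f +_) (sumQ-* (- 1ℚ) (λ j → δδ i j * f j) ∙ cong ((- 1ℚ) *_) (sumQ-δ i f)) ∙ solve 2 (λ a b → a :+ (:- con 1ℚ) :* b := a :- b) refl (sumQ f) (f i)

    drop-≥0 : ∀ {k} (f : Fin k → ℚ) i → (∀ j → 0ℚ ≤ f j) → ∀ j → 0ℚ ≤ f j - δδ i j * f j
    drop-≥0 f i h j = go (i Fin.≟ j)
      where
      go : Dec (i ≡ j) → 0ℚ ≤ f j - δδ i j * f j
      go (yes refl) = ℚP.≤-reflexive (sym (cong (λ t → f i - t * f i) (δδ-refl i) ∙ solve 1 (λ x → x :- con 1ℚ :* x := con 0ℚ) refl (f i)))
      go (no p) = subst (0ℚ ≤_) (sym (cong (λ t → f j - t * f j) (δδ-≢ p) ∙ solve 1 (λ x → x :- con 0ℚ :* x := x) refl (f j))) (h j)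

    drop-off : ∀ {k} (f : Fin k → ℚ) {i j} → i ≢ j → f j - δδ i j * f j ≡ f j
    drop-off f {i} {j} p = cong (λ t → f j - t * f j) (δδ-≢ p) ∙ solve 1 (λ x → x :- con 0ℚ :* x := x) refl (f j)

    sumQ-≥2 : ∀ {k} (f : Fin k → ℚ) {i j} → (∀ j → 0ℚ ≤ f j) → i ≢ j → f i + f j ≤ sumQ f
    sumQ-≥2 f {i} {j} h p = by≤ (sumQ f - f i - f j) (≥sub (subst₂ _≤_ (drop-off f p) (drop-at f i) (sumQ-≥1 {f = λ j → f j - δδ i j * f j} (drop-≥0 f i h) j)))
      (solve 3 (λ s a b → s :- (a :+ b) := s :- a :- b) refl (sumQ f) (f i) (f j))

    -- Removing the terms i and j leaves nonnegative terms with sum at most 0. In `arc` this shows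
    -- that apart from one rise and one fall all squared jumps vanish.
    sumQ-only2 : ∀ {k} (f : Fin k → ℚ) {i j} → (∀ j → 0ℚ ≤ f j) → i ≢ j → sumQ f ≤ f i + f j → ∀ l → l ≢ i → l ≢ j → f l ≡ 0ℚ
    sumQ-only2 {k} f {i} {j} h p le l l≢i l≢j = sym (drop-off f₁ (l≢j ∘ sym) ∙ drop-off f (l≢i ∘ sym)) ∙ sumQ≡0 {f = f₂} f₂≥0 zero′ l
      where
      f₁ f₂ : Fin k → ℚ
      f₁ t = f t - δδ i t * f t
      f₂ t = f₁ t - δδ j t * f₁ t
      f₂≥0 : ∀ t → 0ℚ ≤ f₂ t
      f₂≥0 = drop-≥0 f₁ j (drop-≥0 f i h)
      zero′ : sumQ f₂ ≡ 0ℚ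
      zero′ = ℚP.≤-antisym (subst (_≤ 0ℚ) (sym (drop-at f₁ j ∙ cong₂ _-_ (drop-at f i) (drop-off f p))) (by≤ (f i + f j - sumQ f) (≥sub le) (solve 3 (λ s a b → con 0ℚ :- (s :- a :- b) := a :+ b :- s) refl (sumQ f) (f i) (f j)))) (sumQ-≥0 f₂≥0)

open UnitCoefficients

-- Cardinality of a set with at most two possible members.

module PairSets where
  ∣pair∣ : ∀ {k} (p q : Fin k) → p ≢ q → ∣ Sub.⁅ p ⁆ ∪ Sub.⁅ q ⁆ ∣ ≡ 2
  ∣pair∣ Fin.zero Fin.zero h = ⊥-elim (h refl)
  ∣pair∣ Fin.zero (Fin.suc q) h = cong suc (cong ∣_∣ (SubP.∪-identityˡ Sub.⁅ q ⁆) ∙ SubP.∣⁅x⁆∣≡1 q)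
  ∣pair∣ (Fin.suc p) Fin.zero h = cong suc (cong ∣_∣ (SubP.∪-identityʳ Sub.⁅ p ⁆) ∙ SubP.∣⁅x⁆∣≡1 p)
  ∣pair∣ (Fin.suc p) (Fin.suc q) h = ∣pair∣ p q (h ∘ cong Fin.suc)

  module _ {k : ℕ} {S : Subset k} {p q : Fin k} (S⊆ : ∀ j → j Sub.∈ S → j ≡ p ⊎ j ≡ q) where
    card-0 : ¬ p Sub.∈ S → ¬ q Sub.∈ S → ∣ S ∣ ≡ 0
    card-0 hp hq = cong ∣_∣ (SubP.⊆-antisym {i = S} {j = Sub.⊥} (λ {j} m → ⊥-elim (none (S⊆ j m) m)) (λ m → ⊥-elim (SubP.∉⊥ m))) ∙ SubP.∣⊥∣≡0 k
      where
      none : ∀ {j} → j ≡ p ⊎ j ≡ q → ¬ j Sub.∈ S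
      none (inj₁ refl) = hp
      none (inj₂ refl) = hq

    card-p : p Sub.∈ S → q ≡ p ⊎ ¬ q Sub.∈ S → ∣ S ∣ ≡ 1
    card-p hp hq = cong ∣_∣ (SubP.⊆-antisym {i = S} {j = Sub.⁅ p ⁆} (λ {j} m → subst (Sub._∈ Sub.⁅ p ⁆) (sym (only (S⊆ j m) hq m)) (SubP.x∈⁅x⁆ p)) (λ {j} m → subst (Sub._∈ S) (sym (SubP.x∈⁅y⁆⇒x≡y p m)) hp)) ∙ SubP.∣⁅x⁆∣≡1 p
      where
      only : ∀ {j} → j ≡ p ⊎ j ≡ q → q ≡ p ⊎ ¬ q Sub.∈ S → j Sub.∈ S → j ≡ p
      only (inj₁ e) _ _ = e
      only (inj₂ refl) (inj₁ e) _ = e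
      only (inj₂ refl) (inj₂ h) m = ⊥-elim (h m)

    card-2 : p Sub.∈ S → q Sub.∈ S → p ≢ q → ∣ S ∣ ≡ 2
    card-2 hp hq h = cong ∣_∣ (SubP.⊆-antisym {i = S} {j = Sub.⁅ p ⁆ ∪ Sub.⁅ q ⁆} (λ {j} m → put (S⊆ j m)) (λ {j} m → get (SubP.x∈p∪q⁻ Sub.⁅ p ⁆ Sub.⁅ q ⁆ m))) ∙ ∣pair∣ p q h
      where
      put : ∀ {j} → j ≡ p ⊎ j ≡ q → j Sub.∈ Sub.⁅ p ⁆ ∪ Sub.⁅ q ⁆
      put (inj₁ refl) = SubP.x∈p∪q⁺ (inj₁ (SubP.x∈⁅x⁆ p))
      put (inj₂ refl) = SubP.x∈p∪q⁺ (inj₂ (SubP.x∈⁅x⁆ q))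
      get : ∀ {j} → j Sub.∈ Sub.⁅ p ⁆ ⊎ j Sub.∈ Sub.⁅ q ⁆ → j Sub.∈ S
      get (inj₁ m) = subst (Sub._∈ S) (sym (SubP.x∈⁅y⁆⇒x≡y p m)) hp
      get (inj₂ m) = subst (Sub._∈ S) (sym (SubP.x∈⁅y⁆⇒x≡y q m)) hq

open PairSets

record CartanDatum : Set where
  constructor datum
  field
    {n}  : ℕ
    A    : CartanMatrix n
    d    : Fin n → ℚ
    cart : IsCartan A
    symm : IsSymmetrizer A d

record AffineDatum (𝒞 : CartanDatum) : Set where
  constructor datum
  open CartanDatum 𝒞
  field
    δ m : Vec ℕ n
    aff : Roots.AffineType A d
    isδ : Roots.IsDelta A d δ
    ism : Roots.IsDeltaVee A d m

module Theory (𝒞 : CartanDatum) where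
  open CartanDatum 𝒞
  open Roots A d public

  -- The form K, the reflections and their matrices.

  module Core where
    d>0 : ∀ i → 0ℚ < d i
    d>0 = proj₁ symm

    d≢0 : ∀ i → d i ≢ 0ℚ
    d≢0 i = >⇒≢ (d>0 i)

    da : ∀ i j → d i * a i j ≡ d j * a j i
    da = proj₂ symm

    abstract
      a-diag : ∀ i → a i i ≡ 2ℚ
      a-diag i = cong toℚ (proj₁ cart i)

      a-off : ∀ {i j} → i ≢ j → a i j ≤ 0ℚ
      a-off {i} {j} h = toℚ-mono (proj₁ (proj₂ cart) i j h)

    a-int : ∀ i j → Int (a i j)
    a-int i j = A i j , refl

    abstract
      Kc-lin : ∀ i → Functional (Kc i)
      Kc-lin i = functional
        (λ u v → sumQ-cong (λ j → cong (a i j *_) (lk-+ u v j) ∙ ℚP.*-distribˡ-+ (a i j) (u ! j) (v ! j)) ∙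
                       sumQ-+ (λ j → a i j * u ! j) (λ j → a i j * v ! j))
        (λ q v → sumQ-cong (λ j → cong (a i j *_) (lk-· q v j) ∙
                         solve 3 (λ x y z → x :* (y :* z) := y :* (x :* z)) refl (a i j) q (v ! j)) ∙
                       sumQ-* q (λ j → a i j * v ! j))

      Kc-e : ∀ i j → Kc i (e j) ≡ a i j
      Kc-e i j = sumQ-cong (λ l → cong (a i l *_) (lk-e j l) ∙ ℚP.*-comm (a i l) (δδ j l)) ∙ sumQ-δ j (a i)

      K-Kc : ∀ u v → K u v ≡ sumQ (λ i → u ! i * (d i * Kc i v))
      K-Kc u v = sumQ-cong λ i → sumQ-cong (λ j →
          solve 4 (λ x y p q → x :* y :* (p :* q) := x :* p :* (q :* y)) refl (u ! i) (v ! j) (d i) (a i j)) ∙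
        sumQ-* (u ! i * d i) (λ j → a i j * v ! j) ∙ ℚP.*-assoc (u ! i) (d i) (Kc i v)

      K-sym : ∀ u v → K u v ≡ K v u
      K-sym u v = sumQ-swap (λ i j → u ! i * v ! j * (d i * a i j)) ∙
        (sumQ-cong λ j → sumQ-cong λ i → cong₂ _*_ (ℚP.*-comm (u ! i) (v ! j)) (da i j))

      K-linʳ : ∀ u → Functional (K u)
      K-linʳ u = functional
        (λ v w → K-Kc u (v +ᵥ w) ∙ sumQ-cong (λ i → cong (λ x → u ! i * (d i * x)) (Functional.add (Kc-lin i) v w) ∙
             solve 4 (λ x y p q → x :* (y :* (p :+ q)) := x :* (y :* p) :+ x :* (y :* q)) refl (u ! i) (d i) (Kc i v) (Kc i w)) ∙
          sumQ-+ (λ i → u ! i * (d i * Kc i v)) (λ i → u ! i * (d i * Kc i w)) ∙ sym (cong₂ _+_ (K-Kc u v) (K-Kc u w)))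
        (λ q v → K-Kc u (q ·ᵥ v) ∙ sumQ-cong (λ i → cong (λ x → u ! i * (d i * x)) (Functional.scale (Kc-lin i) q v) ∙
             solve 4 (λ x y p q → x :* (y :* (p :* q)) := p :* (x :* (y :* q))) refl (u ! i) (d i) q (Kc i v)) ∙
          sumQ-* q (λ i → u ! i * (d i * Kc i v)) ∙ cong (q *_) (sym (K-Kc u v)))

      K-linˡ : ∀ u → Functional (λ v → K v u)
      K-linˡ u = functional
        (λ v w → K-sym (v +ᵥ w) u ∙ Functional.add (K-linʳ u) v w ∙ cong₂ _+_ (K-sym u v) (K-sym u w))
        (λ q v → K-sym (q ·ᵥ v) u ∙ Functional.scale (K-linʳ u) q v ∙ cong (q *_) (K-sym u v))

      K-eˡ : ∀ i v → K (e i) v ≡ d i * Kc i v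
      K-eˡ i v = K-Kc (e i) v ∙ sumQ-cong (λ j → cong (_* (d j * Kc j v)) (lk-e i j)) ∙ sumQ-δ i (λ j → d j * Kc j v)

      K-eʳ : ∀ v i → K v (e i) ≡ d i * Kc i v
      K-eʳ v i = K-sym v (e i) ∙ K-eˡ i v

      K-e : ∀ i → K (e i) (e i) ≡ d i + d i
      K-e i = K-eˡ i (e i) ∙ cong (d i *_) (Kc-e i i ∙ a-diag i) ∙
        solve 1 (λ x → x :* con 2ℚ := x :+ x) refl (d i)

      lk-s : ∀ i v j → s i v ! j ≡ v ! j - Kc i v * δδ i j
      lk-s i v j = lk-- v (Kc i v ·ᵥ e i) j ∙ cong (λ x → v ! j - x) (lk-· (Kc i v) (e i) j ∙ cong (Kc i v *_) (lk-e i j))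

      lk-s-≢ : ∀ {i j} v → i ≢ j → s i v ! j ≡ v ! j
      lk-s-≢ {i} {j} v h = lk-s i v j ∙ cong (λ x → v ! j - Kc i v * x) (δδ-≢ h) ∙
        solve 2 (λ x y → x :- y :* con 0ℚ := x) refl (v ! j) (Kc i v)

      lk-s-≡ : ∀ i v → s i v ! i ≡ v ! i - Kc i v
      lk-s-≡ i v = lk-s i v i ∙ cong (λ x → v ! i - x) (cong (Kc i v *_) (δδ-refl i) ∙ ℚP.*-identityʳ (Kc i v))

      s-lin : ∀ i → Linear (s i)
      s-lin i = lin
        (λ u v → vec-ext λ j → begin
          lookup (s i (u +ᵥ v)) j ≡⟨ lk-s i (u +ᵥ v) j ⟩
          (u +ᵥ v) ! j - Kc i (u +ᵥ v) * δδ i j ≡⟨ cong₂ (λ x y → x - y * δδ i j) (lk-+ u v j) (Functional.add (Kc-lin i) u v) ⟩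
          u ! j + v ! j - (Kc i u + Kc i v) * δδ i j
            ≡⟨ solve 5 (λ x y p q t → x :+ y :- (p :+ q) :* t := (x :- p :* t) :+ (y :- q :* t)) refl (u ! j) (v ! j) (Kc i u) (Kc i v) (δδ i j) ⟩
          (u ! j - Kc i u * δδ i j) + (v ! j - Kc i v * δδ i j) ≡⟨ cong₂ _+_ (lk-s i u j) (lk-s i v j) ⟨
          s i u ! j + s i v ! j ≡⟨ lk-+ (s i u) (s i v) j ⟨
          (s i u +ᵥ s i v) ! j ∎)
        (λ q v → vec-ext λ j → begin
          lookup (s i (q ·ᵥ v)) j ≡⟨ lk-s i (q ·ᵥ v) j ⟩
          (q ·ᵥ v) ! j - Kc i (q ·ᵥ v) * δδ i j ≡⟨ cong₂ (λ x y → x - y * δδ i j) (lk-· q v j) (Functional.scale (Kc-lin i) q v) ⟩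
          q * v ! j - (q * Kc i v) * δδ i j ≡⟨ solve 4 (λ x y p t → p :* x :- (p :* y) :* t := p :* (x :- y :* t)) refl (v ! j) (Kc i v) q (δδ i j) ⟩
          q * (v ! j - Kc i v * δδ i j) ≡⟨ cong (q *_) (lk-s i v j) ⟨
          q * s i v ! j ≡⟨ lk-· q (s i v) j ⟨
          (q ·ᵥ s i v) ! j ∎)
        where open ≡-Reasoning

      Kc-s : ∀ j i v → Kc j (s i v) ≡ Kc j v - Kc i v * a j i
      Kc-s j i v = Functional.sub (Kc-lin j) v (Kc i v ·ᵥ e i) ∙ cong (λ x → Kc j v - x)
        (Functional.scale (Kc-lin j) (Kc i v) (e i) ∙ cong (Kc i v *_) (Kc-e j i))

      Kc-s-self : ∀ i v → Kc i (s i v) ≡ - Kc i v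
      Kc-s-self i v = Kc-s i i v ∙ cong (λ x → Kc i v - Kc i v * x) (a-diag i) ∙
        solve 1 (λ x → x :- x :* con 2ℚ := :- x) refl (Kc i v)

      s-invol : ∀ i v → s i (s i v) ≡ v
      s-invol i v = vec-ext λ j → lk-s i (s i v) j ∙ cong₂ (λ x y → x - y * δδ i j) (lk-s i v j) (Kc-s-self i v) ∙
        solve 3 (λ x y t → x :- y :* t :- (:- y) :* t := x) refl (v ! j) (Kc i v) (δδ i j)

      s-null : ∀ i v → Kc i v ≡ 0ℚ → s i v ≡ v
      s-null i v h = vec-ext λ j → lk-s i v j ∙ cong (λ x → v ! j - x * δδ i j) h ∙
        solve 2 (λ x t → x :- con 0ℚ :* t := x) refl (v ! j) (δδ i j)

      s-e : ∀ i → s i (e i) ≡ negSimple i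
      s-e i = vec-ext λ j → lk-s i (e i) j ∙ cong₂ (λ x y → x - y * δδ i j) (lk-e i j) (Kc-e i i ∙ a-diag i) ∙
        solve 1 (λ x → x :- con 2ℚ :* x := :- x) refl (δδ i j) ∙ sym (lk-neg i j)

      s-neg : ∀ i → s i (negSimple i) ≡ e i
      s-neg i = cong (s i) (sym (s-e i)) ∙ s-invol i (e i)

      K-s : ∀ i u v → K (s i u) (s i v) ≡ K u v
      K-s i u v = begin
        K (s i u) (s i v) ≡⟨ Functional.sub (K-linʳ (s i u)) v (Kc i v ·ᵥ e i) ⟩
        K (s i u) v - K (s i u) (Kc i v ·ᵥ e i) ≡⟨ cong₂ _-_ (Functional.sub (K-linˡ v) u (Kc i u ·ᵥ e i))
           (Functional.scale (K-linʳ (s i u)) (Kc i v) (e i) ∙ cong (Kc i v *_) (K-eʳ (s i u) i ∙ cong (d i *_) (Kc-s-self i u))) ⟩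
        (K u v - K (Kc i u ·ᵥ e i) v) - Kc i v * (d i * - Kc i u)
          ≡⟨ cong (λ x → (K u v - x) - Kc i v * (d i * - Kc i u)) (Functional.scale (K-linˡ v) (Kc i u) (e i) ∙ cong (Kc i u *_) (K-eˡ i v)) ⟩
        (K u v - Kc i u * (d i * Kc i v)) - Kc i v * (d i * - Kc i u)
          ≡⟨ solve 4 (λ k x y t → (k :- x :* (t :* y)) :- y :* (t :* :- x) := k) refl (K u v) (Kc i u) (Kc i v) (d i) ⟩
        K u v ∎
        where open ≡-Reasoning

      act-lin : ∀ w → Linear (actW w)
      act-lin [] = lin (λ _ _ → refl) (λ _ _ → refl)
      act-lin (i ∷ w) = lin
        (λ u v → cong (s i) (Linear.add (act-lin w) u v) ∙ Linear.add (s-lin i) (actW w u) (actW w v))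
        (λ q v → cong (s i) (Linear.scale (act-lin w) q v) ∙ Linear.scale (s-lin i) q (actW w v))

      act-++ : ∀ u w v → actW (u ++ w) v ≡ actW u (actW w v)
      act-++ []      w v = refl
      act-++ (i ∷ u) w v = cong (s i) (act-++ u w v)

      rev-∷ : ∀ (i : Fin n) u → reverse (i ∷ u) ≡ reverse u ++ (i ∷ [])
      rev-∷ i u = ListP.unfold-reverse i u

      act-rev : ∀ w v → actW (reverse w) (actW w v) ≡ v
      act-rev []      v = refl
      act-rev (i ∷ w) v = cong (λ t → actW t (s i (actW w v))) (rev-∷ i w) ∙
        act-++ (reverse w) (i ∷ []) (s i (actW w v)) ∙ cong (actW (reverse w)) (s-invol i (actW w v)) ∙ act-rev w v

      rev-act : ∀ w v → actW w (actW (reverse w) v) ≡ v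
      rev-act w v = cong (λ t → actW t (actW (reverse w) v)) (sym (ListP.reverse-involutive w)) ∙ act-rev (reverse w) v

      K-act : ∀ w u v → K (actW w u) (actW w v) ≡ K u v
      K-act []      u v = refl
      K-act (i ∷ w) u v = K-s i (actW w u) (actW w v) ∙ K-act w u v

      act-∉ : ∀ {j} w v → j ∉ w → actW w v ! j ≡ v ! j
      act-∉ []      v h = refl
      act-∉ {j} (i ∷ w) v h = lk-s-≢ {i} {j} (actW w v) (λ p → h (here (sym p))) ∙ act-∉ w v (h ∘ there)

      act-null : ∀ w v → (∀ j → Kc j v ≡ 0ℚ) → actW w v ≡ v
      act-null []      v h = refl
      act-null (i ∷ w) v h = cong (s i) (act-null w v h) ∙ s-null i v (h i)

      apply-mat : ∀ w v → apply (matOf w) v ≡ actW w v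
      apply-mat w v = sumV-cong (λ j → cong (lookup v j ·ᵥ_) (VecP.lookup∘tabulate (λ j → actW w (e j)) j)) ∙
        sumV-cong (λ j → sym (Linear.scale (act-lin w) (v ! j) (e j))) ∙
        sym (Linear.sum (act-lin w) (λ j → v ! j ·ᵥ e j)) ∙ cong (actW w) (e-expand v)

      compose-mat : ∀ u w → compose (matOf u) (matOf w) ≡ matOf (u ++ w)
      compose-mat u w = VecP.tabulate-cong λ j → cong (apply (matOf u)) (VecP.lookup∘tabulate (λ j → actW w (e j)) j) ∙
        apply-mat u (actW w (e j)) ∙ sym (act-++ u w (e j))

      mat-eq : ∀ {u w} → (∀ v → actW u v ≡ actW w v) → matOf u ≡ matOf w
      mat-eq h = VecP.tabulate-cong λ j → h (e j)

      mat-act : ∀ {u w} → matOf u ≡ matOf w → ∀ v → actW u v ≡ actW w v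
      mat-act {u} {w} h v = sym (apply-mat u v) ∙ cong (λ M → apply M v) h ∙ apply-mat w v

      -- The conjugating reflection cancels the letter in front and reappears at the end, since
      -- reflections are involutions.
      conj-front : ∀ i u → conj i (matOf (i ∷ u)) ≡ matOf (u ++ i ∷ [])
      conj-front i u = cong (compose (matOf (i ∷ []))) (compose-mat (i ∷ u) (i ∷ [])) ∙ compose-mat (i ∷ []) ((i ∷ u) ++ (i ∷ [])) ∙
        mat-eq {i ∷ i ∷ (u ++ i ∷ [])} {u ++ i ∷ []} (λ v → s-invol i (actW (u ++ i ∷ []) v))

      conj-back : ∀ i u → conj i (matOf (u ++ i ∷ [])) ≡ matOf (i ∷ u)
      conj-back i u = cong (compose (matOf (i ∷ []))) (compose-mat (u ++ i ∷ []) (i ∷ [])) ∙ compose-mat (i ∷ []) ((u ++ i ∷ []) ++ (i ∷ [])) ∙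
        mat-eq {i ∷ ((u ++ i ∷ []) ++ i ∷ [])} {i ∷ u} (λ v → cong (s i) (act-++ (u ++ i ∷ []) (i ∷ []) v ∙
          act-++ u (i ∷ []) (s i v) ∙ cong (actW u) (s-invol i v)))

  open Core public

  -- The Euler form of a word.

  module EulerForm where
    Supp : List (Fin n) → V n → Set
    Supp w x = ∀ j → j ∉ w → x ! j ≡ 0ℚ

    -- The Euler form of a word: it is the matrix of K made triangular along the word, with halved diagonal.
    E : List (Fin n) → V n → V n → ℚ
    E []      x y = 0ℚ
    E (i ∷ u) x y = (d i * (x ! i * y ! i) + y ! i * lsum u (λ k → d i * a i k * x ! k)) + E u x y

    abstract
      lsum-lk : ∀ u (c : Fin n → ℚ) → Functional (λ x → lsum u (λ k → c k * x ! k))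
      lsum-lk u c = functional
        (λ x y → lsum-cong u (λ k _ → cong (c k *_) (lk-+ x y k) ∙ ℚP.*-distribˡ-+ (c k) (x ! k) (y ! k)) ∙
          lsum-+ u (λ k → c k * x ! k) (λ k → c k * y ! k))
        (λ q x → lsum-cong u (λ k _ → cong (c k *_) (lk-· q x k) ∙ solve 3 (λ a b x → a :* (b :* x) := b :* (a :* x)) refl (c k) q (x ! k)) ∙
          lsum-* u q (λ k → c k * x ! k))

      E-linˡ : ∀ w y → Functional (λ x → E w x y)
      E-linˡ [] y = functional (λ _ _ → refl) (λ q _ → sym (ℚP.*-zeroʳ q))
      E-linˡ (i ∷ u) y = functional
        (λ x x' → cong₂ _+_ (cong₂ (λ p q → d i * (p * y ! i) + y ! i * q) (lk-+ x x' i) (Functional.add L x x'))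
                    (Functional.add (E-linˡ u y) x x') ∙
            solve 8 (λ d y x x' l l' e e' → (d :* ((x :+ x') :* y) :+ y :* (l :+ l')) :+ (e :+ e') := (d :* (x :* y) :+ y :* l) :+ e :+ ((d :* (x' :* y) :+ y :* l') :+ e'))
              refl (d i) (y ! i) (x ! i) (x' ! i) (ℓ x) (ℓ x') (E u x y) (E u x' y))
        (λ q x → cong₂ _+_ (cong₂ (λ p r → d i * (p * y ! i) + y ! i * r) (lk-· q x i) (Functional.scale L q x))
                    (Functional.scale (E-linˡ u y) q x) ∙
            solve 6 (λ d y x l e q → (d :* ((q :* x) :* y) :+ y :* (q :* l)) :+ (q :* e) := q :* ((d :* (x :* y) :+ y :* l) :+ e))
              refl (d i) (y ! i) (x ! i) (ℓ x) (E u x y) q)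
        where
        ℓ : V n → ℚ
        ℓ x = lsum u (λ k → d i * a i k * x ! k)
        L : Functional ℓ
        L = lsum-lk u (λ k → d i * a i k)

      E-linʳ : ∀ w x → Functional (E w x)
      E-linʳ [] x = functional (λ _ _ → refl) (λ q _ → sym (ℚP.*-zeroʳ q))
      E-linʳ (i ∷ u) x = functional
        (λ y y' → cong₂ (λ p q → (d i * (x ! i * p) + p * ℓ) + q) (lk-+ y y' i) (Functional.add (E-linʳ u x) y y') ∙
            solve 7 (λ d x y y' l e e' → (d :* (x :* (y :+ y')) :+ (y :+ y') :* l) :+ (e :+ e') := (d :* (x :* y) :+ y :* l) :+ e :+ ((d :* (x :* y') :+ y' :* l) :+ e'))
              refl (d i) (x ! i) (y ! i) (y' ! i) ℓ (E u x y) (E u x y'))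
        (λ q y → cong₂ (λ p r → (d i * (x ! i * p) + p * ℓ) + r) (lk-· q y i) (Functional.scale (E-linʳ u x) q y) ∙
            solve 6 (λ d y x l e q → (d :* (x :* (q :* y)) :+ (q :* y) :* l) :+ (q :* e) := q :* ((d :* (x :* y) :+ y :* l) :+ e))
              refl (d i) (y ! i) (x ! i) ℓ (E u x y) q)
        where
        ℓ : ℚ
        ℓ = lsum u (λ k → d i * a i k * x ! k)

      E-cong : ∀ w {x x' y y'} → (∀ j → j ∈ w → x ! j ≡ x' ! j) → (∀ j → j ∈ w → y ! j ≡ y' ! j) → E w x y ≡ E w x' y'
      E-cong [] hx hy = refl
      E-cong (i ∷ u) hx hy = cong₂ _+_ (cong₂ _+_ (cong (d i *_) (cong₂ _*_ (hx i (here refl)) (hy i (here refl))))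
        (cong₂ _*_ (hy i (here refl)) (lsum-cong u (λ k p → cong (d i * a i k *_) (hx k (there p))))))
        (E-cong u (λ j p → hx j (there p)) (λ j p → hy j (there p)))

      -- Splitting off the last letter instead of the first exchanges the roles of the two arguments
      -- in the mixed term; symmetrizability moves the factor d from one index to the other.
      E-snoc : ∀ i u x y → E (u ++ i ∷ []) x y ≡
        (d i * (x ! i * y ! i) + x ! i * lsum u (λ k → d i * a i k * y ! k)) + E u x y
      E-snoc i [] x y = cong (λ t → d i * (x ! i * y ! i) + t + 0ℚ)
        (cong (lookup y i *_) (lsum-[] (λ k → d i * a i k * x ! k)) ∙ ℚP.*-zeroʳ (y ! i) ∙ sym
          (cong (lookup x i *_) (lsum-[] (λ k → d i * a i k * y ! k)) ∙ ℚP.*-zeroʳ (x ! i)))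
      E-snoc i (j ∷ u) x y = cong₂ (λ p q → (d j * (x ! j * y ! j) + y ! j * p) + q)
          (lsum-mid u i [] f ∙ cong (λ t → f i + lsum t f) (ListP.++-identityʳ u) ∙ cong (λ t → t * x ! i + lsum u f) (da j i))
          (E-snoc i u x y) ∙
        solve 9 (λ dj xj yj c xi l dd l' e →
            (dj :* (xj :* yj) :+ yj :* (c :* xi :+ l)) :+ ((dd :+ xi :* l') :+ e)
              := (dd :+ xi :* (c :* yj :+ l')) :+ ((dj :* (xj :* yj) :+ yj :* l) :+ e)) refl
          (d j) (x ! j) (y ! j) (d i * a i j) (x ! i) (lsum u f) (d i * (x ! i * y ! i)) (lsum u g) (E u x y) ∙
        cong (λ t → (d i * (x ! i * y ! i) + x ! i * t) + ((d j * (x ! j * y ! j) + y ! j * lsum u f) + E u x y))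
          (sym (lsum-∷ j u g))
        where
        f g : Fin n → ℚ
        f k = d j * a j k * x ! k
        g k = d i * a i k * y ! k

      -- Reversal turns the first letter into the last, and by `E-snoc` a last letter behaves like a
      -- first one with the arguments exchanged.
      E-reverse : ∀ w x y → E (reverse w) x y ≡ E w y x
      E-reverse [] x y = refl
      E-reverse (i ∷ u) x y = cong (λ t → E t x y) (rev-∷ i u) ∙ E-snoc i (reverse u) x y ∙
        cong₂ (λ p q → (p + q) + E (reverse u) x y) (cong (d i *_) (ℚP.*-comm (x ! i) (y ! i))) (cong (lookup x i *_) (lsum-rev u)) ∙
           cong (d i * (y ! i * x ! i) + x ! i * lsum u g +_) (E-reverse u x y)
        where
        g : Fin n → ℚ
        g k = d i * a i k * y ! k
        lsum-rev : ∀ u → lsum (reverse u) g ≡ lsum u g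
        lsum-rev [] = refl
        lsum-rev (j ∷ u) = cong (λ t → lsum t g) (rev-∷ j u) ∙ lsum-mid (reverse u) j [] g ∙
          cong (λ t → g j + lsum t g) (ListP.++-identityʳ (reverse u)) ∙ cong (g j +_) (lsum-rev u) ∙ sym (lsum-∷ j u g)

      Kc-split : ∀ i u x → Unique (i ∷ u) → Supp (i ∷ u) x → d i * Kc i x ≡ d i * (x ! i + x ! i) + lsum u (λ k → d i * a i k * x ! k)
      Kc-split i u x uq sp = trans (cong (d i *_) (sym (lsum-sumQ (i ∷ u) uq (λ k → a i k * x ! k) (λ j p → cong (a i j *_) (sp j p) ∙ ℚP.*-zeroʳ (a i j)))))
        (cong (d i *_) (lsum-∷ i u (λ k → a i k * x ! k) ∙ cong (λ t → t * x ! i + lsum u (λ k → a i k * x ! k)) (a-diag i)) ∙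
        solve 3 (λ d x l → d :* (con 2ℚ :* x :+ l) := d :* (x :+ x) :+ d :* l) refl (d i) (x ! i) (lsum u (λ k → a i k * x ! k)) ∙
          cong (d i * (x ! i + x ! i) +_) (sym (lsum-* u (d i) (λ k → a i k * x ! k)) ∙
            lsum-cong u (λ k _ → sym (ℚP.*-assoc (d i) (a i k) (x ! k)))))

      -- Only the terms containing the coordinate i change. The mixed term is y_i ℓ(x) with i in
      -- front and x_i ℓ(y) with i at the end, and on vectors supported on the word ℓ(z) = d_i
      -- (K(α_i^∨, z) - 2 z_i); substituting s_i turns one expression into the other.
      E-rot : ∀ i u x y → Unique (i ∷ u) → Supp (i ∷ u) x → Supp (i ∷ u) y → E (u ++ i ∷ []) (s i x) (s i y) ≡ E (i ∷ u) x y
      E-rot i u x y uq sx sy = begin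
        E (u ++ i ∷ []) (s i x) (s i y) ≡⟨ E-snoc i u (s i x) (s i y) ⟩
        (d i * (s i x ! i * s i y ! i) + s i x ! i * lsum u (λ k → d i * a i k * s i y ! k)) + E u (s i x) (s i y)
          ≡⟨ cong₂ _+_ (cong₂ (λ p q → d i * (p * q) + p * lsum u (λ k → d i * a i k * s i y ! k)) (lk-s-≡ i x) (lk-s-≡ i y))
               (E-cong u (λ j p → lk-s-≢ x (≢∈ p)) (λ j p → lk-s-≢ y (≢∈ p))) ⟩
        (d i * ((xi - Kx) * (yi - Ky)) + (xi - Kx) * lsum u (λ k → d i * a i k * s i y ! k)) + E u x y
          ≡⟨ cong (λ t → (d i * ((xi - Kx) * (yi - Ky)) + (xi - Kx) * t) + E u x y) (lsum-cong u (λ k p → cong (d i * a i k *_) (lk-s-≢ y (≢∈ p)))) ⟩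
        (d i * ((xi - Kx) * (yi - Ky)) + (xi - Kx) * ℓ y) + E u x y
          ≡⟨ cong (λ t → (d i * ((xi - Kx) * (yi - Ky)) + (xi - Kx) * t) + E u x y) (ℓ-eq y sy) ⟩
        (d i * ((xi - Kx) * (yi - Ky)) + (xi - Kx) * (d i * Ky - d i * (yi + yi))) + E u x y
          ≡⟨ solve 6 (λ d x y p q e → (d :* ((x :- p) :* (y :- q)) :+ (x :- p) :* (d :* q :- d :* (y :+ y))) :+ e
                                   := (d :* (x :* y) :+ y :* (d :* p :- d :* (x :+ x))) :+ e) refl (d i) xi yi Kx Ky (E u x y) ⟩
        (d i * (xi * yi) + yi * (d i * Kx - d i * (xi + xi))) + E u x y ≡⟨ cong (λ t → (d i * (xi * yi) + yi * t) + E u x y) (sym (ℓ-eq x sx)) ⟩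
        E (i ∷ u) x y ∎
        where
        open ≡-Reasoning
        xi yi Kx Ky : ℚ
        xi = x ! i
        yi = y ! i
        Kx = Kc i x
        Ky = Kc i y
        ℓ : V n → ℚ
        ℓ z = lsum u (λ k → d i * a i k * z ! k)
        ≢∈ : ∀ {j} → j ∈ u → i ≢ j
        ≢∈ p refl = head∉ uq p
        ℓ-eq : ∀ z → Supp (i ∷ u) z → ℓ z ≡ d i * Kc i z - d i * (z ! i + z ! i)
        ℓ-eq z sz = solve 2 (λ p l → l := p :+ l :- p) refl (d i * (z ! i + z ! i)) (ℓ z) ∙
          cong (_- d i * (z ! i + z ! i)) (sym (Kc-split i u z uq sz))

      -- The mixed terms vanish because e_i has no coordinate on the later letters. Sign arguments
      -- about the form are reduced to this case by moving a root to the front.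
      E-headˡ : ∀ i u y → Unique (i ∷ u) → E (i ∷ u) (e i) y ≡ d i * y ! i
      E-headˡ i u y uq = cong₂ _+_ (cong₂ (λ p q → d i * (p * y ! i) + y ! i * q) (lk-e i i ∙ δδ-refl i)
          (lsum-cong u (λ k p → cong (d i * a i k *_) (e0 k p) ∙ ℚP.*-zeroʳ (d i * a i k)) ∙ zeros u))
          (E-cong u {e i} {0ᵥ} {y} {y} (λ k p → e0 k p ∙ sym (lk-0 k)) (λ _ _ → refl) ∙ Functional.zer (E-linˡ u y)) ∙
        solve 2 (λ d y → (d :* (con 1ℚ :* y) :+ y :* con 0ℚ) :+ con 0ℚ := d :* y) refl (d i) (y ! i)
        where
        e0 : ∀ k → k ∈ u → e i ! k ≡ 0ℚ
        e0 k p = lk-e i k ∙ (δδ-≢ λ { refl → head∉ uq p })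
        zeros : ∀ (u : List (Fin n)) → lsum u (λ _ → 0ℚ) ≡ 0ℚ
        zeros []      = lsum-[] {Fin n} (λ _ → 0ℚ)
        zeros (j ∷ u) = lsum-∷ j u (λ _ → 0ℚ) ∙ ℚP.+-identityˡ (lsum u (λ _ → 0ℚ)) ∙ zeros u

      E-sym : ∀ w x y → Unique w → Supp w x → Supp w y → E w x y + E w y x ≡ K x y
      E-sym w x y uq sx sy = go w uq ∙ lsum-cong w (λ j p → cong (lookup x j *_) (cong (d j *_) (lsum-sumQ w uq (λ k → a j k * y ! k)
          (λ k q → cong (a j k *_) (sy k q) ∙ ℚP.*-zeroʳ (a j k))))) ∙ lsum-sumQ w uq (λ j → x ! j * (d j * Kc j y)) (λ j q → cong (_* (d j * Kc j y)) (sx j q) ∙ ℚP.*-zeroˡ (d j * Kc j y)) ∙ sym (K-Kc x y)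
        where
        F : List (Fin n) → List (Fin n) → ℚ
        F v w = lsum v (λ j → x ! j * (d j * lsum w (λ k → a j k * y ! k)))
        go : ∀ w → Unique w → E w x y + E w y x ≡ F w w
        go [] _ = sym (lsum-[] (λ j → x ! j * (d j * lsum [] (λ k → a j k * y ! k))))
        go (i ∷ u) uq'@(_ ∷ uu) = begin
          E (i ∷ u) x y + E (i ∷ u) y x
            ≡⟨ solve 7 (λ d x y l m e f → (d :* (x :* y) :+ y :* l :+ e) :+ (d :* (y :* x) :+ x :* m :+ f) := (x :* (d :* (con 2ℚ :* y) :+ m) :+ y :* l) :+ (e :+ f)) refl
                 (d i) (x ! i) (y ! i) (lsum u (λ k → d i * a i k * x ! k)) (lsum u (λ k → d i * a i k * y ! k)) (E u x y) (E u y x) ⟩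
          (x ! i * (d i * (2ℚ * y ! i) + lsum u (λ k → d i * a i k * y ! k)) + y ! i * lsum u (λ k → d i * a i k * x ! k)) + (E u x y + E u y x)
            ≡⟨ cong₂ _+_ (cong₂ _+_ (cong (lookup x i *_) step1) step2) (go u uu) ⟩
          (x ! i * (d i * lsum (i ∷ u) (λ k → a i k * y ! k)) + lsum u (λ j → x ! j * (d j * (a j i * y ! i)))) + F u u
            ≡⟨ ℚP.+-assoc (x ! i * (d i * lsum (i ∷ u) (λ k → a i k * y ! k))) (lsum u (λ j → x ! j * (d j * (a j i * y ! i)))) (F u u) ⟩
          x ! i * (d i * lsum (i ∷ u) (λ k → a i k * y ! k)) + (lsum u (λ j → x ! j * (d j * (a j i * y ! i))) + F u u)
            ≡⟨ cong (x ! i * (d i * lsum (i ∷ u) (λ k → a i k * y ! k)) +_) (sym (lsum-+ u (λ j → x ! j * (d j * (a j i * y ! i))) (λ j → x ! j * (d j * lsum u (λ k → a j k * y ! k)))) ∙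
                 lsum-cong u (λ j _ → solve 4 (λ x d p q → x :* (d :* p) :+ x :* (d :* q) := x :* (d :* (p :+ q))) refl (x ! j) (d j) (a j i * y ! i) (lsum u (λ k → a j k * y ! k)) ∙
                   cong (λ t → x ! j * (d j * t)) (sym (lsum-∷ i u (λ k → a j k * y ! k))))) ⟩
          x ! i * (d i * lsum (i ∷ u) (λ k → a i k * y ! k)) + F u (i ∷ u) ≡⟨ lsum-∷ i u (λ j → x ! j * (d j * lsum (i ∷ u) (λ k → a j k * y ! k))) ⟨
          F (i ∷ u) (i ∷ u) ∎
          where
          open ≡-Reasoning
          step1 : d i * (2ℚ * y ! i) + lsum u (λ k → d i * a i k * y ! k) ≡ d i * lsum (i ∷ u) (λ k → a i k * y ! k)
          step1 = cong₂ (λ p q → d i * (p * y ! i) + q) (sym (a-diag i)) (lsum-cong u (λ k _ → ℚP.*-assoc (d i) (a i k) (y ! k)) ∙ lsum-* u (d i) (λ k → a i k * y ! k)) ∙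
            sym (ℚP.*-distribˡ-+ (d i) (a i i * y ! i) (lsum u (λ k → a i k * y ! k))) ∙ cong (d i *_) (sym (lsum-∷ i u (λ k → a i k * y ! k)))
          step2 : y ! i * lsum u (λ k → d i * a i k * x ! k) ≡ lsum u (λ j → x ! j * (d j * (a j i * y ! i)))
          step2 = trans (sym (lsum-* u (y ! i) (λ k → d i * a i k * x ! k))) (lsum-cong u (λ k _ → cong (λ t → y ! i * (t * x ! k)) (da i k) ∙ solve 4 (λ y d a x → y :* (d :* a :* x) := x :* (d :* (a :* y))) refl (y ! i) (d k) (a k i) (x ! k)))

      -- By induction on the word: the reflection in the first letter changes x, and the correction
      -- this causes in the remaining terms is cancelled by the mixed term of E. A plain sum over w
      -- on the right keeps the induction free of support conditions.
      E-serre′ : ∀ w z x → Unique w → E w z (x -ᵥ actW (reverse w) x) ≡ lsum w (λ k → z ! k * (d k * Kc k x))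
      E-serre′ [] z x _ = sym (lsum-[] (λ k → z ! k * (d k * Kc k x)))
      E-serre′ (i ∷ u) z x uq@(_ ∷ uu) = begin
        (d i * (z ! i * v ! i) + v ! i * ℓ) + E u z v
          ≡⟨ cong₂ (λ p q → (d i * (z ! i * p) + p * ℓ) + q) vi (E-cong u (λ _ _ → refl) vj ∙ E-serre′ u z (s i x) uu) ⟩
        (d i * (z ! i * κ) + κ * ℓ) + lsum u (λ k → z ! k * (d k * Kc k (s i x)))
          ≡⟨ cong ((d i * (z ! i * κ) + κ * ℓ) +_) (lsum-cong u (λ k _ → cong (λ t → z ! k * (d k * t)) (Kc-s k i x) ∙
                solve 5 (λ z d p κ a → z :* (d :* (p :- κ :* a)) := z :* (d :* p) :+ (:- κ) :* (d :* a :* z)) refl (z ! k) (d k) (Kc k x) κ (a k i) ∙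
                  cong (λ t → z ! k * (d k * Kc k x) + (- κ) * (t * z ! k)) (da k i)) ∙
              lsum-+ u (λ k → z ! k * (d k * Kc k x)) (λ k → (- κ) * (d i * a i k * z ! k)) ∙ cong (lsum u (λ k → z ! k * (d k * Kc k x)) +_) (lsum-* u (- κ) (λ k → d i * a i k * z ! k))) ⟩
        (d i * (z ! i * κ) + κ * ℓ) + (lsum u (λ k → z ! k * (d k * Kc k x)) + (- κ) * ℓ)
          ≡⟨ solve 5 (λ d z κ l m → (d :* (z :* κ) :+ κ :* l) :+ (m :+ (:- κ) :* l) := z :* (d :* κ) :+ m) refl (d i) (z ! i) κ ℓ (lsum u (λ k → z ! k * (d k * Kc k x))) ⟩
        z ! i * (d i * κ) + lsum u (λ k → z ! k * (d k * Kc k x)) ≡⟨ lsum-∷ i u (λ k → z ! k * (d k * Kc k x)) ⟨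
        lsum (i ∷ u) (λ k → z ! k * (d k * Kc k x)) ∎
        where
        open ≡-Reasoning
        v : V n
        v = x -ᵥ actW (reverse (i ∷ u)) x
        κ ℓ : ℚ
        κ = Kc i x
        ℓ = lsum u (λ k → d i * a i k * z ! k)
        τ-eq : actW (reverse (i ∷ u)) x ≡ actW (reverse u) (s i x)
        τ-eq = cong (λ t → actW t x) (rev-∷ i u) ∙ act-++ (reverse u) (i ∷ []) x
        ∉rev : i ∉ reverse u
        ∉rev p = head∉ uq (PermP.∈-resp-↭ (PermP.↭-reverse u) p)
        vi : v ! i ≡ κ
        vi = lk-- x (actW (reverse (i ∷ u)) x) i ∙ cong (λ t → x ! i - t ! i) τ-eq ∙
          cong (λ t → x ! i - t) (act-∉ (reverse u) (s i x) ∉rev ∙ lk-s-≡ i x) ∙ solve 2 (λ x k → x :- (x :- k) := k) refl (x ! i) κ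
        vj : ∀ j → j ∈ u → v ! j ≡ (s i x -ᵥ actW (reverse u) (s i x)) ! j
        vj j p = lk-- x (actW (reverse (i ∷ u)) x) j ∙ cong₂ _-_ (sym (lk-s-≢ x (λ { refl → head∉ uq p }))) (cong (λ t → t ! j) τ-eq) ∙
          sym (lk-- (s i x) (actW (reverse u) (s i x)) j)

      -- Together with `E-sym` this becomes E(z, c⁻¹x) = -E(x, z), the Serre duality of the form,
      -- from which the behaviour of `τ` is derived.
      E-serre : ∀ w z x → Unique w → Supp w z → E w z (x -ᵥ actW (reverse w) x) ≡ K z x
      E-serre w z x uq sz = E-serre′ w z x uq ∙ lsum-sumQ w uq (λ k → z ! k * (d k * Kc k x))
        (λ j p → cong (_* (d j * Kc j x)) (sz j p) ∙ ℚP.*-zeroˡ (d j * Kc j x)) ∙ sym (K-Kc z x)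

      E-mid : ∀ p i q x y → x ! i ≡ 0ℚ → y ! i ≡ 0ℚ → E (p ++ i ∷ q) x y ≡ E (p ++ q) x y
      E-mid [] i q x y hx hy = cong (_+ E q x y) (cong₂ (λ s t → d i * (s * t) + t * lsum q (λ k → d i * a i k * x ! k)) hx hy) ∙
        solve 3 (λ d l e → (d :* (con 0ℚ :* con 0ℚ) :+ con 0ℚ :* l) :+ e := e) refl (d i) (lsum q (λ k → d i * a i k * x ! k)) (E q x y)
      E-mid (j ∷ p) i q x y hx hy = cong₂ (λ s t → (d j * (x ! j * y ! j) + y ! j * s) + t)
        (lsum-mid p i q (λ k → d j * a j k * x ! k) ∙ cong (λ t → d j * a j i * t + lsum (p ++ q) (λ k → d j * a j k * x ! k)) hx ∙
          solve 2 (λ c l → c :* con 0ℚ :+ l := l) refl (d j * a j i) (lsum (p ++ q) (λ k → d j * a j k * x ! k)))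
        (E-mid p i q x y hx hy)

      -- The only terms that depend on the order of i and a letter k of p carry the factor a_ik,
      -- which is zero.
      E-commute : ∀ p i q x y → (∀ k → k ∈ p → a i k ≡ 0ℚ) → E (p ++ i ∷ q) x y ≡ E (i ∷ p ++ q) x y
      E-commute [] i q x y h = refl
      E-commute (j ∷ p) i q x y h = cong₂ (λ s t → (d j * (x ! j * y ! j) + y ! j * s) + t)
          (lsum-mid p i q (λ k → d j * a j k * x ! k) ∙ cong (λ t → t * x ! i + lf) (da j i ∙ cong (d i *_) aij ∙ ℚP.*-zeroʳ (d i)) ∙
            solve 2 (λ x l → con 0ℚ :* x :+ l := l) refl (x ! i) lf)
          (E-commute p i q x y (λ k m → h k (there m))) ∙
        solve 6 (λ P dd y l e x → P :+ ((dd :+ y :* l) :+ e) := (dd :+ y :* (con 0ℚ :* x :+ l)) :+ (P :+ e)) refl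
            (d j * (x ! j * y ! j) + y ! j * lf) (d i * (x ! i * y ! i)) (y ! i) lg (E (p ++ q) x y) (x ! j) ∙
        cong (λ t → (d i * (x ! i * y ! i) + y ! i * t) + ((d j * (x ! j * y ! j) + y ! j * lf) + E (p ++ q) x y))
          (sym (lsum-∷ j (p ++ q) (λ k → d i * a i k * x ! k) ∙ cong (λ t → t * x ! j + lg) (cong (d i *_) aij ∙ ℚP.*-zeroʳ (d i))))
        where
        lf lg : ℚ
        lf = lsum (p ++ q) (λ k → d j * a j k * x ! k)
        lg = lsum (p ++ q) (λ k → d i * a i k * x ! k)
        aij : a i j ≡ 0ℚ
        aij = h j (here refl)

    supp-all : ∀ {w} → (∀ j → j ∈ w) → ∀ x → Supp w x
    supp-all h x j p = ⊥-elim (p (h j))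

    supp-s : ∀ {w i x} → i ∈ w → Supp w x → Supp w (s i x)
    supp-s {w} {i} {x} m h j p = lk-s-≢ x (λ { refl → p m }) ∙ h j p

    supp-↭ : ∀ {w w' x} → w ↭ w' → Supp w x → Supp w' x
    supp-↭ p h j q = h j (λ r → q (PermP.∈-resp-↭ p r))

    supp-act : ∀ {w x} u → (∀ j → j ∈ u → j ∈ w) → Supp w x → Supp w (actW u x)
    supp-act []      h sp = sp
    supp-act {x = x} (i ∷ u) h sp = supp-s {x = actW u x} (h i (here refl)) (supp-act {x = x} u (λ j p → h j (there p)) sp)

  open EulerForm public

  -- Words representing a given Coxeter element.

  module CoxWords where
    abstract
      Kc-nonpos : ∀ k x → (∀ j → 0ℚ ≤ x ! j) → x ! k ≡ 0ℚ → Kc k x ≤ 0ℚ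
      Kc-nonpos k x h0 hk = 0≤- (subst (0ℚ ≤_) eq (sumQ-≥0 {f = λ j → (- a k j) * x ! j} term))
        where
        eq : sumQ (λ j → (- a k j) * x ! j) ≡ - Kc k x
        eq = sumQ-cong (λ j → solve 2 (λ a x → (:- a) :* x := (:- con 1ℚ) :* (a :* x)) refl (a k j) (x ! j)) ∙
          sumQ-* (- 1ℚ) (λ j → a k j * x ! j) ∙ solve 1 (λ x → (:- con 1ℚ) :* x := :- x) refl (Kc k x)
        term : ∀ j → 0ℚ ≤ (- a k j) * x ! j
        term j = go (k Fin.≟ j)
          where
          go : Dec (k ≡ j) → 0ℚ ≤ (- a k j) * x ! j
          go (yes refl) = ℚP.≤-reflexive (sym (cong ((- a k k) *_) hk ∙ ℚP.*-zeroʳ (- a k k)))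
          go (no p) = 0≤* (≤0⇒ (a-off p)) (h0 j)

      s-nonneg : ∀ k x → (∀ j → 0ℚ ≤ x ! j) → x ! k ≡ 0ℚ → ∀ j → 0ℚ ≤ s k x ! j
      s-nonneg k x h0 hk j = go (k Fin.≟ j)
        where
        go : Dec (k ≡ j) → 0ℚ ≤ s k x ! j
        go (yes refl) = subst (0ℚ ≤_) (sym (lk-s-≡ k x ∙ cong (_- Kc k x) hk ∙ ℚP.+-identityˡ (- Kc k x))) (≤0⇒ (Kc-nonpos k x h0 hk))
        go (no p) = subst (0ℚ ≤_) (sym (lk-s-≢ x p)) (h0 j)

      act-rev-∷ : ∀ i u v → actW (reverse (i ∷ u)) v ≡ actW (reverse u) (s i v)
      act-rev-∷ i u v = cong (λ t → actW t v) (rev-∷ i u) ∙ act-++ (reverse u) (i ∷ []) v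

      act-rev-++ : ∀ p q v → actW (reverse (p ++ q)) v ≡ actW (reverse q) (actW (reverse p) v)
      act-rev-++ p q v = cong (λ t → actW t v) (ListP.reverse-++ p q) ∙ act-++ (reverse q) (reverse p) v

      act-rev-snoc : ∀ i u v → actW (reverse (u ++ i ∷ [])) v ≡ s i (actW (reverse u) v)
      act-rev-snoc i u v = act-rev-++ u (i ∷ []) v

      act-mid : ∀ p i q v → actW (p ++ i ∷ q) v ≡ actW p (s i (actW q v))
      act-mid p i q v = act-++ p (i ∷ q) v

      ∉-rev : ∀ {j : Fin n} u → j ∉ u → j ∉ reverse u
      ∉-rev u h p = h (PermP.∈-resp-↭ (PermP.↭-reverse u) p)

      -- Each letter is reflected once, at a moment when its coordinate is still 0. The other
      -- coordinates being nonnegative, the pairing with its coroot is at most 0, and the new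
      -- coordinate is at least 0.
      act-rev-nonneg : ∀ v x → Unique v → (∀ j → 0ℚ ≤ x ! j) → (∀ j → j ∈ v → x ! j ≡ 0ℚ) →
        ∀ j → 0ℚ ≤ actW (reverse v) x ! j
      act-rev-nonneg [] x _ h0 _ = h0
      act-rev-nonneg (k ∷ v) x uq@(_ ∷ uv) h0 hv j = subst (λ t → 0ℚ ≤ t ! j) (sym (act-rev-∷ k v x))
        (act-rev-nonneg v (s k x) uv (s-nonneg k x h0 (hv k (here refl)))
          (λ l p → lk-s-≢ x (λ { refl → head∉ uq p }) ∙ hv l (there p)) j)

      e-nonneg : ∀ (i : Fin n) j → 0ℚ ≤ e i ! j
      e-nonneg i j = go (i Fin.≟ j)
        where
        go : Dec (i ≡ j) → 0ℚ ≤ e i ! j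
        go (yes refl) = subst (0ℚ ≤_) (sym (lk-e i i ∙ δδ-refl i)) 0≤1
        go (no p) = ℚP.≤-reflexive (sym (lk-e i j ∙ δδ-≢ p))

      e-off : ∀ {i j : Fin n} → i ≢ j → e i ! j ≡ 0ℚ
      e-off {i} {j} h = lk-e i j ∙ δδ-≢ h

      e-on : ∀ (i : Fin n) → e i ! i ≡ 1ℚ
      e-on i = lk-e i i ∙ δδ-refl i

      -- The first letter k of p gives the coordinate k the value -a_ki, which is at least 0, and no
      -- later reflection changes it. So a_ki = 0, the reflection in k fixes α_i, and the argument
      -- passes to the rest of p.
      commuting : ∀ i p → Unique p → i ∉ p → (∀ k → k ∈ p → actW (reverse p) (e i) ! k ≤ 0ℚ) → ∀ k → k ∈ p → a i k ≡ 0ℚ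
      commuting i (k ∷ p) uq@(_ ∷ up) i∉ h = λ { j (here refl) → aik ; j (there m) → commuting i p up (i∉ ∘ there) h' j m }
        where
        i≢k : i ≢ k
        i≢k q = i∉ (here q)
        val : actW (reverse (k ∷ p)) (e i) ! k ≡ - a k i
        val = cong (λ t → t ! k) (act-rev-∷ k p (e i)) ∙ act-∉ (reverse p) (s k (e i)) (∉-rev p (head∉ uq)) ∙
          lk-s-≡ k (e i) ∙ cong₂ _-_ (e-off i≢k) (Kc-e k i) ∙ ℚP.+-identityˡ (- a k i)
        aki : a k i ≡ 0ℚ
        aki = ℚP.≤-antisym (a-off (i≢k ∘ sym)) (subst (0ℚ ≤_) (solve 1 (λ x → :- (:- x) := x) refl (a k i)) (≤0⇒ (subst (_≤ 0ℚ) val (h k (here refl)))))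
        aik : a i k ≡ 0ℚ
        aik = *≡0 (d≢0 i) (da i k ∙ cong (d k *_) aki ∙ ℚP.*-zeroʳ (d k))
        h' : ∀ j → j ∈ p → actW (reverse p) (e i) ! j ≤ 0ℚ
        h' j m = subst (λ t → t ! j ≤ 0ℚ) (act-rev-∷ k p (e i) ∙ cong (actW (reverse p)) (s-null k (e i) (Kc-e k i ∙ aki))) (h j (there m))

      act-commute : ∀ p i q v → (∀ k → k ∈ p → a i k ≡ 0ℚ) → actW (p ++ i ∷ q) v ≡ actW (i ∷ p ++ q) v
      act-commute [] i q v h = refl
      act-commute (j ∷ p) i q v h = cong (s j) (act-commute p i q v (λ k m → h k (there m))) ∙ swap (actW (p ++ q) v)
        where
        aij : a i j ≡ 0ℚ
        aij = h j (here refl)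
        aji : a j i ≡ 0ℚ
        aji = *≡0 (d≢0 j) (da j i ∙ cong (d i *_) aij ∙ ℚP.*-zeroʳ (d i))
        swap : ∀ x → s j (s i x) ≡ s i (s j x)
        swap x = vec-ext λ k → lk-s j (s i x) k ∙ cong₂ (λ p q → p - q * δδ j k) (lk-s i x k) (Kc-s j i x ∙ cong (λ t → Kc j x - Kc i x * t) aji) ∙
          solve 5 (λ x p q u v → (x :- p :* u) :- (q :- p :* con 0ℚ) :* v := (x :- q :* v) :- (p :- q :* con 0ℚ) :* u) refl (x ! k) (Kc i x) (Kc j x) (δδ i k) (δδ j k) ∙
          sym (lk-s i (s j x) k ∙ cong₂ (λ p q → p - q * δδ i k) (lk-s j x k) (Kc-s i j x ∙ cong (λ t → Kc i x - Kc j x * t) aij))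

      rev-eq : ∀ {w w'} → (∀ v → actW w v ≡ actW w' v) → ∀ v → actW (reverse w) v ≡ actW (reverse w') v
      rev-eq {w} {w'} h v = trans (cong (actW (reverse w)) (sym (rev-act w' v))) (cong (actW (reverse w)) (sym (h (actW (reverse w') v))) ∙ act-rev w (actW (reverse w') v))

      -- Words for the same Coxeter element differ by commutations, which do not change the Euler form.
      E-mat : ∀ w w' → Unique w → w ↭ w' → (∀ v → actW w v ≡ actW w' v) → ∀ x y → E w x y ≡ E w' x y
      E-mat [] w' _ p _ x y = cong (λ t → E t x y) (sym (PermP.↭-empty-inv (↭-sym p)))
      E-mat (i ∷ u) w' uq@(_ ∷ uu) perm heq x y with MemP.∈-∃++ (PermP.∈-resp-↭ perm (here refl))
      ... | p , q , refl = cong₂ _+_ (cong (λ t → d i * (x ! i * y ! i) + y ! i * t) lsum-eq)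
          (E-mat u (p ++ q) uu upq heq' x y) ∙ sym (E-commute p i q x y comm)
        where
        uq' : Unique (p ++ i ∷ q)
        uq' = uq-↭ perm uq
        mids : i ∉ p × i ∉ q × Unique (p ++ q)
        mids = uq-mid p uq'
        upq : u ↭ p ++ q
        upq = PermP.drop-mid [] p perm
        disj : ∀ (p : List (Fin n)) {q} → Unique (p ++ q) → ∀ {k} → k ∈ p → k ∉ q
        disj (_ ∷ p) (h ∷ _) (here refl) m = All.lookup h (MemP.∈-++⁺ʳ p m) refl
        disj (_ ∷ p) (_ ∷ u) (there k∈) m = disj p u k∈ m
        uniqueˡ : ∀ (p : List (Fin n)) {q} → Unique (p ++ q) → Unique p
        uniqueˡ [] _ = []
        uniqueˡ (x ∷ p) (h ∷ u) = All.tabulate (λ m → All.lookup h (MemP.∈-++⁺ˡ m)) ∷ uniqueˡ p u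
        -- The inverse of c is computed with both words. The word starting with i sends α_i to the
        -- negative of a nonnegative vector; in the other word the coordinates in p are settled once
        -- `reverse p` has acted.
        low : ∀ k → k ∈ p → actW (reverse p) (e i) ! k ≤ 0ℚ
        low k m = subst (_≤ 0ℚ) eq (0≤- (subst (0ℚ ≤_) (sym neg) (act-rev-nonneg u (e i) uu (e-nonneg i) (λ j r → e-off λ { refl → head∉ uq r }) k)))
          where
          k≢i : i ≢ k
          k≢i refl = proj₁ mids m
          neg : - actW (reverse (i ∷ u)) (e i) ! k ≡ actW (reverse u) (e i) ! k
          neg = cong (λ t → - t ! k) (act-rev-∷ i u (e i) ∙ cong (actW (reverse u)) (s-e i ∙ neg-simple i) ∙ Linear.scale (act-lin (reverse u)) (- 1ℚ) (e i)) ∙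
            cong -_ (lk-· (- 1ℚ) (actW (reverse u) (e i)) k) ∙ solve 1 (λ x → :- ((:- con 1ℚ) :* x) := x) refl (actW (reverse u) (e i) ! k)
          eq : actW (reverse (i ∷ u)) (e i) ! k ≡ actW (reverse p) (e i) ! k
          eq = cong (λ t → t ! k) (rev-eq {i ∷ u} {p ++ i ∷ q} heq (e i) ∙ act-rev-++ p (i ∷ q) (e i) ∙ act-rev-∷ i q (actW (reverse p) (e i))) ∙
            act-∉ (reverse q) (s i (actW (reverse p) (e i))) (∉-rev q (disj p (proj₂ (proj₂ mids)) m)) ∙ lk-s-≢ (actW (reverse p) (e i)) k≢i
        comm : ∀ k → k ∈ p → a i k ≡ 0ℚ
        comm = commuting i p (uniqueˡ p uq') (proj₁ mids) low
        heq' : ∀ v → actW u v ≡ actW (p ++ q) v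
        heq' v = sym (s-invol i (actW u v)) ∙ cong (s i) (heq v ∙ act-commute p i q v comm) ∙ s-invol i (actW (p ++ q) v)
        lsum-eq : lsum u (λ k → d i * a i k * x ! k) ≡ lsum (p ++ q) (λ k → d i * a i k * x ! k)
        lsum-eq = lsum-↭ upq
          where
          lsum-↭ : ∀ {u v : List (Fin n)} {f : Fin n → ℚ} → u ↭ v → lsum u f ≡ lsum v f
          lsum-↭ Perm.refl = refl
          lsum-↭ {f = f} (Perm.prep {xs} {ys} x r) = lsum-∷ x xs f ∙ cong (f x +_) (lsum-↭ r) ∙ sym (lsum-∷ x ys f)
          lsum-↭ {f = f} (Perm.swap {xs} {ys} x y r) = lsum-∷ x (y ∷ xs) f ∙ cong (f x +_) (lsum-∷ y xs f ∙ cong (f y +_) (lsum-↭ r)) ∙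
            solve 3 (λ a b c → a :+ (b :+ c) := b :+ (a :+ c)) refl (f x) (f y) (lsum ys f) ∙
              sym (lsum-∷ y (x ∷ ys) f ∙ cong (f y +_) (lsum-∷ x ys f))
          lsum-↭ (Perm.trans r r') = lsum-↭ r ∙ lsum-↭ r'

      -- With w = u j q, the vector q⁻¹α_j has coordinate 1 at j before w acts and -1 afterwards. A
      -- word without j leaves this coordinate unchanged.
      letters : ∀ {w w'} → Unique w → (∀ v → actW w v ≡ actW w' v) → ∀ j → j ∈ w → j ∈ w'
      letters {w} {w'} uq heq j j∈ = go (j ∈ₗ? w')
        where
        go : Dec (j ∈ w') → j ∈ w'
        go (yes p) = p
        go (no p) with MemP.∈-∃++ j∈
        ... | u , q , refl = ⊥-elim (ℚP.<-irrefl (sym left ∙ right) (ℚP.<-trans (ℚP.negative⁻¹ (- 1ℚ)) 0<1))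
          where
          x : V n
          x = actW (reverse q) (e j)
          xj : x ! j ≡ 1ℚ
          xj = act-∉ (reverse q) (e j) (∉-rev q (proj₁ (proj₂ (uq-mid u uq)))) ∙ e-on j
          left : actW (u ++ j ∷ q) x ! j ≡ - 1ℚ
          left = cong (λ t → t ! j) (act-mid u j q x) ∙ act-∉ u (s j (actW q x)) (proj₁ (uq-mid u uq)) ∙
            cong (λ t → s j t ! j) (rev-act q (e j)) ∙ cong (λ t → t ! j) (s-e j) ∙ lk-neg j j ∙ cong -_ (δδ-refl j)
          right : actW (u ++ j ∷ q) x ! j ≡ 1ℚ
          right = cong (λ t → t ! j) (heq x) ∙ act-∉ w' x p ∙ xj

    cox-length : ∀ {w : List (Fin n)} → Cox w → length w ≡ n
    cox-length c = PermP.↭-length (ordering-cox c) ∙ ListP.length-tabulate (λ i → i)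

    -- By `letters` the word contains all n letters, and by minimality its length is at most n.
    reduced-cox : ∀ {w w'} → Cox w → ReducedFor (matOf w) w' → Cox w'
    reduced-cox {w} {w'} cw (eq , short) = cox-ordering (proj₂ (all-length {w = w'} (λ j → letters {w} {w'} (proj₁ cw) (λ v → sym (mat-act {w'} {w} eq v)) j (proj₂ cw j)))
      (ℕP.≤-trans (short w refl) (ℕP.≤-reflexive (cox-length cw))))

    cox-reduced : ∀ {w} → Cox w → ReducedFor (matOf w) w
    cox-reduced {w} cw = refl , λ w' eq → ℕP.≤-trans (ℕP.≤-reflexive (cox-length cw))
      (proj₁ (all-length {w = w'} (λ j → letters {w} {w'} (proj₁ cw) (λ v → sym (mat-act {w'} {w} eq v)) j (proj₂ cw j))))

    IsWord : Mat → List (Fin n) → Set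
    IsWord M w = (∀ j → j ∈ w) × matOf w ≡ M

    abstract
      -- Only the finitely many words of length n are candidates. The function `f` is defined on all
      -- matrices, so it has to recognise the Coxeter elements among them.
      findWord : ∀ M → Dec (∃ λ w → Cox w × matOf w ≡ M)
      findWord M = map′ found lost (Any.any? (λ w → FinP.all? (λ j → j ∈ₗ? w) ×-dec VecP.≡-dec _≟ᵥ_ (matOf w) M) (words (allFin n) n))
        where
        wordLength : ∀ {X : Set} (xs : List X) k {w} → w ∈ words xs k → length w ≡ k
        wordLength xs zero (here refl) = refl
        wordLength xs (suc k) p with MemP.∈-cartesianProductWith⁻ _∷_ xs (words xs k) p
        ... | _ , _ , _ , q , refl = cong suc (wordLength xs k q)
        found : Any.Any (IsWord M) (words (allFin n) n) → ∃ λ w → Cox w × matOf w ≡ M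
        found p with find p
        ... | w , m , (h , eq) = w , cox-ordering (proj₂ (all-length h) (ℕP.≤-reflexive (wordLength (allFin n) n m))) , eq
        lost : (∃ λ w → Cox w × matOf w ≡ M) → Any.Any (IsWord M) (words (allFin n) n)
        lost (w , c , eq) = lose (subst (λ k → w ∈ words (allFin n) k) (cox-length c) (∈-words w)) (proj₂ c , eq)

  open CoxWords public

  module Semidefinite (psd : ∀ v → 0ℚ ≤ K v v) (pdp : ∀ i v → v ! i ≡ 0ℚ → v ≢ 0ᵥ → 0ℚ < K v v) where

    -- Real roots as the solutions of integrality conditions.

    module RootTheory where
      -- Roots characterised arithmetically: v and its coroot v / N have integral coordinates, where K(v,v) = 2N.
      record IsRt (N : ℚ) (v : V n) : Set where
        constructor rt
        field
          N>0   : 0ℚ < N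
          norm  : K v v ≡ N + N
          int   : ∀ j → Int (v ! j)
          coint : ∀ j → N ∣ᵢ (d j * v ! j)
        N≢0 : N ≢ 0ℚ
        N≢0 = >⇒≢ N>0
      open IsRt

      Null : V n → Set
      Null x = ∀ j → Kc j x ≡ 0ℚ

      abstract
        Kc-int : ∀ i {v} → (∀ j → Int (v ! j)) → Int (Kc i v)
        Kc-int i h = sumQ-int (λ j → int-* (a-int i j) (h j))

        dKc-div : ∀ {N} i v → (∀ j → N ∣ᵢ (d j * v ! j)) → N ∣ᵢ (d i * Kc i v)
        dKc-div {N} i v h = subst (N ∣ᵢ_) (sumQ-* (d i) (λ j → a i j * v ! j))
          (div-sum (λ j → subst (N ∣ᵢ_) (solve 3 (λ a d v → a :* (d :* v) := d :* a :* v) refl (a j i) (d j) (v ! j) ∙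
            cong (_* lookup v j) (da j i) ∙ ℚP.*-assoc (d i) (a i j) (v ! j)) (div-*ˡ (a-int j i) (h j))))

        rt-e : ∀ i → IsRt (d i) (e i)
        rt-e i = rt (d>0 i) (K-e i) (λ j → subst Int (sym (lk-e i j)) (int-δδ i j)) λ j → dv (δδ i j) (int-δδ i j) (go j (i Fin.≟ j))
          where
          go : ∀ j → Dec (i ≡ j) → d j * e i ! j ≡ d i * δδ i j
          go j (yes refl) = cong (d i *_) (lk-e i i)
          go j (no p) = cong (d j *_) (lk-e i j ∙ δδ-≢ p) ∙ ℚP.*-zeroʳ (d j) ∙ sym (cong (d i *_) (δδ-≢ p) ∙ ℚP.*-zeroʳ (d i))

        rt-s : ∀ {N v} i → IsRt N v → IsRt N (s i v)
        rt-s {N} {v} i r = rt (N>0 r) (K-s i v v ∙ norm r)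
          (λ j → subst Int (sym (lk-s i v j)) (int-sub (int r j) (int-* (Kc-int i {v} (int r)) (int-δδ i j)))) (λ j → go j (i Fin.≟ j))
          where
          go : ∀ j → Dec (i ≡ j) → N ∣ᵢ (d j * s i v ! j)
          go j (yes refl) = subst (N ∣ᵢ_) (solve 3 (λ d v k → d :* v :+ :- (d :* k) := d :* (v :- k)) refl (d i) (v ! i) (Kc i v) ∙ cong (d i *_) (sym (lk-s-≡ i v)))
            (div-+ (coint r i) (div-neg (dKc-div i v (coint r))))
          go j (no p) = subst (λ t → N ∣ᵢ (d j * t)) (sym (lk-s-≢ v p)) (coint r j)

        rt-act : ∀ {N v} w → IsRt N v → IsRt N (actW w v)
        rt-act []      r = r
        rt-act {v = v} (i ∷ w) r = rt-s {v = actW w v} i (rt-act w r)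

        K-scale2 : ∀ q v → K (q ·ᵥ v) (q ·ᵥ v) ≡ q * q * K v v
        K-scale2 q v = Functional.scale (K-linˡ (q ·ᵥ v)) q v ∙ cong (q *_) (Functional.scale (K-linʳ v) q v) ∙ sym (ℚP.*-assoc q q (K v v))

        rt-neg : ∀ {N v} → IsRt N v → IsRt N ((- 1ℚ) ·ᵥ v)
        rt-neg {N} {v} r = rt (N>0 r) (K-scale2 (- 1ℚ) v ∙ solve 1 (λ k → (:- con 1ℚ) :* (:- con 1ℚ) :* k := k) refl (K v v) ∙ norm r)
          (λ j → subst Int (sym (lk-· (- 1ℚ) v j ∙ solve 1 (λ x → (:- con 1ℚ) :* x := :- x) refl (v ! j))) (int-neg (int r j)))
          (λ j → subst (N ∣ᵢ_) (solve 2 (λ d x → :- (d :* x) := d :* ((:- con 1ℚ) :* x)) refl (d j) (v ! j) ∙ cong (d j *_) (sym (lk-· (- 1ℚ) v j))) (div-neg (coint r j)))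

        half-inj : ∀ {x y} → x + x ≡ y + y → x ≡ y
        half-inj {x} {y} h = *-cancelˡ {2ℚ} (>⇒≢ 0<2) (solve 1 (λ x → con 2ℚ :* x := x :+ x) refl x ∙ h ∙ solve 1 (λ x → x :+ x := con 2ℚ :* x) refl y)

        rt-N : ∀ {N M v} → IsRt N v → IsRt M v → N ≡ M
        rt-N r r' = half-inj (sym (norm r) ∙ norm r')

        real-rt : ∀ {v} → RealRoot v → ∃ λ N → IsRt N v
        real-rt (w , i , refl) = d i , rt-act w (rt-e i)

        -- Each coefficient d_i a_ik of the form equals d_k a_ki; written with the d belonging to
        -- the first argument, every term is a multiple of some d_k x_k by an integer.
        E-div : ∀ {N} w x y → (∀ j → N ∣ᵢ (d j * x ! j)) → (∀ j → Int (y ! j)) → N ∣ᵢ E w x y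
        E-div [] x y hx hy = div-0
        E-div {N} (i ∷ u) x y hx hy = div-+ (div-+ (subst (N ∣ᵢ_) (ℚP.*-assoc (d i) (x ! i) (y ! i)) (div-* (hx i) (hy i)))
            (div-*ˡ (hy i) (div-lsum u (λ k → subst (N ∣ᵢ_) (solve 3 (λ a d x → a :* (d :* x) := d :* a :* x) refl (a k i) (d k) (x ! k) ∙ cong (_* lookup x k) (da k i)) (div-*ˡ (a-int k i) (hx k))))))
          (E-div u x y hx hy)

        K-div : ∀ {N} x y → (∀ j → N ∣ᵢ (d j * x ! j)) → (∀ j → Int (y ! j)) → N ∣ᵢ K x y
        K-div {N} x y hx hy = subst (N ∣ᵢ_) (sym (K-Kc x y)) (div-sum (λ i → subst (N ∣ᵢ_) (solve 3 (λ d x k → d :* x :* k := x :* (d :* k)) refl (d i) (x ! i) (Kc i y)) (div-* (hx i) (Kc-int i {y} hy))))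

        allCox : Cox (allFin n)
        allCox = cox-ordering ↭-refl

        E-double : ∀ {w} → Cox w → ∀ x → E w x x + E w x x ≡ K x x
        E-double {w} c x = E-sym w x x (proj₁ c) (supp-all (proj₂ c) x) (supp-all (proj₂ c) x)

        K-sub : ∀ x y → K (x -ᵥ y) (x -ᵥ y) ≡ K x x - (K x y + K x y) + K y y
        K-sub x y = trans (Functional.sub (K-linˡ (x -ᵥ y)) x y) (cong₂ _-_ (Functional.sub (K-linʳ x) x y) (Functional.sub (K-linʳ y) x y ∙ cong (_- K y y) (K-sym y x)) ∙
          solve 3 (λ a b c → (a :- b) :- (b :- c) := a :- (b :+ b) :+ c) refl (K x x) (K x y) (K y y))

        -- The norms of the positive and the negative part of a root are divisible by 2N and add up to at most 2N.
        posneg : ∀ {N v} → IsRt N v → Pos v ⊎ Pos ((- 1ℚ) ·ᵥ v)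
        posneg {N} {v} r = go (FinP.any? (λ i → 0ℚ ℚP.<? p ! i)) (FinP.any? (λ i → 0ℚ ℚP.<? m ! i))
          where
          p m : V n
          p = tabulate (λ j → [ lookup v j ]₊)
          m = p -ᵥ v
          pj : ∀ j → p ! j ≡ [ lookup v j ]₊
          pj j = VecP.lookup∘tabulate (λ j → [ lookup v j ]₊) j
          Cases : Fin n → Set
          Cases j = (p ! j ≡ v ! j × m ! j ≡ 0ℚ × 0ℚ ≤ v ! j) ⊎ (p ! j ≡ 0ℚ × m ! j ≡ - v ! j × v ! j ≤ 0ℚ)
          cases : ∀ j → Cases j
          cases j = go' ([]₊-cases (v ! j))
            where
            go' : ([ lookup v j ]₊ ≡ v ! j × 0ℚ ≤ v ! j) ⊎ ([ lookup v j ]₊ ≡ 0ℚ × v ! j ≤ 0ℚ) → Cases j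
            go' (inj₁ (q , h)) = inj₁ (pj j ∙ q , lk-- p v j ∙ cong (_- lookup v j) (pj j ∙ q) ∙ ℚP.+-inverseʳ (v ! j) , h)
            go' (inj₂ (q , h)) = inj₂ (pj j ∙ q , lk-- p v j ∙ cong (_- lookup v j) (pj j ∙ q) ∙ ℚP.+-identityˡ (- v ! j) , h)
          p≥0 : ∀ j → 0ℚ ≤ p ! j
          p≥0 j = subst (0ℚ ≤_) (sym (pj j)) ([]₊-nonneg (v ! j))
          m≥0 : ∀ j → 0ℚ ≤ m ! j
          m≥0 j = go' (cases j)
            where
            go' : Cases j → 0ℚ ≤ m ! j
            go' (inj₁ (_ , q , _)) = ℚP.≤-reflexive (sym q)
            go' (inj₂ (_ , q , h)) = subst (0ℚ ≤_) (sym q) (≤0⇒ h)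
          pm : ∀ j → p ! j * m ! j ≡ 0ℚ
          pm j = go' (cases j)
            where
            go' : Cases j → p ! j * m ! j ≡ 0ℚ
            go' (inj₁ (_ , q , _)) = cong (lookup p j *_) q ∙ ℚP.*-zeroʳ (p ! j)
            go' (inj₂ (q , _ , _)) = cong (_* lookup m j) q ∙ ℚP.*-zeroˡ (m ! j)
          p-int : ∀ j → Int (p ! j) × N ∣ᵢ (d j * p ! j)
          p-int j = go' (cases j)
            where
            go' : Cases j → Int (p ! j) × N ∣ᵢ (d j * p ! j)
            go' (inj₁ (q , _ , _)) = subst Int (sym q) (int r j) , subst (λ t → N ∣ᵢ (d j * t)) (sym q) (coint r j)
            go' (inj₂ (q , _ , _)) = subst Int (sym q) int-0 , subst (N ∣ᵢ_) (sym (cong (d j *_) q ∙ ℚP.*-zeroʳ (d j))) div-0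
          m-int : ∀ j → Int (m ! j) × N ∣ᵢ (d j * m ! j)
          m-int j = subst Int (sym (lk-- p v j)) (int-sub (proj₁ (p-int j)) (int r j)) ,
            subst (N ∣ᵢ_) (solve 3 (λ d p v → d :* p :+ :- (d :* v) := d :* (p :- v)) refl (d j) (p ! j) (v ! j) ∙ cong (d j *_) (sym (lk-- p v j))) (div-+ (proj₂ (p-int j)) (div-neg (coint r j)))
          -- The factor 2 comes from the Euler form: N divides E(x, x), and the norm is twice this
          -- value, whereas K alone would only give divisibility by N.
          big : ∀ x → (∀ j → Int (x ! j) × N ∣ᵢ (d j * x ! j)) → 0ℚ < K x x → N + N ≤ K x x
          big x h q = ℚP.≤-trans (ℚP.+-mono-≤ N≤E N≤E) (ℚP.≤-reflexive (E-double allCox x))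
            where
            E>0 : 0ℚ < E (allFin n) x x
            E>0 = pos-cancel {2ℚ} 0<2 (subst (0ℚ <_) (sym (E-double allCox x) ∙ solve 1 (λ x → x :+ x := con 2ℚ :* x) refl (E (allFin n) x x)) q)
            N≤E : N ≤ E (allFin n) x x
            N≤E = div≥ (N>0 r) (E-div (allFin n) x x (proj₂ ∘ h) (proj₁ ∘ h)) E>0
          cross : K p m ≤ 0ℚ
          cross = 0≤- (subst (0ℚ ≤_) (sumQ-cong (λ i → sumQ-cong (λ j → solve 1 (λ x → :- x := (:- con 1ℚ) :* x) refl (p ! i * m ! j * (d i * a i j))) ∙ sumQ-* (- 1ℚ) (λ j → p ! i * m ! j * (d i * a i j))) ∙
                sumQ-* (- 1ℚ) (λ i → sumQ (λ j → p ! i * m ! j * (d i * a i j))) ∙ solve 1 (λ x → (:- con 1ℚ) :* x := :- x) refl (K p m))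
              (sumQ-≥0 {f = λ i → sumQ (λ j → - (p ! i * m ! j * (d i * a i j)))} λ i → sumQ-≥0 {f = λ j → - (p ! i * m ! j * (d i * a i j))} λ j → term i j (i Fin.≟ j)))
            where
            term : ∀ i j → Dec (i ≡ j) → 0ℚ ≤ - (p ! i * m ! j * (d i * a i j))
            term i j (yes refl) = ℚP.≤-reflexive (sym (cong (λ t → - (t * (d i * a i i))) (pm i) ∙ solve 1 (λ x → :- (con 0ℚ :* x) := con 0ℚ) refl (d i * a i i)))
            term i j (no q) = subst (0ℚ ≤_) (solve 4 (λ p m d a → p :* m :* (d :* (:- a)) := :- (p :* m :* (d :* a))) refl (p ! i) (m ! j) (d i) (a i j))
              (0≤* (0≤* (p≥0 i) (m≥0 j)) (0≤* (ℚP.<⇒≤ (d>0 i)) (≤0⇒ (a-off q))))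
          v≡ : v ≡ p -ᵥ m
          v≡ = vec-ext λ j → sym (lk-- p m j ∙ cong (λ t → p ! j - t) (lk-- p v j) ∙ solve 2 (λ p v → p :- (p :- v) := v) refl (p ! j) (v ! j))
          total : K p p + K m m ≤ N + N
          total = by≤ (- (K p m + K p m)) (≤0⇒ (ℚP.+-mono-≤ cross cross))
            (cong (_- (K p p + K m m)) (sym (norm r) ∙ cong (λ t → K t t) v≡ ∙ K-sub p m) ∙ solve 3 (λ a b c → a :- (b :+ b) :+ c :- (a :+ c) := :- (b :+ b)) refl (K p p) (K p m) (K m m))
          nz : ∀ x i → 0ℚ < x ! i → x ≢ 0ᵥ {n}
          nz x i h q = >⇒≢ h (cong (λ t → t ! i) q ∙ lk-0 {n} i)
          go : Dec (∃ λ i → 0ℚ < p ! i) → Dec (∃ λ i → 0ℚ < m ! i) → Pos v ⊎ Pos ((- 1ℚ) ·ᵥ v)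
          go (yes (i , hi)) (yes (j , hj)) = ⊥-elim (<⇒≱ (by< (N + N) (0<+ (N>0 r) (ℚP.<⇒≤ (N>0 r))) (solve 1 (λ n → (n :+ n :+ (n :+ n)) :- (n :+ n) := n :+ n) refl N))
              (ℚP.≤-trans (ℚP.+-mono-≤ (big p p-int Kp) (big m m-int Km)) total))
            where
            -- The positive part vanishes where the negative part does not, and conversely. So both
            -- have a zero coordinate, and their norms are positive even when K is only
            -- semidefinite.
            Kp : 0ℚ < K p p
            Kp = pdp j p (*≡0 {m ! j} (>⇒≢ hj) (ℚP.*-comm (m ! j) (p ! j) ∙ pm j)) (nz p i hi)
            Km : 0ℚ < K m m
            Km = pdp i m (*≡0 {p ! i} (>⇒≢ hi) (pm i)) (nz m j hj)
          go (no h) _ = inj₂ λ j → subst (0ℚ ≤_) (lk-- p v j ∙ cong (_- lookup v j) (p0 j) ∙ solve 1 (λ x → con 0ℚ :- x := (:- con 1ℚ) :* x) refl (v ! j) ∙ sym (lk-· (- 1ℚ) v j)) (m≥0 j)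
            where
            p0 : ∀ j → p ! j ≡ 0ℚ
            p0 j = ℚP.≤-antisym (ℚP.≮⇒≥ (λ q → h (j , q))) (p≥0 j)
          go (yes _) (no h) = inj₁ λ j → subst (0ℚ ≤_) (eq j) (p≥0 j)
            where
            eq : ∀ j → p ! j ≡ v ! j
            eq j = solve 2 (λ p v → p := v :+ (p :- v)) refl (p ! j) (v ! j) ∙ cong (lookup v j +_) (sym (lk-- p v j) ∙ ℚP.≤-antisym (ℚP.≮⇒≥ (λ q → h (j , q))) (m≥0 j)) ∙ ℚP.+-identityʳ (v ! j)

        cauchy : ∀ x y → 0ℚ < K y y → K x y * K x y ≤ K x x * K y y
        cauchy x y h = sub≥ (nonneg-cancel h (subst (0ℚ ≤_) eq (psd z)))
          where
          z : V n
          z = (K y y ·ᵥ x) -ᵥ (K x y ·ᵥ y)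
          eq : K z z ≡ K y y * (K x x * K y y - K x y * K x y)
          eq = K-sub (K y y ·ᵥ x) (K x y ·ᵥ y) ∙ cong₂ (λ a b → a - (b + b) + K (K x y ·ᵥ y) (K x y ·ᵥ y)) (K-scale2 (K y y) x)
              (Functional.scale (K-linˡ (K x y ·ᵥ y)) (K y y) x ∙ cong (K y y *_) (Functional.scale (K-linʳ x) (K x y) y)) ∙
            cong (λ t → K y y * K y y * K x x - (K y y * (K x y * K x y) + K y y * (K x y * K x y)) + t) (K-scale2 (K x y) y) ∙
              solve 3 (λ b a c → b :* b :* a :- (b :* (c :* c) :+ b :* (c :* c)) :+ c :* c :* b := b :* (a :* b :- c :* c)) refl (K y y) (K x x) (K x y)

        sq≡0 : ∀ {x} → x * x ≤ 0ℚ → x ≡ 0ℚ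
        sq≡0 {x} h = decidable-stable (x ℚP.≟ 0ℚ) (λ p → <⇒≱ (0<sq p) h)

        -- Cauchy's inequality against each simple root. In affine type it turns vectors of norm 0
        -- into multiples of δ, by `null-δ`.
        norm0-null : ∀ {x} → K x x ≡ 0ℚ → Null x
        norm0-null {x} h j = *≡0 (d≢0 j) (sym (K-eʳ x j) ∙ sq≡0 (ℚP.≤-trans (cauchy x (e j) Ke) (ℚP.≤-reflexive (cong (_* K (e j) (e j)) h ∙ ℚP.*-zeroˡ (K (e j) (e j))))))
          where
          Ke : 0ℚ < K (e j) (e j)
          Ke = subst (0ℚ <_) (sym (K-e j)) (0<+ (d>0 j) (ℚP.<⇒≤ (d>0 j)))

        null-K : ∀ {x} → Null x → ∀ y → K y x ≡ 0ℚ
        null-K {x} h y = K-Kc y x ∙ sumQ-cong (λ i → cong (λ t → y ! i * (d i * t)) (h i) ∙ solve 2 (λ y d → y :* (d :* con 0ℚ) := con 0ℚ) refl (y ! i) (d i)) ∙ sumQ-0 n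

      -- The numbers k and k' are the two Cartan integers K(x^∨, y) and K(y^∨, x); `bound` is the
      -- Cauchy inequality divided by N M.
      record Pairing (N M : ℚ) (x y : V n) : Set where
        field
          k k'  : ℚ
          k-int : Int k
          k'-int : Int k'
          eqN   : K x y ≡ N * k
          eqM   : K x y ≡ M * k'
          bound : k * k' ≤ toℚ (ℤ.+ 4)

      abstract
        pairing : ∀ {N M x y} → IsRt N x → IsRt M y → Pairing N M x y
        pairing {N} {M} {x} {y} rx ry = record { k = quo p ; k' = quo q ; k-int = quo-int p ; k'-int = quo-int q
          ; eqN = quo-eq p ; eqM = eqM ; bound = sub≥ (nonneg-cancel NM>0 (subst (0ℚ ≤_) eq (≥sub (cauchy x y Ky)))) }
          where
          p : N ∣ᵢ K x y
          p = K-div x y (coint rx) (int ry)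
          q : M ∣ᵢ K y x
          q = K-div y x (coint ry) (int rx)
          eqM : K x y ≡ M * quo q
          eqM = K-sym x y ∙ quo-eq q
          NM>0 : 0ℚ < N * M
          NM>0 = 0<* (N>0 rx) (N>0 ry)
          Ky : 0ℚ < K y y
          Ky = subst (0ℚ <_) (sym (norm ry)) (0<+ (N>0 ry) (ℚP.<⇒≤ (N>0 ry)))
          eq : K x x * K y y - K x y * K x y ≡ N * M * (toℚ (ℤ.+ 4) - quo p * quo q)
          eq = cong₂ _-_ (cong₂ _*_ (norm rx) (norm ry)) (cong₂ _*_ (quo-eq p) eqM) ∙
            solve 4 (λ n m p q → (n :+ n) :* (m :+ m) :- n :* p :* (m :* q) := n :* m :* (con (toℚ (ℤ.+ 4)) :- p :* q)) refl N M (quo p) (quo q)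

        -- If s_i v is negative, v has no coordinate outside i and is a multiple m α_i. Integrality
        -- of v and of its coroot make m an integer with integral inverse, so m = 1.
        pos-s : ∀ {N v} i → IsRt N v → Pos v → v ≢ e i → Pos (s i v)
        pos-s {N} {v} i r pv ne = go (posneg (rt-s i r))
          where
          go : Pos (s i v) ⊎ Pos ((- 1ℚ) ·ᵥ s i v) → Pos (s i v)
          go (inj₁ p) = p
          go (inj₂ p) = ⊥-elim (ne (v≡ ∙ cong (_·ᵥ e i) m≡1 ∙ 1·ᵥ (e i)))
            where
            vj : ∀ j → i ≢ j → v ! j ≡ 0ℚ
            vj j h = ℚP.≤-antisym (0≤- (subst (0ℚ ≤_) (lk-· (- 1ℚ) (s i v) j ∙ cong ((- 1ℚ) *_) (lk-s-≢ v h) ∙ solve 1 (λ x → (:- con 1ℚ) :* x := :- x) refl (v ! j)) (p j))) (pv j)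
            m : ℚ
            m = v ! i
            v≡ : v ≡ m ·ᵥ e i
            v≡ = vec-ext λ j → go' j (i Fin.≟ j) ∙ sym (lk-· m (e i) j)
              where
              go' : ∀ j → Dec (i ≡ j) → v ! j ≡ m * e i ! j
              go' j (yes refl) = sym (cong (m *_) (e-on i) ∙ ℚP.*-identityʳ m)
              go' j (no h) = vj j h ∙ sym (cong (m *_) (e-off h) ∙ ℚP.*-zeroʳ m)
            N≡ : N ≡ m * m * d i
            N≡ = half-inj (sym (norm r) ∙ cong (λ t → K t t) v≡ ∙ K-scale2 m (e i) ∙ cong (m * m *_) (K-e i) ∙ ℚP.*-distribˡ-+ (m * m) (d i) (d i))
            m≢0 : m ≢ 0ℚ
            m≢0 h = >⇒≢ (N>0 r) (N≡ ∙ cong (λ t → t * t * d i) h ∙ ℚP.*-zeroˡ (d i))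
            q : ℚ
            q = quo (coint r i)
            mq : m * q ≡ 1ℚ
            mq = *-cancelˡ {m * d i} (λ h → m≢0 (*≡0 (d≢0 i) (ℚP.*-comm (d i) m ∙ h))) (solve 3 (λ m q d → m :* d :* (m :* q) := m :* m :* d :* q) refl m q (d i) ∙
              cong (_* q) (sym N≡) ∙ sym (quo-eq (coint r i)) ∙ solve 2 (λ m d → d :* m := m :* d :* con 1ℚ) refl m (d i))
            m≡1 : m ≡ 1ℚ
            m≡1 = unit (int r i) (quo-int (coint r i)) (pv i) mq

        -- Since K(v, v) > 0, some i has v_i > 0 and K(α_i^∨, v) > 0, and s_i lowers the height by
        -- at least 1. The recursion on the height bound h stops at a simple root.
        descent : ∀ (h : ℕ) {N v} → IsRt N v → Pos v → sumQ (lookup v) ≤ toℚ (ℤ.+ h) → RealRoot v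
        descent h {N} {v} r pv le = go h le (v ≟ᵥ e i)
          where
          tf : Fin n → ℚ
          tf i = v ! i * (d i * Kc i v)
          K>0 : 0ℚ < sumQ tf
          K>0 = subst (0ℚ <_) (sym (norm r) ∙ K-Kc v v) (0<+ (N>0 r) (ℚP.<⇒≤ (N>0 r)))
          i : Fin n
          i = proj₁ (sumQ>0 {n} {tf} K>0)
          t>0 : 0ℚ < v ! i * (d i * Kc i v)
          t>0 = proj₂ (sumQ>0 {n} {tf} K>0)
          vi>0 : 0ℚ < v ! i
          vi>0 = go' (≤⇒<⊎≡ (pv i))
            where
            go' : 0ℚ < v ! i ⊎ 0ℚ ≡ v ! i → 0ℚ < v ! i
            go' (inj₁ p) = p
            go' (inj₂ p) = ⊥-elim (>⇒≢ t>0 (cong (_* (d i * Kc i v)) (sym p) ∙ ℚP.*-zeroˡ (d i * Kc i v)))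
          Kc≥1 : 1ℚ ≤ Kc i v
          Kc≥1 = int≥1 (Kc-int i {v} (int r)) (pos-cancel (d>0 i) (pos-cancel vi>0 t>0))
          go : ∀ h → sumQ (lookup v) ≤ toℚ (ℤ.+ h) → Dec (v ≡ e i) → RealRoot v
          go h le (yes q) = [] , i , sym q
          go zero le (no q) = ⊥-elim (<⇒≱ vi>0 (ℚP.≤-trans (sumQ-≥1 pv i) le))
          go (suc h) le (no q) = i ∷ proj₁ rec , proj₁ (proj₂ rec) , cong (s i) (proj₂ (proj₂ rec)) ∙ s-invol i v
            where
            sum-eq : sumQ (lookup (s i v)) ≡ sumQ (lookup v) - Kc i v
            sum-eq = sumQ-cong (λ j → lk-s i v j ∙ solve 3 (λ x k t → x :- k :* t := x :+ (:- k) :* t) refl (v ! j) (Kc i v) (δδ i j)) ∙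
              sumQ-+ (lookup v) (λ j → (- Kc i v) * δδ i j) ∙ cong (sumQ (lookup v) +_) (sumQ-cong (λ j → ℚP.*-comm (- Kc i v) (δδ i j)) ∙ sumQ-δ i (λ _ → - Kc i v))
            le' : sumQ (lookup (s i v)) ≤ toℚ (ℤ.+ h)
            le' = subst₂ _≤_ (sym sum-eq) (cong (_- 1ℚ) (toℚ-+ (ℤ.+ 1) (ℤ.+ h)) ∙ solve 1 (λ x → con 1ℚ :+ x :- con 1ℚ := x) refl (toℚ (ℤ.+ h)))
              (ℚP.+-mono-≤ le (ℚP.neg-antimono-≤ Kc≥1))
            rec : RealRoot (s i v)
            rec = descent h (rt-s i r) (pos-s i r pv q) le'

        real-neg : ∀ {v} → RealRoot v → RealRoot ((- 1ℚ) ·ᵥ v)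
        real-neg (w , i , refl) = w ++ i ∷ [] , i , act-++ w (i ∷ []) (e i) ∙ cong (actW w) (s-e i ∙ neg-simple i) ∙ Linear.scale (act-lin w) (- 1ℚ) (e i)

        neg-neg : ∀ (v : V n) → (- 1ℚ) ·ᵥ ((- 1ℚ) ·ᵥ v) ≡ v
        neg-neg v = vec-ext λ j → lk-· (- 1ℚ) ((- 1ℚ) ·ᵥ v) j ∙ cong ((- 1ℚ) *_) (lk-· (- 1ℚ) v j) ∙ solve 1 (λ x → (:- con 1ℚ) :* ((:- con 1ℚ) :* x) := x) refl (v ! j)

        rt-real : ∀ {N v} → IsRt N v → RealRoot v
        rt-real {N} {v} r = go (posneg r)
          where
          posreal : ∀ {x} → IsRt N x → Pos x → RealRoot x
          posreal {x} rx px = let (h , eq) = int-ℕ (sumQ-int (int rx)) (sumQ-≥0 px) in descent h rx px (ℚP.≤-reflexive eq)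
          go : Pos v ⊎ Pos ((- 1ℚ) ·ᵥ v) → RealRoot v
          go (inj₁ p) = posreal r p
          go (inj₂ p) = subst RealRoot (neg-neg v) (real-neg (posreal (rt-neg r) p))

        -- Half the norm is the only possible N, and the remaining conditions ask whether finitely
        -- many rationals are integers. `RealRoot` itself quantifies over all words.
        rt? : ∀ v → Dec (∃ λ N → IsRt N v)
        rt? v = go (0ℚ ℚP.<? N)
          where
          N : ℚ
          N = inv (>⇒≢ 0<2) * K v v
          NN : K v v ≡ N + N
          NN = sym (ℚP.*-identityˡ (K v v)) ∙ cong (_* K v v) (sym (inv-r (>⇒≢ 0<2))) ∙ solve 2 (λ i k → con 2ℚ :* i :* k := i :* k :+ i :* k) refl (inv (>⇒≢ 0<2)) (K v v)
          go : Dec (0ℚ < N) → Dec (∃ λ N → IsRt N v)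
          go (no p) = no λ { (M , r) → p (subst (0ℚ <_) (half-inj {M} {N} (sym (norm r) ∙ NN)) (N>0 r)) }
          go (yes p) = map′ (λ { (h , h') → N , rt p NN h (λ j → dv (inv (>⇒≢ p) * (d j * v ! j)) (h' j) (eq j)) })
              (λ { (M , r) → int r , λ j → subst Int (*-cancelˡ (>⇒≢ p) (sym (quo-eq (coint r j) ∙ cong (_* quo (coint r j)) (half-inj {M} {N} (sym (norm r) ∙ NN))) ∙ eq j)) (quo-int (coint r j)) })
              (FinP.all? (λ j → int? (v ! j)) ×-dec FinP.all? (λ j → int? (inv (>⇒≢ p) * (d j * v ! j))))
            where
            eq : ∀ j → d j * v ! j ≡ N * (inv (>⇒≢ p) * (d j * v ! j))
            eq j = sym (ℚP.*-identityˡ (d j * v ! j)) ∙ cong (_* (d j * v ! j)) (sym (inv-r (>⇒≢ p))) ∙ ℚP.*-assoc N (inv (>⇒≢ p)) (d j * v ! j)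

        coroot-spec : ∀ v i → K v v ≢ 0ℚ → K v v * corootCoordRe v i ≡ 2ℚ * d i * lookup v i
        coroot-spec v i h with K v v ℚP.≟ 0ℚ
        ... | yes p = ⊥-elim (h p)
        ... | no p = solve 3 (λ k x i → k :* (x :* i) := (k :* i) :* x) refl (K v v) (2ℚ * d i * v ! i) (inv p) ∙
          cong (_* (2ℚ * d i * v ! i)) (inv-r p) ∙ ℚP.*-identityˡ (2ℚ * d i * v ! i)

        coroot-rt : ∀ {N v} (r : IsRt N v) i → corootCoordRe v i ≡ inv (N≢0 r) * (d i * v ! i)
        coroot-rt {N} {v} r i = *-cancelˡ {K v v} K≢0 (coroot-spec v i K≢0 ∙ sym eq ∙ cong (_* (inv (N≢0 r) * (d i * v ! i))) (sym (norm r)))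
          where
          K≢0 : K v v ≢ 0ℚ
          K≢0 = >⇒≢ (subst (0ℚ <_) (sym (norm r)) (0<+ (N>0 r) (ℚP.<⇒≤ (N>0 r))))
          eq : (N + N) * (inv (N≢0 r) * (d i * v ! i)) ≡ 2ℚ * d i * v ! i
          eq = solve 4 (λ n i d v → (n :+ n) :* (i :* (d :* v)) := (n :* i) :* (con 2ℚ :* d :* v)) refl N (inv (N≢0 r)) (d i) (v ! i) ∙
            cong (_* (2ℚ * d i * v ! i)) (inv-r (N≢0 r)) ∙ ℚP.*-identityˡ (2ℚ * d i * v ! i)

    open RootTheory public

    -- Orbits of the inverse Coxeter element and walks to simple roots.

    module Walks where
      τ : List (Fin n) → V n → V n
      τ w = actW (reverse w)

      τ^ : List (Fin n) → ℕ → V n → V n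
      τ^ w zero    v = v
      τ^ w (suc k) v = τ w (τ^ w k v)

      orb : List (Fin n) → ℕ → V n → V n
      orb w zero    v = 0ᵥ
      orb w (suc p) v = orb w p v +ᵥ τ^ w p v

      -- A root that can be made simple by moving first letters of the word to its end.
      data Fwd : List (Fin n) → V n → Set where
        stop : ∀ {i u} → Fwd (i ∷ u) (e i)
        step : ∀ {i u v} → v ≢ e i → Fwd (u ++ i ∷ []) (s i v) → Fwd (i ∷ u) v

      -- The number of possible vectors of Cartan integers K(α_j^∨, v), each between -4 and 4; it
      -- bounds the period of `τ` on a root modulo the radical of K.
      L : ℕ
      L = 9 ℕ.^ n

      abstract
        τ^-lin : ∀ w k → Linear (τ^ w k)
        τ^-lin w zero    = lin (λ _ _ → refl) (λ _ _ → refl)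
        τ^-lin w (suc k) = lin
          (λ u v → cong (τ w) (Linear.add (τ^-lin w k) u v) ∙ Linear.add (act-lin (reverse w)) (τ^ w k u) (τ^ w k v))
          (λ q v → cong (τ w) (Linear.scale (τ^-lin w k) q v) ∙ Linear.scale (act-lin (reverse w)) q (τ^ w k v))

        τ^-K : ∀ w k u v → K (τ^ w k u) (τ^ w k v) ≡ K u v
        τ^-K w zero    u v = refl
        τ^-K w (suc k) u v = K-act (reverse w) (τ^ w k u) (τ^ w k v) ∙ τ^-K w k u v

        τ^-rt : ∀ {N v} w k → IsRt N v → IsRt N (τ^ w k v)
        τ^-rt w zero    r = r
        τ^-rt w (suc k) r = rt-act (reverse w) (τ^-rt w k r)

        τ^-+ : ∀ w k l v → τ^ w (k ℕ.+ l) v ≡ τ^ w k (τ^ w l v)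
        τ^-+ w zero    l v = refl
        τ^-+ w (suc k) l v = cong (τ w) (τ^-+ w k l v)

        τ^-null : ∀ w k v → Null v → τ^ w k v ≡ v
        τ^-null w zero    v h = refl
        τ^-null w (suc k) v h = cong (τ w) (τ^-null w k v h) ∙ act-null (reverse w) v h

        ∈-rev : ∀ {w : List (Fin n)} j → j ∈ reverse w → j ∈ w
        ∈-rev {w} j p = PermP.∈-resp-↭ (PermP.↭-reverse w) p

        τ^-supp : ∀ {w v} k → Supp w v → Supp w (τ^ w k v)
        τ^-supp zero h = h
        τ^-supp {w} {v} (suc k) h = supp-act {w} {τ^ w k v} (reverse w) ∈-rev (τ^-supp {w} {v} k h)

        orb-supp : ∀ {w v} p → Supp w v → Supp w (orb w p v)
        orb-supp zero h j _ = lk-0 j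
        orb-supp {w} {v} (suc p) h j q = lk-+ (orb w p v) (τ^ w p v) j ∙ cong₂ _+_ (orb-supp {w} {v} p h j q) (τ^-supp {w} {v} p h j q)

        -- The sum telescopes. Through `E-serre` this expresses the pairing of any vector with an
        -- orbit sum by the difference of the two ends of the orbit.
        orb-tel : ∀ w p v → orb w p v -ᵥ τ w (orb w p v) ≡ v -ᵥ τ^ w p v
        orb-tel w zero v = cong (0ᵥ -ᵥ_) (Linear.zer (act-lin (reverse w))) ∙ -ᵥ-self 0ᵥ ∙ sym (-ᵥ-self v)
        orb-tel w (suc p) v = vec-ext λ j → begin
          lookup ((o +ᵥ t) -ᵥ τ w (o +ᵥ t)) j ≡⟨ lk-- (o +ᵥ t) (τ w (o +ᵥ t)) j ∙ cong₂ _-_ (lk-+ o t j) (cong (λ x → x ! j) (Linear.add (act-lin (reverse w)) o t) ∙ lk-+ (τ w o) (τ w t) j) ⟩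
          (o ! j + t ! j) - (τ w o ! j + τ w t ! j)
            ≡⟨ solve 4 (λ o t o' t' → (o :+ t) :- (o' :+ t') := (o :- o') :+ (t :- t')) refl (o ! j) (t ! j) (τ w o ! j) (τ w t ! j) ⟩
          (o ! j - τ w o ! j) + (t ! j - τ w t ! j) ≡⟨ cong (_+ (t ! j - τ w t ! j)) (sym (lk-- o (τ w o) j) ∙ cong (λ x → x ! j) (orb-tel w p v) ∙ lk-- v t j) ⟩
          (v ! j - t ! j) + (t ! j - τ w t ! j) ≡⟨ solve 3 (λ v t t' → (v :- t) :+ (t :- t') := v :- t') refl (v ! j) (t ! j) (τ w t ! j) ⟩
          v ! j - τ w t ! j ≡⟨ lk-- v (τ w t) j ⟨
          (v -ᵥ τ w t) ! j ∎
          where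
          open ≡-Reasoning
          o t : V n
          o = orb w p v
          t = τ^ w p v

        orb-≥ : ∀ w p v → (∀ k → k ℕ.< suc p → Pos (τ^ w k v)) → ∀ j → v ! j ≤ orb w (suc p) v ! j
        orb-≥ w zero v h j = ℚP.≤-reflexive (sym (lk-+ 0ᵥ v j ∙ cong (_+ lookup v j) (lk-0 j) ∙ ℚP.+-identityˡ (v ! j)))
        orb-≥ w (suc p) v h j = ℚP.≤-trans (orb-≥ w p v (λ k q → h k (ℕP.m<n⇒m<1+n q)) j)
          (by≤ (τ^ w (suc p) v ! j) (h (suc p) ℕP.≤-refl j) (cong (_- lookup (orb w (suc p) v) j) (lk-+ (orb w (suc p) v) (τ^ w (suc p) v) j) ∙
            solve 2 (λ a b → a :+ b :- a := b) refl (orb w (suc p) v ! j) (τ^ w (suc p) v ! j)))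

        pos-k : ∀ {N M x y} → (p : Pairing N M x y) → 0ℚ < N → 0ℚ < M → 0ℚ < K x y → 1ℚ ≤ Pairing.k p × 1ℚ ≤ Pairing.k' p
        pos-k {x = x} {y} p hN hM h = int≥1 (Pairing.k-int p) (pos-cancel hN (subst (0ℚ <_) (Pairing.eqN p) h)) , int≥1 (Pairing.k'-int p) (pos-cancel hM (subst (0ℚ <_) (Pairing.eqM p) h))

        *-mono : ∀ {x y} → 0ℚ ≤ x → 1ℚ ≤ y → x ≤ x * y
        *-mono {x} {y} hx hy = by≤ (x * (y - 1ℚ)) (0≤* hx (≥sub hy)) (solve 2 (λ x y → x :* y :- x := x :* (y :- con 1ℚ)) refl x y)

        -- When the value is positive, the opposite Cartan integer is at least 1, and the product of
        -- both is at most 4.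
        Kc≤4 : ∀ {N v} j → IsRt N v → Kc j v ≤ toℚ (ℤ.+ 4)
        Kc≤4 {N} {v} j r = go (0ℚ ℚP.<? Kc j v)
          where
          p : Pairing (d j) N (e j) v
          p = pairing (rt-e j) r
          k≡ : Pairing.k p ≡ Kc j v
          k≡ = *-cancelˡ (d≢0 j) (sym (Pairing.eqN p) ∙ K-eˡ j v)
          go : Dec (0ℚ < Kc j v) → Kc j v ≤ toℚ (ℤ.+ 4)
          go (no q) = ℚP.≤-trans (ℚP.≮⇒≥ q) (ℚP.nonNegative⁻¹ (toℚ (ℤ.+ 4)))
          go (yes q) = ℚP.≤-trans (*-mono (ℚP.<⇒≤ q) k'≥1) (subst (λ t → t * Pairing.k' p ≤ toℚ (ℤ.+ 4)) k≡ (Pairing.bound p))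
            where
            k'≥1 : 1ℚ ≤ Pairing.k' p
            k'≥1 = proj₂ (pos-k p (d>0 j) (IsRt.N>0 r) (subst (0ℚ <_) (sym (K-eˡ j v)) (0<* (d>0 j) q)))

        null-from : ∀ {x} → (∀ z → K z x ≡ 0ℚ) → Null x
        null-from {x} h j = *≡0 (d≢0 j) (sym (K-eˡ j x) ∙ h (e j))

        -- By the pigeonhole principle two of the first L + 1 translates of v have the same pairings
        -- with all simple coroots. Their difference lies in the radical, and so does its preimage
        -- under a power of the isometry `τ`.
        period : ∀ {N v} w → IsRt N v → ∃ λ p → suc p ℕ.≤ L × Null (τ^ w (suc p) v -ᵥ v)
        period {N} {v} w r with FinP.pigeonhole {L} {suc L} ℕP.≤-refl (λ t → Fin.funToFin (λ j → code (proj₁ (zz t j))))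
          where
          zz : ∀ (t : Fin (suc L)) j → Int (Kc j (τ^ w (Fin.toℕ t) v))
          zz t j = Kc-int j {τ^ w (Fin.toℕ t) v} (IsRt.int (τ^-rt w (Fin.toℕ t) r))
        ... | i , j , i<j , eq = p , p≤ , null-from {τ^ w (suc p) v -ᵥ v} λ z → sym (τ^-K w (Fin.toℕ i) z (τ^ w (suc p) v -ᵥ v)) ∙ cong (K (τ^ w (Fin.toℕ i) z)) shift ∙
              null-K {τ^ w (Fin.toℕ j) v -ᵥ τ^ w (Fin.toℕ i) v} nl (τ^ w (Fin.toℕ i) z)
          where
          p : ℕ
          p = Fin.toℕ j ℕ.∸ suc (Fin.toℕ i)
          j≡ : Fin.toℕ i ℕ.+ suc p ≡ Fin.toℕ j
          j≡ = ℕP.+-suc (Fin.toℕ i) p ∙ ℕP.m+[n∸m]≡n i<j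
          p≤ : suc p ℕ.≤ L
          p≤ = ℕP.≤-trans (ℕP.m≤n+m (suc p) (Fin.toℕ i)) (subst (ℕ._≤ L) (sym j≡) (ℕP.≤-pred (FinP.toℕ<n j)))
          z : ∀ (t : Fin (suc L)) l → Int (Kc l (τ^ w (Fin.toℕ t) v))
          z t l = Kc-int l {τ^ w (Fin.toℕ t) v} (IsRt.int (τ^-rt w (Fin.toℕ t) r))
          small : ∀ t l → proj₁ (z t l) ℤ.≤ ℤ.+ 4
          small t l = ℤP.≮⇒≥ λ q → <⇒≱ (ℚP.<-≤-trans (toℚ-<4) (toℚ-mono (ℤP.i<j⇒suc[i]≤j q))) (subst (_≤ toℚ (ℤ.+ 4)) (proj₂ (z t l)) (Kc≤4 l (τ^-rt w (Fin.toℕ t) r)))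
            where
            toℚ-<4 : toℚ (ℤ.+ 4) < toℚ (ℤ.+ 5)
            toℚ-<4 = sub> (ℚP.positive⁻¹ 1ℚ)
          small' : ∀ t l → ℤ.- proj₁ (z t l) ℤ.≤ ℤ.+ 4
          small' t l = ℤP.≮⇒≥ λ q → <⇒≱ (ℚP.<-≤-trans (toℚ-<4) (toℚ-mono (ℤP.i<j⇒suc[i]≤j q)))
              (subst (_≤ toℚ (ℤ.+ 4)) (Functional.neg (Kc-lin l) (τ^ w (Fin.toℕ t) v) ∙ cong -_ (proj₂ (z t l)) ∙ sym (toℚ-neg (proj₁ (z t l)))) (Kc≤4 l (rt-neg (τ^-rt w (Fin.toℕ t) r))))
            where
            toℚ-<4 : toℚ (ℤ.+ 4) < toℚ (ℤ.+ 5)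
            toℚ-<4 = sub> (ℚP.positive⁻¹ 1ℚ)
          codes : ∀ l → code (proj₁ (z i l)) ≡ code (proj₁ (z j l))
          codes l = sym (FinP.finToFun-funToFin (λ l → code (proj₁ (z i l))) l) ∙ cong (λ F → Fin.finToFun F l) eq ∙ FinP.finToFun-funToFin (λ l → code (proj₁ (z j l))) l
          same : ∀ l → Kc l (τ^ w (Fin.toℕ i) v) ≡ Kc l (τ^ w (Fin.toℕ j) v)
          same l = proj₂ (z i l) ∙ cong toℚ (sym (decode-code (proj₁ (z i l)) (small i l) (small' i l)) ∙ cong decode (codes l) ∙ decode-code (proj₁ (z j l)) (small j l) (small' j l)) ∙ sym (proj₂ (z j l))
          nl : Null (τ^ w (Fin.toℕ j) v -ᵥ τ^ w (Fin.toℕ i) v)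
          nl l = Functional.sub (Kc-lin l) (τ^ w (Fin.toℕ j) v) (τ^ w (Fin.toℕ i) v) ∙ cong (λ t → Kc l (τ^ w (Fin.toℕ j) v) - t) (same l) ∙ ℚP.+-inverseʳ (Kc l (τ^ w (Fin.toℕ j) v))
          shift : τ^ w (Fin.toℕ i) (τ^ w (suc p) v -ᵥ v) ≡ τ^ w (Fin.toℕ j) v -ᵥ τ^ w (Fin.toℕ i) v
          shift = Linear.sub (τ^-lin w (Fin.toℕ i)) (τ^ w (suc p) v) v ∙ cong (_-ᵥ τ^ w (Fin.toℕ i) v) (sym (τ^-+ w (Fin.toℕ i) (suc p) v) ∙ cong (λ t → τ^ w t v) j≡)

        -- The letters of p are moved to the end one at a time. Either the root meets the simple
        -- root of the current letter, or it stays positive throughout and a walk from its image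
        -- extends to a walk from v.
        round : ∀ {N} p q v → IsRt N v → Pos v → Fwd (p ++ q) v ⊎ (Pos (actW (reverse p) v) × (Fwd (q ++ p) (actW (reverse p) v) → Fwd (p ++ q) v))
        round [] q v r pv = inj₂ (pv , subst (λ t → Fwd t v) (ListP.++-identityʳ q))
        round (i ∷ p) q v r pv = go (v ≟ᵥ e i)
          where
          Goal : Set
          Goal = Fwd (i ∷ p ++ q) v ⊎ (Pos (actW (reverse (i ∷ p)) v) × (Fwd (q ++ i ∷ p) (actW (reverse (i ∷ p)) v) → Fwd (i ∷ p ++ q) v))
          go : Dec (v ≡ e i) → Goal
          go (yes refl) = inj₁ stop
          go (no ne) = next (round p (q ++ i ∷ []) (s i v) (rt-s i r) (pos-s i r pv ne))
            where
            back : Fwd (p ++ q ++ i ∷ []) (s i v) → Fwd (i ∷ p ++ q) v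
            back f = step ne (subst (λ t → Fwd t (s i v)) (sym (ListP.++-assoc p q (i ∷ []))) f)
            next : Fwd (p ++ q ++ i ∷ []) (s i v) ⊎ (Pos (actW (reverse p) (s i v)) × (Fwd ((q ++ i ∷ []) ++ p) (actW (reverse p) (s i v)) → Fwd (p ++ q ++ i ∷ []) (s i v))) → Goal
            next (inj₁ f) = inj₁ (back f)
            next (inj₂ (pp , k)) = inj₂ (subst Pos (sym (act-rev-∷ i p v)) pp , λ f → back (k (subst₂ Fwd (sym (ListP.++-assoc q (i ∷ []) p)) (act-rev-∷ i p v) f)))

        -- One `round` through all of w is one application of `τ`; as long as no walk has been
        -- found, all translates so far are positive.
        rounds : ∀ {N v} w → IsRt N v → Pos v → ∀ m → Fwd w v ⊎ ((∀ k → k ℕ.≤ m → Pos (τ^ w k v)) × (Fwd w (τ^ w m v) → Fwd w v))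
        rounds {N} {v} w r pv zero = inj₂ ((λ { zero _ → pv }) , λ f → f)
        rounds {N} {v} w r pv (suc m) = go (rounds w r pv m)
          where
          Goal : Set
          Goal = Fwd w v ⊎ ((∀ k → k ℕ.≤ suc m → Pos (τ^ w k v)) × (Fwd w (τ^ w (suc m) v) → Fwd w v))
          go : Fwd w v ⊎ ((∀ k → k ℕ.≤ m → Pos (τ^ w k v)) × (Fwd w (τ^ w m v) → Fwd w v)) → Goal
          go (inj₁ f) = inj₁ f
          go (inj₂ (ps , k)) = next (round w [] (τ^ w m v) (τ^-rt w m r) (ps m ℕP.≤-refl))
            where
            fix : ∀ {x} → Fwd (w ++ []) x → Fwd w x
            fix {x} = subst (λ t → Fwd t x) (ListP.++-identityʳ w)
            next : Fwd (w ++ []) (τ^ w m v) ⊎ (Pos (τ w (τ^ w m v)) × (Fwd w (τ w (τ^ w m v)) → Fwd (w ++ []) (τ^ w m v))) → Goal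
            next (inj₁ f) = inj₁ (k (fix f))
            next (inj₂ (pp , k')) = inj₂ ((λ l q → last l (ℕP.m≤n⇒m<n∨m≡n q)) , λ f → k (fix (k' f)))
              where
              last : ∀ l → l ℕ.< suc m ⊎ l ≡ suc m → Pos (τ^ w l v)
              last l (inj₁ (ℕ.s≤s q)) = ps l q
              last l (inj₂ refl) = pp

        rt-nz : ∀ {N} → ¬ IsRt N 0ᵥ
        rt-nz r = >⇒≢ (0<+ (IsRt.N>0 r) (ℚP.<⇒≤ (IsRt.N>0 r))) (sym (IsRt.norm r) ∙ Functional.zer (K-linʳ 0ᵥ))

        -- If K is definite on the letters of w, the orbit sum of a root that stays positive would be a nonzero vector of norm 0.
        fwd-finite : ∀ {N v} w → Unique w → (∀ x → Supp w x → K x x ≡ 0ℚ → x ≡ 0ᵥ) → IsRt N v → Pos v → Supp w v → Fwd w v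
        fwd-finite {N} {v} w uq def r pv sv = go (rounds w r pv (suc p))
          where
          p : ℕ
          p = proj₁ (period w r)
          nl : Null (τ^ w (suc p) v -ᵥ v)
          nl = proj₂ (proj₂ (period w r))
          per : τ^ w (suc p) v ≡ v
          per = -ᵥ≡0 (def (τ^ w (suc p) v -ᵥ v) (λ j q → lk-- (τ^ w (suc p) v) v j ∙ cong₂ _-_ (τ^-supp {w} {v} (suc p) sv j q) (sv j q) ∙ ℚP.+-inverseʳ 0ℚ)
            (null-K {τ^ w (suc p) v -ᵥ v} nl (τ^ w (suc p) v -ᵥ v)))
          o : V n
          o = orb w (suc p) v
          o≡0 : o ≡ 0ᵥ
          o≡0 = def o (orb-supp {w} {v} (suc p) sv) (sym (E-serre w o o uq (orb-supp {w} {v} (suc p) sv)) ∙ cong (E w o) (orb-tel w (suc p) v ∙ cong (v -ᵥ_) per ∙ -ᵥ-self v) ∙ Functional.zer (E-linʳ w o))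
          go : Fwd w v ⊎ ((∀ k → k ℕ.≤ suc p → Pos (τ^ w k v)) × (Fwd w (τ^ w (suc p) v) → Fwd w v)) → Fwd w v
          go (inj₁ f) = f
          go (inj₂ (ps , _)) = ⊥-elim (rt-nz (subst (IsRt N) v≡0 r))
            where
            v≡0 : v ≡ 0ᵥ
            v≡0 = vec-ext λ j → ℚP.≤-antisym (ℚP.≤-trans (orb-≥ w p v (λ k q → ps k (ℕP.<⇒≤ q)) j) (ℚP.≤-reflexive (cong (λ t → t ! j) o≡0 ∙ lk-0 j))) (pv j) ∙ sym (lk-0 j)

      -- This is what a walk of v to a simple root leaves behind. It will be used for the special
      -- root ξ and the parabolic word that omits one letter, to transport both the action and the
      -- Euler form.
      record Conjugate (w : List (Fin n)) (v : V n) : Set where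
        field
          g      : List (Fin n)
          j      : Fin n
          u      : List (Fin n)
          g-e    : actW g (e j) ≡ v
          perm   : w ↭ j ∷ u
          g⊆     : ∀ l → l ∈ g → l ∈ w
          act-eq : ∀ x → actW w x ≡ actW g (actW (j ∷ u) (actW (reverse g) x))
          E-eq   : ∀ x y → Supp w x → Supp w y → E w x y ≡ E (j ∷ u) (actW (reverse g) x) (actW (reverse g) y)

      abstract
        fwd-conj : ∀ {w v} → Unique w → Fwd w v → Conjugate w v
        fwd-conj {i ∷ u} uq stop = record { g = [] ; j = i ; u = u ; g-e = refl ; perm = ↭-refl ; g⊆ = λ _ () ; act-eq = λ _ → refl ; E-eq = λ _ _ _ _ → refl }
        fwd-conj {i ∷ u} {v} uq (step _ f) = record { g = i ∷ g ; j = j ; u = u'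
          ; g-e = cong (s i) g-e ∙ s-invol i v
          ; perm = ↭-trans (snoc↭ i u) perm
          ; g⊆ = λ { l (here refl) → here refl ; l (there m) → PermP.∈-resp-↭ (↭-sym (snoc↭ i u)) (g⊆ l m) }
          ; act-eq = λ x → cong (s i) (sym (act-++ u (i ∷ []) (s i x) ∙ cong (actW u) (s-invol i x)) ∙ act-eq (s i x)) ∙
              cong (λ t → s i (actW g (actW (j ∷ u') t))) (sym (act-rev-∷ i g x))
          ; E-eq = λ x y sx sy → sym (E-rot i u x y uq sx sy) ∙ E-eq (s i x) (s i y) (sp x sx) (sp y sy) ∙ cong₂ (E (j ∷ u')) (sym (act-rev-∷ i g x)) (sym (act-rev-∷ i g y)) }
          where
          open Conjugate (fwd-conj (uq-↭ (snoc↭ i u) uq) f) renaming (u to u')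
          sp : ∀ x → Supp (i ∷ u) x → Supp (u ++ i ∷ []) (s i x)
          sp x sx = supp-↭ {x = s i x} (snoc↭ i u) (supp-s {i ∷ u} {i} {x} (here refl) sx)

    open Walks public

    -- The arrow expressions under moves of a letter.

    module Compatibility where
      -- The factor lam covers both kinds of arguments: it is 1 / N for a real root of norm 2N, and
      -- κ for δ.
      module Coroot (c : Fin n → ℚ) (α : V n) (lam : ℚ) (lam≥0 : 0ℚ ≤ lam) (c-eq : ∀ i → c i ≡ lam * (d i * α ! i)) where
        abstract
          cα≥0 : Pos α → ∀ i → 0ℚ ≤ c i
          cα≥0 pα i = subst (0ℚ ≤_) (sym (c-eq i)) (0≤* lam≥0 (0≤* (ℚP.<⇒≤ (d>0 i)) (pα i)))

          pos-part : ∀ {x} → 0ℚ ≤ x → [ x ]₊ ≡ x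
          pos-part = ℚP.p≥q⇒p⊔q≡p

          arrowTo-E : Pos α → ∀ β → Pos β → ∀ w → arrowTo c β w + lam * lsum w (λ i → d i * (α ! i * β ! i)) ≡ lam * E w α β
          arrowTo-E pα β pβ [] = cong (λ t → 0ℚ + lam * t) (lsum-[] (λ i → d i * (α ! i * β ! i))) ∙ ℚP.+-identityˡ (lam * 0ℚ)
          arrowTo-E pα β pβ (x ∷ xs) = cong₂ (λ s t → s + arrowTo c β xs + lam * t) head (lsum-∷ x xs f) ∙
              solve 5 (λ h a l p q → h :+ a :+ l :* (p :+ q) := (h :+ l :* p) :+ (a :+ l :* q)) refl (lam * (β ! x * S)) (arrowTo c β xs) lam (f x) (lsum xs f) ∙
              cong (λ t → (lam * (β ! x * S) + lam * f x) + t) (arrowTo-E pα β pβ xs) ∙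
                solve 4 (λ l b p q → (l :* b :+ l :* p) :+ l :* q := l :* ((p :+ b) :+ q)) refl lam (β ! x * S) (f x) (E xs α β)
            where
            f : Fin n → ℚ
            f i = d i * (α ! i * β ! i)
            S : ℚ
            S = lsum xs (λ k → d x * a x k * α ! k)
            head : List.foldr (λ y acc → a y x * [ c y ]₊ * [ lookup β x ]₊ + acc) 0ℚ xs ≡ lam * (β ! x * S)
            head = sym (lsum-def xs (λ y → a y x * [ c y ]₊ * [ lookup β x ]₊)) ∙ lsum-cong xs (λ y _ → cong₂ (λ p q → a y x * p * q) (pos-part (cα≥0 pα y) ∙ c-eq y) (pos-part (pβ x)) ∙
                solve 5 (λ a l d x b → a :* (l :* (d :* x)) :* b := l :* b :* (d :* a :* x)) refl (a y x) lam (d y) (α ! y) (β ! x) ∙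
                  cong (λ t → lam * β ! x * (t * α ! y)) (da y x)) ∙
              lsum-* xs (lam * β ! x) (λ k → d x * a x k * α ! k) ∙ ℚP.*-assoc lam (β ! x) S

          arrowFrom-E : Pos α → ∀ β → Pos β → ∀ w → arrowFrom c β w + lam * lsum w (λ i → d i * (α ! i * β ! i)) ≡ lam * E w β α
          arrowFrom-E pα β pβ [] = cong (λ t → 0ℚ + lam * t) (lsum-[] (λ i → d i * (α ! i * β ! i))) ∙ ℚP.+-identityˡ (lam * 0ℚ)
          arrowFrom-E pα β pβ (x ∷ xs) = cong₂ (λ s t → s + arrowFrom c β xs + lam * t) head (lsum-∷ x xs f) ∙
              solve 5 (λ h a l p q → h :+ a :+ l :* (p :+ q) := (h :+ l :* p) :+ (a :+ l :* q)) refl (lam * (α ! x * S)) (arrowFrom c β xs) lam (f x) (lsum xs f) ∙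
              cong (λ t → (lam * (α ! x * S) + lam * f x) + t) (arrowFrom-E pα β pβ xs) ∙
                solve 6 (λ l b d x y q → (l :* b :+ l :* (d :* (x :* y))) :+ l :* q := l :* ((d :* (y :* x) :+ b) :+ q)) refl lam (α ! x * S) (d x) (α ! x) (β ! x) (E xs β α)
            where
            f : Fin n → ℚ
            f i = d i * (α ! i * β ! i)
            S : ℚ
            S = lsum xs (λ k → d x * a x k * β ! k)
            head : List.foldr (λ y acc → a x y * [ c x ]₊ * [ lookup β y ]₊ + acc) 0ℚ xs ≡ lam * (α ! x * S)
            head = sym (lsum-def xs (λ y → a x y * [ c x ]₊ * [ lookup β y ]₊)) ∙ lsum-cong xs (λ y _ → cong₂ (λ p q → a x y * p * q) (pos-part (cα≥0 pα x) ∙ c-eq x) (pos-part (pβ y)) ∙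
                solve 5 (λ a l d x b → a :* (l :* (d :* x)) :* b := l :* x :* (d :* a :* b)) refl (a x y) lam (d x) (α ! x) (β ! y)) ∙
              lsum-* xs (lam * α ! x) (λ k → d x * a x k * β ! k) ∙ ℚP.*-assoc lam (α ! x) S

          diag-sum : ∀ β {w} → Cox w → sumQ (λ i → c i * β ! i) ≡ lam * lsum w (λ i → d i * (α ! i * β ! i))
          diag-sum β {w} (uq , all) = sumQ-cong (λ i → cong (_* lookup β i) (c-eq i) ∙ solve 4 (λ l d x y → l :* (d :* x) :* y := l :* (d :* (x :* y))) refl lam (d i) (α ! i) (β ! i)) ∙
            sumQ-* lam (λ i → d i * (α ! i * β ! i)) ∙ cong (lam *_) (sym (lsum-sumQ w uq (λ i → d i * (α ! i * β ! i)) (λ j q → ⊥-elim (q (all j)))))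

          cm-pos : ∀ {w} → Cox w → Pos α → ∀ β → Pos β → compMax c β w ≡ (- (lam * E w α β)) ⊔ (- (lam * E w β α))
          cm-pos {w} cw pα β pβ = cong₂ _⊔_ (neg-sum (diag-sum β cw) (arrowTo-E pα β pβ w)) (neg-sum (diag-sum β cw) (arrowFrom-E pα β pβ w))
            where
            neg-sum : ∀ {s l a e} → s ≡ l → a + l ≡ e → - s - a ≡ - e
            neg-sum {s} {l} {a} refl refl = solve 2 (λ s a → :- s :- a := :- (a :+ s)) refl s a

      abstract
        ⊔-left : ∀ {x y} → y ≤ x → x ⊔ y ≡ x
        ⊔-left = ℚP.p≥q⇒p⊔q≡p

        ⊔-right : ∀ {x y} → x ≤ y → x ⊔ y ≡ y
        ⊔-right = ℚP.p≤q⇒p⊔q≡q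

        neg≤ : ∀ {x y} → 0ℚ ≤ x → 0ℚ ≤ y → - x ≤ y
        neg≤ p q = ℚP.≤-trans (ℚP.neg-antimono-≤ p) q

        neg-coord : ∀ (i j : Fin n) → [ lookup (negSimple i) j ]₊ ≡ 0ℚ
        neg-coord i j = ℚP.p≤q⇒p⊔q≡q (subst (_≤ 0ℚ) (sym (lk-neg i j)) (ℚP.neg-antimono-≤ (δ≥0 (i Fin.≟ j))))
          where
          δ≥0 : Dec (i ≡ j) → 0ℚ ≤ δδ i j
          δ≥0 (yes refl) = subst (0ℚ ≤_) (sym (δδ-refl i)) 0≤1
          δ≥0 (no p) = ℚP.≤-reflexive (sym (δδ-≢ p))

        foldr-0 : ∀ (xs : List (Fin n)) (f : Fin n → ℚ) → (∀ y → f y ≡ 0ℚ) → List.foldr (λ y acc → f y + acc) 0ℚ xs ≡ 0ℚ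
        foldr-0 [] f h = refl
        foldr-0 (x ∷ xs) f h = cong₂ _+_ (h x) (foldr-0 xs f h)

        -- All positive parts of a negative simple root vanish, so both arrow sums are 0 and only
        -- the bilinear term survives. This yields (P2), and `cm-negˡ` yields (P1).
        cm-negʳ : ∀ c i w → compMax c (negSimple i) w ≡ c i
        cm-negʳ c i w = cong₂ (λ p q → (- S - p) ⊔ (- S - q)) (to w) (from w) ∙ ℚP.⊔-idem (- S - 0ℚ) ∙ solve 1 (λ x → :- x :- con 0ℚ := :- x) refl S ∙ cong -_ S≡ ∙ solve 1 (λ x → :- (:- x) := x) refl (c i)
          where
          S : ℚ
          S = sumQ (λ j → c j * negSimple i ! j)
          S≡ : S ≡ - c i
          S≡ = sumQ-cong (λ j → cong (c j *_) (lk-neg i j) ∙ solve 2 (λ c d → c :* (:- d) := d :* (:- c)) refl (c j) (δδ i j)) ∙ sumQ-δ i (λ j → - c j)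
          to : ∀ w → arrowTo c (negSimple i) w ≡ 0ℚ
          to [] = refl
          to (x ∷ xs) = cong₂ _+_ (foldr-0 xs (λ y → a y x * [ c y ]₊ * [ lookup (negSimple i) x ]₊) (λ y → cong (a y x * [ c y ]₊ *_) (neg-coord i x) ∙ ℚP.*-zeroʳ (a y x * [ c y ]₊))) (to xs)
          from : ∀ w → arrowFrom c (negSimple i) w ≡ 0ℚ
          from [] = refl
          from (x ∷ xs) = cong₂ _+_ (foldr-0 xs (λ y → a x y * [ c x ]₊ * [ lookup (negSimple i) y ]₊) (λ y → cong (a x y * [ c x ]₊ *_) (neg-coord i y) ∙ ℚP.*-zeroʳ (a x y * [ c x ]₊))) (from xs)

        cm-negˡ : ∀ c i β w → (∀ j → c j ≡ negSimple i ! j) → compMax c β w ≡ β ! i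
        cm-negˡ c i β w h = cong₂ (λ p q → (- S - p) ⊔ (- S - q)) (to w) (from w) ∙ ℚP.⊔-idem (- S - 0ℚ) ∙ solve 1 (λ x → :- x :- con 0ℚ := :- x) refl S ∙ cong -_ S≡ ∙ solve 1 (λ x → :- (:- x) := x) refl (β ! i)
          where
          S : ℚ
          S = sumQ (λ j → c j * β ! j)
          S≡ : S ≡ - β ! i
          S≡ = sumQ-cong (λ j → cong (_* lookup β j) (h j ∙ lk-neg i j) ∙ solve 2 (λ c d → (:- d) :* c := d :* (:- c)) refl (β ! j) (δδ i j)) ∙ sumQ-δ i (λ j → - β ! j)
          c0 : ∀ j → [ c j ]₊ ≡ 0ℚ
          c0 j = cong [_]₊ (h j) ∙ neg-coord i j
          z : ∀ p x q → x ≡ 0ℚ → p * x * q ≡ 0ℚ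
          z p x q refl = solve 2 (λ p q → p :* con 0ℚ :* q := con 0ℚ) refl p q
          to : ∀ w → arrowTo c β w ≡ 0ℚ
          to [] = refl
          to (x ∷ xs) = cong₂ _+_ (foldr-0 xs (λ y → a y x * [ c y ]₊ * [ lookup β x ]₊) (λ y → z (a y x) [ c y ]₊ [ lookup β x ]₊ (c0 y))) (to xs)
          from : ∀ w → arrowFrom c β w ≡ 0ℚ
          from [] = refl
          from (x ∷ xs) = cong₂ _+_ (foldr-0 xs (λ y → a x y * [ c x ]₊ * [ lookup β y ]₊) (λ y → z (a x y) [ c x ]₊ [ lookup β y ]₊ (c0 x))) (from xs)

      -- How σ_i moves an element of -Π ∪ Φ⁺.
      data Typ (i : Fin n) : V n → V n → Set where
        fixed : ∀ j → j ≢ i → Typ i (negSimple j) (negSimple j)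
        up    : Typ i (negSimple i) (e i)
        down  : Typ i (e i) (negSimple i)
        move  : ∀ {v} → Pos v → Pos (s i v) → Typ i v (s i v)

      data Kind (v : V n) : Set where
        isNeg : ∀ j → v ≡ negSimple j → Kind v
        isPos : Pos v → Kind v

      typ-sym : ∀ {i v v'} → Typ i v v' → Typ i v' v
      typ-sym (fixed j h) = fixed j h
      typ-sym up = down
      typ-sym down = up
      typ-sym {i} (move {v} p q) = subst (Typ i (s i v)) (s-invol i v) (move q (subst Pos (sym (s-invol i v)) p))

      -- c lists the coordinates of α^∨ = lam α in the simple coroots.
      record Cor (c : Fin n → ℚ) (α : V n) (lam : ℚ) : Set where
        field
          lam≥0 : 0ℚ ≤ lam
          c-eq  : ∀ i → c i ≡ lam * (d i * α ! i)
          unit-e : ∀ j → α ≡ e j ⊎ α ≡ negSimple j → lam * d j ≡ 1ℚ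
      open Cor

      abstract
        cor-neg : ∀ {c lam} i → Cor c (negSimple i) lam → ∀ j → c j ≡ negSimple i ! j
        cor-neg {c} {lam} i C j = c-eq C j ∙ go (i Fin.≟ j)
          where
          go : Dec (i ≡ j) → lam * (d j * negSimple i ! j) ≡ negSimple i ! j
          go (yes refl) = sym (ℚP.*-assoc lam (d i) (negSimple i ! i)) ∙ cong (_* lookup (negSimple i) i) (unit-e C i (inj₂ refl)) ∙ ℚP.*-identityˡ (negSimple i ! i)
          go (no p) = cong (λ t → lam * (d j * t)) z ∙ solve 2 (λ l d → l :* (d :* con 0ℚ) := con 0ℚ) refl lam (d j) ∙ sym z
            where
            z : negSimple i ! j ≡ 0ℚ
            z = lk-neg i j ∙ cong -_ (δδ-≢ p)

        typ-coord : ∀ {i v v'} → Typ i v v' → ∀ j → j ≢ i → v ! j ≡ v' ! j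
        typ-coord (fixed _ _) j h = refl
        typ-coord {i} up j h = lk-neg i j ∙ cong -_ (δδ-≢ (h ∘ sym)) ∙ sym (e-off (h ∘ sym))
        typ-coord {i} down j h = e-off (h ∘ sym) ∙ sym (lk-neg i j ∙ cong -_ (δδ-≢ (h ∘ sym)))
        typ-coord (move {v} _ _) j h = sym (lk-s-≢ v (h ∘ sym))

        -- K is the sum of the form and its transpose, and `E-headˡ` evaluates the transposed term.
        E-lastˡ : ∀ i u y → Cox (i ∷ u) → E (i ∷ u) y (e i) ≡ - (d i * s i y ! i)
        E-lastˡ i u y c = solve 2 (λ x y → x := (y :+ x) :- y) refl (E (i ∷ u) y (e i)) (E (i ∷ u) (e i) y) ∙ cong₂ _-_ (E-sym (i ∷ u) (e i) y (proj₁ c) (supp-all (proj₂ c) (e i)) (supp-all (proj₂ c) y) ∙ K-eˡ i y) (E-headˡ i u y (proj₁ c)) ∙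
          solve 3 (λ d k x → d :* k :- d :* x := :- (d :* (x :- k))) refl (d i) (Kc i y) (y ! i) ∙ cong (λ t → - (d i * t)) (sym (lk-s-≡ i y))

        E-rot-neg : ∀ i u y → Cox (i ∷ u) → E (u ++ i ∷ []) (e i) (s i y) ≡ - (d i * y ! i) × E (u ++ i ∷ []) (s i y) (e i) ≡ d i * s i y ! i
        E-rot-neg i u y c = cong (λ t → E w' t (s i y)) e≡ ∙ Functional.neg (E-linˡ w' (s i y)) (s i (e i)) ∙ cong -_ (E-rot i u (e i) y (proj₁ c) (sp (e i)) (sp y) ∙ E-headˡ i u y (proj₁ c)) ,
            cong (E w' (s i y)) e≡ ∙ Functional.neg (E-linʳ w' (s i y)) (s i (e i)) ∙ cong -_ (E-rot i u y (e i) (proj₁ c) (sp y) (sp (e i)) ∙ E-lastˡ i u y c) ∙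
              solve 1 (λ x → :- (:- x) := x) refl (d i * s i y ! i)
          where
          w' : List (Fin n)
          w' = u ++ i ∷ []
          sp : ∀ x → Supp (i ∷ u) x
          sp = supp-all (proj₂ c)
          e≡ : e i ≡ (- 1ℚ) ·ᵥ s i (e i)
          e≡ = sym (cong ((- 1ℚ) ·ᵥ_) (s-e i ∙ neg-simple i) ∙ neg-neg (e i))

        -- If both arguments stay positive, this is `E-rot`. If one of them passes between α_i and
        -- -α_i while the other stays positive, one side is a coordinate by `cm-negˡ` or `cm-negʳ`;
        -- on the other side one of the two expressions is this coordinate and the other is the
        -- negative of a nonnegative number, so the maximum is the coordinate.
        cm-inv : ∀ {i u α α' β β' c c' lam} → Cox (i ∷ u) → Typ i α α' → Typ i β β' → Cor c α lam → Cor c' α' lam →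
          compMax c β (i ∷ u) ≡ compMax c' β' (u ++ i ∷ [])
        cm-inv {i} {u} {β = β} {β'} {c} {c'} cw (fixed j h) tβ C C' = cm-negˡ c j β (i ∷ u) (cor-neg j C) ∙ typ-coord tβ j h ∙ sym (cm-negˡ c' j β' (u ++ i ∷ []) (cor-neg j C'))
        cm-inv {i} {u} {c = c} {c'} {lam} cw up (fixed j h) C C' = cm-negˡ c i (negSimple j) (i ∷ u) (cor-neg i C) ∙ lk-neg j i ∙ cong -_ (δδ-≢ h) ∙ sym (cm-negʳ c' j (u ++ i ∷ []) ∙ c-eq C' j ∙ cong (λ t → lam * (d j * t)) (e-off (h ∘ sym)) ∙ solve 2 (λ l d → l :* (d :* con 0ℚ) := con 0ℚ) refl lam (d j))
        cm-inv {i} {u} {c = c} {c'} {lam} cw up down C C' = cm-negˡ c i (e i) (i ∷ u) (cor-neg i C) ∙ e-on i ∙ sym (cm-negʳ c' i (u ++ i ∷ []) ∙ c-eq C' i ∙ cong (λ t → lam * (d i * t)) (e-on i) ∙ cong (lam *_) (ℚP.*-identityʳ (d i)) ∙ unit-e C' i (inj₁ refl))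
        cm-inv {i} {u} {c = c} {c'} {lam} cw up up C C' = cm-negˡ c i (negSimple i) (i ∷ u) (cor-neg i C) ∙
            sym (Coroot.cm-pos c' (e i) lam (lam≥0 C') (c-eq C') (cox-↭ (snoc↭ i u) cw) (e-nonneg i) (e i) (e-nonneg i) ∙ ⊔-idem' eq ∙ cong -_ (cong (lam *_) val ∙ unit-e C' i (inj₁ refl)) ∙ sym (lk-neg i i ∙ cong -_ (δδ-refl i)))
          where
          eq : E (u ++ i ∷ []) (e i) (e i) ≡ E (u ++ i ∷ []) (e i) (e i)
          eq = refl
          ⊔-idem' : ∀ {x} → x ≡ x → (- (lam * x)) ⊔ (- (lam * x)) ≡ - (lam * x)
          ⊔-idem' {x} _ = ℚP.⊔-idem (- (lam * x))
          val : E (u ++ i ∷ []) (e i) (e i) ≡ d i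
          val = half-inj (E-double (cox-↭ (snoc↭ i u) cw) (e i) ∙ K-e i)
        cm-inv {i} {u} {c = c} {c'} {lam} cw up (move {v} p q) C C' = cm-negˡ c i v (i ∷ u) (cor-neg i C) ∙
            sym (Coroot.cm-pos c' (e i) lam (lam≥0 C') (c-eq C') (cox-↭ (snoc↭ i u) cw) (e-nonneg i) (s i v) q ∙ cong₂ _⊔_ l r ∙ ⊔-left (neg≤ (q i) (p i)))
          where
          l : - (lam * E (u ++ i ∷ []) (e i) (s i v)) ≡ v ! i
          l = cong (λ t → - (lam * t)) (proj₁ (E-rot-neg i u v cw)) ∙ solve 3 (λ l d x → :- (l :* :- (d :* x)) := l :* d :* x) refl lam (d i) (v ! i) ∙ cong (_* lookup v i) (unit-e C' i (inj₁ refl)) ∙ ℚP.*-identityˡ (v ! i)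
          r : - (lam * E (u ++ i ∷ []) (s i v) (e i)) ≡ - s i v ! i
          r = cong -_ (cong (lam *_) (proj₂ (E-rot-neg i u v cw)) ∙ sym (ℚP.*-assoc lam (d i) (s i v ! i)) ∙ cong (_* lookup (s i v) i) (unit-e C' i (inj₁ refl)) ∙ ℚP.*-identityˡ (s i v ! i))
        cm-inv {i} {u} {c = c} {c'} {lam} cw down (fixed j h) C C' = cm-negʳ c j (i ∷ u) ∙ c-eq C j ∙ cong (λ t → lam * (d j * t)) (e-off (h ∘ sym)) ∙ solve 2 (λ l d → l :* (d :* con 0ℚ) := con 0ℚ) refl lam (d j) ∙
            sym (cm-negˡ c' i (negSimple j) (u ++ i ∷ []) (cor-neg i C') ∙ lk-neg j i ∙ cong -_ (δδ-≢ h))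
        cm-inv {i} {u} {c = c} {c'} {lam} cw down up C C' = cm-negʳ c i (i ∷ u) ∙ c-eq C i ∙ cong (λ t → lam * (d i * t)) (e-on i) ∙ cong (lam *_) (ℚP.*-identityʳ (d i)) ∙ unit-e C i (inj₁ refl) ∙
            sym (cm-negˡ c' i (e i) (u ++ i ∷ []) (cor-neg i C') ∙ e-on i)
        cm-inv {i} {u} {c = c} {c'} {lam} cw down down C C' = Coroot.cm-pos c (e i) lam (lam≥0 C) (c-eq C) cw (e-nonneg i) (e i) (e-nonneg i) ∙ ℚP.⊔-idem (- (lam * E (i ∷ u) (e i) (e i))) ∙ cong (λ t → - (lam * t)) val ∙ cong -_ (unit-e C i (inj₁ refl)) ∙ sym (lk-neg i i ∙ cong -_ (δδ-refl i)) ∙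
            sym (cm-negˡ c' i (negSimple i) (u ++ i ∷ []) (cor-neg i C'))
          where
          val : E (i ∷ u) (e i) (e i) ≡ d i
          val = half-inj (E-double cw (e i) ∙ K-e i)
        cm-inv {i} {u} {c = c} {c'} {lam} cw down (move {v} p q) C C' = Coroot.cm-pos c (e i) lam (lam≥0 C) (c-eq C) cw (e-nonneg i) v p ∙ cong₂ _⊔_ l r ∙ ⊔-right (neg≤ (p i) (q i)) ∙
            sym (cm-negˡ c' i (s i v) (u ++ i ∷ []) (cor-neg i C'))
          where
          l : - (lam * E (i ∷ u) (e i) v) ≡ - v ! i
          l = cong -_ (cong (lam *_) (E-headˡ i u v (proj₁ cw)) ∙ sym (ℚP.*-assoc lam (d i) (v ! i)) ∙ cong (_* lookup v i) (unit-e C i (inj₁ refl)) ∙ ℚP.*-identityˡ (v ! i))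
          r : - (lam * E (i ∷ u) v (e i)) ≡ s i v ! i
          r = cong (λ t → - (lam * t)) (E-lastˡ i u v cw) ∙ solve 3 (λ l d x → :- (l :* :- (d :* x)) := l :* d :* x) refl lam (d i) (s i v ! i) ∙ cong (_* lookup (s i v) i) (unit-e C i (inj₁ refl)) ∙ ℚP.*-identityˡ (s i v ! i)
        cm-inv {i} {u} {c = c} {c'} {lam} cw (move {v} p q) (fixed j h) C C' = cm-negʳ c j (i ∷ u) ∙ c-eq C j ∙ cong (λ t → lam * (d j * t)) (sym (lk-s-≢ v (h ∘ sym))) ∙ sym (c-eq C' j) ∙ sym (cm-negʳ c' j (u ++ i ∷ []))
        cm-inv {i} {u} {c = c} {c'} {lam} cw (move {v} p q) up C C' = cm-negʳ c i (i ∷ u) ∙ c-eq C i ∙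
            sym (Coroot.cm-pos c' (s i v) lam (lam≥0 C') (c-eq C') (cox-↭ (snoc↭ i u) cw) q (e i) (e-nonneg i) ∙ cong₂ _⊔_ l r ∙ ⊔-right (neg≤ (0≤* (lam≥0 C) (0≤* (ℚP.<⇒≤ (d>0 i)) (q i))) (0≤* (lam≥0 C) (0≤* (ℚP.<⇒≤ (d>0 i)) (p i)))))
          where
          l : - (lam * E (u ++ i ∷ []) (s i v) (e i)) ≡ - (lam * (d i * s i v ! i))
          l = cong (λ t → - (lam * t)) (proj₂ (E-rot-neg i u v cw))
          r : - (lam * E (u ++ i ∷ []) (e i) (s i v)) ≡ lam * (d i * v ! i)
          r = cong (λ t → - (lam * t)) (proj₁ (E-rot-neg i u v cw)) ∙ solve 2 (λ l x → :- (l :* :- x) := l :* x) refl lam (d i * v ! i)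
        cm-inv {i} {u} {c = c} {c'} {lam} cw (move {v} p q) down C C' = Coroot.cm-pos c v lam (lam≥0 C) (c-eq C) cw p (e i) (e-nonneg i) ∙ cong₂ _⊔_ l r ∙ ⊔-left (neg≤ (0≤* (lam≥0 C) (0≤* (ℚP.<⇒≤ (d>0 i)) (p i))) (0≤* (lam≥0 C) (0≤* (ℚP.<⇒≤ (d>0 i)) (q i)))) ∙
            sym (c-eq C' i) ∙ sym (cm-negʳ c' i (u ++ i ∷ []))
          where
          l : - (lam * E (i ∷ u) v (e i)) ≡ lam * (d i * s i v ! i)
          l = cong (λ t → - (lam * t)) (E-lastˡ i u v cw) ∙ solve 2 (λ l x → :- (l :* :- x) := l :* x) refl lam (d i * s i v ! i)
          r : - (lam * E (i ∷ u) (e i) v) ≡ - (lam * (d i * v ! i))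
          r = cong (λ t → - (lam * t)) (E-headˡ i u v (proj₁ cw))
        cm-inv {i} {u} {c = c} {c'} {lam} cw (move {v} p q) (move {v'} p' q') C C' = Coroot.cm-pos c v lam (lam≥0 C) (c-eq C) cw p v' p' ∙
            cong₂ (λ x y → (- (lam * x)) ⊔ (- (lam * y))) (sym (E-rot i u v v' (proj₁ cw) (sp v) (sp v'))) (sym (E-rot i u v' v (proj₁ cw) (sp v') (sp v))) ∙
            sym (Coroot.cm-pos c' (s i v) lam (lam≥0 C') (c-eq C') (cox-↭ (snoc↭ i u) cw) q (s i v') q')
          where
          sp : ∀ x → Supp (i ∷ u) x
          sp = supp-all (proj₂ cw)

        E-cox : ∀ {w w'} → Cox w → Cox w' → matOf w ≡ matOf w' → ∀ x y → E w x y ≡ E w' x y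
        E-cox {w} {w'} cw cw' eq = E-mat w w' (proj₁ cw) (↭-trans (ordering-cox cw) (↭-sym (ordering-cox cw'))) (mat-act {w} {w'} eq)

        cm-word : ∀ {w w' α β c lam} → Cox w → Cox w' → matOf w ≡ matOf w' → Kind α → Kind β → Cor c α lam → compMax c β w ≡ compMax c β w'
        cm-word {w} {w'} {β = β} {c} cw cw' eq (isNeg j refl) _ C = cm-negˡ c j β w (cor-neg j C) ∙ sym (cm-negˡ c j β w' (cor-neg j C))
        cm-word {w} {w'} {c = c} cw cw' eq (isPos p) (isNeg j refl) C = cm-negʳ c j w ∙ sym (cm-negʳ c j w')
        cm-word {w} {w'} {α} {β} {c} {lam} cw cw' eq (isPos p) (isPos q) C = Coroot.cm-pos c α lam (lam≥0 C) (c-eq C) cw p β q ∙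
          cong₂ (λ x y → (- (lam * x)) ⊔ (- (lam * y))) (E-cox cw cw' eq α β) (E-cox cw cw' eq β α) ∙ sym (Coroot.cm-pos c α lam (lam≥0 C) (c-eq C) cw' p β q)

        pos≢neg : ∀ {v} j → Pos v → v ≢ negSimple j
        pos≢neg {v} j p h = <⇒≱ (ℚP.negative⁻¹ (- 1ℚ)) (subst (0ℚ ≤_) (cong (λ t → t ! j) h ∙ lk-neg j j ∙ cong -_ (δδ-refl j)) (p j))

        σ-fixed : ∀ i j → j ≢ i → σ i (negSimple j) ≡ negSimple j
        σ-fixed i j h with FinP.any? (λ l → ¬? (l Fin.≟ i) ×-dec VecP.≡-dec ℚP._≟_ (negSimple j) (negSimple l))
        ... | yes _ = refl
        ... | no p = ⊥-elim (p (j , h , refl))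

        σ-else : ∀ i v → (∀ j → j ≢ i → v ≢ negSimple j) → σ i v ≡ s i v
        σ-else i v h with FinP.any? (λ l → ¬? (l Fin.≟ i) ×-dec VecP.≡-dec ℚP._≟_ v (negSimple l))
        ... | yes (j , p , q) = ⊥-elim (h j p q)
        ... | no _ = refl

        negSimple-inj : ∀ {i j : Fin n} → negSimple i ≡ negSimple j → i ≡ j
        negSimple-inj {i} {j} h = decidable-stable (i Fin.≟ j) λ p → >⇒≢ 0<1 (solve 0 (con 1ℚ := :- (:- con 1ℚ)) refl ∙ cong -_
          (cong -_ (sym (δδ-refl i)) ∙ sym (lk-neg i i) ∙ cong (λ t → t ! i) h ∙ lk-neg j i ∙ cong -_ (δδ-≢ (p ∘ sym))))

        σ-typ-neg : ∀ i j → Typ i (negSimple j) (σ i (negSimple j))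
        σ-typ-neg i j = go (j Fin.≟ i)
          where
          go : Dec (j ≡ i) → Typ i (negSimple j) (σ i (negSimple j))
          go (yes refl) = subst (Typ i (negSimple i)) (sym (σ-else i (negSimple i) (λ l p q → p (sym (negSimple-inj q))) ∙ s-neg i)) up
          go (no p) = subst (Typ i (negSimple j)) (sym (σ-fixed i j p)) (fixed j p)

        σ-typ-e : ∀ i → Typ i (e i) (σ i (e i))
        σ-typ-e i = subst (Typ i (e i)) (sym (σ-else i (e i) (λ l _ → pos≢neg l (e-nonneg i)) ∙ s-e i)) down

        σ-typ-pos : ∀ {v} i → Pos v → Pos (s i v) → Typ i v (σ i v)
        σ-typ-pos {v} i p q = subst (Typ i v) (sym (σ-else i v (λ l _ → pos≢neg l p))) (move p q)

        σ-typ-rt : ∀ {N v} i → IsRt N v → Pos v → Typ i v (σ i v)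
        σ-typ-rt {N} {v} i r p = go (v ≟ᵥ e i)
          where
          go : Dec (v ≡ e i) → Typ i v (σ i v)
          go (yes refl) = σ-typ-e i
          go (no h) = σ-typ-pos i p (pos-s i r p h)

        rt-ns : ∀ i → IsRt (d i) (negSimple i)
        rt-ns i = subst (IsRt (d i)) (sym (neg-simple i)) (rt-neg (rt-e i))

        rt-typ : ∀ {i v v′ N} → IsRt N v → Typ i v v′ → IsRt N v′
        rt-typ r (fixed _ _) = r
        rt-typ {i} r up = subst (IsRt _) (s-neg i) (rt-s i r)
        rt-typ {i} r down = subst (IsRt _) (s-e i) (rt-s i r)
        rt-typ {i} r (move _ _) = rt-s i r

        cor-rt : ∀ {N v} (r : IsRt N v) → Cor (corootCoordRe v) v (inv (IsRt.N≢0 r))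
        cor-rt {N} {v} r = record { lam≥0 = ℚP.<⇒≤ (inv-pos (IsRt.N>0 r)) ; c-eq = coroot-rt r
          ; unit-e = λ { j (inj₁ refl) → un (rt-N (rt-e j) r) ; j (inj₂ refl) → un (rt-N (rt-ns j) r) } }
          where
          un : ∀ {x} → x ≡ N → inv (IsRt.N≢0 r) * x ≡ 1ℚ
          un refl = ℚP.*-comm (inv (IsRt.N≢0 r)) N ∙ inv-r (IsRt.N≢0 r)

        inv-irr : ∀ {N} (p q : N ≢ 0ℚ) → inv p ≡ inv q
        inv-irr p q = *-cancelˡ p (inv-r p ∙ sym (inv-r q))

        cor-rt′ : ∀ {N v v′} (r : IsRt N v) → IsRt N v′ → Cor (corootCoordRe v′) v′ (inv (IsRt.N≢0 r))
        cor-rt′ {v′ = v′} r r′ = subst (Cor (corootCoordRe v′) v′) (inv-irr (IsRt.N≢0 r′) (IsRt.N≢0 r)) (cor-rt r′)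

        initial-word : ∀ {w i} → Cox w → Initial i (matOf w) → ∃ λ u → Cox (i ∷ u) × matOf (i ∷ u) ≡ matOf w
        initial-word {w} {i} cw (u , red) = u , reduced-cox {w} {i ∷ u} cw red , proj₁ red

        final-word : ∀ {w i} → Cox w → Final i (matOf w) → ∃ λ u → Cox (u ++ i ∷ []) × matOf (u ++ i ∷ []) ≡ matOf w
        final-word {w} {i} cw (u , red) = u , reduced-cox {w} {u ++ i ∷ []} cw red , proj₁ red

        word-initial : ∀ {i u} → Cox (i ∷ u) → Initial i (matOf (i ∷ u))
        word-initial {i} {u} c = u , cox-reduced c

        word-final : ∀ {i u} → Cox (u ++ i ∷ []) → Final i (matOf (u ++ i ∷ []))
        word-final {i} {u} c = u , cox-reduced c

    open Compatibility public

  -- Finite type.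

  module FiniteTheorem (fin : FiniteType) where
    private
      psd : ∀ v → 0ℚ ≤ K v v
      psd v = go (v ≟ᵥ 0ᵥ)
        where
        go : Dec (v ≡ 0ᵥ) → 0ℚ ≤ K v v
        go (yes refl) = ℚP.≤-reflexive (sym (Functional.zer (K-linʳ 0ᵥ)))
        go (no p) = ℚP.<⇒≤ (fin v p)

    open Semidefinite psd (λ _ v _ p → fin v p)
    open FiniteCase

    phi-rt : ∀ {w v} → PhiC w v → ∃ λ N → IsRt N v
    phi-rt (inj₁ (i , refl)) = d i , rt-ns i
    phi-rt (inj₂ (r , _)) = real-rt r

    phi-kind : ∀ {w v} → PhiC w v → Kind v
    phi-kind (inj₁ (i , e)) = isNeg i e
    phi-kind (inj₂ (_ , p)) = isPos p

    phi-typ : ∀ {w v} i → PhiC w v → Typ i v (σ i v)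
    phi-typ i (inj₁ (j , refl)) = σ-typ-neg i j
    phi-typ i (inj₂ (r , p)) = σ-typ-rt i (proj₂ (real-rt r)) p

    typ-phi : ∀ {i v v' w} → ∃ (λ N → IsRt N v) → Typ i v v' → PhiC w v'
    typ-phi r (fixed j _) = inj₁ (j , refl)
    typ-phi {i} r up = inj₂ (([] , i , refl) , e-nonneg i)
    typ-phi {i} r down = inj₁ (i , refl)
    typ-phi {i} (_ , r) (move _ q) = inj₂ (rt-real (rt-s i r) , q)

    phi-σ : ∀ {w v} i → PhiC w v → PhiC w (σ i v)
    phi-σ {w} i φ = typ-phi {w = w} (phi-rt {w} φ) (phi-typ {w} i φ)

    val : List (Fin n) → V n → V n → ℚ
    val w α β = compMax (corootCoordRe α) β w

    val-inv : ∀ {i u α α' β β'} → Cox (i ∷ u) → ∃ (λ N → IsRt N α) → Typ i α α' → Typ i β β' → val (i ∷ u) α β ≡ val (u ++ i ∷ []) α' β'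
    val-inv {α' = α'} c (N , r) tα tβ = cm-inv c tα tβ (cor-rt r) (cor-rt′ r (rt-typ r tα))

    -- Whichever word is found, the value is the same by `fun-val`; the value 0 off the Coxeter
    -- elements is arbitrary.
    fun : Mat → V n → V n → ℚ
    fun M α β = pick (findWord M)
      module Fun where
      pick : Dec (∃ λ w → Cox w × matOf w ≡ M) → ℚ
      pick (yes (w , _)) = val w α β
      pick (no _)        = 0ℚ

    fun-val : ∀ {w α β} → Cox w → PhiC w α → PhiC w β → fun (matOf w) α β ≡ val w α β
    fun-val {w} {α} {β} cw φ ψ = go (findWord (matOf w))
      where
      go : (x : Dec (∃ λ w' → Cox w' × matOf w' ≡ matOf w)) → Fun.pick (matOf w) α β x ≡ val w α β
      go (yes (w' , cw' , eq)) = cm-word cw' cw eq (phi-kind {w} φ) (phi-kind {w} ψ) (cor-rt (proj₂ (phi-rt {w} φ)))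
      go (no p) = ⊥-elim (p (w , cw , refl))

    fun-props : Props fun
    fun-props =
      (λ w ow i β φ → fun-val {w} (cox-ordering ow) (inj₁ (i , refl)) φ ∙ cm-negˡ (corootCoordRe (negSimple i)) i β w (cor-neg i (cor-rt (rt-ns i)))) ,
      (λ w ow i β φ → fun-val {w} (cox-ordering ow) φ (inj₁ (i , refl)) ∙ cm-negʳ (corootCoordRe β) i w) ,
      λ { w ow i (inj₁ ini) α β φ ψ → front i α β φ ψ (cox-ordering ow) (initial-word (cox-ordering ow) ini)
        ; w ow i (inj₂ fi) α β φ ψ → back i α β φ ψ (cox-ordering ow) (final-word (cox-ordering ow) fi) }
      where
      front : ∀ {w} i α β → PhiC w α → PhiC w β → Cox w → (∃ λ u → Cox (i ∷ u) × matOf (i ∷ u) ≡ matOf w) →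
        fun (matOf w) α β ≡ fun (conj i (matOf w)) (σ i α) (σ i β)
      front {w} i α β φ ψ cw (u , cu , eq) = cong (λ M → fun M α β) (sym eq) ∙ fun-val {i ∷ u} cu φ ψ ∙
        val-inv cu (phi-rt {w} φ) (phi-typ {w} i φ) (phi-typ {w} i ψ) ∙
        sym (fun-val {u ++ i ∷ []} (cox-↭ (snoc↭ i u) cu) (phi-σ {w} i φ) (phi-σ {w} i ψ)) ∙
          cong (λ M → fun M (σ i α) (σ i β)) (sym (conj-front i u) ∙ cong (conj i) eq)
      back : ∀ {w} i α β → PhiC w α → PhiC w β → Cox w → (∃ λ u → Cox (u ++ i ∷ []) × matOf (u ++ i ∷ []) ≡ matOf w) →
        fun (matOf w) α β ≡ fun (conj i (matOf w)) (σ i α) (σ i β)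
      back {w} i α β φ ψ cw (u , cu , eq) = cong (λ M → fun M α β) (sym eq) ∙ fun-val {u ++ i ∷ []} cu φ ψ ∙
        sym (val-inv cu' (phi-rt {w} (phi-σ {w} i φ)) (typ-sym (phi-typ {w} i φ)) (typ-sym (phi-typ {w} i ψ))) ∙
        sym (fun-val {i ∷ u} cu' (phi-σ {w} i φ) (phi-σ {w} i ψ)) ∙
          cong (λ M → fun M (σ i α) (σ i β)) (sym (conj-back i u) ∙ cong (conj i) eq)
        where
        cu' : Cox (i ∷ u)
        cu' = cox-↭ (↭-sym (snoc↭ i u)) cu

    unique : ∀ f → Props f → ∀ w → IsOrdering w → ∀ α β → PhiC w α → PhiC w β → f (cox w) α β ≡ val w α β
    unique f (p1 , p2 , p5) w ow α β (inj₁ (i , refl)) ψ = p1 w ow i β ψ ∙ sym (cm-negˡ (corootCoordRe (negSimple i)) i β w (cor-neg i (cor-rt (rt-ns i))))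
    unique f (p1 , p2 , p5) w ow α β (inj₂ (r , p)) ψ = go {w} (cox-ordering ow) (fwd-finite w (proj₁ (cox-ordering ow)) def (proj₂ (real-rt r)) p (supp-all (proj₂ (cox-ordering ow)) α)) p (real-rt r) β ψ
      where
      def : ∀ x → Supp w x → K x x ≡ 0ℚ → x ≡ 0ᵥ
      def x _ h = decidable-stable (x ≟ᵥ 0ᵥ) λ q → >⇒≢ (fin x q) h
      go : ∀ {w α} → Cox w → Fwd w α → Pos α → ∃ (λ N → IsRt N α) → ∀ β → PhiC w β → f (cox w) α β ≡ val w α β
      go {i ∷ u} cw stop pα r β ψ = p5 (i ∷ u) (ordering-cox cw) i (inj₁ (word-initial cw)) (e i) β (inj₂ (([] , i , refl) , e-nonneg i)) ψ ∙
        cong₂ (λ M x → f M x (σ i β)) (conj-front i u) (σ-else i (e i) (λ l _ → pos≢neg l (e-nonneg i)) ∙ s-e i) ∙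
        p1 (u ++ i ∷ []) (ordering-cox cw') i (σ i β) (phi-σ {w} i ψ) ∙ sym (cm-negˡ (corootCoordRe (negSimple i)) i (σ i β) (u ++ i ∷ []) (cor-neg i (cor-rt (rt-ns i)))) ∙
          sym (val-inv cw r down (phi-typ {w} i ψ))
        where
        cw' : Cox (u ++ i ∷ [])
        cw' = cox-↭ (snoc↭ i u) cw
      go {i ∷ u} {α} cw (step ne f') pα (N , r) β ψ = p5 (i ∷ u) (ordering-cox cw) i (inj₁ (word-initial cw)) α β (inj₂ (rt-real r , pα)) ψ ∙
        cong₂ (λ M x → f M x (σ i β)) (conj-front i u) (σ-else i α (λ l _ → pos≢neg l pα)) ∙
        go (cox-↭ (snoc↭ i u) cw) f' pα' (N , rt-s i r) (σ i β) (phi-σ {w} i ψ) ∙ sym (val-inv cw (N , r) (move pα pα') (phi-typ {w} i ψ))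
        where
        pα' : Pos (s i α)
        pα' = pos-s i r pα ne

    conclusion : Conclusion
    conclusion = (fun , fun-props) , unique

  module AffineTheory (𝒜 : AffineDatum 𝒞) where
    open AffineDatum 𝒜
    open Semidefinite (proj₁ aff) (proj₂ (proj₂ aff)) public
    open AffineCase δ m public
    open IsRt public

    -- The radical, the drift of orbits along δ and the defect of a vector.

    module Affine where
      δ′ m′ : Fin n → ℚ
      δ′ i = toℚ (ℤ.+ δ ! i)
      m′ i = toℚ (ℤ.+ m ! i)

      -- The defect of x: it is invariant under `τ`, and its sign tells in which direction along δ
      -- the orbit of a root drifts.
      D : List (Fin n) → V n → ℚ
      D w x = E w x δQ

      -- D w y ≡ 0ℚ expresses that y lies in U_c (see γ-D).
      record Ups (w : List (Fin n)) (y : V n) : Set where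
        constructor ups
        field
          {norm½} : ℚ
          root : IsRt norm½ y
          posi : Pos y
          D≡0  : D w y ≡ 0ℚ
      open Ups public

      abstract
        lk-δ : ∀ j → δQ ! j ≡ δ′ j
        lk-δ j = VecP.lookup-map j (λ k → toℚ (ℤ.+ k)) δ

        toℚ-pos : ∀ {k} → 0 ℕ.< k → 0ℚ < toℚ (ℤ.+ k)
        toℚ-pos {suc k} _ = ℚP.<-≤-trans 0<1 (toℚ-mono {ℤ.+ 1} {ℤ.+ suc k} (ℤ.+≤+ (ℕ.s≤s ℕ.z≤n)))

        δ>0 : ∀ j → 0ℚ < δQ ! j
        δ>0 j = subst (0ℚ <_) (sym (lk-δ j)) (toℚ-pos {δ ! j} (proj₁ isδ j))

        δ-null : Null δQ
        δ-null i = sumQ-cong (λ j → cong (a i j *_) (lk-δ j)) ∙ proj₁ (proj₂ isδ) i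

        δ-int : ∀ j → Int (δQ ! j)
        δ-int j = subst Int (sym (lk-δ j)) (int-toℚ (ℤ.+ δ ! j))

        δ-pos : Pos δQ
        δ-pos j = ℚP.<⇒≤ (δ>0 j)

        i₀ : Fin n
        i₀ = proj₁ (≢0ᵥ (proj₁ (proj₂ (proj₁ (proj₂ aff)))))

        null-scale : ∀ q {x} → Null x → Null (q ·ᵥ x)
        null-scale q {x} h j = Functional.scale (Kc-lin j) q x ∙ cong (q *_) (h j) ∙ ℚP.*-zeroʳ q

        -- Subtracting the multiple of δ that kills one coordinate leaves a vector of norm 0 in a
        -- subspace on which K is definite.
        null-δ : ∀ x → Null x → ∃ λ q → x ≡ q ·ᵥ δQ
        null-δ x h = q , -ᵥ≡0 (decidable-stable ((x -ᵥ (q ·ᵥ δQ)) ≟ᵥ 0ᵥ) λ p → >⇒≢ (proj₂ (proj₂ aff) i₀ (x -ᵥ (q ·ᵥ δQ)) coord p) (null-K {x -ᵥ (q ·ᵥ δQ)} nl (x -ᵥ (q ·ᵥ δQ))))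
          where
          q : ℚ
          q = inv (>⇒≢ (δ>0 i₀)) * x ! i₀
          coord : (x -ᵥ (q ·ᵥ δQ)) ! i₀ ≡ 0ℚ
          coord = lk-- x (q ·ᵥ δQ) i₀ ∙ cong (λ t → x ! i₀ - t) (lk-· q δQ i₀ ∙ solve 3 (λ i x d → i :* x :* d := d :* i :* x) refl (inv (>⇒≢ (δ>0 i₀))) (x ! i₀) (δQ ! i₀) ∙
            cong (_* lookup x i₀) (inv-r (>⇒≢ (δ>0 i₀))) ∙ ℚP.*-identityˡ (x ! i₀)) ∙ ℚP.+-inverseʳ (x ! i₀)
          nl : Null (x -ᵥ (q ·ᵥ δQ))
          nl j = Functional.sub (Kc-lin j) x (q ·ᵥ δQ) ∙ cong₂ _-_ (h j) (null-scale q {δQ} δ-null j)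

        K-δ : ∀ x → K x δQ ≡ 0ℚ
        K-δ = null-K {δQ} δ-null

        -- The vector with coordinates m_j / d_j is δ^∨ written in simple roots. By symmetrizability
        -- it lies in the radical, hence is a multiple of δ.
        κ-exists : ∃ λ κ → ∀ j → m′ j ≡ κ * (d j * δQ ! j)
        κ-exists = proj₁ r , λ j → sym (cong (_* m′ j) (inv-r (d≢0 j)) ∙ ℚP.*-identityˡ (m′ j)) ∙
            solve 3 (λ d i m → d :* i :* m := d :* (i :* m)) refl (d j) (inv (d≢0 j)) (m′ j) ∙ cong (d j *_) (sym (lk-y j) ∙ cong (λ t → t ! j) (proj₂ r) ∙ lk-· (proj₁ r) δQ j) ∙
              solve 3 (λ d q x → d :* (q :* x) := q :* (d :* x)) refl (d j) (proj₁ r) (δQ ! j)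
          where
          y : V n
          y = tabulate (λ j → inv (d≢0 j) * m′ j)
          lk-y : ∀ j → y ! j ≡ inv (d≢0 j) * m′ j
          lk-y = VecP.lookup∘tabulate (λ j → inv (d≢0 j) * m′ j)
          term : ∀ i j → a i j * y ! j ≡ inv (d≢0 i) * (a j i * m′ j)
          term i j = *-cancelˡ (d≢0 i) (cong (λ t → d i * (a i j * t)) (lk-y j) ∙ solve 4 (λ d a v m → d :* (a :* (v :* m)) := d :* a :* (v :* m)) refl (d i) (a i j) (inv (d≢0 j)) (m′ j) ∙
            cong (_* (inv (d≢0 j) * m′ j)) (da i j) ∙ solve 4 (λ d a v m → d :* a :* (v :* m) := d :* v :* (a :* m)) refl (d j) (a j i) (inv (d≢0 j)) (m′ j) ∙
              cong (_* (a j i * m′ j)) (inv-r (d≢0 j) ∙ sym (inv-r (d≢0 i))) ∙ ℚP.*-assoc (d i) (inv (d≢0 i)) (a j i * m′ j))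
          r : ∃ λ q → y ≡ q ·ᵥ δQ
          r = null-δ y λ i → sumQ-cong (term i) ∙ sumQ-* (inv (d≢0 i)) (λ j → a j i * m′ j) ∙ cong (inv (d≢0 i) *_) (proj₁ (proj₂ ism) i) ∙ ℚP.*-zeroʳ (inv (d≢0 i))

      κ : ℚ
      κ = proj₁ κ-exists

      abstract
        m-κ : ∀ j → m′ j ≡ κ * (d j * δQ ! j)
        m-κ = proj₂ κ-exists

        m>0 : ∀ j → 0ℚ < m′ j
        m>0 j = toℚ-pos {m ! j} (proj₁ ism j)

        κ>0 : 0ℚ < κ
        κ>0 = pos-cancel (0<* (d>0 i₀) (δ>0 i₀)) (subst (0ℚ <_) (m-κ i₀ ∙ ℚP.*-comm κ (d i₀ * δQ ! i₀)) (m>0 i₀))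

        module _ {w : List (Fin n)} (cw : Cox w) where
          spt : ∀ x → Supp w x
          spt = supp-all (proj₂ cw)

          E+ : ∀ x y → E w x y + E w y x ≡ K x y
          E+ x y = E-sym w x y (proj₁ cw) (spt x) (spt y)

          serre : ∀ z x → E w z (τ w x) ≡ - E w x z
          serre z x = solve 2 (λ p q → q := p :- (p :- q)) refl (E w z x) (E w z (τ w x)) ∙ cong (λ t → E w z x - t) (sym (Functional.sub (E-linʳ w z) x (τ w x)) ∙ E-serre w z x (proj₁ cw) (spt z) ∙ K-sym z x ∙ sym (E+ x z)) ∙
            solve 2 (λ p q → p :- (q :+ p) := :- q) refl (E w z x) (E w x z)

          E-δ : ∀ x → E w δQ x ≡ - D w x
          E-δ x = solve 2 (λ p q → p := (q :+ p) :- q) refl (E w δQ x) (D w x) ∙ cong (_- D w x) (E+ x δQ ∙ K-δ x) ∙ ℚP.+-identityˡ (- D w x)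

          D-δ : D w δQ ≡ 0ℚ
          D-δ = half-inj (E+ δQ δQ ∙ K-δ δQ)

          E-τ : ∀ x y → E w (τ w x) (τ w y) ≡ E w x y
          E-τ x y = serre (τ w x) y ∙ cong -_ (serre y x) ∙ solve 1 (λ x → :- (:- x) := x) refl (E w x y)

          E-τ^ : ∀ k x y → E w (τ^ w k x) (τ^ w k y) ≡ E w x y
          E-τ^ zero x y = refl
          E-τ^ (suc k) x y = E-τ (τ^ w k x) (τ^ w k y) ∙ E-τ^ k x y

          D-τ^ : ∀ k x → D w (τ^ w k x) ≡ D w x
          D-τ^ k x = cong (E w (τ^ w k x)) (sym (τ^-null w k δQ δ-null)) ∙ E-τ^ k x δQ

          D-orb : ∀ p x → D w (orb w p x) ≡ toℚ (ℤ.+ p) * D w x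
          D-orb zero x = Functional.zer (E-linˡ w δQ) ∙ sym (ℚP.*-zeroˡ (D w x))
          D-orb (suc p) x = trans (Functional.add (E-linˡ w δQ) (orb w p x) (τ^ w p x)) (cong₂ _+_ (D-orb p x) (D-τ^ p x) ∙
            solve 2 (λ p d → p :* d :+ d := (con 1ℚ :+ p) :* d) refl (toℚ (ℤ.+ p)) (D w x) ∙ cong (_* D w x) (sym (toℚ-+ (ℤ.+ 1) (ℤ.+ p))))

        -- Let o be the orbit sum over a period, after which v becomes v + kδ. Telescoping gives
        -- K(z, o) = -k D(z), so K(o, o) = -k (P + 1) D(v) is nonnegative. If k = 0 while D(v) > 0,
        -- then o would be a multiple of δ although D(o) = (P + 1) D(v) is nonzero. If D(v) = 0,
        -- then o lies in the radical and k D(z) = 0 for all z.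
        drift : ∀ {N v w} → Cox w → IsRt N v → ∃₂ λ P k → suc P ℕ.≤ L × τ^ w (suc P) v ≡ v +ᵥ (k ·ᵥ δQ) ×
          (∀ z → K z (orb w (suc P) v) ≡ - (k * D w z)) × (0ℚ < D w v → k < 0ℚ) × (D w v ≡ 0ℚ → k ≡ 0ℚ)
        drift {N} {v} {w} cw r = P , k , proj₁ (proj₂ pr) , sub-add (τ^ w (suc P) v) v ∙ cong (v +ᵥ_) (proj₂ kk) , Ko , neg , zer
          where
          pr : ∃ λ p → suc p ℕ.≤ L × Null (τ^ w (suc p) v -ᵥ v)
          pr = period w r
          P : ℕ
          P = proj₁ pr
          kk : ∃ λ q → τ^ w (suc P) v -ᵥ v ≡ q ·ᵥ δQ
          kk = null-δ (τ^ w (suc P) v -ᵥ v) (proj₂ (proj₂ pr))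
          k : ℚ
          k = proj₁ kk
          o : V n
          o = orb w (suc P) v
          Ko : ∀ z → K z o ≡ - (k * D w z)
          Ko z = sym (E-serre w z o (proj₁ cw) (spt cw z)) ∙ cong (E w z) (orb-tel w (suc P) v ∙ flip) ∙ Functional.scale (E-linʳ w z) (- k) δQ ∙ solve 2 (λ k d → (:- k) :* d := :- (k :* d)) refl k (D w z)
            where
            flip : v -ᵥ τ^ w (suc P) v ≡ (- k) ·ᵥ δQ
            flip = vec-ext λ j → lk-- v (τ^ w (suc P) v) j ∙ solve 2 (λ a b → a :- b := :- (b :- a)) refl (v ! j) (τ^ w (suc P) v ! j) ∙
              cong -_ (sym (lk-- (τ^ w (suc P) v) v j) ∙ cong (λ t → t ! j) (proj₂ kk) ∙ lk-· k δQ j) ∙ solve 2 (λ k d → :- (k :* d) := (:- k) :* d) refl k (δQ ! j) ∙ sym (lk-· (- k) δQ j)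
          P>0 : 0ℚ < toℚ (ℤ.+ suc P)
          P>0 = toℚ-pos {suc P} (ℕ.s≤s ℕ.z≤n)
          Koo : K o o ≡ (- k) * (toℚ (ℤ.+ suc P) * D w v)
          Koo = Ko o ∙ cong (λ t → - (k * t)) (D-orb cw (suc P) v) ∙ solve 2 (λ k x → :- (k :* x) := (:- k) :* x) refl k (toℚ (ℤ.+ suc P) * D w v)
          neg : 0ℚ < D w v → k < 0ℚ
          neg h = go (≤⇒<⊎≡ (nonneg-cancel (0<* P>0 h) (subst (0ℚ ≤_) (Koo ∙ ℚP.*-comm (- k) (toℚ (ℤ.+ suc P) * D w v)) (proj₁ aff o))))
            where
            go : 0ℚ < - k ⊎ 0ℚ ≡ - k → k < 0ℚ
            go (inj₁ q) = sub> (subst (0ℚ <_) (sym (ℚP.+-identityˡ (- k))) q)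
            go (inj₂ q) = ⊥-elim (>⇒≢ (0<* P>0 h) (sym (D-orb cw (suc P) v) ∙ cong (D w) (proj₂ od) ∙ Functional.scale (E-linˡ w δQ) (proj₁ od) δQ ∙ cong (proj₁ od *_) (D-δ cw) ∙ ℚP.*-zeroʳ (proj₁ od)))
              where
              od : ∃ λ q → o ≡ q ·ᵥ δQ
              od = null-δ o (norm0-null {o} (Koo ∙ cong (_* (toℚ (ℤ.+ suc P) * D w v)) (sym q) ∙ ℚP.*-zeroˡ (toℚ (ℤ.+ suc P) * D w v)))
          zer : D w v ≡ 0ℚ → k ≡ 0ℚ
          zer h = go w cw Ko
            where
            nul : Null o
            nul = norm0-null {o} (Koo ∙ cong (λ t → (- k) * (toℚ (ℤ.+ suc P) * t)) h ∙ solve 2 (λ k p → k :* (p :* con 0ℚ) := con 0ℚ) refl (- k) (toℚ (ℤ.+ suc P)))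
            go : ∀ w → Cox w → (∀ z → K z o ≡ - (k * D w z)) → k ≡ 0ℚ
            go [] (_ , all) _ = ⊥-elim (case all i₀ of λ ())
            -- The simple root of the first letter serves as z: its defect d_i δ_i is nonzero.
            go (i ∷ u) cu Ko = *≡0 {d i * δQ ! i} (>⇒≢ (0<* (d>0 i) (δ>0 i))) (ℚP.*-comm (d i * δQ ! i) k ∙ cong (k *_) (sym (E-headˡ i u δQ (proj₁ cu))) ∙
              solve 1 (λ x → x := :- (:- x)) refl (k * D (i ∷ u) (e i)) ∙ cong -_ (sym (Ko (e i))) ∙ cong -_ (null-K {o} nul (e i)))

        τ^-drift : ∀ w v P k → τ^ w (suc P) v ≡ v +ᵥ (k ·ᵥ δQ) → ∀ t → τ^ w (t ℕ.* suc P) v ≡ v +ᵥ ((toℚ (ℤ.+ t) * k) ·ᵥ δQ)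
        τ^-drift w v P k h zero = sym (cong (λ t → v +ᵥ (t ·ᵥ δQ)) (ℚP.*-zeroˡ k) ∙ cong (v +ᵥ_) (0·ᵥ δQ) ∙ +ᵥ-0 v)
        τ^-drift w v P k h (suc t) = τ^-+ w (suc P) (t ℕ.* suc P) v ∙ cong (τ^ w (suc P)) (τ^-drift w v P k h t) ∙ Linear.add (τ^-lin w (suc P)) v ((toℚ (ℤ.+ t) * k) ·ᵥ δQ) ∙
          cong₂ _+ᵥ_ h (τ^-null w (suc P) ((toℚ (ℤ.+ t) * k) ·ᵥ δQ) (null-scale (toℚ (ℤ.+ t) * k) {δQ} δ-null)) ∙ (vec-ext λ j →
            lk-+ (v +ᵥ (k ·ᵥ δQ)) ((toℚ (ℤ.+ t) * k) ·ᵥ δQ) j ∙ cong₂ _+_ (lk-+ v (k ·ᵥ δQ) j ∙ cong (lookup v j +_) (lk-· k δQ j)) (lk-· (toℚ (ℤ.+ t) * k) δQ j) ∙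
            solve 4 (λ v k d t → v :+ k :* d :+ t :* k :* d := v :+ (con 1ℚ :+ t) :* k :* d) refl (v ! j) k (δQ ! j) (toℚ (ℤ.+ t)) ∙
            cong (λ s → v ! j + s * k * δQ ! j) (sym (toℚ-+ (ℤ.+ 1) (ℤ.+ t))) ∙ sym (lk-+ v ((toℚ (ℤ.+ suc t) * k) ·ᵥ δQ) j ∙ cong (lookup v j +_) (lk-· (toℚ (ℤ.+ suc t) * k) δQ j)))

        -- The drift lowers the coordinate at i₀ by an integer that is at least 1 in every period.
        -- After h + 1 periods, where h is its initial value, it would be negative, so the root
        -- cannot stay positive that long.
        fwd-affine : ∀ {N v w} → Cox w → IsRt N v → Pos v → 0ℚ < D w v → Fwd w v
        fwd-affine {N} {v} {w} cw r pv Dv = go (rounds w r pv (suc h ℕ.* suc P))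
          where
          dr : ∃₂ λ P k → suc P ℕ.≤ L × τ^ w (suc P) v ≡ v +ᵥ (k ·ᵥ δQ) × (∀ z → K z (orb w (suc P) v) ≡ - (k * D w z)) × (0ℚ < D w v → k < 0ℚ) × (D w v ≡ 0ℚ → k ≡ 0ℚ)
          dr = drift cw r
          P : ℕ
          P = proj₁ dr
          k : ℚ
          k = proj₁ (proj₂ dr)
          eqP : τ^ w (suc P) v ≡ v +ᵥ (k ·ᵥ δQ)
          eqP = proj₁ (proj₂ (proj₂ (proj₂ dr)))
          k<0 : k < 0ℚ
          k<0 = proj₁ (proj₂ (proj₂ (proj₂ (proj₂ (proj₂ dr))))) Dv
          hh : Σ ℕ λ h → v ! i₀ ≡ toℚ (ℤ.+ h)
          hh = int-ℕ (int r i₀) (pv i₀)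
          h : ℕ
          h = proj₁ hh
          kδ : 1ℚ ≤ (- k) * δQ ! i₀
          kδ = int≥1 (subst Int (solve 2 (λ a b → a :- (a :+ b) := :- b) refl (v ! i₀) (k * δQ ! i₀) ∙ solve 2 (λ k d → :- (k :* d) := (:- k) :* d) refl k (δQ ! i₀))
              (int-sub (int r i₀) (subst Int (cong (λ t → t ! i₀) eqP ∙ lk-+ v (k ·ᵥ δQ) i₀ ∙ cong (lookup v i₀ +_) (lk-· k δQ i₀)) (int (τ^-rt w (suc P) r) i₀))))
            (0<* (<0⇒ k<0) (δ>0 i₀))
          bad : ¬ Pos (τ^ w (suc h ℕ.* suc P) v)
          bad p = <⇒≱ (by< (1ℚ + (1ℚ + toℚ (ℤ.+ h)) * ((- k) * δQ ! i₀ - 1ℚ)) (0<+ 0<1 (0≤* (0≤+ 0≤1 (subst (0ℚ ≤_) (proj₂ hh) (pv i₀))) (≥sub kδ)))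
              (cong (λ t → 0ℚ - t) val ∙ solve 3 (λ h k d → con 0ℚ :- (h :+ (con 1ℚ :+ h) :* k :* d) := con 1ℚ :+ (con 1ℚ :+ h) :* ((:- k) :* d :- con 1ℚ)) refl (toℚ (ℤ.+ h)) k (δQ ! i₀))) (p i₀)
            where
            val : τ^ w (suc h ℕ.* suc P) v ! i₀ ≡ toℚ (ℤ.+ h) + (1ℚ + toℚ (ℤ.+ h)) * k * δQ ! i₀
            val = cong (λ t → t ! i₀) (τ^-drift w v P k eqP (suc h)) ∙ lk-+ v ((toℚ (ℤ.+ suc h) * k) ·ᵥ δQ) i₀ ∙ cong₂ _+_ (proj₂ hh) (lk-· (toℚ (ℤ.+ suc h) * k) δQ i₀ ∙ cong (λ t → t * k * δQ ! i₀) (toℚ-+ (ℤ.+ 1) (ℤ.+ h)))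
          go : Fwd w v ⊎ ((∀ j → j ℕ.≤ suc h ℕ.* suc P → Pos (τ^ w j v)) × (Fwd w (τ^ w (suc h ℕ.* suc P) v) → Fwd w v)) → Fwd w v
          go (inj₁ f) = f
          go (inj₂ (ps , _)) = ⊥-elim (bad (ps (suc h ℕ.* suc P) ℕP.≤-refl))

        cox-rev : ∀ {w : List (Fin n)} → Cox w → Cox (reverse w)
        cox-rev {w} = cox-↭ (↭-sym (PermP.↭-reverse w))

        D-rev : ∀ {w} → Cox w → ∀ x → D (reverse w) x ≡ - D w x
        D-rev {w} cw x = E-reverse w x δQ ∙ E-δ cw x

        D-rot : ∀ {i u} → Cox (i ∷ u) → ∀ x → D (u ++ i ∷ []) (s i x) ≡ D (i ∷ u) x
        D-rot {i} {u} cw x = cong (E (u ++ i ∷ []) (s i x)) (sym (s-null i δQ (δ-null i))) ∙ E-rot i u x δQ (proj₁ cw) (spt cw x) (spt cw δQ)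

        D-head : ∀ {i u} → Cox (i ∷ u) → D (i ∷ u) (e i) ≡ d i * δQ ! i
        D-head {i} {u} cw = E-headˡ i u δQ (proj₁ cw)

        ups≢e : ∀ {i u y} → Cox (i ∷ u) → D (i ∷ u) y ≡ 0ℚ → y ≢ e i
        ups≢e {i} cw h refl = >⇒≢ (0<* (d>0 i) (δ>0 i)) (sym (D-head cw) ∙ h)

        ups-rot : ∀ {i u y} → Cox (i ∷ u) → Ups (i ∷ u) y → Ups (u ++ i ∷ []) (s i y)
        ups-rot {i} {y = y} cw (ups r p h) = ups (rt-s i r) (pos-s i r p (ups≢e cw h)) (D-rot cw y ∙ h)

        rots-cox : ∀ (p q : List (Fin n)) {i} → Cox (i ∷ p ++ q) → Cox (p ++ q ++ i ∷ [])
        rots-cox p q {i} c = subst Cox (ListP.++-assoc p q (i ∷ [])) (cox-↭ (snoc↭ i (p ++ q)) c)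

        E-rots : ∀ p q x y → Cox (p ++ q) → E (q ++ p) (actW (reverse p) x) (actW (reverse p) y) ≡ E (p ++ q) x y
        E-rots [] q x y c = cong (λ t → E t x y) (ListP.++-identityʳ q)
        E-rots (i ∷ p) q x y c = cong₂ (E (q ++ i ∷ p)) (act-rev-∷ i p x) (act-rev-∷ i p y) ∙ cong (λ t → E t (actW (reverse p) (s i x)) (actW (reverse p) (s i y))) (sym (ListP.++-assoc q (i ∷ []) p)) ∙
          E-rots p (q ++ i ∷ []) (s i x) (s i y) (rots-cox p q c) ∙ cong (λ t → E t (s i x) (s i y)) (sym (ListP.++-assoc p q (i ∷ []))) ∙ E-rot i (p ++ q) x y (proj₁ c) (spt c x) (spt c y)

        ups-rots : ∀ p q {y} → Cox (p ++ q) → Ups (p ++ q) y → Ups (q ++ p) (actW (reverse p) y)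
        ups-rots [] q {y} c h = subst (λ t → Ups t y) (sym (ListP.++-identityʳ q)) h
        ups-rots (i ∷ p) q {y} c h = subst₂ Ups (ListP.++-assoc q (i ∷ []) p) (sym (act-rev-∷ i p y)) (ups-rots p (q ++ i ∷ []) (rots-cox p q c) (subst (λ t → Ups t (s i y)) (ListP.++-assoc p q (i ∷ [])) (ups-rot c h)))

        ups-τ : ∀ {w y} → Cox w → Ups w y → Ups w (τ w y)
        ups-τ {w} {y} c h = ups-rots w [] (subst Cox (sym (ListP.++-identityʳ w)) c) (subst (λ t → Ups t y) (sym (ListP.++-identityʳ w)) h)

        ups-rev : ∀ {w y} → Cox w → Ups w y → Ups (reverse w) y
        ups-rev {y = y} c (ups r p h) = ups r p (D-rev c y ∙ cong -_ h ∙ refl)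

        ups-c : ∀ {w y} → Cox w → Ups w y → Ups w (actW w y)
        ups-c {w} {y} c h = subst₂ Ups (ListP.reverse-involutive w) (cong (λ t → actW t y) (ListP.reverse-involutive w)) (ups-rev (cox-rev c) (ups-τ (cox-rev c) (ups-rev c h)))

        ups-τ^ : ∀ {w y} → Cox w → ∀ k → Ups w y → Ups w (τ^ w k y)
        ups-τ^ c zero h = h
        ups-τ^ c (suc k) h = ups-τ c (ups-τ^ c k h)

        -- The walk moves ρ to the front, where E(ρ, y) is a multiple of a coordinate of y.
        -- Meanwhile y stays positive: its defect is 0, so it is never the simple root being
        -- reflected.
        law⁺ : ∀ {w ρ y N} → Cox w → Fwd w ρ → IsRt N ρ → Ups w y → 0ℚ ≤ E w ρ y
        law⁺ {y = y} cw (stop {i} {u}) r h = subst (0ℚ ≤_) (sym (E-headˡ i u y (proj₁ cw))) (0≤* (ℚP.<⇒≤ (d>0 i)) (posi h i))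
        law⁺ {ρ = ρ} {y} cw (step {i} {u} _ f) r h = subst (0ℚ ≤_) (E-rot i u ρ y (proj₁ cw) (spt cw ρ) (spt cw y)) (law⁺ (cox-↭ (snoc↭ i u) cw) f (rt-s i r) (ups-rot cw h))

        -- The sign of ρ is not prescribed. If τρ is positive, it walks forward along w. Otherwise
        -- `serre` rewrites the value as E(y, -τρ), which is the form of the reversed word at (-τρ,
        -- y), and -τρ walks forward along that word.
        law : ∀ {w ρ y N} → Cox w → IsRt N ρ → 0ℚ < D w ρ → Ups w y → 0ℚ ≤ E w ρ y
        law {w} {ρ} {y} cw r Dρ h = go (posneg (rt-act (reverse w) r))
          where
          go : Pos (τ w ρ) ⊎ Pos ((- 1ℚ) ·ᵥ τ w ρ) → 0ℚ ≤ E w ρ y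
          go (inj₁ p) = subst (0ℚ ≤_) (E-τ cw ρ y) (law⁺ cw (fwd-affine cw (rt-act (reverse w) r) p (subst (0ℚ <_) (sym (D-τ^ cw 1 ρ)) Dρ)) (rt-act (reverse w) r) (ups-τ cw h))
          go (inj₂ p) = subst (0ℚ ≤_) (E-reverse w x y ∙ Functional.neg (E-linʳ w y) (τ w ρ) ∙ cong -_ (serre cw y ρ) ∙ solve 1 (λ x → :- (:- x) := x) refl (E w ρ y))
              (law⁺ (cox-rev cw) (fwd-affine (cox-rev cw) (rt-neg (rt-act (reverse w) r)) p (subst (0ℚ <_) (sym Dx) Dρ)) (rt-neg (rt-act (reverse w) r)) (ups-rev cw h))
            where
            x : V n
            x = (- 1ℚ) ·ᵥ τ w ρ
            Dx : D (reverse w) x ≡ D w ρ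
            Dx = D-rev cw x ∙ cong -_ (Functional.neg (E-linˡ w δQ) (τ w ρ)) ∙ solve 1 (λ x → :- (:- x) := x) refl (D w (τ w ρ)) ∙ D-τ^ cw 1 ρ

        -- Moves preserve the norm and the defect, so both can be read off at the first simple root.
        type⁺ : ∀ {w ρ N} → Cox w → Fwd w ρ → IsRt N ρ → ∃ λ i → N ≡ d i × D w ρ ≡ d i * δQ ! i
        type⁺ cw (stop {i} {u}) r = i , rt-N r (rt-e i) , D-head cw
        type⁺ {ρ = ρ} cw (step {i} {u} _ f) r = let (j , p , q) = type⁺ (cox-↭ (snoc↭ i u) cw) f (rt-s i r) in j , p , sym (D-rot cw ρ) ∙ q

        type : ∀ {w ρ N} → Cox w → IsRt N ρ → 0ℚ < D w ρ → ∃ λ i → N ≡ d i × D w ρ ≡ d i * δQ ! i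
        type {w} {ρ} {N} cw r Dρ = go (posneg r)
          where
          Dx : D (reverse w) ((- 1ℚ) ·ᵥ ρ) ≡ D w ρ
          Dx = D-rev cw ((- 1ℚ) ·ᵥ ρ) ∙ cong -_ (Functional.neg (E-linˡ w δQ) ρ) ∙ solve 1 (λ x → :- (:- x) := x) refl (D w ρ)
          go : Pos ρ ⊎ Pos ((- 1ℚ) ·ᵥ ρ) → ∃ λ i → N ≡ d i × D w ρ ≡ d i * δQ ! i
          go (inj₁ p) = type⁺ cw (fwd-affine cw r p Dρ) r
          go (inj₂ p) = let (j , a , b) = type⁺ (cox-rev cw) (fwd-affine (cox-rev cw) (rt-neg r) p (subst (0ℚ <_) (sym Dx) Dρ)) (rt-neg r) in j , a , sym Dx ∙ b

        -- The pairing of t with the orbit sum of ρ is -k D(t), with k < 0 by `drift`; a positive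
        -- sum has a positive term.
        average : ∀ {w ρ t N} → Cox w → IsRt N ρ → 0ℚ < D w ρ → 0ℚ < D w t → ∃ λ k → 0ℚ < K (τ^ w k ρ) t
        average {w} {ρ} {t} cw r Dρ Dt = pick (suc (proj₁ dr)) (subst (0ℚ <_) (sym (Ko t)) (subst (0ℚ <_) (solve 2 (λ k d → (:- k) :* d := :- (k :* d)) refl k (D w t)) (0<* (<0⇒ (proj₁ (proj₂ (proj₂ (proj₂ (proj₂ (proj₂ dr))))) Dρ)) Dt)))
          where
          dr : ∃₂ λ P k → suc P ℕ.≤ L × τ^ w (suc P) ρ ≡ ρ +ᵥ (k ·ᵥ δQ) × (∀ z → K z (orb w (suc P) ρ) ≡ - (k * D w z)) × (0ℚ < D w ρ → k < 0ℚ) × (D w ρ ≡ 0ℚ → k ≡ 0ℚ)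
          dr = drift cw r
          k : ℚ
          k = proj₁ (proj₂ dr)
          Ko : ∀ z → K z (orb w (suc (proj₁ dr)) ρ) ≡ - (k * D w z)
          Ko = proj₁ (proj₂ (proj₂ (proj₂ (proj₂ dr))))
          pick : ∀ p → 0ℚ < K t (orb w p ρ) → ∃ λ k → 0ℚ < K (τ^ w k ρ) t
          pick zero h = ⊥-elim (>⇒≢ h (Functional.zer (K-linʳ t)))
          pick (suc p) h = go (0ℚ ℚP.<? K (τ^ w p ρ) t)
            where
            go : Dec (0ℚ < K (τ^ w p ρ) t) → ∃ λ k → 0ℚ < K (τ^ w k ρ) t
            go (yes q) = p , q
            go (no q) = pick p (ℚP.<-≤-trans h (by≤ (- K t (τ^ w p ρ)) (≤0⇒ (subst (_≤ 0ℚ) (K-sym (τ^ w p ρ) t) (ℚP.≮⇒≥ q))) (cong (λ s → K t (orb w p ρ) - s) (Functional.add (K-linʳ t) (orb w p ρ) (τ^ w p ρ)) ∙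
              solve 2 (λ a b → a :- (a :+ b) := :- b) refl (K t (orb w p ρ)) (K t (τ^ w p ρ)))))

        -- Rotating the prefix p to the end turns p α_i into the first simple root. Thus the roots p
        -- α_i are dual to the coordinates under E, up to the factors d_i.
        E-ζ : ∀ p i q → Cox (p ++ i ∷ q) → ∀ x → E (p ++ i ∷ q) (actW p (e i)) x ≡ d i * x ! i
        E-ζ p i q c x = sym (E-rots p (i ∷ q) (actW p (e i)) x c) ∙ cong (λ t → E ((i ∷ q) ++ p) t (actW (reverse p) x)) (act-rev p (e i)) ∙
          E-headˡ i (q ++ p) (actW (reverse p) x) (uq-↭ (PermP.++-comm p (i ∷ q)) (proj₁ c)) ∙ cong (d i *_) (act-∉ (reverse p) x (∉-rev p (proj₁ (uq-mid p (proj₁ c)))))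

        corootCoord-≡ : ∀ {v i x} → v ≡ δQ → m′ i ≡ x → corootCoord v i ≡ x
        corootCoord-≡ {v} h eq with VecP.≡-dec ℚP._≟_ v δQ
        ... | yes _ = eq
        ... | no q = ⊥-elim (q h)

        corootCoord-≢ : ∀ {v i x} → v ≢ δQ → corootCoordRe v i ≡ x → corootCoord v i ≡ x
        corootCoord-≢ {v} h eq with VecP.≡-dec ℚP._≟_ v δQ
        ... | yes q = ⊥-elim (h q)
        ... | no _ = eq

        δ-norm : ¬ (∃ λ N → IsRt N δQ)
        δ-norm (_ , r) = >⇒≢ (0<+ (N>0 r) (ℚP.<⇒≤ (N>0 r))) (sym (norm r) ∙ K-δ δQ)

        cor-aff : ∀ {N v} (r : IsRt N v) → Cor (corootCoord v) v (inv (N≢0 r))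
        cor-aff {N} r = record { lam≥0 = Cor.lam≥0 (cor-rt r) ; c-eq = λ i → corootCoord-≢ (λ q → δ-norm (N , subst (IsRt N) q r)) (Cor.c-eq (cor-rt r) i) ; unit-e = Cor.unit-e (cor-rt r) }

    open Affine public

    -- Coordinates of δ and δ^∨ equal to 1, and the special simple root.

    module Special where
      abstract
        -- The factorization K(x, t) = N k identifies t - k x as the reflection of t in x; the
        -- second factorization M k' makes its coroot integral.
        refl-rt : ∀ {N M x t k k'} → IsRt N x → IsRt M t → Int k → Int k' → K x t ≡ N * k → K x t ≡ M * k' → IsRt M (t -ᵥ (k ·ᵥ x))
        refl-rt {N} {M} {x} {t} {k} {k'} rx rt′ ik ik' e e' = rt (N>0 rt′)
          (K-sub t (k ·ᵥ x) ∙ cong₂ (λ a b → K t t - (a + a) + b) (Functional.scale (K-linʳ t) k x ∙ cong (k *_) (K-sym t x ∙ e)) (K-scale2 k x ∙ cong (k * k *_) (norm rx)) ∙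
            solve 3 (λ t k n → t :- (k :* (n :* k) :+ k :* (n :* k)) :+ k :* k :* (n :+ n) := t) refl (K t t) k N ∙ norm rt′)
          (λ j → subst Int (sym (lk-- t (k ·ᵥ x) j ∙ cong (λ s → t ! j - s) (lk-· k x j))) (int-sub (int rt′ j) (int-* ik (int rx j))))
          (λ j → subst (M ∣ᵢ_) (solve 4 (λ d t k x → d :* t :+ :- (k :* (d :* x)) := d :* (t :- k :* x)) refl (d j) (t ! j) k (x ! j) ∙
              cong (d j *_) (sym (lk-- t (k ·ᵥ x) j ∙ cong (λ s → t ! j - s) (lk-· k x j))))
            (div-+ (coint rt′ j) (div-neg (dv (k' * quo (coint rx j)) (int-* ik' (quo-int (coint rx j)))
              (cong (k *_) (quo-eq (coint rx j)) ∙ solve 3 (λ k n q → k :* (n :* q) := n :* k :* q) refl k N (quo (coint rx j)) ∙ cong (_* quo (coint rx j)) (sym e ∙ e') ∙ ℚP.*-assoc M k' (quo (coint rx j))))))) 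

      module _ {w : List (Fin n)} (cw : Cox w) where
        split : ∀ i → ∃₂ λ p q → w ≡ p ++ i ∷ q
        split i = MemP.∈-∃++ (proj₂ cw i)

        ζ : Fin n → V n
        ζ i = actW (proj₁ (split i)) (e i)

        abstract
          ζ-rt : ∀ i → IsRt (d i) (ζ i)
          ζ-rt i = rt-act (proj₁ (split i)) (rt-e i)

          ζ-E : ∀ i x → E w (ζ i) x ≡ d i * x ! i
          ζ-E i x = cong (λ t → E t (ζ i) x) eq ∙ E-ζ (proj₁ (split i)) i (proj₁ (proj₂ (split i))) (subst Cox eq cw) x
            where
            eq : w ≡ proj₁ (split i) ++ i ∷ proj₁ (proj₂ (split i))
            eq = proj₂ (proj₂ (split i))

          ζ-i : ∀ i → ζ i ! i ≡ 1ℚ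
          ζ-i i = act-∉ (proj₁ (split i)) (e i) (proj₁ (uq-mid (proj₁ (split i)) (subst Unique (proj₂ (proj₂ (split i))) (proj₁ cw)))) ∙ e-on i

          ζ-D : ∀ i → 0ℚ < D w (ζ i)
          ζ-D i = subst (0ℚ <_) (sym (ζ-E i δQ)) (0<* (d>0 i) (δ>0 i))

          -- Cartan integers 2 and 2 force equal norms and K(x - t, x - t) = 0, so x - t is a
          -- multiple of δ, which has defect 0.
          D-parallel : ∀ {N M x t} → IsRt N x → IsRt M t → (p : Pairing N M x t) → Pairing.k p ≡ 2ℚ → Pairing.k' p ≡ 2ℚ → N ≡ M × D w x ≡ D w t
          D-parallel {N} {M} {x} {t} rx rt′ p h h' = NM , solve 2 (λ a b → a := a :- b :+ b) refl (D w x) (D w t) ∙ cong (_+ D w t) (sym (Functional.sub (E-linˡ w δQ) x t) ∙ cong (D w) (proj₂ xt) ∙ Functional.scale (E-linˡ w δQ) (proj₁ xt) δQ ∙ cong (proj₁ xt *_) (D-δ cw) ∙ ℚP.*-zeroʳ (proj₁ xt)) ∙ ℚP.+-identityˡ (D w t)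
            where
            NM : N ≡ M
            NM = *-cancelˡ {2ℚ} (>⇒≢ 0<2) (ℚP.*-comm 2ℚ N ∙ cong (N *_) (sym h) ∙ sym (Pairing.eqN p) ∙ Pairing.eqM p ∙ cong (M *_) h' ∙ ℚP.*-comm M 2ℚ)
            xt : ∃ λ q → x -ᵥ t ≡ q ·ᵥ δQ
            xt = null-δ (x -ᵥ t) (norm0-null {x -ᵥ t} (K-sub x t ∙ cong₂ (λ a b → a - (K x t + K x t) + b) (norm rx) (norm rt′ ∙ cong₂ _+_ (sym NM) (sym NM)) ∙
              cong (λ s → N + N - (s + s) + (N + N)) (Pairing.eqN p ∙ cong (N *_) h) ∙ solve 1 (λ n → n :+ n :- (n :* con 2ℚ :+ n :* con 2ℚ) :+ (n :+ n) := con 0ℚ) refl N))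

          -- A Euclidean algorithm. For f i minimal, some translate x of ζ_i pairs positively with a
          -- given root t. If one of the Cartan integers is 1, a reflection produces a root with
          -- value F(t) - F(x), to which the argument applies again as long as the value is
          -- positive. Otherwise both are 2, and x and t have the same value. It is used for F = κD,
          -- with values m_i, and for F = D / N, with values δ_i.
          minDivides : (f : Fin n → ℕ) (F : ℚ → V n → ℚ) →
            (∀ {N v} → IsRt N v → 0ℚ < D w v → ∃ λ i → F N v ≡ toℚ (ℤ.+ f i)) → (∀ i → F (d i) (ζ i) ≡ toℚ (ℤ.+ f i)) →
            (∀ {N v} → IsRt N v → 0ℚ < F N v → 0ℚ < D w v) → (∀ {N v} k → F N (τ^ w k v) ≡ F N v) →
            (∀ {N x t} → D w x ≡ D w t → F N x ≡ F N t) →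
            (∀ {N M x t} → IsRt N x → IsRt M t → (p : Pairing N M x t) → Pairing.k p ≡ 1ℚ ⊎ Pairing.k' p ≡ 1ℚ → ∃₂ λ R r → IsRt R r × F R r ≡ F M t - F N x) →
            (∀ i → 0 ℕ.< f i) → ∃ λ i → ∀ j → f i ℕD.∣ f j
          minDivides f F typ Fζ Fpos Fτ par red f>0 = i , λ j → go (f j) (f j) (ζ-rt j) (ζ-D j) (Fζ j) ℕP.≤-refl
            where
            i : Fin n
            i = proj₁ (argmin f i₀)
            imin : ∀ j → f i ℕ.≤ f j
            imin = proj₂ (argmin f i₀)
            go : ∀ fuel h {M t} → IsRt M t → 0ℚ < D w t → F M t ≡ toℚ (ℤ.+ h) → h ℕ.≤ fuel → f i ℕD.∣ h
            go fuel h {M} {t} rt′ Dt Ft le = next (Pairing.k p ℚP.≟ 1ℚ) (Pairing.k' p ℚP.≟ 1ℚ)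
              where
              av : ∃ λ k → 0ℚ < K (τ^ w k (ζ i)) t
              av = average cw (ζ-rt i) (ζ-D i) Dt
              x : V n
              x = τ^ w (proj₁ av) (ζ i)
              rx : IsRt (d i) x
              rx = τ^-rt w (proj₁ av) (ζ-rt i)
              p : Pairing (d i) M x t
              p = pairing rx rt′
              k≥1 : 1ℚ ≤ Pairing.k p × 1ℚ ≤ Pairing.k' p
              k≥1 = pos-k p (d>0 i) (N>0 rt′) (proj₂ av)
              Fx : F (d i) x ≡ toℚ (ℤ.+ f i)
              Fx = Fτ (proj₁ av) ∙ Fζ i
              ty : ∃ λ j → F M t ≡ toℚ (ℤ.+ f j)
              ty = typ rt′ Dt
              hj : h ≡ f (proj₁ ty)
              hj = ℤP.+-injective (toℚ-injective {ℤ.+ h} {ℤ.+ f (proj₁ ty)} (sym Ft ∙ proj₂ ty))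
              b≤h : f i ℕ.≤ h
              b≤h = subst (f i ℕ.≤_) (sym hj) (imin (proj₁ ty))
              same : h ≡ f i → f i ℕD.∣ h
              same q = subst (f i ℕD.∣_) (sym q) ℕD.∣-refl
              lower : (∃₂ λ R r → IsRt R r × F R r ≡ F M t - F (d i) x) → ∀ fuel → h ℕ.≤ fuel → f i ℕD.∣ h
              lower _ zero le' = ⊥-elim (ℕP.<⇒≱ (ℕP.<-≤-trans (f>0 i) b≤h) le')
              lower (R , r , rr , Fr) (suc fuel) le' = cmp (ℕP.m≤n⇒m<n∨m≡n b≤h)
                where
                Fr′ : F R r ≡ toℚ (ℤ.+ (h ℕ.∸ f i))
                Fr′ = Fr ∙ cong₂ _-_ Ft Fx ∙ toℚ-∸ b≤h
                cmp : f i ℕ.< h ⊎ f i ≡ h → f i ℕD.∣ h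
                cmp (inj₂ q) = same (sym q)
                cmp (inj₁ b<h) = subst (f i ℕD.∣_) (ℕP.m∸n+n≡m b≤h) (ℕD.∣m∣n⇒∣m+n (go fuel (h ℕ.∸ f i) rr (Fpos rr (subst (0ℚ <_) (sym Fr′) (toℚ-pos {h ℕ.∸ f i} (ℕP.m<n⇒0<n∸m b<h)))) Fr′
                   (ℕP.≤-trans (ℕP.∸-monoʳ-≤ h (f>0 i)) (ℕP.∸-monoˡ-≤ 1 le'))) ℕD.∣-refl)
              next : Dec (Pairing.k p ≡ 1ℚ) → Dec (Pairing.k' p ≡ 1ℚ) → f i ℕD.∣ h
              next (yes q) _ = lower (red rx rt′ p (inj₁ q)) fuel le
              next (no _) (yes q) = lower (red rx rt′ p (inj₂ q)) fuel le
              next (no q) (no q') = same (ℤP.+-injective (toℚ-injective {ℤ.+ h} {ℤ.+ f i} (sym Ft ∙ sym (cong (λ s → F s x) (proj₁ pp) ∙ par {M} (proj₂ pp)) ∙ Fx)))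
                where
                k2 : 2ℚ ≤ Pairing.k p
                k2 = int≥2 (Pairing.k-int p) (proj₁ k≥1) q
                k2' : 2ℚ ≤ Pairing.k' p
                k2' = int≥2 (Pairing.k'-int p) (proj₂ k≥1) q'
                pp : d i ≡ M × D w x ≡ D w t
                pp = D-parallel rx rt′ p (two-two k2 k2' (Pairing.bound p)) (two-two k2' k2 (subst (_≤ toℚ (ℤ.+ 4)) (ℚP.*-comm (Pairing.k p) (Pairing.k' p)) (Pairing.bound p)))

          -- A value that divides all others is a common divisor, and the coordinates of δ and of
          -- δ^∨ have none above 1.
          one : ∀ {f : Fin n → ℕ} → (∀ i → 0 ℕ.< f i) → (∀ k → 2 ℕ.≤ k → ¬ (∀ i → k ℕD.∣ f i)) → (∃ λ i → ∀ j → f i ℕD.∣ f j) → ∃ λ i → f i ≡ 1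
          one {f} f>0 prim (i , h) = i , ℕP.≤-antisym (ℕP.≮⇒≥ λ q → prim (f i) q h) (f>0 i)

          mult : ∀ {N M x t} (p : Pairing N M x t) → N * Pairing.k p ≡ M * Pairing.k' p
          mult p = sym (Pairing.eqN p) ∙ Pairing.eqM p

          D-comb : ∀ t k x → D w (t -ᵥ (k ·ᵥ x)) ≡ D w t - k * D w x
          D-comb t k x = Functional.sub (E-linˡ w δQ) t (k ·ᵥ x) ∙ cong (λ s → D w t - s) (Functional.scale (E-linˡ w δQ) k x)

          reflections : ∀ {N M x t} → IsRt N x → IsRt M t → (p : Pairing N M x t) →
            IsRt M (t -ᵥ (Pairing.k p ·ᵥ x)) × (∃ λ r → IsRt N r × D w r ≡ Pairing.k' p * D w t - D w x)
          reflections {N} {M} {x} {t} rx rt′ p = refl-rt rx rt′ (Pairing.k-int p) (Pairing.k'-int p) (Pairing.eqN p) (Pairing.eqM p) ,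
            (- 1ℚ) ·ᵥ (x -ᵥ (Pairing.k' p ·ᵥ t)) , rt-neg (refl-rt rt′ rx (Pairing.k'-int p) (Pairing.k-int p) (K-sym t x ∙ Pairing.eqM p) (K-sym t x ∙ Pairing.eqN p)) ,
            Functional.neg (E-linˡ w δQ) (x -ᵥ (Pairing.k' p ·ᵥ t)) ∙ cong -_ (D-comb x (Pairing.k' p) t) ∙ solve 2 (λ a b → :- (a :- b) := b :- a) refl (D w x) (Pairing.k' p * D w t)

          m-one : ∃ λ i → m ! i ≡ 1
          m-one = one (proj₁ ism) (proj₂ (proj₂ ism)) (minDivides (lookup m) (λ _ v → κ * D w v)
            (λ r h → let (i , _ , eq) = type cw r h in i , cong (κ *_) eq ∙ sym (m-κ i))
            (λ i → cong (κ *_) (ζ-E i δQ) ∙ sym (m-κ i))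
            (λ _ h → pos-cancel κ>0 h) (λ {_} {v} k → cong (κ *_) (D-τ^ cw k v)) (λ h → cong (κ *_) h) red (proj₁ ism))
            where
            red : ∀ {N M x t} → IsRt N x → IsRt M t → (p : Pairing N M x t) → Pairing.k p ≡ 1ℚ ⊎ Pairing.k' p ≡ 1ℚ → ∃₂ λ R r → IsRt R r × κ * D w r ≡ κ * D w t - κ * D w x
            red {N} {M} {x} {t} rx rt′ p (inj₁ q) = M , t -ᵥ (Pairing.k p ·ᵥ x) , proj₁ (reflections rx rt′ p) , cong (κ *_) (D-comb t (Pairing.k p) x ∙ cong (λ s → D w t - s * D w x) q) ∙
              solve 3 (λ k a b → k :* (a :- con 1ℚ :* b) := k :* a :- k :* b) refl κ (D w t) (D w x)
            red {N} {M} {x} {t} rx rt′ p (inj₂ q) = let (r , rr , eq) = proj₂ (reflections rx rt′ p) in N , r , rr , cong (κ *_) (eq ∙ cong (λ s → s * D w t - D w x) q) ∙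
              solve 3 (λ k a b → k :* (con 1ℚ :* a :- b) := k :* a :- k :* b) refl κ (D w t) (D w x)

          δ-one : ∃ λ i → δ ! i ≡ 1
          δ-one = one (proj₁ isδ) (proj₂ (proj₂ isδ)) (minDivides (lookup δ) (λ N v → recip N * D w v)
            (λ r h → let (i , eqN , eq) = type cw r h in i , cong₂ (λ s t → recip s * t) eqN eq ∙ ratio i)
            (λ i → cong (recip (d i) *_) (ζ-E i δQ) ∙ ratio i)
            (λ r h → pos-cancel (rpos r) h) (λ {N} {v} k → cong (recip N *_) (D-τ^ cw k v)) (λ {N} h → cong (recip N *_) h) red (proj₁ isδ))
            where
            ratio : ∀ i → recip (d i) * (d i * δQ ! i) ≡ δ′ i
            ratio i = solve 3 (λ r d x → r :* (d :* x) := d :* r :* x) refl (recip (d i)) (d i) (δQ ! i) ∙ cong (_* lookup δQ i) (recip-r (d≢0 i)) ∙ ℚP.*-identityˡ (δQ ! i) ∙ lk-δ i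
            rpos : ∀ {N v} → IsRt N v → 0ℚ < recip N
            rpos r = pos-cancel (N>0 r) (subst (0ℚ <_) (sym (recip-r (N≢0 r))) 0<1)
            red : ∀ {N M x t} → IsRt N x → IsRt M t → (p : Pairing N M x t) → Pairing.k p ≡ 1ℚ ⊎ Pairing.k' p ≡ 1ℚ → ∃₂ λ R r → IsRt R r × recip R * D w r ≡ recip M * D w t - recip N * D w x
            -- The reflection is chosen so that the half norms match: with k = 1 one has N = M k',
            -- hence (k' D(t) - D(x)) / N = D(t) / M - D(x) / N. In `m-one`, where no half norm
            -- enters, the other reflection is the right one for k = 1.
            red {N} {M} {x} {t} rx rt′ p (inj₁ q) = let (r , rr , eq) = proj₂ (reflections rx rt′ p) in N , r , rr ,
              *-cancelˡ (N≢0 rx) (cong (λ s → N * (recip N * s)) eq ∙ solve 5 (λ n i k a b → n :* (i :* (k :* a :- b)) := n :* i :* k :* a :- n :* i :* b) refl N (recip N) (Pairing.k' p) (D w t) (D w x) ∙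
                cong₂ (λ s u → s * Pairing.k' p * D w t - u * D w x) (recip-r (N≢0 rx) ∙ sym (recip-r (N≢0 rt′))) (recip-r (N≢0 rx)) ∙
                solve 5 (λ m j k a b → m :* j :* k :* a :- con 1ℚ :* b := (m :* k) :* (j :* a) :- con 1ℚ :* b) refl M (recip M) (Pairing.k' p) (D w t) (D w x) ∙
                cong₂ (λ s u → s * (recip M * D w t) - u * D w x) (sym (mult p) ∙ cong (N *_) q ∙ ℚP.*-identityʳ N) (sym (recip-r (N≢0 rx))) ∙
                  solve 5 (λ n j a i b → n :* (j :* a) :- n :* i :* b := n :* (j :* a :- i :* b)) refl N (recip M) (D w t) (recip N) (D w x))
            red {N} {M} {x} {t} rx rt′ p (inj₂ q) = M , t -ᵥ (Pairing.k p ·ᵥ x) , proj₁ (reflections rx rt′ p) ,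
              *-cancelˡ (N≢0 rt′) (cong (λ s → M * (recip M * s)) (D-comb t (Pairing.k p) x) ∙ solve 5 (λ m i k a b → m :* (i :* (a :- k :* b)) := m :* i :* a :- m :* i :* (k :* b)) refl M (recip M) (Pairing.k p) (D w t) (D w x) ∙
                cong (λ s → M * recip M * D w t - s * (Pairing.k p * D w x)) (recip-r (N≢0 rt′) ∙ sym (recip-r (N≢0 rx))) ∙
                solve 5 (λ m n j k b → m :- n :* j :* (k :* b) := m :- (n :* k) :* (j :* b)) refl (M * recip M * D w t) N (recip N) (Pairing.k p) (D w x) ∙
                cong (λ s → M * recip M * D w t - s * (recip N * D w x)) (mult p ∙ cong (M *_) q ∙ ℚP.*-identityʳ M) ∙
                  solve 5 (λ m i a j b → m :* i :* a :- m :* (j :* b) := m :* (i :* a :- j :* b)) refl M (recip M) (D w t) (recip N) (D w x))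

        -- A simple root α_i whose class ζ_i modulo δ is proportional to that of a root ξ of the parabolic subsystem without α_i.
        record SpecialRoot : Set where
          field
            i     : Fin n
            ξ     : V n
            {Nξ}  : ℚ
            ξ-rt  : IsRt Nξ ξ
            ξ-pos : Pos ξ
            ξ-i   : ξ ! i ≡ 0ℚ
            q μ   : ℚ
            ξ-eq  : ξ ≡ (q ·ᵥ ζ i) +ᵥ (μ ·ᵥ δQ)
            q≢0   : q ≢ 0ℚ
            μ≢0   : μ ≢ 0ℚ

        abstract
          -- The choice q = δ_i makes the coordinate i of q ζ_i - δ vanish, as ζ_i has coordinate 1
          -- there; up to sign this root is ξ.
          signed : ∀ i q {N} → 0ℚ < q → IsRt N ((q ·ᵥ ζ i) -ᵥ δQ) → q ≡ δQ ! i → SpecialRoot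
          signed i q {N} q>0 r eq = go (posneg r)
            where
            x : V n
            x = (q ·ᵥ ζ i) -ᵥ δQ
            xi : x ! i ≡ 0ℚ
            xi = lk-- (q ·ᵥ ζ i) δQ i ∙ cong₂ _-_ (lk-· q (ζ i) i ∙ cong (q *_) (ζ-i i) ∙ ℚP.*-identityʳ q) (sym eq) ∙ ℚP.+-inverseʳ q
            go : Pos x ⊎ Pos ((- 1ℚ) ·ᵥ x) → SpecialRoot
            go (inj₁ p) = record { i = i ; ξ = x ; ξ-rt = r ; ξ-pos = p ; ξ-i = xi ; q = q ; μ = - 1ℚ ; ξ-eq = sub-as (q ·ᵥ ζ i) δQ ; q≢0 = >⇒≢ q>0 ; μ≢0 = λ h → >⇒≢ 0<1 (neg0 h) }
              where
              neg0 : - 1ℚ ≡ 0ℚ → 1ℚ ≡ 0ℚ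
              neg0 ()
            go (inj₂ p) = record { i = i ; ξ = (- 1ℚ) ·ᵥ x ; ξ-rt = rt-neg r ; ξ-pos = p ; ξ-i = lk-· (- 1ℚ) x i ∙ cong ((- 1ℚ) *_) xi ∙ ℚP.*-zeroʳ (- 1ℚ) ; q = - q ; μ = 1ℚ
              ; ξ-eq = vec-ext (λ j → lk-· (- 1ℚ) x j ∙ cong ((- 1ℚ) *_) (lk-- (q ·ᵥ ζ i) δQ j ∙ cong (_- lookup δQ j) (lk-· q (ζ i) j)) ∙
                  solve 3 (λ q z d → (:- con 1ℚ) :* (q :* z :- d) := (:- q) :* z :+ con 1ℚ :* d) refl q (ζ i ! j) (δQ ! j) ∙ sym (lk-+ ((- q) ·ᵥ ζ i) (1ℚ ·ᵥ δQ) j ∙ cong₂ _+_ (lk-· (- q) (ζ i) j) (lk-· 1ℚ δQ j)))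
              ; q≢0 = λ h → >⇒≢ q>0 (solve 1 (λ q → q := :- (:- q)) refl q ∙ cong -_ h) ; μ≢0 = >⇒≢ 0<1 }

          K-mδ : ∀ (y : V n) → K (y -ᵥ δQ) (y -ᵥ δQ) ≡ K y y
          K-mδ y = K-sub y δQ ∙ cong₂ (λ a b → K y y - (a + a) + b) (K-δ y) (K-δ δQ) ∙ solve 1 (λ k → k :- (con 0ℚ :+ con 0ℚ) :+ con 0ℚ := k) refl (K y y)

          lk-qδ : ∀ q i j → ((q ·ᵥ ζ i) -ᵥ δQ) ! j ≡ q * ζ i ! j - δQ ! j
          lk-qδ q i j = lk-- (q ·ᵥ ζ i) δQ j ∙ cong (_- lookup δQ j) (lk-· q (ζ i) j)

          -- The point is that subtracting δ keeps the coroot integral. With δ_i = m_i = 1 one gets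
          -- κ d_i = 1, so d_j δ_j = d_i m_j is divisible by d_i.
          nice : ∀ i → δ ! i ≡ 1 → m ! i ≡ 1 → SpecialRoot
          nice i δ1 m1 = signed i 1ℚ 0<1 (rt (d>0 i) (K-mδ (1ℚ ·ᵥ ζ i) ∙ cong (λ t → K t t) (1·ᵥ (ζ i)) ∙ norm (ζ-rt i))
              (λ j → subst Int (sym (lk-qδ 1ℚ i j)) (int-sub (int-* int-1 (int (ζ-rt i) j)) (δ-int j)))
              (λ j → subst (d i ∣ᵢ_) (solve 3 (λ d z x → d :* z :+ :- (d :* x) := d :* (con 1ℚ :* z :- x)) refl (d j) (ζ i ! j) (δQ ! j) ∙ cong (d j *_) (sym (lk-qδ 1ℚ i j)))
                (div-+ (coint (ζ-rt i) j) (div-neg (dv (m′ j) (int-toℚ (ℤ.+ m ! j)) (κδ j)))))) (sym δi)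
            where
            δi : δQ ! i ≡ 1ℚ
            δi = lk-δ i ∙ cong (λ t → toℚ (ℤ.+ t)) δ1
            κd : κ * d i ≡ 1ℚ
            κd = cong (κ *_) (sym (ℚP.*-identityʳ (d i)) ∙ cong (d i *_) (sym δi)) ∙ sym (m-κ i) ∙ cong (λ t → toℚ (ℤ.+ t)) m1
            κδ : ∀ j → d j * δQ ! j ≡ d i * m′ j
            κδ j = sym (cong (d i *_) (m-κ j) ∙ solve 3 (λ d k x → d :* (k :* x) := k :* d :* x) refl (d i) κ (d j * δQ ! j) ∙ cong (_* (d j * δQ ! j)) κd ∙ ℚP.*-identityˡ (d j * δQ ! j))

          -- The situation of type A_{2l}^{(2)}: a long root x with x ≡ 2ζ_i modulo δ.
          weird : ∀ i → δ ! i ≡ 2 → m ! i ≡ 1 → ∀ {x} → IsRt (toℚ (ℤ.+ 4) * d i) x → ∀ μ → x ≡ (2ℚ ·ᵥ ζ i) +ᵥ (μ ·ᵥ δQ) → SpecialRoot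
          weird i δ2 m1 {x} r μ eq = signed i 2ℚ 0<2 (rt (N>0 r) (K-mδ (2ℚ ·ᵥ ζ i) ∙ K-scale2 2ℚ (ζ i) ∙ cong (2ℚ * 2ℚ *_) (norm (ζ-rt i)) ∙ solve 1 (λ d → con 2ℚ :* con 2ℚ :* (d :+ d) := con (toℚ (ℤ.+ 4)) :* d :+ con (toℚ (ℤ.+ 4)) :* d) refl (d i))
              (λ j → subst Int (sym (lk-qδ 2ℚ i j)) (int-sub (int-* (int-toℚ (ℤ.+ 2)) (int (ζ-rt i) j)) (δ-int j))) λ j → dv (quo (coint r j) - h * m′ j) (int-sub (quo-int (coint r j)) (int-* (quo-int (coint r i)) (int-toℚ (ℤ.+ m ! j)))) (val j)) (sym δi)
            where
            δi : δQ ! i ≡ 2ℚ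
            δi = lk-δ i ∙ cong (λ t → toℚ (ℤ.+ t)) δ2
            h : ℚ
            h = quo (coint r i)
            lkx : ∀ j → x ! j ≡ 2ℚ * ζ i ! j + μ * δQ ! j
            lkx j = cong (λ t → t ! j) eq ∙ lk-+ (2ℚ ·ᵥ ζ i) (μ ·ᵥ δQ) j ∙ cong₂ _+_ (lk-· 2ℚ (ζ i) j) (lk-· μ δQ j)
            κd : κ * (d i * 2ℚ) ≡ 1ℚ
            κd = cong (λ t → κ * (d i * t)) (sym δi) ∙ sym (m-κ i) ∙ cong (λ t → toℚ (ℤ.+ t)) m1
            κδ : ∀ j → d j * δQ ! j ≡ 2ℚ * d i * m′ j
            κδ j = sym (cong (2ℚ * d i *_) (m-κ j) ∙ solve 3 (λ d k x → con 2ℚ :* d :* (k :* x) := k :* (d :* con 2ℚ) :* x) refl (d i) κ (d j * δQ ! j) ∙ cong (_* (d j * δQ ! j)) κd ∙ ℚP.*-identityˡ (d j * δQ ! j))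
            μh : 1ℚ + μ ≡ 2ℚ * h
            μh = *-cancelˡ {2ℚ * d i} (>⇒≢ (0<* 0<2 (d>0 i))) (solve 2 (λ d m → con 2ℚ :* d :* (con 1ℚ :+ m) := d :* (con 2ℚ :* con 1ℚ :+ m :* con 2ℚ)) refl (d i) μ ∙ cong₂ (λ s t → d i * (2ℚ * s + μ * t)) (sym (ζ-i i)) (sym δi) ∙
              cong (d i *_) (sym (lkx i)) ∙ quo-eq (coint r i) ∙ solve 2 (λ d h → con (toℚ (ℤ.+ 4)) :* d :* h := con 2ℚ :* d :* (con 2ℚ :* h)) refl (d i) h)
            val : ∀ j → d j * ((2ℚ ·ᵥ ζ i) -ᵥ δQ) ! j ≡ toℚ (ℤ.+ 4) * d i * (quo (coint r j) - h * m′ j)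
            val j = cong (d j *_) (lk-qδ 2ℚ i j) ∙ solve 4 (λ d z x m → d :* (con 2ℚ :* z :- x) := d :* (con 2ℚ :* z :+ m :* x) :- (con 1ℚ :+ m) :* (d :* x)) refl (d j) (ζ i ! j) (δQ ! j) μ ∙
              cong₂ _-_ (cong (d j *_) (sym (lkx j)) ∙ quo-eq (coint r j)) (cong₂ _*_ μh (κδ j)) ∙
                solve 4 (λ d q h m → con (toℚ (ℤ.+ 4)) :* d :* q :- con 2ℚ :* h :* (con 2ℚ :* d :* m) := con (toℚ (ℤ.+ 4)) :* d :* (q :- h :* m)) refl (d i) (quo (coint r j)) h (m′ j)

          -- Take i with m_i = 1, s with δ_s = 1 and a translate x of ζ_s pairing positively with
          -- ζ_i. The Cartan integers satisfy k' = m_s δ_i k, so m_s δ_i k² is at most 4. Unless m_s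
          -- or δ_i is 1, this forces m_s = δ_i = 2, k = 1 and d_s = 4 d_i, and then x - 2ζ_i has
          -- norm 0.
          special : SpecialRoot
          special = choose (lookup m s′ ℕP.≟ 1) (lookup δ i ℕP.≟ 1)
            where
            i s′ : Fin n
            i = proj₁ m-one
            s′ = proj₁ δ-one
            av : ∃ λ k → 0ℚ < K (τ^ w k (ζ s′)) (ζ i)
            av = average cw (ζ-rt s′) (ζ-D s′) (ζ-D i)
            x : V n
            x = τ^ w (proj₁ av) (ζ s′)
            rx : IsRt (d s′) x
            rx = τ^-rt w (proj₁ av) (ζ-rt s′)
            p : Pairing (d s′) (d i) x (ζ i)
            p = pairing rx (ζ-rt i)
            open Pairing p
            k≥1 : 1ℚ ≤ k
            k≥1 = proj₁ (pos-k p (d>0 s′) (d>0 i) (proj₂ av))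
            κi : κ * (d i * δ′ i) ≡ 1ℚ
            κi = cong (λ t → κ * (d i * t)) (sym (lk-δ i)) ∙ sym (m-κ i) ∙ cong (λ t → toℚ (ℤ.+ t)) (proj₂ m-one)
            κs : κ * d s′ ≡ m′ s′
            κs = cong (κ *_) (sym (cong (d s′ *_) (lk-δ s′ ∙ cong (λ t → toℚ (ℤ.+ t)) (proj₂ δ-one)) ∙ ℚP.*-identityʳ (d s′))) ∙ sym (m-κ s′)
            k'≡ : k' ≡ m′ s′ * δ′ i * k
            k'≡ = sym (ℚP.*-identityˡ k') ∙ cong (_* k') (sym κi) ∙ solve 4 (λ κ d x k → κ :* (d :* x) :* k := κ :* x :* (d :* k)) refl κ (d i) (δ′ i) k' ∙ cong (κ * δ′ i *_) (sym (mult p)) ∙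
              solve 4 (λ κ x d k → κ :* x :* (d :* k) := κ :* d :* x :* k) refl κ (δ′ i) (d s′) k ∙ cong (λ t → t * δ′ i * k) κs
            choose : Dec (m ! s′ ≡ 1) → Dec (δ ! i ≡ 1) → SpecialRoot
            choose (yes q) _ = nice s′ (proj₂ δ-one) q
            choose (no _) (yes q) = nice i q (proj₂ m-one)
            choose (no nm) (no nδ) = weird i δ2 (proj₂ m-one) (subst (λ t → IsRt t x) ds rx) (proj₁ xd) (sub-add x (2ℚ ·ᵥ ζ i) ∙ cong ((2ℚ ·ᵥ ζ i) +ᵥ_) (proj₂ xd))
              where
              ge2 : ∀ {a} → 0 ℕ.< a → a ≢ 1 → 2 ℕ.≤ a
              ge2 {suc zero} _ h = ⊥-elim (h refl)
              ge2 {suc (suc a)} _ _ = ℕ.s≤s (ℕ.s≤s ℕ.z≤n)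
              mδ≤4 : m′ s′ * δ′ i ≤ toℚ (ℤ.+ 4)
              mδ≤4 = ℚP.≤-trans (*-mono (0≤* (ℚP.<⇒≤ (m>0 s′)) δ≥0) (ℚP.≤-trans k≥1 (*-mono (ℚP.≤-trans 0≤1 k≥1) k≥1))) (subst (_≤ toℚ (ℤ.+ 4)) (cong (k *_) k'≡ ∙ solve 3 (λ k m x → k :* (m :* x :* k) := m :* x :* (k :* k)) refl k (m′ s′) (δ′ i)) bound)
                where
                δ≥0 : 0ℚ ≤ δ′ i
                δ≥0 = subst (0ℚ ≤_) (lk-δ i) (δ-pos i)
              le4 : m ! s′ ℕ.* δ ! i ℕ.≤ 4
              le4 = ℤP.drop‿+≤+ (ℤP.≮⇒≥ λ q → <⇒≱ (ℚP.<-≤-trans (sub> {toℚ (ℤ.+ 4)} {toℚ (ℤ.+ 5)} (ℚP.positive⁻¹ 1ℚ)) (toℚ-mono (ℤP.i<j⇒suc[i]≤j q)))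
                (subst (_≤ toℚ (ℤ.+ 4)) (sym (toℚ-* (ℤ.+ m ! s′) (ℤ.+ δ ! i)) ∙ cong toℚ (sym (ℤP.pos-* (m ! s′) (δ ! i)))) mδ≤4))
              two : ∀ a b → 2 ℕ.≤ a → 2 ℕ.≤ b → a ℕ.* b ℕ.≤ 4 → a ≡ 2 × b ≡ 2
              two a b ha hb h = ℕP.≤-antisym (half a (ℕP.≤-trans (ℕP.*-monoʳ-≤ a hb) h)) ha , ℕP.≤-antisym (half b (ℕP.≤-trans (ℕP.*-monoʳ-≤ b ha) (subst (ℕ._≤ 4) (ℕP.*-comm a b) h))) hb
                where
                half : ∀ a → a ℕ.* 2 ℕ.≤ 4 → a ℕ.≤ 2
                half a h = ℕP.*-cancelʳ-≤ a 2 2 h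
              both : m ! s′ ≡ 2 × δ ! i ≡ 2
              both = two (m ! s′) (δ ! i) (ge2 (proj₁ ism s′) nm) (ge2 (proj₁ isδ i) nδ) le4
              δ2 : δ ! i ≡ 2
              δ2 = proj₂ both
              k'4 : k' ≡ toℚ (ℤ.+ 4) * k
              k'4 = k'≡ ∙ cong (_* k) (cong₂ (λ a b → toℚ (ℤ.+ a) * toℚ (ℤ.+ b)) (proj₁ both) δ2)
              k≡1 : k ≡ 1ℚ
              k≡1 = ℚP.≤-antisym (ℚP.≤-trans (*-mono (ℚP.≤-trans 0≤1 k≥1) k≥1) (ℚP.*-cancelˡ-≤-pos (toℚ (ℤ.+ 4)) (subst₂ _≤_ (cong (k *_) k'4 ∙ solve 1 (λ k → k :* (con (toℚ (ℤ.+ 4)) :* k) := con (toℚ (ℤ.+ 4)) :* (k :* k)) refl k) (sym (ℚP.*-identityʳ (toℚ (ℤ.+ 4)))) bound))) k≥1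
              ds : d s′ ≡ toℚ (ℤ.+ 4) * d i
              ds = sym (ℚP.*-identityʳ (d s′)) ∙ cong (d s′ *_) (sym k≡1) ∙ mult p ∙ cong (d i *_) (k'4 ∙ cong (toℚ (ℤ.+ 4) *_) k≡1) ∙ solve 1 (λ d → d :* (con (toℚ (ℤ.+ 4)) :* con 1ℚ) := con (toℚ (ℤ.+ 4)) :* d) refl (d i)
              Kx : K x (ζ i) ≡ toℚ (ℤ.+ 4) * d i
              Kx = eqN ∙ cong (d s′ *_) k≡1 ∙ ℚP.*-identityʳ (d s′) ∙ ds
              xd : ∃ λ μ → x -ᵥ (2ℚ ·ᵥ ζ i) ≡ μ ·ᵥ δQ
              xd = null-δ (x -ᵥ (2ℚ ·ᵥ ζ i)) (norm0-null {x -ᵥ (2ℚ ·ᵥ ζ i)} (K-sub x (2ℚ ·ᵥ ζ i) ∙ cong₂ (λ a b → K x x - (a + a) + b) (Functional.scale (K-linʳ x) 2ℚ (ζ i) ∙ cong (2ℚ *_) Kx) (K-scale2 2ℚ (ζ i) ∙ cong (2ℚ * 2ℚ *_) (norm (ζ-rt i))) ∙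
                cong (λ t → t - (2ℚ * (toℚ (ℤ.+ 4) * d i) + 2ℚ * (toℚ (ℤ.+ 4) * d i)) + 2ℚ * 2ℚ * (d i + d i)) (norm rx ∙ cong₂ _+_ ds ds) ∙
                  solve 1 (λ d → con (toℚ (ℤ.+ 4)) :* d :+ con (toℚ (ℤ.+ 4)) :* d :- (con 2ℚ :* (con (toℚ (ℤ.+ 4)) :* d) :+ con 2ℚ :* (con (toℚ (ℤ.+ 4)) :* d)) :+ con 2ℚ :* con 2ℚ :* (d :+ d) := con 0ℚ) refl (d i)))

    open Special public

    -- Tests for fullness that do not refer to Π_c.

    module Tests {w : List (Fin n)} (cw : Cox w) where
      -- At most one element of each component of Π_c involves the special simple root, and every
      -- τ-orbit meets such an element. So this coordinate, followed along the orbit, shows the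
      -- coefficients of v one after another.
      FullT : V n → Set
      FullT v = ∀ (s : Fin L) → τ^ w (Fin.toℕ s) v ! (SpecialRoot.i (special cw)) ≢ 0ℚ

      -- The form is 0 between different components, and for two arcs on one cycle it cannot vanish
      -- at every rotation of u, see `same-tube`.
      SameTube : V n → V n → Set
      SameTube v u = Σ (Fin L) λ s → E w v (τ^ w (Fin.toℕ s) u) ≢ 0ℚ

      Tube : V n → Set
      Tube v = ((∃ λ N → IsRt N v) × Pos v × D w v ≡ 0ℚ) × ¬ FullT v

      FullPair : V n → V n → Set
      FullPair v u = Tube v × Tube u × SameTube v u × FullT (v +ᵥ u)

      fullT? : ∀ v → Dec (FullT v)
      fullT? v = FinP.all? (λ s → ¬? (τ^ w (Fin.toℕ s) v ! (SpecialRoot.i (special cw)) ℚP.≟ 0ℚ))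

      tube? : ∀ v → Dec (Tube v)
      tube? v = (rt? v ×-dec FinP.all? (λ i → 0ℚ ℚP.≤? v ! i) ×-dec (D w v ℚP.≟ 0ℚ)) ×-dec ¬? (fullT? v)

      fullPair? : ∀ v u → Dec (FullPair v u)
      fullPair? v u = tube? v ×-dec tube? u ×-dec FinP.any? (λ s → ¬? (E w v (τ^ w (Fin.toℕ s) u) ℚP.≟ 0ℚ)) ×-dec fullT? (v +ᵥ u)

      -- For a full pair the value has to be the number of neighbours of the arc of v, all of which
      -- lie in u: 1 if the complement of the arc is a single element, 2 otherwise. By `gap`, the
      -- complement is a single element exactly when v + τv is full.
      degree : V n → V n → ℚ
      degree v u = pick (fullPair? v u) (fullT? (v +ᵥ τ w v))
        module Degree where
        pick : Dec (FullPair v u) → Dec (FullT (v +ᵥ τ w v)) → ℚ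
        pick (yes _) (yes _) = 1ℚ
        pick (yes _) (no _)  = 2ℚ
        pick (no _) _        = compMax (corootCoord v) u w

      degree-yes : ∀ {v u r} → FullPair v u → (FullT (v +ᵥ τ w v) → r ≡ 1ℚ) → (¬ FullT (v +ᵥ τ w v) → r ≡ 2ℚ) → degree v u ≡ r
      degree-yes {v} {u} {r} h f g = go (fullPair? v u) (fullT? (v +ᵥ τ w v))
        where
        go : (a : Dec (FullPair v u)) (b : Dec (FullT (v +ᵥ τ w v))) → Degree.pick v u a b ≡ r
        go (yes _) (yes q) = sym (f q)
        go (yes _) (no q)  = sym (g q)
        go (no q) _        = ⊥-elim (q h)

      degree-no : ∀ {v u} → ¬ FullPair v u → degree v u ≡ compMax (corootCoord v) u w
      degree-no {v} {u} h = go (fullPair? v u) (fullT? (v +ᵥ τ w v))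
        where
        go : (a : Dec (FullPair v u)) (b : Dec (FullT (v +ᵥ τ w v))) → Degree.pick v u a b ≡ compMax (corootCoord v) u w
        go (yes q) _ = ⊥-elim (h q)
        go (no _) _  = refl

    module Tubes {w : List (Fin n)} (cw : Cox w) (T : AffData w) where
      open AffData T public

      -- The cone of Π_c and its extreme rays.

      module Cones where
        P′ : Fin k → V n
        P′ = lookup P

        sumP : (Fin k → ℚ) → V n
        sumP x = sumV (λ j → x j ·ᵥ P′ j)

        Cone : V n → Set
        Cone v = Σ (Fin k → ℚ) λ x → (∀ j → 0ℚ ≤ x j) × sumP x ≡ v

        abstract
          -- Apply `E-serre` to cγ: the inverse of c takes it back to γ, and the difference δ is
          -- orthogonal to v.
          γ-D : ∀ v → K γ v ≡ D w v
          γ-D v = sym (cong (E w v) (sym γ-eq) ∙ cong (λ t → E w v (actW w γ -ᵥ t)) (sym (act-rev w γ)) ∙ E-serre w v (actW w γ) (proj₁ cw) (spt cw v) ∙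
            cong (K v) (sub-add (actW w γ) γ) ∙ Functional.add (K-linʳ v) γ (actW w γ -ᵥ γ) ∙ cong (K v γ +_) (cong (K v) γ-eq ∙ K-δ v) ∙ ℚP.+-identityʳ (K v γ) ∙ K-sym v γ)

          sumP-comb : ∀ x q y → sumP (λ l → x l + q * y l) ≡ sumP x +ᵥ (q ·ᵥ sumP y)
          sumP-comb x q y = combine-comb x y q P′

          sumP-δ : ∀ i → sumP (δδ i) ≡ P′ i
          sumP-δ i = δδ-comb i P′

          sumP-0 : sumP (λ _ → 0ℚ) ≡ 0ᵥ
          sumP-0 = vec-ext λ j → lk-comb (λ _ → 0ℚ) P′ j ∙ sumQ-cong {g = λ _ → 0ℚ} (λ l → ℚP.*-zeroˡ (P′ l ! j)) ∙ sumQ-0 k ∙ sym (lk-0 j)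

          sumP-cong : ∀ {x y} → (∀ j → x j ≡ y j) → sumP x ≡ sumP y
          sumP-cong h = sumV-cong (λ j → cong (_·ᵥ P′ j) (h j))

          sumP-single : ∀ x j → (∀ l → l ≢ j → x l ≡ 0ℚ) → sumP x ≡ x j ·ᵥ P′ j
          sumP-single x j h = sumP-cong (λ l → at l (l Fin.≟ j) ∙ sym (ℚP.+-identityˡ (x j * δδ j l))) ∙ sumP-comb (λ _ → 0ℚ) (x j) (δδ j) ∙
            cong₂ _+ᵥ_ sumP-0 (cong (x j ·ᵥ_) (sumP-δ j)) ∙ 0-+ᵥ (x j ·ᵥ P′ j)
            where
            at : ∀ l → Dec (l ≡ j) → x l ≡ x j * δδ j l
            at l (yes refl) = sym (cong (x l *_) (δδ-refl l) ∙ ℚP.*-identityʳ (x l))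
            at l (no q) = h l q ∙ sym (cong (x j *_) (δδ-≢ (q ∘ sym)) ∙ ℚP.*-zeroʳ (x j))

          sumP-F : ∀ {f : V n → ℚ} → Functional f → ∀ x → f (sumP x) ≡ sumQ (λ j → x j * f (P′ j))
          sumP-F F x = Functional.comb F x P′

          cone-upsPos : ∀ {v} → UpsPos γ v → Cone v
          cone-upsPos {v} h = let (co , co≥0 , _ , eq) = proj₁ (proj₂ (proj₂ P-spec)) v h in lookup co , co≥0 , eq

          ups-upsPos : ∀ {v} → Ups w v → UpsPos γ v
          ups-upsPos {v} (ups r p h) = inj₁ (rt-real r) , p , γ-D v ∙ h

          cone : ∀ {v} → Ups w v → Cone v
          cone h = cone-upsPos (ups-upsPos h)

          P-upsPos : ∀ j → UpsPos γ (P′ j)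
          P-upsPos = proj₁ P-spec

          P-inj : ∀ i j → P′ i ≡ P′ j → i ≡ j
          P-inj = proj₁ (proj₂ P-spec)

          P-pos : ∀ j → Pos (P′ j)
          P-pos j = proj₁ (proj₂ (P-upsPos j))

          nonzero-coord : ∀ {v} → Pos v → v ≢ 0ᵥ → ∃ λ j → 0ℚ < v ! j
          nonzero-coord {v} p h = let (j , q) = ≢0ᵥ h in j , go j q (≤⇒<⊎≡ (p j))
            where
            go : ∀ j → v ! j ≢ 0ℚ → 0ℚ < v ! j ⊎ 0ℚ ≡ v ! j → 0ℚ < v ! j
            go j q (inj₁ r) = r
            go j q (inj₂ r) = ⊥-elim (q (sym r))

          P-nz : ∀ j → P′ j ≢ 0ᵥ
          P-nz j h = go (proj₁ (P-upsPos j))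
            where
            go : Root (P′ j) → ⊥
            go (inj₁ r) = let (N , r′) = real-rt r in rt-nz (subst (IsRt N) h r′)
            go (inj₂ (z , z≢0 , eq)) = z≢0 (toℚ-injective {z} {ℤ.+ 0} (*≡0 {δQ ! i₀} (>⇒≢ (δ>0 i₀)) (ℚP.*-comm (δQ ! i₀) (toℚ z) ∙ sym (lk-· (toℚ z) δQ i₀) ∙ cong (λ t → t ! i₀) (sym eq ∙ h) ∙ lk-0 i₀)))

          -- The P_j are nonnegative and nonzero, so nothing can cancel.
          zero-comb : ∀ x → (∀ j → 0ℚ ≤ x j) → sumP x ≡ 0ᵥ → ∀ j → x j ≡ 0ℚ
          zero-comb x h eq j = let (l , q) = nonzero-coord (P-pos j) (P-nz j) in *≡0 (>⇒≢ q) (ℚP.*-comm (P′ j ! l) (x j) ∙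
            sumQ≡0 {f = λ j → x j * P′ j ! l} (λ j → 0≤* (h j) (P-pos j l)) (sym (sumP-F (lookup-lin l) x) ∙ cong (λ t → t ! l) eq ∙ lk-0 l) j)

          -- By minimality of Π_c each of its elements spans an extreme ray.
          extreme : ∀ i q x → (∀ j → 0ℚ ≤ x j) → q ·ᵥ P′ i ≡ sumP x → ∀ l → l ≢ i → x l ≡ 0ℚ
          extreme i q x x≥0 eq l l≢i = go (x i ℚP.<? q)
            where
            offi : ∀ {j} → j ≢ i → δδ i j ≡ 0ℚ
            offi h = δδ-≢ (h ∘ sym)
            x′ : Fin k → ℚ
            x′ j = x j + (- q) * δδ i j
            x′-off : ∀ j → j ≢ i → x′ j ≡ x j
            x′-off j h = cong (λ t → x j + (- q) * t) (offi h) ∙ solve 2 (λ x q → x :+ (:- q) :* con 0ℚ := x) refl (x j) q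
            x′-on : x′ i ≡ x i - q
            x′-on = cong (λ t → x i + (- q) * t) (δδ-refl i) ∙ solve 2 (λ x q → x :+ (:- q) :* con 1ℚ := x :- q) refl (x i) q
            zero′ : sumP x′ ≡ 0ᵥ
            zero′ = sumP-comb x (- q) (δδ i) ∙ cong₂ (λ s t → s +ᵥ ((- q) ·ᵥ t)) (sym eq) (sumP-δ i) ∙ (vec-ext λ j → lk-+ (q ·ᵥ P′ i) ((- q) ·ᵥ P′ i) j ∙ cong₂ _+_ (lk-· q (P′ i) j) (lk-· (- q) (P′ i) j) ∙
              solve 2 (λ q p → q :* p :+ (:- q) :* p := con 0ℚ) refl q (P′ i ! j) ∙ sym (lk-0 j))
            big : q ≤ x i → x l ≡ 0ℚ
            big h = sym (x′-off l l≢i) ∙ zero-comb x′ (λ j → nn j (j Fin.≟ i)) zero′ l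
              where
              nn : ∀ j → Dec (j ≡ i) → 0ℚ ≤ x′ j
              nn j (yes refl) = subst (0ℚ ≤_) (sym x′-on) (≥sub h)
              nn j (no p) = subst (0ℚ ≤_) (sym (x′-off j p)) (x≥0 j)
            small : x i < q → ⊥
            small h = proj₂ (proj₂ (proj₂ P-spec)) S S≢⊤ λ v hv → let (co , co≥0 , eqv) = cone-upsPos hv in
                tabulate (y co) , (λ j → subst (0ℚ ≤_) (sym (lk co j)) (y≥0 co co≥0 j (j Fin.≟ i))) , (λ j nz → inS j λ { refl → nz (lk co i ∙ y-i co) }) ,
                sumV-cong (λ j → cong (_·ᵥ P′ j) (lk co j)) ∙ y-sum co ∙ eqv
              where
              S : Subset k
              S = ∁ Sub.⁅ i ⁆
              S≢⊤ : S ≢ ⊤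
              S≢⊤ e = SubP.x∈∁p⇒x∉p (subst (i Sub.∈_) (sym e) SubP.∈⊤) (SubP.x∈⁅x⁆ i)
              inS : ∀ j → j ≢ i → j Sub.∈ S
              inS j h = SubP.x∉p⇒x∈∁p (λ q → h (SubP.x∈⁅y⁆⇒x≡y i q))
              r : ℚ
              r = inv (>⇒≢ (>sub h))
              qr : (q - x i) * r ≡ 1ℚ
              qr = inv-r (>⇒≢ (>sub h))
              -- The relation x′ is nonnegative off i and equals x_i - q < 0 at i. The multiple
              -- added to an expansion makes the coefficient of P_i vanish, so P_i could be dropped
              -- from Π_c.
              y : (Fin k → ℚ) → Fin k → ℚ
              y co j = co j + (co i * r) * x′ j
              lk : ∀ co j → tabulate (y co) ! j ≡ y co j
              lk co j = VecP.lookup∘tabulate (y co) j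
              y-i : ∀ co → y co i ≡ 0ℚ
              y-i co = cong (λ t → co i + co i * r * t) x′-on ∙ solve 4 (λ c r x q → c :+ c :* r :* (x :- q) := c :* (con 1ℚ :- (q :- x) :* r)) refl (co i) r (x i) q ∙ cong (λ t → co i * (1ℚ - t)) qr ∙ solve 1 (λ c → c :* (con 1ℚ :- con 1ℚ) := con 0ℚ) refl (co i)
              y≥0 : ∀ co → (∀ j → 0ℚ ≤ co j) → ∀ j → Dec (j ≡ i) → 0ℚ ≤ y co j
              y≥0 co h′ j (yes refl) = ℚP.≤-reflexive (sym (y-i co))
              y≥0 co h′ j (no p) = 0≤+ (h′ j) (0≤* (0≤* (h′ i) (ℚP.<⇒≤ (inv-pos (>sub h)))) (subst (0ℚ ≤_) (sym (x′-off j p)) (x≥0 j)))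
              y-sum : ∀ co → sumP (y co) ≡ sumP co
              y-sum co = sumP-comb co (co i * r) x′ ∙ cong (λ t → sumP co +ᵥ ((co i * r) ·ᵥ t)) zero′ ∙ cong (sumP co +ᵥ_) (·ᵥ-0ᵥ (co i * r)) ∙ +ᵥ-0 (sumP co)
            go : Dec (x i < q) → x l ≡ 0ℚ
            go (yes h) = ⊥-elim (small h)
            go (no h) = big (ℚP.≮⇒≥ h)

          cone-+ : ∀ {u v} → Cone u → Cone v → Cone (u +ᵥ v)
          cone-+ (x , x≥0 , refl) (y , y≥0 , refl) = (λ j → x j + 1ℚ * y j) , (λ j → 0≤+ (x≥0 j) (0≤* 0≤1 (y≥0 j))) , sumP-comb x 1ℚ y ∙ cong (sumP x +ᵥ_) (1·ᵥ (sumP y))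

          -- Both y and its inverse are integral, because E(z, y z) is divisible by the half norm of
          -- z and E(y z, z) by that of y z.
          scale-one : ∀ {N M z} y → IsRt N z → IsRt M (y ·ᵥ z) → 0ℚ ≤ y → y ≡ 1ℚ
          scale-one {N} {M} {z} y r r′ h = unit y-int (quo-int eb) h yq
            where
            EN : E w z z ≡ N
            EN = half-inj (E-double cw z ∙ norm r)
            ea : N ∣ᵢ E w z (y ·ᵥ z)
            ea = E-div w z (y ·ᵥ z) (coint r) (int r′)
            eb : M ∣ᵢ E w (y ·ᵥ z) z
            eb = E-div w (y ·ᵥ z) z (coint r′) (int r)
            y-int : Int y
            y-int = subst Int (*-cancelˡ (N≢0 r) (sym (quo-eq ea) ∙ Functional.scale (E-linʳ w z) y z ∙ cong (y *_) EN ∙ ℚP.*-comm y N)) (quo-int ea)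
            M≡ : M ≡ y * y * N
            M≡ = half-inj (sym (norm r′) ∙ K-scale2 y z ∙ cong (y * y *_) (norm r) ∙ ℚP.*-distribˡ-+ (y * y) N N)
            y≢0 : y ≢ 0ℚ
            y≢0 e = N≢0 r′ (M≡ ∙ cong (λ t → t * t * N) e ∙ ℚP.*-zeroˡ N)
            yq : y * quo eb ≡ 1ℚ
            yq = *-cancelˡ {y * N} (λ e → y≢0 (*≡0 (N≢0 r) (ℚP.*-comm N y ∙ e))) (solve 3 (λ y n q → y :* n :* (y :* q) := y :* y :* n :* q) refl y N (quo eb) ∙ cong (_* quo eb) (sym M≡) ∙
              sym (quo-eq eb) ∙ Functional.scale (E-linˡ w z) y z ∙ cong (y *_) EN ∙ sym (ℚP.*-identityʳ (y * N)))

      open Cones public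

      -- If U_c contains no real root, as in rank 2, the elements of Π_c are imaginary; the
      -- parameter a₀ excludes this. In the applications it is the tube root under consideration.
      module OneTube (a₀ : V n) (a₀-ups : Ups w a₀) where

        -- The permutation of Π_c induced by τ, and linear relations in Π_c.

        module Rotation where
          abstract
            per0 : ∀ {y} → Ups w y → ∃ λ p → suc p ℕ.≤ L × τ^ w (suc p) y ≡ y × Null (orb w (suc p) y)
            per0 {y} (ups r _ h) = let (p , q , le , eq , Ko , _ , z) = drift cw r in p , le ,
              eq ∙ cong (λ t → y +ᵥ (t ·ᵥ δQ)) (z h) ∙ cong (y +ᵥ_) (0·ᵥ δQ) ∙ +ᵥ-0 y , null-from {orb w (suc p) y} (λ x → Ko x ∙ cong (λ t → - (t * D w x)) (z h) ∙ cong -_ (ℚP.*-zeroˡ (D w x)))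

            orb-cone : ∀ {y} → Ups w y → ∀ p → ∃ λ v → Cone v × orb w (suc p) y ≡ y +ᵥ v
            orb-cone {y} h zero = 0ᵥ , ((λ _ → 0ℚ) , (λ _ → ℚP.≤-refl) , sumP-0) , 0-+ᵥ y ∙ sym (+ᵥ-0 y)
            orb-cone {y} h (suc p) = let (v , c , eq) = orb-cone h p in v +ᵥ τ^ w (suc p) y , cone-+ c (cone (ups-τ^ cw (suc p) h)) ,
              trans (cong (_+ᵥ τ^ w (suc p) y) eq) (vec-ext λ j → lk-+ (y +ᵥ v) (τ^ w (suc p) y) j ∙ cong (_+ lookup (τ^ w (suc p) y) j) (lk-+ y v j) ∙ ℚP.+-assoc (y ! j) (v ! j) (τ^ w (suc p) y ! j) ∙
                sym (lk-+ y (v +ᵥ τ^ w (suc p) y) j ∙ cong (lookup y j +_) (lk-+ v (τ^ w (suc p) y) j)))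

            -- If some element of Π_c were imaginary, then the orbit sum of a₀ would be a multiple of it.
            P-ups : ∀ j → Ups w (P′ j)
            P-ups j = go (P-upsPos j)
              where
              go : UpsPos γ (P′ j) → Ups w (P′ j)
              go (inj₁ r , p , h) = ups (proj₂ (real-rt r)) p (sym (γ-D (P′ j)) ∙ h)
              go (inj₂ (z , z≢0 , eq) , p , h) = ⊥-elim (rt-nz′ (root a₀-ups))
                where
                pr : ∃ λ p → suc p ℕ.≤ L × τ^ w (suc p) a₀ ≡ a₀ × Null (orb w (suc p) a₀)
                pr = per0 a₀-ups
                od : ∃ λ q → orb w (suc (proj₁ pr)) a₀ ≡ q ·ᵥ δQ
                od = null-δ (orb w (suc (proj₁ pr)) a₀) (proj₂ (proj₂ (proj₂ pr)))
                oc : ∃ λ v → Cone v × orb w (suc (proj₁ pr)) a₀ ≡ a₀ +ᵥ v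
                oc = orb-cone a₀-ups (proj₁ pr)
                tz≢0 : toℚ z ≢ 0ℚ
                tz≢0 e = z≢0 (toℚ-injective {z} {ℤ.+ 0} e)
                x y : Fin k → ℚ
                x = proj₁ (cone a₀-ups)
                y = proj₁ (proj₁ (proj₂ oc))
                x≥0 : ∀ l → 0ℚ ≤ x l
                x≥0 = proj₁ (proj₂ (cone a₀-ups))
                y≥0 : ∀ l → 0ℚ ≤ 1ℚ * y l
                y≥0 l = 0≤* 0≤1 (proj₁ (proj₂ (proj₁ (proj₂ oc))) l)
                q : ℚ
                q = proj₁ od * inv tz≢0
                total : q ·ᵥ P′ j ≡ sumP (λ l → x l + 1ℚ * y l)
                total = cong (q ·ᵥ_) eq ∙ (vec-ext λ l → lk-· q (toℚ z ·ᵥ δQ) l ∙ cong (q *_) (lk-· (toℚ z) δQ l) ∙ solve 4 (λ a i z d → a :* i :* (z :* d) := z :* i :* (a :* d)) refl (proj₁ od) (inv tz≢0) (toℚ z) (δQ ! l) ∙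
                    cong (_* (proj₁ od * δQ ! l)) (inv-r tz≢0) ∙ ℚP.*-identityˡ (proj₁ od * δQ ! l) ∙ sym (lk-· (proj₁ od) δQ l)) ∙
                  sym (proj₂ od) ∙ proj₂ (proj₂ oc) ∙ cong₂ _+ᵥ_ (sym (proj₂ (proj₂ (cone a₀-ups)))) (sym (proj₂ (proj₂ (proj₁ (proj₂ oc)))) ∙ sym (1·ᵥ (sumP y))) ∙ sym (sumP-comb x 1ℚ y)
                x0 : ∀ l → l ≢ j → x l ≡ 0ℚ
                x0 l h′ = sum≡0ˡ (x≥0 l) (y≥0 l) (extreme j q (λ l → x l + 1ℚ * y l) (λ l → 0≤+ (x≥0 l) (y≥0 l)) total l h′)
                a₀≡ : a₀ ≡ x j ·ᵥ P′ j
                a₀≡ = sym (proj₂ (proj₂ (cone a₀-ups))) ∙ sumP-single x j x0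
                rt-nz′ : ∀ {N} → ¬ IsRt N a₀
                rt-nz′ r = >⇒≢ (0<+ (N>0 r) (ℚP.<⇒≤ (N>0 r))) (sym (norm r) ∙ null-K {a₀} (subst Null (sym a₀≡) (null-scale (x j) {P′ j} (subst Null (sym eq) (null-scale (toℚ z) {δQ} δ-null)))) a₀)

            -- Expanding f(P_i) in the cone and applying g writes P_i as a nonnegative combination.
            -- By `extreme`, each P_l occurring in f(P_i) has g(P_l) on the ray of P_i, so P_l is a
            -- multiple of f(P_i); proportional positive roots are equal.
            permutes : (f g : V n → V n) → Linear g → (∀ y → g (f y) ≡ y) → (∀ {y} → Ups w y → Ups w (f y)) → (∀ {y} → Ups w y → Ups w (g y)) →
              (∀ q y → f (q ·ᵥ y) ≡ q ·ᵥ f y) → (∀ y → f (g y) ≡ y) → ∀ i → ∃ λ l → f (P′ i) ≡ P′ l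
            permutes f g G gf f-ups g-ups f-sc fg i = l , P-eq
              where
              c : Cone (f (P′ i))
              c = cone (f-ups (P-ups i))
              x : Fin k → ℚ
              x = proj₁ c
              x≥0 : ∀ j → 0ℚ ≤ x j
              x≥0 = proj₁ (proj₂ c)
              cc : ∀ j → Cone (g (P′ j))
              cc j = cone (g-ups (P-ups j))
              y : Fin k → Fin k → ℚ
              y j = proj₁ (cc j)
              y≥0 : ∀ j t → 0ℚ ≤ y j t
              y≥0 j = proj₁ (proj₂ (cc j))
              fP≢0 : f (P′ i) ≢ 0ᵥ
              fP≢0 h = rt-nz (subst (IsRt (norm½ (f-ups (P-ups i)))) h (root (f-ups (P-ups i))))
              lx : ∃ λ l → x l ≢ 0ℚ
              lx = go (proj₁ (≢0ᵥ fP≢0)) (sumQ≢0 {f = λ l → x l * P′ l ! (proj₁ (≢0ᵥ fP≢0))} (λ e → proj₂ (≢0ᵥ fP≢0) (cong (λ s → s ! (proj₁ (≢0ᵥ fP≢0))) (sym (proj₂ (proj₂ c))) ∙ sumP-F (lookup-lin (proj₁ (≢0ᵥ fP≢0))) x ∙ e)))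
                where
                go : ∀ t → (∃ λ l → x l * P′ l ! t ≢ 0ℚ) → ∃ λ l → x l ≢ 0ℚ
                go t (l , h) = l , λ e → h (cong (_* lookup (P′ l) t) e ∙ ℚP.*-zeroˡ (P′ l ! t))
              l : Fin k
              l = proj₁ lx
              total : 1ℚ ·ᵥ P′ i ≡ sumP (λ t → sumQ (λ j → x j * y j t))
              total = 1·ᵥ (P′ i) ∙ sym (gf (P′ i)) ∙ cong g (sym (proj₂ (proj₂ c))) ∙ Linear.sum G (λ j → x j ·ᵥ P′ j) ∙ sumV-cong (λ j → Linear.scale G (x j) (P′ j) ∙ cong (x j ·ᵥ_) (sym (proj₂ (proj₂ (cc j))))) ∙ (vec-ext λ s → begin
                  lookup (sumV (λ j → x j ·ᵥ sumP (y j))) s ≡⟨ lk-comb x (λ j → sumP (y j)) s ⟩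
                  sumQ (λ j → x j * sumP (y j) ! s) ≡⟨ sumQ-cong (λ j → cong (x j *_) (sumP-F (lookup-lin s) (y j)) ∙ sym (sumQ-* (x j) (λ t → y j t * P′ t ! s))) ⟩
                  sumQ (λ j → sumQ (λ t → x j * (y j t * P′ t ! s))) ≡⟨ sumQ-swap (λ j t → x j * (y j t * P′ t ! s)) ⟩
                  sumQ (λ t → sumQ (λ j → x j * (y j t * P′ t ! s))) ≡⟨ sumQ-cong (λ t → sumQ-cong (λ j → solve 3 (λ a b p → a :* (b :* p) := p :* (a :* b)) refl (x j) (y j t) (P′ t ! s)) ∙ sumQ-* (P′ t ! s) (λ j → x j * y j t) ∙ ℚP.*-comm (P′ t ! s) (sumQ (λ j → x j * y j t))) ⟩
                  sumQ (λ t → sumQ (λ j → x j * y j t) * P′ t ! s) ≡⟨ sumP-F (lookup-lin s) (λ t → sumQ (λ j → x j * y j t)) ⟨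
                  sumP (λ t → sumQ (λ j → x j * y j t)) ! s ∎)
                where open ≡-Reasoning
              yl : ∀ t → t ≢ i → y l t ≡ 0ℚ
              yl t h = *≡0 (proj₂ lx) (sumQ≡0 {f = λ j → x j * y j t} (λ j → 0≤* (x≥0 j) (y≥0 j t)) (extreme i 1ℚ (λ t → sumQ (λ j → x j * y j t)) (λ t → sumQ-≥0 {f = λ j → x j * y j t} (λ j → 0≤* (x≥0 j) (y≥0 j t))) total t h) l)
              gl : g (P′ l) ≡ y l i ·ᵥ P′ i
              gl = sym (proj₂ (proj₂ (cc l))) ∙ sumP-single (y l) i yl
              Pl : P′ l ≡ y l i ·ᵥ f (P′ i)
              Pl = sym (fg (P′ l)) ∙ cong f gl ∙ f-sc (y l i) (P′ i)
              P-eq : f (P′ i) ≡ P′ l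
              P-eq = sym (Pl ∙ cong (_·ᵥ f (P′ i)) (scale-one (y l i) (root (f-ups (P-ups i))) (subst (IsRt (norm½ (P-ups l))) Pl (root (P-ups l))) (y≥0 l i)) ∙ 1·ᵥ (f (P′ i)))

            τ-perm : ∀ i → ∃ λ l → τ w (P′ i) ≡ P′ l
            τ-perm = permutes (τ w) (actW w) (act-lin w) (rev-act w) (ups-τ cw) (ups-c cw) (Linear.scale (act-lin (reverse w))) (act-rev w)

            c-perm : ∀ i → ∃ λ l → actW w (P′ i) ≡ P′ l
            c-perm = permutes (actW w) (τ w) (act-lin (reverse w)) (act-rev w) (ups-c cw) (ups-τ cw) (Linear.scale (act-lin w)) (rev-act w)

          π π⁻ : Fin k → Fin k
          π i = proj₁ (τ-perm i)
          π⁻ i = proj₁ (c-perm i)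

          abstract
            τP : ∀ i → τ w (P′ i) ≡ P′ (π i)
            τP i = proj₂ (τ-perm i)

            cP : ∀ i → actW w (P′ i) ≡ P′ (π⁻ i)
            cP i = proj₂ (c-perm i)

            ππ⁻ : ∀ i → π (π⁻ i) ≡ i
            ππ⁻ i = P-inj (π (π⁻ i)) i (sym (τP (π⁻ i)) ∙ cong (τ w) (sym (cP i)) ∙ act-rev w (P′ i))

            π⁻π : ∀ i → π⁻ (π i) ≡ i
            π⁻π i = P-inj (π⁻ (π i)) i (sym (cP (π i)) ∙ cong (actW w) (sym (τP i)) ∙ rev-act w (P′ i))

            δδ≥0 : ∀ (i l : Fin k) → 0ℚ ≤ δδ i l
            δδ≥0 i l = go (i Fin.≟ l)
              where
              go : Dec (i ≡ l) → 0ℚ ≤ δδ i l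
              go (yes refl) = subst (0ℚ ≤_) (sym (δδ-refl i)) 0≤1
              go (no q) = ℚP.≤-reflexive (sym (δδ-≢ q))

            ray-free : ∀ {i j v} c q → i ≢ j → 0ℚ < c → Cone v → q ·ᵥ P′ j ≡ v +ᵥ (c ·ᵥ P′ i) → ⊥
            ray-free {i} {j} c q i≢j c>0 (x , x≥0 , eq) tot = >⇒≢ c>0 (sum≡0ʳ {x i} {c} (x≥0 i) (ℚP.<⇒≤ c>0) (cong (x i +_) (sym cδ) ∙ y-i))
              where
              y : Fin k → ℚ
              y l = x l + c * δδ i l
              cδ : c * δδ i i ≡ c
              cδ = cong (c *_) (δδ-refl i) ∙ ℚP.*-identityʳ c
              y≥0 : ∀ l → 0ℚ ≤ y l
              y≥0 l = 0≤+ (x≥0 l) (0≤* (ℚP.<⇒≤ c>0) (δδ≥0 i l))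
              total : q ·ᵥ P′ j ≡ sumP y
              total = tot ∙ cong₂ (λ s t → s +ᵥ (c ·ᵥ t)) (sym eq) (sym (sumP-δ i)) ∙ sym (sumP-comb x c (δδ i))
              y-i : y i ≡ 0ℚ
              y-i = extreme j q y y≥0 total i i≢j

            -- Otherwise a reflection makes P_i - k P_j with k > 0 a root of U_c. Whatever its sign,
            -- it exhibits P_i or a multiple of P_j as a combination in which the other one occurs,
            -- against extremality.
            K-P≤0 : ∀ {i j} → i ≢ j → K (P′ i) (P′ j) ≤ 0ℚ
            K-P≤0 {i} {j} i≢j = ℚP.≮⇒≥ λ h → bad (Pairing.k p) (c>0 h) z-rt z-D (posneg z-rt)
              where
              p : Pairing (norm½ (P-ups j)) (norm½ (P-ups i)) (P′ j) (P′ i)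
              p = pairing (root (P-ups j)) (root (P-ups i))
              c>0 : 0ℚ < K (P′ i) (P′ j) → 0ℚ < Pairing.k p
              c>0 h = pos-cancel (N>0 (root (P-ups j))) (subst (0ℚ <_) (K-sym (P′ i) (P′ j) ∙ Pairing.eqN p) h)
              z-rt : IsRt (norm½ (P-ups i)) (P′ i -ᵥ (Pairing.k p ·ᵥ P′ j))
              z-rt = proj₁ (reflections cw (root (P-ups j)) (root (P-ups i)) p)
              z-D : D w (P′ i -ᵥ (Pairing.k p ·ᵥ P′ j)) ≡ 0ℚ
              z-D = D-comb cw (P′ i) (Pairing.k p) (P′ j) ∙ cong₂ (λ s t → s - Pairing.k p * t) (D≡0 (P-ups i)) (D≡0 (P-ups j)) ∙ solve 1 (λ c → con 0ℚ :- c :* con 0ℚ := con 0ℚ) refl (Pairing.k p)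
              bad : ∀ c → 0ℚ < c → ∀ {N} → IsRt N (P′ i -ᵥ (c ·ᵥ P′ j)) → D w (P′ i -ᵥ (c ·ᵥ P′ j)) ≡ 0ℚ → Pos (P′ i -ᵥ (c ·ᵥ P′ j)) ⊎ Pos ((- 1ℚ) ·ᵥ (P′ i -ᵥ (c ·ᵥ P′ j))) → ⊥
              bad c c>0 r h (inj₁ pz) = ray-free {j} {i} c 1ℚ (i≢j ∘ sym) c>0 (cone (ups r pz h)) (vec-ext λ s → lk-· 1ℚ (P′ i) s ∙ solve 3 (λ a c b → con 1ℚ :* a := a :- c :* b :+ c :* b) refl (P′ i ! s) c (P′ j ! s) ∙
                sym (lk-+ (P′ i -ᵥ (c ·ᵥ P′ j)) (c ·ᵥ P′ j) s ∙ cong₂ _+_ (lk-- (P′ i) (c ·ᵥ P′ j) s ∙ cong (λ t → P′ i ! s - t) (lk-· c (P′ j) s)) (lk-· c (P′ j) s)))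
              bad c c>0 r h (inj₂ pz) = ray-free {i} {j} 1ℚ c i≢j 0<1 (cone (ups (rt-neg r) pz (Functional.neg (E-linˡ w δQ) (P′ i -ᵥ (c ·ᵥ P′ j)) ∙ cong -_ h))) (vec-ext λ s → lk-· c (P′ j) s ∙ solve 3 (λ a c b → c :* b := (:- con 1ℚ) :* (a :- c :* b) :+ con 1ℚ :* a) refl (P′ i ! s) c (P′ j ! s) ∙
                sym (lk-+ ((- 1ℚ) ·ᵥ (P′ i -ᵥ (c ·ᵥ P′ j))) (1ℚ ·ᵥ P′ i) s ∙ cong₂ _+_ (lk-· (- 1ℚ) (P′ i -ᵥ (c ·ᵥ P′ j)) s ∙ cong ((- 1ℚ) *_) (lk-- (P′ i) (c ·ᵥ P′ j) s ∙ cong (λ t → P′ i ! s - t) (lk-· c (P′ j) s))) (lk-· 1ℚ (P′ i) s)))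

            -- The sum is fixed by `τ`, which permutes its terms, and by `E-serre` a fixed vector
            -- lies in the radical.
            S-null : Null (sumV P′)
            S-null = null-from {sumV P′} λ z → sym (E-serre w z (sumV P′) (proj₁ cw) (spt cw z)) ∙ cong (E w z) (cong (sumV P′ -ᵥ_) inv′ ∙ -ᵥ-self (sumV P′)) ∙ Functional.zer (E-linʳ w z)
              where
              inv′ : τ w (sumV P′) ≡ sumV P′
              inv′ = Linear.sum (act-lin (reverse w)) P′ ∙ (vec-ext λ s → lk-sumV (λ j → τ w (P′ j)) s ∙ sumQ-cong (λ j → cong (λ t → t ! s) (τP j)) ∙ sumQ-permute π π⁻ ππ⁻ π⁻π (λ j → P′ j ! s) ∙ sym (lk-sumV P′ s))

            rowsum : ∀ i → sumQ (λ l → K (P′ i) (P′ l)) ≡ 0ℚ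
            rowsum i = trans (sym (Functional.sum (K-linʳ (P′ i)) P′)) (null-K {sumV P′} S-null (P′ i))

            -- As the rows of the Gram matrix sum to 0, the norm of a combination with coefficients
            -- x is half the sum of all -K(P_s, P_t) (x_s - x_t)². The terms are nonnegative, so
            -- they all vanish for a null combination.
            relation-edge : ∀ x → Null (sumP x) → ∀ {s t} → Edge P s t → x s ≡ x t
            relation-edge x nl {s′} {t′} h = diff (decidable-stable (x s′ - x t′ ℚP.≟ 0ℚ) λ q → >⇒≢ (0<sq q) (*≡0 {K (P′ s′) (P′ t′)} h (solve 2 (λ c y → c :* y := :- ((:- c) :* y)) refl (K (P′ s′) (P′ t′)) ((x s′ - x t′) * (x s′ - x t′)) ∙ cong -_ (each s′ t′))))
              where
              diff : x s′ - x t′ ≡ 0ℚ → x s′ ≡ x t′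
              diff q = solve 2 (λ a b → a := a :- b :+ b) refl (x s′) (x t′) ∙ cong (_+ x t′) q ∙ ℚP.+-identityˡ (x t′)
              c : Fin k → Fin k → ℚ
              c s t = K (P′ s) (P′ t)
              term : Fin k → Fin k → ℚ
              term s t = (- c s t) * ((x s - x t) * (x s - x t))
              term≥0 : ∀ s t → 0ℚ ≤ term s t
              term≥0 s t = go (s Fin.≟ t)
                where
                go : Dec (s ≡ t) → 0ℚ ≤ term s t
                go (yes refl) = ℚP.≤-reflexive (sym (solve 2 (λ c x → (:- c) :* ((x :- x) :* (x :- x)) := con 0ℚ) refl (c s s) (x s)))
                go (no q) = 0≤* (≤0⇒ (K-P≤0 q)) (0≤sq (x s - x t))
              ΣΣ : (Fin k → Fin k → ℚ) → ℚ
              ΣΣ f = sumQ (λ s → sumQ (f s))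
              cross : ΣΣ (λ s t → x s * x t * c s t) ≡ 0ℚ
              cross = sumQ-cong (λ s → sumQ-cong (λ t → ℚP.*-assoc (x s) (x t) (c s t)) ∙ sumQ-* (x s) (λ t → x t * c s t) ∙ cong (x s *_) (sym (sumP-F (K-linʳ (P′ s)) x) ∙ null-K {sumP x} nl (P′ s)) ∙ ℚP.*-zeroʳ (x s)) ∙ sumQ-0 k
              sqˡ : ΣΣ (λ s t → x s * x s * c s t) ≡ 0ℚ
              sqˡ = sumQ-cong (λ s → sumQ-* (x s * x s) (c s) ∙ cong (x s * x s *_) (rowsum s) ∙ ℚP.*-zeroʳ (x s * x s)) ∙ sumQ-0 k
              sqʳ : ΣΣ (λ s t → x t * x t * c s t) ≡ 0ℚ
              sqʳ = sumQ-swap (λ s t → x t * x t * c s t) ∙ sumQ-cong (λ t → sumQ-cong (λ s → cong (x t * x t *_) (K-sym (P′ s) (P′ t)))) ∙ sqˡ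
              expand : ΣΣ term ≡ 0ℚ
              expand = sumQ-cong (λ s → sumQ-cong (λ t → solve 3 (λ c x y → (:- c) :* ((x :- y) :* (x :- y)) := con 2ℚ :* (x :* y :* c) :+ ((:- con 1ℚ) :* (x :* x :* c) :+ (:- con 1ℚ) :* (y :* y :* c))) refl (c s t) (x s) (x t)) ∙
                  sumQ-+ (λ t → 2ℚ * (x s * x t * c s t)) (λ t → (- 1ℚ) * (x s * x s * c s t) + (- 1ℚ) * (x t * x t * c s t)) ∙ cong₂ _+_ (sumQ-* 2ℚ (λ t → x s * x t * c s t))
                    (sumQ-+ (λ t → (- 1ℚ) * (x s * x s * c s t)) (λ t → (- 1ℚ) * (x t * x t * c s t)) ∙ cong₂ _+_ (sumQ-* (- 1ℚ) (λ t → x s * x s * c s t)) (sumQ-* (- 1ℚ) (λ t → x t * x t * c s t)))) ∙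
                sumQ-+ (λ s → 2ℚ * sumQ (λ t → x s * x t * c s t)) (λ s → (- 1ℚ) * sumQ (λ t → x s * x s * c s t) + (- 1ℚ) * sumQ (λ t → x t * x t * c s t)) ∙
                cong₂ _+_ (sumQ-* 2ℚ (λ s → sumQ (λ t → x s * x t * c s t)) ∙ cong (2ℚ *_) cross)
                  (sumQ-+ (λ s → (- 1ℚ) * sumQ (λ t → x s * x s * c s t)) (λ s → (- 1ℚ) * sumQ (λ t → x t * x t * c s t)) ∙
                    cong₂ _+_ (sumQ-* (- 1ℚ) (λ s → sumQ (λ t → x s * x s * c s t)) ∙ cong ((- 1ℚ) *_) sqˡ) (sumQ-* (- 1ℚ) (λ s → sumQ (λ t → x t * x t * c s t)) ∙ cong ((- 1ℚ) *_) sqʳ))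
              each : ∀ s t → term s t ≡ 0ℚ
              each s t = sumQ≡0 {f = term s} (term≥0 s) (sumQ≡0 {f = λ s → sumQ (term s)} (λ s → sumQ-≥0 (term≥0 s)) expand s) t

            relation : ∀ x → Null (sumP x) → ∀ {s t} → Conn P s t → x s ≡ x t
            relation x nl ε = refl
            relation x nl (h ◅ c) = relation-edge x nl h ∙ relation x nl c

            edge-sym : ∀ {s t} → Edge P s t → Edge P t s
            edge-sym {s} {t} h e = h (K-sym (P′ s) (P′ t) ∙ e)

            conn-sym : ∀ {s t} → Conn P s t → Conn P t s
            conn-sym ε = ε
            conn-sym (_◅_ {s} {t} h c) = conn-sym c ◅◅ (edge-sym {s} {t} h ◅ ε)

        open Rotation public

        -- Components as cycles of τ, and the Euler form on them.

        module TubeForm where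
          open SpecialRoot (special cw) renaming (i to i⋆; q to q⋆)

          private
            p₀ q₀ u₀ : List (Fin n)
            p₀ = proj₁ (split cw i⋆)
            q₀ = proj₁ (proj₂ (split cw i⋆))
            u₀ = p₀ ++ q₀

          z⋆ : V n
          z⋆ = ζ cw i⋆

          abstract
            w≡ : w ≡ p₀ ++ i⋆ ∷ q₀
            w≡ = proj₂ (proj₂ (split cw i⋆))

            mids⋆ : i⋆ ∉ p₀ × i⋆ ∉ q₀ × Unique u₀
            mids⋆ = uq-mid p₀ (subst Unique w≡ (proj₁ cw))

            i∉u : i⋆ ∉ u₀
            i∉u h with MemP.∈-++⁻ p₀ h
            ... | inj₁ q = proj₁ mids⋆ q
            ... | inj₂ q = proj₁ (proj₂ mids⋆) q

            ∉u : ∀ j → j ∉ u₀ → i⋆ ≡ j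
            ∉u j h with PermP.∈-resp-↭ (PermP.shift i⋆ p₀ q₀) (subst (j ∈_) w≡ (proj₂ cw j))
            ... | here r  = sym r
            ... | there r = ⊥-elim (h r)

            -- Without the letter i⋆ the form is definite, so `fwd-finite` applies. The conjugating
            -- word g avoids i⋆ and leaves that coordinate alone.
            conj⋆ : Conjugate u₀ ξ
            conj⋆ = fwd-conj (proj₂ (proj₂ mids⋆)) (fwd-finite u₀ (proj₂ (proj₂ mids⋆)) def ξ-rt ξ-pos (λ j h → cong (lookup ξ) (sym (∉u j h)) ∙ ξ-i))
              where
              def : ∀ x → Supp u₀ x → K x x ≡ 0ℚ → x ≡ 0ᵥ
              def x sp h = decidable-stable (x ≟ᵥ 0ᵥ) λ ne → >⇒≢ (proj₂ (proj₂ aff) i⋆ x (sp i⋆ i∉u) ne) h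

          open Conjugate conj⋆ renaming (j to j⋆; u to u⋆)

          g⁻ : V n → V n
          g⁻ = actW (reverse g)

          θ : Fin n → V n
          θ l = actW g (e l)

          abstract
            i∉g : i⋆ ∉ g
            i∉g h = i∉u (g⊆ i⋆ h)

            i∉ju : i⋆ ∉ j⋆ ∷ u⋆
            i∉ju h = i∉u (PermP.∈-resp-↭ (↭-sym perm) h)

            g⁻-i : ∀ z → g⁻ z ! i⋆ ≡ z ! i⋆
            g⁻-i z = act-∉ (reverse g) z (∉-rev g i∉g)

            -- On vectors without coordinate i⋆ the value is computed twice: here through g as a
            -- coordinate at j⋆, and in `E-ξ′` through ζ and δ as a multiple of the defect. So on
            -- this hyperplane g⁻¹ turns U_c into a coordinate hyperplane.
            E-ξ : ∀ z → z ! i⋆ ≡ 0ℚ → E w ξ z ≡ d j⋆ * g⁻ z ! j⋆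
            E-ξ z h = cong (λ t → E t ξ z) w≡ ∙ E-mid p₀ i⋆ q₀ ξ z ξ-i h ∙ E-eq ξ z (sp ξ ξ-i) (sp z h) ∙ cong (λ t → E (j⋆ ∷ u⋆) t (g⁻ z)) (cong g⁻ (sym g-e) ∙ act-rev g (e j⋆)) ∙
              E-headˡ j⋆ u⋆ (g⁻ z) (uq-↭ perm (proj₂ (proj₂ mids⋆)))
              where
              sp : ∀ x → x ! i⋆ ≡ 0ℚ → Supp u₀ x
              sp x h j q = cong (lookup x) (sym (∉u j q)) ∙ h

            E-ξ′ : ∀ z → z ! i⋆ ≡ 0ℚ → E w ξ z ≡ μ * (- D w z)
            E-ξ′ z h = cong (λ t → E w t z) ξ-eq ∙ Functional.add (E-linˡ w z) (q⋆ ·ᵥ z⋆) (μ ·ᵥ δQ) ∙ cong₂ _+_ (Functional.scale (E-linˡ w z) q⋆ z⋆ ∙ cong (q⋆ *_) (ζ-E cw i⋆ z ∙ cong (d i⋆ *_) h) ∙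
                solve 2 (λ q d → q :* (d :* con 0ℚ) := con 0ℚ) refl q⋆ (d i⋆)) (Functional.scale (E-linˡ w z) μ δQ ∙ cong (μ *_) (E-δ cw z)) ∙ ℚP.+-identityˡ (μ * (- D w z))

            D⇒j : ∀ z → z ! i⋆ ≡ 0ℚ → D w z ≡ 0ℚ → g⁻ z ! j⋆ ≡ 0ℚ
            D⇒j z h q = *≡0 (d≢0 j⋆) (sym (E-ξ z h) ∙ E-ξ′ z h ∙ cong (λ t → μ * (- t)) q ∙ ℚP.*-zeroʳ μ)

            j⇒D : ∀ z → z ! i⋆ ≡ 0ℚ → g⁻ z ! j⋆ ≡ 0ℚ → D w z ≡ 0ℚ
            j⇒D z h q = solve 1 (λ x → x := :- (:- x)) refl (D w z) ∙ cong -_ (*≡0 μ≢0 (sym (E-ξ′ z h) ∙ E-ξ z h ∙ cong (d j⋆ *_) q ∙ ℚP.*-zeroʳ (d j⋆)))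

            θ-i : ∀ l → l ∈ u⋆ → θ l ! i⋆ ≡ 0ℚ
            θ-i l h = act-∉ g (e l) i∉g ∙ (e-off λ { refl → i∉ju (there h) })

            θ-D : ∀ l → l ∈ u⋆ → D w (θ l) ≡ 0ℚ
            θ-D l h = j⇒D (θ l) (θ-i l h) (cong (λ t → t ! j⋆) (act-rev g (e l)) ∙ (e-off λ { refl → head∉ (uq-↭ perm (proj₂ (proj₂ mids⋆))) h }))

            -- Modulo δ the reflections in ζ and ξ cancel, so c acts as a product of reflections in roots of the tube system.
            act-factor : ∀ x → ∃ λ c → actW w x ≡ actW g (actW u⋆ (g⁻ x)) +ᵥ (c ·ᵥ δQ)
            act-factor x = - (b * μ) , vec-ext λ t → begin
                lookup (actW w x) t ≡⟨ cong (λ s → s ! t) (cong (λ s → actW s x) w≡ ∙ act-mid p₀ i⋆ q₀ x ∙ Linear.sub (act-lin p₀) (actW q₀ x) (a′ ·ᵥ e i⋆) ∙ cong₂ _-ᵥ_ (sym (act-++ p₀ q₀ x) ∙ z≡) (Linear.scale (act-lin p₀) a′ (e i⋆))) ⟩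
                ((G -ᵥ (b ·ᵥ ξ)) -ᵥ (a′ ·ᵥ z⋆)) ! t ≡⟨ lk-- (G -ᵥ (b ·ᵥ ξ)) (a′ ·ᵥ z⋆) t ∙ cong₂ _-_ (lk-- G (b ·ᵥ ξ) t ∙ cong (λ s → G ! t - s) (lk-· b ξ t)) (lk-· a′ z⋆ t) ⟩
                G ! t - b * ξ ! t - a′ * z⋆ ! t
                  ≡⟨ cong₂ (λ r s → G ! t - b * r - s * z⋆ ! t) (cong (λ s → s ! t) ξ-eq ∙ lk-+ (q⋆ ·ᵥ z⋆) (μ ·ᵥ δQ) t ∙ cong₂ _+_ (lk-· q⋆ z⋆ t) (lk-· μ δQ t)) a≡ ⟩
                G ! t - b * (q⋆ * z⋆ ! t + μ * δQ ! t) - (- (q⋆ * b)) * z⋆ ! t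
                  ≡⟨ solve 6 (λ G b q z μ d → G :- b :* (q :* z :+ μ :* d) :- (:- (q :* b)) :* z := G :+ (:- (b :* μ)) :* d) refl (G ! t) b q⋆ (z⋆ ! t) μ (δQ ! t) ⟩
                G ! t + (- (b * μ)) * δQ ! t ≡⟨ sym (lk-+ G ((- (b * μ)) ·ᵥ δQ) t ∙ cong (lookup G t +_) (lk-· (- (b * μ)) δQ t)) ⟩
                (G +ᵥ ((- (b * μ)) ·ᵥ δQ)) ! t ∎
              where
              open ≡-Reasoning
              y G : V n
              y = actW u⋆ (g⁻ x)
              G = actW g y
              a′ b κ′ : ℚ
              a′ = Kc i⋆ (actW q₀ x)
              b = Kc j⋆ y
              κ′ = K z⋆ G
              z≡ : actW u₀ x ≡ G -ᵥ (b ·ᵥ ξ)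
              z≡ = act-eq x ∙ Linear.sub (act-lin g) y (b ·ᵥ e j⋆) ∙ cong (G -ᵥ_) (Linear.scale (act-lin g) b (e j⋆) ∙ cong (b ·ᵥ_) g-e)
              Kzξ : ∀ v → K v ξ ≡ q⋆ * K v z⋆
              Kzξ v = cong (K v) ξ-eq ∙ Functional.add (K-linʳ v) (q⋆ ·ᵥ z⋆) (μ ·ᵥ δQ) ∙ cong₂ _+_ (Functional.scale (K-linʳ v) q⋆ z⋆) (Functional.scale (K-linʳ v) μ δQ ∙ cong (μ *_) (K-δ v) ∙ ℚP.*-zeroʳ μ) ∙ ℚP.+-identityʳ (q⋆ * K v z⋆)
              Kzz : K z⋆ z⋆ ≡ d i⋆ + d i⋆
              Kzz = norm (ζ-rt cw i⋆)
              dj : d j⋆ ≡ q⋆ * q⋆ * d i⋆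
              dj = half-inj (sym (cong (λ t → K t t) (sym g-e) ∙ K-act g (e j⋆) (e j⋆) ∙ K-e j⋆) ∙ Kzξ ξ ∙ cong (q⋆ *_) (K-sym ξ z⋆ ∙ Kzξ z⋆ ∙ cong (q⋆ *_) Kzz) ∙ solve 2 (λ q d → q :* (q :* (d :+ d)) := q :* q :* d :+ q :* q :* d) refl q⋆ (d i⋆))
              db : q⋆ * d i⋆ * b ≡ κ′
              db = *-cancelˡ q≢0 (solve 3 (λ q d b → q :* (q :* d :* b) := q :* q :* d :* b) refl q⋆ (d i⋆) b ∙ cong (_* b) (sym dj) ∙ sym (K-eˡ j⋆ y) ∙ sym (K-act g (e j⋆) y) ∙ cong (λ t → K t G) g-e ∙ K-sym ξ G ∙ Kzξ G ∙ cong (q⋆ *_) (K-sym G z⋆))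
              da′ : d i⋆ * a′ ≡ κ′ - b * (q⋆ * (d i⋆ + d i⋆))
              da′ = sym (K-eˡ i⋆ (actW q₀ x)) ∙ sym (K-act p₀ (e i⋆) (actW q₀ x)) ∙ cong (K z⋆) (sym (act-++ p₀ q₀ x) ∙ z≡) ∙ Functional.sub (K-linʳ z⋆) G (b ·ᵥ ξ) ∙
                cong (λ t → κ′ - t) (Functional.scale (K-linʳ z⋆) b ξ ∙ cong (b *_) (Kzξ z⋆ ∙ cong (q⋆ *_) Kzz))
              -- This is the cancellation: the reflection in ξ subtracts bξ, congruent to b q ζ, and
              -- the reflection in ζ that follows adds the same vector back.
              a≡ : a′ ≡ - (q⋆ * b)
              a≡ = *-cancelˡ (d≢0 i⋆) (da′ ∙ cong (_- b * (q⋆ * (d i⋆ + d i⋆))) (sym db) ∙ solve 3 (λ q d b → q :* d :* b :- b :* (q :* (d :+ d)) := d :* (:- (q :* b))) refl q⋆ (d i⋆) b)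

          -- The span, modulo δ, of the component of P_j.
          record InC (j : Fin k) (v : V n) : Set where
            constructor inC
            field
              co   : Fin k → ℚ
              conn : ∀ l → co l ≢ 0ℚ → Conn P j l
              null : Null (v -ᵥ sumP co)

          abstract
            InC-cong : ∀ {j v v′} → Null (v′ -ᵥ v) → InC j v → InC j v′
            InC-cong {v = v} {v′} h (inC co cn nl) = inC co cn λ t → cong (Kc t) parts ∙ Functional.add (Kc-lin t) (v′ -ᵥ v) (v -ᵥ sumP co) ∙ cong₂ _+_ (h t) (nl t)
              where
              parts : v′ -ᵥ sumP co ≡ (v′ -ᵥ v) +ᵥ (v -ᵥ sumP co)
              parts = vec-ext λ s → lk-- v′ (sumP co) s ∙ solve 3 (λ a b c → a :- c := a :- b :+ (b :- c)) refl (v′ ! s) (v ! s) (sumP co ! s) ∙ sym (lk-+ (v′ -ᵥ v) (v -ᵥ sumP co) s ∙ cong₂ _+_ (lk-- v′ v s) (lk-- v (sumP co) s))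

            InC-P : ∀ j → InC j (P′ j)
            InC-P j = inC (δδ j) (λ l h → go l h (j Fin.≟ l)) (λ t → cong (Kc t) (cong (P′ j -ᵥ_) (sumP-δ j) ∙ -ᵥ-self (P′ j)) ∙ Functional.zer (Kc-lin t))
              where
              go : ∀ l → δδ j l ≢ 0ℚ → Dec (j ≡ l) → Conn P j l
              go l h (yes refl) = ε
              go l h (no q) = ⊥-elim (h (δδ-≢ q))

            sum-nz : ∀ (f h : Fin k → ℚ) → sumQ (λ l → f l * h l) ≢ 0ℚ → ∃ λ l → f l ≢ 0ℚ × h l ≢ 0ℚ
            sum-nz f h ne = let (l , q) = sumQ≢0 {f = λ l → f l * h l} ne in l , (λ e → q (cong (_* h l) e ∙ ℚP.*-zeroˡ (h l))) , (λ e → q (cong (f l *_) e ∙ ℚP.*-zeroʳ (f l)))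

            -- If t is not orthogonal to v, some element in the expansion of t is joined to one in
            -- the expansion of v, so t belongs to the same component; otherwise nothing is
            -- subtracted.
            InC-reflect : ∀ {j v} t → RealRoot t → K γ t ≡ 0ℚ → ∀ c → (K t v ≡ 0ℚ → c ≡ 0ℚ) → InC j v → InC j (v -ᵥ (c ·ᵥ t))
            InC-reflect {j} {v} t rt′ γt c h (inC co cn nl) = go (K t v ℚP.≟ 0ℚ)
              where
              spec : Σ (Vec ℚ k) λ co → (sumV (λ j → co ! j ·ᵥ P ! j) ≡ t) × (Σ (Fin k) λ j₀ → ∀ j → co ! j ≢ 0ℚ → Conn P j₀ j) ×
                (∀ j → (j Sub.∈ supp t → co ! j ≢ 0ℚ) × (co ! j ≢ 0ℚ → j Sub.∈ supp t))
              spec = supp-spec t rt′ γt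
              co′ : Fin k → ℚ
              co′ = lookup (proj₁ spec)
              t≡ : sumP co′ ≡ t
              t≡ = proj₁ (proj₂ spec)
              j₀ : Fin k
              j₀ = proj₁ (proj₁ (proj₂ (proj₂ spec)))
              cn′ : ∀ l → co′ l ≢ 0ℚ → Conn P j₀ l
              cn′ = proj₂ (proj₁ (proj₂ (proj₂ spec)))
              go : Dec (K t v ≡ 0ℚ) → InC j (v -ᵥ (c ·ᵥ t))
              go (yes q) = subst (InC j) same (inC co cn nl)
                where
                same : v ≡ v -ᵥ (c ·ᵥ t)
                same = vec-ext λ r → sym (lk-- v (c ·ᵥ t) r ∙ cong (λ x → v ! r - x) (lk-· c t r ∙ cong (_* lookup t r) (h q) ∙ ℚP.*-zeroˡ (t ! r)) ∙ solve 1 (λ x → x :- con 0ℚ := x) refl (v ! r))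
              go (no q) = inC (λ l → co l + (- c) * co′ l) cn″ nl″
                where
                Ktv : K t v ≡ sumQ (λ l → co l * K t (P′ l))
                Ktv = cong (K t) (sub-add v (sumP co)) ∙ Functional.add (K-linʳ t) (sumP co) (v -ᵥ sumP co) ∙ cong (K t (sumP co) +_) (null-K {v -ᵥ sumP co} nl t) ∙ ℚP.+-identityʳ (K t (sumP co)) ∙ sumP-F (K-linʳ t) co
                l₁ : ∃ λ l → co l ≢ 0ℚ × K t (P′ l) ≢ 0ℚ
                l₁ = sum-nz co (λ l → K t (P′ l)) (λ x → q (Ktv ∙ x))
                l₂ : ∃ λ l → co′ l ≢ 0ℚ × K (P′ l) (P′ (proj₁ l₁)) ≢ 0ℚ
                l₂ = sum-nz co′ (λ l → K (P′ l) (P′ (proj₁ l₁))) (λ x → proj₂ (proj₂ l₁) (cong (λ s → K s (P′ (proj₁ l₁))) (sym t≡) ∙ sumP-F (K-linˡ (P′ (proj₁ l₁))) co′ ∙ x))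
                link : Conn P j j₀
                link = conn-sym (cn′ (proj₁ l₂) (proj₁ (proj₂ l₂)) ◅◅ (proj₂ (proj₂ l₂) ◅ conn-sym (cn (proj₁ l₁) (proj₁ (proj₂ l₁)))))
                cn″ : ∀ l → co l + (- c) * co′ l ≢ 0ℚ → Conn P j l
                cn″ l ne = pick (co l ℚP.≟ 0ℚ) (co′ l ℚP.≟ 0ℚ)
                  where
                  pick : Dec (co l ≡ 0ℚ) → Dec (co′ l ≡ 0ℚ) → Conn P j l
                  pick (no x) _ = cn l x
                  pick (yes _) (no y) = link ◅◅ cn′ l y
                  pick (yes x) (yes y) = ⊥-elim (ne (cong₂ (λ s t → s + (- c) * t) x y ∙ solve 1 (λ c → con 0ℚ :+ (:- c) :* con 0ℚ := con 0ℚ) refl c))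
                nl″ : Null ((v -ᵥ (c ·ᵥ t)) -ᵥ sumP (λ l → co l + (- c) * co′ l))
                nl″ = subst Null (sym same) nl
                  where
                  same : (v -ᵥ (c ·ᵥ t)) -ᵥ sumP (λ l → co l + (- c) * co′ l) ≡ v -ᵥ sumP co
                  same = cong ((v -ᵥ (c ·ᵥ t)) -ᵥ_) (sumP-comb co (- c) co′ ∙ cong (λ s → sumP co +ᵥ ((- c) ·ᵥ s)) t≡) ∙ (vec-ext λ s → lk-- (v -ᵥ (c ·ᵥ t)) (sumP co +ᵥ ((- c) ·ᵥ t)) s ∙ cong₂ _-_ (lk-- v (c ·ᵥ t) s ∙ cong (λ x → v ! s - x) (lk-· c t s)) (lk-+ (sumP co) ((- c) ·ᵥ t) s ∙ cong (lookup (sumP co) s +_) (lk-· (- c) t s)) ∙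
                    solve 4 (λ v c t p → v :- c :* t :- (p :+ (:- c) :* t) := v :- p) refl (v ! s) c (t ! s) (sumP co ! s) ∙ sym (lk-- v (sumP co) s))

            InC-word : ∀ {j} u x → (∀ l → l ∈ u → l ∈ u⋆) → InC j (actW g x) → InC j (actW g (actW u x))
            InC-word [] x h c = c
            InC-word {j} (l ∷ u) x h c = subst (InC j) (sym (Linear.sub (act-lin g) X (Kc l X ·ᵥ e l) ∙ cong (actW g X -ᵥ_) (Linear.scale (act-lin g) (Kc l X) (e l))))
              (InC-reflect (θ l) (g , l , refl) (γ-D (θ l) ∙ θ-D l (h l (here refl))) (Kc l X) (λ q → *≡0 (d≢0 l) (sym (K-eˡ l X) ∙ sym (K-act g (e l) X) ∙ q)) (InC-word u x (λ t r → h t (there r)) c))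
              where
              X : V n
              X = actW u x

            Kself>0 : ∀ j → 0ℚ < K (P′ j) (P′ j)
            Kself>0 j = subst (0ℚ <_) (sym (norm (root (P-ups j)))) (0<+ (N>0 (root (P-ups j))) (ℚP.<⇒≤ (N>0 (root (P-ups j)))))

            -- The row of j in the Gram matrix sums to 0 and has a positive diagonal entry.
            neighbour : ∀ j → ∃ λ l → j ≢ l × Edge P j l
            neighbour j = let (l , h) = sumQ>0 {f = f} (subst (0ℚ <_) (sym fsum) (Kself>0 j)) in l , pick l h (j Fin.≟ l)
              where
              f : Fin k → ℚ
              f l = δδ j l * K (P′ j) (P′ j) - K (P′ j) (P′ l)
              fsum : sumQ f ≡ K (P′ j) (P′ j)
              fsum = sumQ-cong (λ l → solve 2 (λ a b → a :- b := a :+ (:- con 1ℚ) :* b) refl (δδ j l * K (P′ j) (P′ j)) (K (P′ j) (P′ l))) ∙ sumQ-+ (λ l → δδ j l * K (P′ j) (P′ j)) (λ l → (- 1ℚ) * K (P′ j) (P′ l)) ∙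
                cong₂ _+_ (sumQ-δ j (λ _ → K (P′ j) (P′ j))) (sumQ-* (- 1ℚ) (λ l → K (P′ j) (P′ l)) ∙ cong ((- 1ℚ) *_) (rowsum j) ∙ ℚP.*-zeroʳ (- 1ℚ)) ∙ ℚP.+-identityʳ (K (P′ j) (P′ j))
              pick : ∀ l → 0ℚ < f l → Dec (j ≡ l) → j ≢ l × Edge P j l
              pick l h (yes refl) = ⊥-elim (>⇒≢ h (cong (λ t → t * K (P′ j) (P′ j) - K (P′ j) (P′ j)) (δδ-refl j) ∙ solve 1 (λ x → con 1ℚ :* x :- x := con 0ℚ) refl (K (P′ j) (P′ j))))
              pick l h (no q) = q , λ e → >⇒≢ h (cong₂ (λ s t → s * K (P′ j) (P′ j) - t) (δδ-≢ q) e ∙ solve 1 (λ x → con 0ℚ :* x :- con 0ℚ := con 0ℚ) refl (K (P′ j) (P′ j)))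

            -- By `act-factor` and `InC-word`, c P_j is modulo δ a combination of the component of
            -- P_j. Comparing it with the element at π⁻ j gives a null relation, which is constant
            -- along edges; so the combination involves π⁻ j itself or a neighbour of it.
            conn-π⁻ : ∀ j → Conn P j (π⁻ j)
            conn-π⁻ j = finish (InC.co C) (InC.conn C) (relation-edge r nl-r)
              where
              fac : ∃ λ c → actW w (P′ j) ≡ actW g (actW u⋆ (g⁻ (P′ j))) +ᵥ (c ·ᵥ δQ)
              fac = act-factor (P′ j)
              G : V n
              G = actW g (actW u⋆ (g⁻ (P′ j)))
              C : InC j (P′ (π⁻ j))
              C = InC-cong {v = G} (subst Null (sym diff) (null-scale (proj₁ fac) {δQ} δ-null))
                (InC-word u⋆ (g⁻ (P′ j)) (λ _ h → h) (subst (InC j) (sym (rev-act g (P′ j))) (InC-P j)))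
                where
                diff : P′ (π⁻ j) -ᵥ G ≡ proj₁ fac ·ᵥ δQ
                diff = cong (_-ᵥ G) (sym (cP j) ∙ proj₂ fac) ∙ (vec-ext λ s → lk-- (G +ᵥ (proj₁ fac ·ᵥ δQ)) G s ∙ cong (_- lookup G s) (lk-+ G (proj₁ fac ·ᵥ δQ) s) ∙ solve 2 (λ a b → a :+ b :- a := b) refl (G ! s) ((proj₁ fac ·ᵥ δQ) ! s))
              r : Fin k → ℚ
              r l = δδ (π⁻ j) l + (- 1ℚ) * InC.co C l
              nl-r : Null (sumP r)
              nl-r = subst Null (sym (sumP-comb (δδ (π⁻ j)) (- 1ℚ) (InC.co C) ∙ cong (_+ᵥ ((- 1ℚ) ·ᵥ sumP (InC.co C))) (sumP-δ (π⁻ j)) ∙ sym (sub-as (P′ (π⁻ j)) (sumP (InC.co C))))) (InC.null C)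
              finish : (co : Fin k → ℚ) → (∀ l → co l ≢ 0ℚ → Conn P j l) → (∀ {s t} → Edge P s t → δδ (π⁻ j) s + (- 1ℚ) * co s ≡ δδ (π⁻ j) t + (- 1ℚ) * co t) → Conn P j (π⁻ j)
              finish co cn rel = go (neighbour (π⁻ j)) (co (π⁻ j) ℚP.≟ 0ℚ)
                where
                go : (∃ λ l → π⁻ j ≢ l × Edge P (π⁻ j) l) → Dec (co (π⁻ j) ≡ 0ℚ) → Conn P j (π⁻ j)
                go _ (no q) = cn (π⁻ j) q
                go (l , ne , ed) (yes q) = cn l (λ q′ → >⇒≢ 0<1 (cong₂ (λ s t → s + (- 1ℚ) * t) (sym (δδ-refl (π⁻ j))) (sym q) ∙ rel ed ∙ cong₂ (λ s t → s + (- 1ℚ) * t) (δδ-≢ ne) q′)) ◅◅ (edge-sym {π⁻ j} {l} ed ◅ ε)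

            conn-π : ∀ j → Conn P j (π j)
            conn-π j = conn-sym (subst (Conn P (π j)) (π⁻π j) (conn-π⁻ (π j)))

            private
              NX : V n → Set
              NX z = Σ (Fin k → ℚ) λ x → (∀ l → P′ l ! i⋆ ≢ 0ℚ → x l ≡ 0ℚ) × sumP x ≡ z

            NX-add : ∀ {u v} c → NX u → NX v → NX (u +ᵥ (c ·ᵥ v))
            NX-add c (x , hx , refl) (y , hy , refl) = (λ l → x l + c * y l) , (λ l q → cong₂ (λ s t → s + c * t) (hx l q) (hy l q) ∙ solve 1 (λ c → con 0ℚ :+ c :* con 0ℚ := con 0ℚ) refl c) , sumP-comb x c y

            NX-0 : NX 0ᵥ
            NX-0 = (λ _ → 0ℚ) , (λ _ _ → refl) , sumP-0

            NX-cone : ∀ {v} → Ups w v → v ! i⋆ ≡ 0ℚ → NX v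
            NX-cone {v} h q = let (x , x≥0 , eq) = cone h in x , (λ l ne → *≡0 ne (ℚP.*-comm (P′ l ! i⋆) (x l) ∙
              sumQ≡0 {f = λ l → x l * P′ l ! i⋆} (λ l → 0≤* (x≥0 l) (P-pos l i⋆)) (sym (sumP-F (lookup-lin i⋆) x) ∙ cong (λ t → t ! i⋆) eq ∙ q) l)) , eq

            NX-θ : ∀ l → l ∈ u⋆ → NX (θ l)
            NX-θ l h = go (posneg r)
              where
              r : IsRt (d l) (θ l)
              r = rt-act g (rt-e l)
              go : Pos (θ l) ⊎ Pos ((- 1ℚ) ·ᵥ θ l) → NX (θ l)
              go (inj₁ p) = NX-cone (ups r p (θ-D l h)) (θ-i l h)
              go (inj₂ p) = subst NX (0-+ᵥ ((- 1ℚ) ·ᵥ ((- 1ℚ) ·ᵥ θ l)) ∙ neg-neg (θ l)) (NX-add (- 1ℚ) NX-0 (NX-cone (ups (rt-neg r) p (Functional.neg (E-linˡ w δQ) (θ l) ∙ cong -_ (θ-D l h))) (lk-· (- 1ℚ) (θ l) i⋆ ∙ cong ((- 1ℚ) *_) (θ-i l h) ∙ ℚP.*-zeroʳ (- 1ℚ))))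

            -- On the hyperplane without coordinate i⋆, U_c is spanned by the roots θ_l with l in
            -- `u⋆`. Each of them is up to sign in the cone of Π_c, and a nonnegative combination
            -- without coordinate i⋆ uses only elements without it.
            NX-U : ∀ v → v ! i⋆ ≡ 0ℚ → D w v ≡ 0ℚ → NX v
            NX-U v vi Dv = subst NX (sym (Linear.sum (act-lin g) (λ l → g⁻ v ! l ·ᵥ e l)) ∙ cong (actW g) (e-expand (g⁻ v)) ∙ rev-act g v) (sums (λ l → actW g (g⁻ v ! l ·ᵥ e l)) term)
              where
              sums : ∀ {m} (f : Fin m → V n) → (∀ l → NX (f l)) → NX (sumV f)
              sums {zero} f h = NX-0
              sums {suc m} f h = subst NX (cong (f Fin.zero +ᵥ_) (1·ᵥ (sumV (f ∘ Fin.suc)))) (NX-add 1ℚ (h Fin.zero) (sums (f ∘ Fin.suc) (h ∘ Fin.suc)))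
              term : ∀ l → NX (actW g (g⁻ v ! l ·ᵥ e l))
              term l = subst NX (sym (Linear.scale (act-lin g) (g⁻ v ! l) (e l))) (go (l ∈ₗ? u⋆))
                where
                zero-case : g⁻ v ! l ≡ 0ℚ → NX (g⁻ v ! l ·ᵥ θ l)
                zero-case q = subst NX (sym (cong (_·ᵥ θ l) q ∙ 0·ᵥ (θ l))) NX-0
                go : Dec (l ∈ u⋆) → NX (g⁻ v ! l ·ᵥ θ l)
                go (yes h) = subst NX (0-+ᵥ (g⁻ v ! l ·ᵥ θ l)) (NX-add (g⁻ v ! l) NX-0 (NX-θ l h))
                go (no h) = zero-case (go′ (l Fin.≟ j⋆))
                  where
                  go′ : Dec (l ≡ j⋆) → g⁻ v ! l ≡ 0ℚ
                  go′ (yes refl) = D⇒j v vi Dv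
                  go′ (no q) = cong (lookup (g⁻ v)) (sym (∉u l (λ x → not (PermP.∈-resp-↭ perm x)))) ∙ g⁻-i v ∙ vi
                    where
                    not : l ∈ j⋆ ∷ u⋆ → ⊥
                    not (here r) = q r
                    not (there r) = h r

            -- A combination of P_s and P_t with coefficients of opposite signs kills the coordinate
            -- i⋆, so by `NX-U` it is also a combination of elements without this coordinate. The
            -- resulting relation has opposite signs at s and t, whereas relations are constant on
            -- components.
            X-single : ∀ {s t} → Conn P s t → P′ s ! i⋆ ≢ 0ℚ → P′ t ! i⋆ ≢ 0ℚ → s ≡ t
            X-single {s′} {t′} cn hs ht = decidable-stable (s′ Fin.≟ t′) λ ne → bad ne
              where
              α′ β′ : ℚ
              α′ = P′ t′ ! i⋆
              β′ = P′ s′ ! i⋆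
              pos : ∀ {l} → P′ l ! i⋆ ≢ 0ℚ → 0ℚ < P′ l ! i⋆
              pos {l} h = go (≤⇒<⊎≡ (P-pos l i⋆))
                where
                go : 0ℚ < P′ l ! i⋆ ⊎ 0ℚ ≡ P′ l ! i⋆ → 0ℚ < P′ l ! i⋆
                go (inj₁ p) = p
                go (inj₂ p) = ⊥-elim (h (sym p))
              v : V n
              v = (α′ ·ᵥ P′ s′) -ᵥ (β′ ·ᵥ P′ t′)
              F : ∀ {f : V n → ℚ} → Functional f → f v ≡ α′ * f (P′ s′) - β′ * f (P′ t′)
              F Ff = Functional.sub Ff (α′ ·ᵥ P′ s′) (β′ ·ᵥ P′ t′) ∙ cong₂ _-_ (Functional.scale Ff α′ (P′ s′)) (Functional.scale Ff β′ (P′ t′))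
              nx : NX v
              nx = NX-U v (F (lookup-lin i⋆) ∙ solve 2 (λ a b → a :* b :- b :* a := con 0ℚ) refl α′ β′) (F (E-linˡ w δQ) ∙ cong₂ (λ x y → α′ * x - β′ * y) (D≡0 (P-ups s′)) (D≡0 (P-ups t′)) ∙ solve 2 (λ a b → a :* con 0ℚ :- b :* con 0ℚ := con 0ℚ) refl α′ β′)
              x : Fin k → ℚ
              x = proj₁ nx
              y₁ y : Fin k → ℚ
              y₁ l = x l + (- α′) * δδ s′ l
              y l = y₁ l + β′ * δδ t′ l
              y-null : Null (sumP y)
              y-null = λ j → cong (Kc j) (sumP-comb y₁ β′ (δδ t′) ∙ cong₂ (λ a b → a +ᵥ (β′ ·ᵥ b)) (sumP-comb x (- α′) (δδ s′) ∙ cong₂ (λ a b → a +ᵥ ((- α′) ·ᵥ b)) (proj₂ (proj₂ nx)) (sumP-δ s′)) (sumP-δ t′) ∙ zero′) ∙ Functional.zer (Kc-lin j)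
                where
                zero′ : (v +ᵥ ((- α′) ·ᵥ P′ s′)) +ᵥ (β′ ·ᵥ P′ t′) ≡ 0ᵥ
                zero′ = vec-ext λ r → lk-+ (v +ᵥ ((- α′) ·ᵥ P′ s′)) (β′ ·ᵥ P′ t′) r ∙ cong₂ _+_ (lk-+ v ((- α′) ·ᵥ P′ s′) r ∙ cong₂ _+_ (F (lookup-lin r)) (lk-· (- α′) (P′ s′) r)) (lk-· β′ (P′ t′) r) ∙
                  solve 4 (λ a s b t → a :* s :- b :* t :+ (:- a) :* s :+ b :* t := con 0ℚ) refl α′ (P′ s′ ! r) β′ (P′ t′ ! r) ∙ sym (lk-0 r)
              bad : s′ ≢ t′ → ⊥
              bad ne = >⇒≢ (0<+ (pos ht) (ℚP.<⇒≤ (pos hs))) (solve 2 (λ a b → a :+ b := b :- (:- a)) refl α′ β′ ∙ cong₂ _-_ (sym yt) (sym ys) ∙ cong (λ c → y t′ - c) (relation y y-null cn) ∙ ℚP.+-inverseʳ (y t′))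
                where
                ys : y s′ ≡ - α′
                ys = cong₂ (λ a b → a + β′ * b) (cong₂ (λ a b → a + (- α′) * b) (proj₁ (proj₂ nx) s′ hs) (δδ-refl s′) ∙ refl) (δδ-≢ (ne ∘ sym)) ∙ solve 2 (λ a b → con 0ℚ :+ (:- a) :* con 1ℚ :+ b :* con 0ℚ := :- a) refl α′ β′
                yt : y t′ ≡ β′
                yt = cong₂ (λ a b → a + β′ * b) (cong₂ (λ a b → a + (- α′) * b) (proj₁ (proj₂ nx) t′ ht) (δδ-≢ ne)) (δδ-refl t′) ∙ solve 2 (λ a b → con 0ℚ :+ (:- a) :* con 0ℚ :+ b :* con 1ℚ := b) refl α′ β′

          π^ : ℕ → Fin k → Fin k
          π^ zero    j = j
          π^ (suc s) j = π (π^ s j)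

          abstract
            τ^P : ∀ s j → τ^ w s (P′ j) ≡ P′ (π^ s j)
            τ^P zero    j = refl
            τ^P (suc s) j = cong (τ w) (τ^P s j) ∙ τP (π^ s j)

            conn-π^ : ∀ s j → Conn P j (π^ s j)
            conn-π^ zero    j = ε
            conn-π^ (suc s) j = conn-π^ s j ◅◅ conn-π (π^ s j)

            π-inj : ∀ {s t} → π s ≡ π t → s ≡ t
            π-inj {s} {t} h = sym (π⁻π s) ∙ cong π⁻ h ∙ π⁻π t

            π^-inj : ∀ r {s t} → π^ r s ≡ π^ r t → s ≡ t
            π^-inj zero    h = h
            π^-inj (suc r) h = π^-inj r (π-inj h)

            π^-per : ∀ j → ∃ λ p → suc p ℕ.≤ L × π^ (suc p) j ≡ j
            π^-per j = let (p , le , eq , _) = per0 (P-ups j) in p , le , P-inj (π^ (suc p) j) j (sym (τ^P (suc p) j) ∙ eq)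

            π^-mod : ∀ j p → π^ (suc p) j ≡ j → ∀ s → ∃ λ r → r ℕ.≤ p × π^ s j ≡ π^ r j
            π^-mod j p per zero = zero , ℕ.z≤n , refl
            π^-mod j p per (suc s) = go (π^-mod j p per s)
              where
              go : (∃ λ r → r ℕ.≤ p × π^ s j ≡ π^ r j) → ∃ λ r → r ℕ.≤ p × π^ (suc s) j ≡ π^ r j
              go (r , le , eq) = next (ℕP.m≤n⇒m<n∨m≡n le)
                where
                next : r ℕ.< p ⊎ r ≡ p → ∃ λ r → r ℕ.≤ p × π^ (suc s) j ≡ π^ r j
                next (inj₁ lt) = suc r , lt , cong π eq
                next (inj₂ q) = zero , ℕ.z≤n , cong π (eq ∙ cong (λ r → π^ r j) q) ∙ per

            π^-+ : ∀ r s j → π^ (r ℕ.+ s) j ≡ π^ r (π^ s j)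
            π^-+ zero    s j = refl
            π^-+ (suc r) s j = cong π (π^-+ r s j)

            K-orb : ∀ p j z → (∀ s → 0ℚ ≤ - K (P′ (π^ s j)) z) → - K (P′ j) z ≤ - K (orb w (suc p) (P′ j)) z
            K-orb zero j z h = ℚP.≤-reflexive (cong (λ t → - K t z) (sym (0-+ᵥ (P′ j))))
            K-orb (suc p) j z h = ℚP.≤-trans (K-orb p j z h) (by≤ (- K (P′ (π^ (suc p) j)) z) (h (suc p)) (cong (λ t → - t - (- K (orb w (suc p) (P′ j)) z)) (Functional.add (K-linˡ z) (orb w (suc p) (P′ j)) (τ^ w (suc p) (P′ j)) ∙
              cong (λ t → K (orb w (suc p) (P′ j)) z + K t z) (τ^P (suc p) j)) ∙ solve 2 (λ a b → :- (a :+ b) :- (:- a) := :- b) refl (K (orb w (suc p) (P′ j)) z) (K (P′ (π^ (suc p) j)) z)))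

          Nn : Fin k → ℚ
          Nn i = norm½ (P-ups i)

          Orb : Fin k → Fin k → Set
          Orb i j = Σ (Fin L) λ s → π^ (Fin.toℕ s) i ≡ j

          abstract
            orb? : ∀ i j → Dec (Orb i j)
            orb? i j = FinP.any? (λ s → π^ (Fin.toℕ s) i Fin.≟ j)

            orb-any : ∀ s {i j} → π^ s i ≡ j → Orb i j
            orb-any s {i} {j} eq = Fin.fromℕ< lt , cong (λ t → π^ t i) (FinP.toℕ-fromℕ< lt) ∙ sym (proj₂ (proj₂ md)) ∙ eq
              where
              per : ∃ λ p → suc p ℕ.≤ L × π^ (suc p) i ≡ i
              per = π^-per i
              md : ∃ λ r → r ℕ.≤ proj₁ per × π^ s i ≡ π^ r i
              md = π^-mod i (proj₁ per) (proj₂ (proj₂ per)) s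
              lt : proj₁ md ℕ.< L
              lt = ℕP.≤-trans (ℕ.s≤s (proj₁ (proj₂ md))) (proj₁ (proj₂ per))

            orb-conn : ∀ {i j} → Orb i j → Conn P i j
            orb-conn {i} (s , refl) = conn-π^ (Fin.toℕ s) i

            -- The orbit sum of P_i lies in the radical. For j outside the orbit, all pairings of
            -- P_j with the orbit are at most 0 and their sum is 0, so there is no edge.
            edge-orb : ∀ {i j} → Edge P i j → Orb i j
            edge-orb {i} {j} h = go (orb? i j)
              where
              go : Dec (Orb i j) → Orb i j
              go (yes o) = o
              go (no o) = ⊥-elim (h (ℚP.≤-antisym (nonpos 0) (ℚP.≤-trans (ℚP.≤-reflexive (sym (cong -_ zero′))) (ℚP.≤-trans (ℚP.neg-antimono-≤ (K-orb p i (P′ j) (λ s → ≤0⇒ (nonpos s)))) (ℚP.≤-reflexive (solve 1 (λ x → :- (:- x) := x) refl (K (P′ i) (P′ j))))))))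
                where
                p : ℕ
                p = proj₁ (per0 (P-ups i))
                nonpos : ∀ s → K (P′ (π^ s i)) (P′ j) ≤ 0ℚ
                nonpos s = K-P≤0 (λ q → o (orb-any s q))
                zero′ : - K (orb w (suc p) (P′ i)) (P′ j) ≡ 0ℚ
                zero′ = cong -_ (K-sym (orb w (suc p) (P′ i)) (P′ j) ∙ null-K {orb w (suc p) (P′ i)} (proj₂ (proj₂ (proj₂ (per0 (P-ups i))))) (P′ j))

            conn-orb : ∀ {i j} → Conn P i j → Orb i j
            conn-orb {i} ε = orb-any 0 refl
            conn-orb {i} (_◅_ {j = l} h c) = let (s , eq) = edge-orb {i} {l} h ; (r , eq′) = conn-orb c in
              orb-any (Fin.toℕ r ℕ.+ Fin.toℕ s) (π^-+ (Fin.toℕ r) (Fin.toℕ s) i ∙ cong (π^ (Fin.toℕ r)) eq ∙ eq′)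

            -- Otherwise the orbit sum, which is a multiple of δ, has coordinate 0 at i⋆ and is 0,
            -- although it is a sum of nonzero nonnegative vectors.
            visits : ∀ j → Σ (Fin L) λ s → P′ (π^ (Fin.toℕ s) j) ! i⋆ ≢ 0ℚ
            visits j = go (FinP.any? (λ s → ¬? (P′ (π^ (Fin.toℕ s) j) ! i⋆ ℚP.≟ 0ℚ)))
              where
              pr : ∃ λ p → suc p ℕ.≤ L × τ^ w (suc p) (P′ j) ≡ P′ j × Null (orb w (suc p) (P′ j))
              pr = per0 (P-ups j)
              p : ℕ
              p = proj₁ pr
              go : Dec (Σ (Fin L) λ s → P′ (π^ (Fin.toℕ s) j) ! i⋆ ≢ 0ℚ) → Σ (Fin L) λ s → P′ (π^ (Fin.toℕ s) j) ! i⋆ ≢ 0ℚ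
              go (yes h) = h
              go (no h) = ⊥-elim (P-nz j (vec-ext λ r → ℚP.≤-antisym (ℚP.≤-trans (orb-≥ w p (P′ j) (λ s _ → posi (ups-τ^ cw s (P-ups j))) r) (ℚP.≤-reflexive (cong (λ t → t ! r) o≡0 ∙ lk-0 r))) (P-pos j r) ∙ sym (lk-0 r)))
                where
                zero-at : ∀ s → P′ (π^ s j) ! i⋆ ≡ 0ℚ
                zero-at s = decidable-stable (P′ (π^ s j) ! i⋆ ℚP.≟ 0ℚ) λ ne → let (r , eq) = orb-any s {j} refl in h (r , subst (λ t → P′ t ! i⋆ ≢ 0ℚ) (sym eq) ne)
                oi : ∀ q → orb w q (P′ j) ! i⋆ ≡ 0ℚ
                oi zero = lk-0 i⋆
                oi (suc q) = lk-+ (orb w q (P′ j)) (τ^ w q (P′ j)) i⋆ ∙ cong₂ _+_ (oi q) (cong (λ t → t ! i⋆) (τ^P q j) ∙ zero-at q)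
                od : ∃ λ c → orb w (suc p) (P′ j) ≡ c ·ᵥ δQ
                od = null-δ (orb w (suc p) (P′ j)) (proj₂ (proj₂ (proj₂ pr)))
                o≡0 : orb w (suc p) (P′ j) ≡ 0ᵥ
                o≡0 = proj₂ od ∙ cong (_·ᵥ δQ) (*≡0 (>⇒≢ (δ>0 i⋆)) (ℚP.*-comm (δQ ! i⋆) (proj₁ od) ∙ sym (lk-· (proj₁ od) δQ i⋆) ∙ cong (λ t → t ! i⋆) (sym (proj₂ od)) ∙ oi (suc p))) ∙ 0·ᵥ δQ

            E-π^ : ∀ s i j → E w (P′ (π^ s i)) (P′ (π^ s j)) ≡ E w (P′ i) (P′ j)
            E-π^ s i j = cong₂ (E w) (sym (τ^P s i)) (sym (τ^P s j)) ∙ E-τ^ cw s (P′ i) (P′ j)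

            Nn>0 : ∀ i → 0ℚ < Nn i
            Nn>0 i = N>0 (root (P-ups i))

            Nn-π : ∀ i → Nn (π i) ≡ Nn i
            Nn-π i = rt-N (root (P-ups (π i))) (subst (IsRt (Nn i)) (τP i) (rt-act (reverse w) (root (P-ups i))))

            E-self : ∀ i → E w (P′ i) (P′ i) ≡ Nn i
            E-self i = half-inj (E-double cw (P′ i) ∙ norm (root (P-ups i)))

            E-step : ∀ i j → E w (P′ i) (P′ (π j)) ≡ - E w (P′ j) (P′ i)
            E-step i j = cong (E w (P′ i)) (sym (τP j)) ∙ serre cw (P′ i) (P′ j)

            E-next : ∀ i → E w (P′ i) (P′ (π i)) ≡ - Nn i
            E-next i = E-step i i ∙ cong -_ (E-self i)

            π≢ : ∀ i → π i ≢ i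
            π≢ i h = <⇒≱ (Nn>0 i) (ℚP.≤-trans (ℚP.≤-reflexive (sym (E-self i) ∙ cong (λ t → E w (P′ i) (P′ t)) (sym h) ∙ E-next i)) (0≤- (subst (0ℚ ≤_) (solve 1 (λ x → x := :- (:- x)) refl (Nn i)) (ℚP.<⇒≤ (Nn>0 i)))))

            -- Apply the positivity law to the reflection of ζ in the unique element b of the component involving α_{i⋆}.
            star-at : ∀ {b j} → P′ b ! i⋆ ≢ 0ℚ → Conn P b j → b ≢ j → E w (P′ b) (P′ j) ≤ 0ℚ
            star-at {b} {j} hb cn b≢j = 0≤- (nonneg-cancel c>0 (subst (0ℚ ≤_) val (law cw ρ-rt (subst (0ℚ <_) (sym ρ-D) (ζ-D cw i⋆)) (P-ups j))))
              where
              zero-i : ∀ {l} → Conn P b l → b ≢ l → P′ l ! i⋆ ≡ 0ℚ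
              zero-i {l} c ne = decidable-stable (P′ l ! i⋆ ℚP.≟ 0ℚ) λ h → ne (X-single c hb h)
              p : Pairing (Nn b) (d i⋆) (P′ b) z⋆
              p = pairing (root (P-ups b)) (ζ-rt cw i⋆)
              c : ℚ
              c = Pairing.k p
              Kbz : K (P′ b) z⋆ ≡ d i⋆ * P′ b ! i⋆
              Kbz = sym (E+ cw (P′ b) z⋆) ∙ cong₂ _+_ (solve 1 (λ x → x := :- (:- x)) refl (E w (P′ b) z⋆) ∙ cong -_ (sym (cong (E w z⋆) (sym (τP b)) ∙ serre cw z⋆ (P′ b)) ∙ ζ-E cw i⋆ (P′ (π b)) ∙ cong (d i⋆ *_) (zero-i (conn-π b) (π≢ b ∘ sym)) ∙ ℚP.*-zeroʳ (d i⋆))) (ζ-E cw i⋆ (P′ b)) ∙ ℚP.+-identityˡ (d i⋆ * P′ b ! i⋆)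
              b>0 : 0ℚ < P′ b ! i⋆
              b>0 = go (≤⇒<⊎≡ (P-pos b i⋆))
                where
                go : 0ℚ < P′ b ! i⋆ ⊎ 0ℚ ≡ P′ b ! i⋆ → 0ℚ < P′ b ! i⋆
                go (inj₁ q) = q
                go (inj₂ q) = ⊥-elim (hb (sym q))
              c>0 : 0ℚ < c
              c>0 = pos-cancel (Nn>0 b) (subst (0ℚ <_) (sym Kbz ∙ Pairing.eqN p) (0<* (d>0 i⋆) b>0))
              ρ-rt : IsRt (d i⋆) (z⋆ -ᵥ (c ·ᵥ P′ b))
              ρ-rt = proj₁ (reflections cw (root (P-ups b)) (ζ-rt cw i⋆) p)
              ρ-D : D w (z⋆ -ᵥ (c ·ᵥ P′ b)) ≡ D w z⋆
              ρ-D = D-comb cw z⋆ c (P′ b) ∙ cong (λ t → D w z⋆ - c * t) (D≡0 (P-ups b)) ∙ solve 2 (λ x c → x :- c :* con 0ℚ := x) refl (D w z⋆) c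
              val : E w (z⋆ -ᵥ (c ·ᵥ P′ b)) (P′ j) ≡ c * (- E w (P′ b) (P′ j))
              val = Functional.sub (E-linˡ w (P′ j)) z⋆ (c ·ᵥ P′ b) ∙ cong₂ _-_ (ζ-E cw i⋆ (P′ j) ∙ cong (d i⋆ *_) (zero-i cn b≢j) ∙ ℚP.*-zeroʳ (d i⋆)) (Functional.scale (E-linˡ w (P′ j)) c (P′ b)) ∙ solve 2 (λ c x → con 0ℚ :- c :* x := c :* (:- x)) refl c (E w (P′ b) (P′ j))

            -- A rotation brings i to the element of its component that involves i⋆.
            star : ∀ {i j} → Conn P i j → i ≢ j → E w (P′ i) (P′ j) ≤ 0ℚ
            star {i} {j} cn ne = let (s , h) = visits i in subst (_≤ 0ℚ) (E-π^ (Fin.toℕ s) i j)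
              (star-at h (conn-sym (conn-π^ (Fin.toℕ s) i) ◅◅ (cn ◅◅ conn-π^ (Fin.toℕ s) j)) (λ q → ne (π^-inj (Fin.toℕ s) q)))

            -- Inside a component `star` bounds the value from above and, after `E-step`, also from
            -- below. Between components K vanishes, so E(P_i, τ^s P_j) does not depend on s, and
            -- its sum over a period is a multiple of the defect of P_i, which is 0.
            E-other : ∀ {i j} → j ≢ i → j ≢ π i → E w (P′ i) (P′ j) ≡ 0ℚ
            E-other {i} {j} h h′ = go (orb? i j)
              where
              go : Dec (Orb i j) → E w (P′ i) (P′ j) ≡ 0ℚ
              go (yes o) = ℚP.≤-antisym (star (orb-conn o) (h ∘ sym)) (subst (0ℚ ≤_) (sym (E-step i (π⁻ j)) ∙ cong (λ t → E w (P′ i) (P′ t)) (ππ⁻ j))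
                  (≤0⇒ (star (conn-sym (orb-conn o ◅◅ conn-π⁻ j)) (λ q → h′ (sym (ππ⁻ j) ∙ cong π q)))))
              go (no o) = *≡0 {toℚ (ℤ.+ suc p)} (>⇒≢ (toℚ-pos {suc p} (ℕ.s≤s ℕ.z≤n))) (sym (sums (suc p)) ∙ cong (E w (P′ i)) (proj₂ od) ∙ Functional.scale (E-linʳ w (P′ i)) (proj₁ od) δQ ∙ cong (proj₁ od *_) (D≡0 (P-ups i)) ∙ ℚP.*-zeroʳ (proj₁ od))
                where
                p : ℕ
                p = proj₁ (per0 (P-ups j))
                od : ∃ λ c → orb w (suc p) (P′ j) ≡ c ·ᵥ δQ
                od = null-δ (orb w (suc p) (P′ j)) (proj₂ (proj₂ (proj₂ (per0 (P-ups j)))))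
                K0 : ∀ s → K (P′ i) (P′ (π^ s j)) ≡ 0ℚ
                K0 s = decidable-stable (K (P′ i) (P′ (π^ s j)) ℚP.≟ 0ℚ) λ ed → o (conn-orb (ed ◅ conn-sym (conn-π^ s j)))
                const : ∀ s → E w (P′ i) (P′ (π^ s j)) ≡ E w (P′ i) (P′ j)
                const zero = refl
                const (suc s) = E-step i (π^ s j) ∙ solve 2 (λ a b → :- b := a :- (a :+ b)) refl (E w (P′ i) (P′ (π^ s j))) (E w (P′ (π^ s j)) (P′ i)) ∙ cong (λ t → E w (P′ i) (P′ (π^ s j)) - t) (E+ cw (P′ i) (P′ (π^ s j)) ∙ K0 s) ∙
                  solve 1 (λ a → a :- con 0ℚ := a) refl (E w (P′ i) (P′ (π^ s j))) ∙ const s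
                sums : ∀ q → E w (P′ i) (orb w q (P′ j)) ≡ toℚ (ℤ.+ q) * E w (P′ i) (P′ j)
                sums zero = Functional.zer (E-linʳ w (P′ i)) ∙ sym (ℚP.*-zeroˡ (E w (P′ i) (P′ j)))
                sums (suc q) = Functional.add (E-linʳ w (P′ i)) (orb w q (P′ j)) (τ^ w q (P′ j)) ∙ cong₂ _+_ (sums q) (cong (E w (P′ i)) (τ^P q j) ∙ const q) ∙
                  solve 2 (λ p d → p :* d :+ d := (con 1ℚ :+ p) :* d) refl (toℚ (ℤ.+ q)) (E w (P′ i) (P′ j)) ∙ cong (_* E w (P′ i) (P′ j)) (sym (toℚ-+ (ℤ.+ 1) (ℤ.+ q)))

        open TubeForm public

        -- Coefficients of tube roots.

        module Arcs where
          abstract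
            π⁻≢ : ∀ j → j ≢ π⁻ j
            π⁻≢ j h = π≢ (π⁻ j) (ππ⁻ j ∙ h)

            Nn-π⁻ : ∀ j → Nn (π⁻ j) ≡ Nn j
            Nn-π⁻ j = sym (Nn-π (π⁻ j)) ∙ cong Nn (ππ⁻ j)

            E-P : ∀ l j → E w (P′ l) (P′ j) ≡ Nn j * (δδ j l - δδ (π⁻ j) l)
            E-P l j = go (j Fin.≟ l) (π⁻ j Fin.≟ l)
              where
              go : Dec (j ≡ l) → Dec (π⁻ j ≡ l) → E w (P′ l) (P′ j) ≡ Nn j * (δδ j l - δδ (π⁻ j) l)
              go (yes refl) _ = E-self j ∙ sym (cong₂ (λ s t → Nn j * (s - t)) (δδ-refl j) (δδ-≢ (π⁻≢ j ∘ sym)) ∙ solve 1 (λ n → n :* (con 1ℚ :- con 0ℚ) := n) refl (Nn j))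
              go (no p) (yes refl) = cong (λ t → E w (P′ (π⁻ j)) (P′ t)) (sym (ππ⁻ j)) ∙ E-next (π⁻ j) ∙ cong -_ (Nn-π⁻ j) ∙ sym (cong₂ (λ s t → Nn j * (s - t)) (δδ-≢ p) (δδ-refl (π⁻ j)) ∙ solve 1 (λ n → n :* (con 0ℚ :- con 1ℚ) := :- n) refl (Nn j))
              go (no p) (no q) = E-other p (λ e → q (cong π⁻ e ∙ π⁻π l)) ∙ sym (cong₂ (λ s t → Nn j * (s - t)) (δδ-≢ p) (δδ-≢ q) ∙ solve 1 (λ n → n :* (con 0ℚ :- con 0ℚ) := con 0ℚ) refl (Nn j))

            E-co : ∀ x j → E w (sumP x) (P′ j) ≡ Nn j * (x j - x (π⁻ j))
            E-co x j = sumP-F (E-linˡ w (P′ j)) x ∙ sumQ-cong (λ l → cong (x l *_) (E-P l j) ∙ solve 4 (λ x n a b → x :* (n :* (a :- b)) := n :* (a :* x) :+ (:- n) :* (b :* x)) refl (x l) (Nn j) (δδ j l) (δδ (π⁻ j) l)) ∙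
              sumQ-+ (λ l → Nn j * (δδ j l * x l)) (λ l → (- Nn j) * (δδ (π⁻ j) l * x l)) ∙ cong₂ _+_ (sumQ-* (Nn j) (λ l → δδ j l * x l) ∙ cong (Nn j *_) (sumQ-δ j x)) (sumQ-* (- Nn j) (λ l → δδ (π⁻ j) l * x l) ∙ cong ((- Nn j) *_) (sumQ-δ (π⁻ j) x)) ∙
                solve 3 (λ n a b → n :* a :+ (:- n) :* b := n :* (a :- b)) refl (Nn j) (x j) (x (π⁻ j))

            -- Pairing the relation with P_j leaves only the difference of two consecutive
            -- coefficients.
            co-const : ∀ x → sumP x ≡ 0ᵥ → ∀ j s → x (π^ s j) ≡ x j
            co-const x h j zero = refl
            co-const x h j (suc s) = sym (cong x (sym (π⁻π (π^ s j))) ∙ sym (eq (π (π^ s j)))) ∙ co-const x h j s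
              where
              eq : ∀ j → x j ≡ x (π⁻ j)
              eq j = solve 2 (λ a b → a := a :- b :+ b) refl (x j) (x (π⁻ j)) ∙ cong (_+ x (π⁻ j)) (*≡0 (>⇒≢ (Nn>0 j)) (sym (E-co x j) ∙ cong (λ t → E w t (P′ j)) h ∙ Functional.zer (E-linˡ w (P′ j)))) ∙ ℚP.+-identityˡ (x (π⁻ j))

            diff0 : ∀ x y → sumP x ≡ sumP y → sumP (λ l → x l + (- 1ℚ) * y l) ≡ 0ᵥ
            diff0 x y h = trans (sumP-comb x (- 1ℚ) y) (cong (_+ᵥ ((- 1ℚ) ·ᵥ sumP y)) h ∙ sym (sub-as (sumP y) (sumP y)) ∙ -ᵥ-self (sumP y))

            -- All coefficients have the sign of c, so `zero-comb` applies to the relation or to its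
            -- negative.
            const-zero : ∀ x j c → sumP x ≡ 0ᵥ → (∀ l → Orb j l → x l ≡ c) → (∀ l → ¬ Orb j l → x l ≡ 0ℚ) → ∀ l → x l ≡ 0ℚ
            const-zero x j c h on off = go (ℚP.≤-total 0ℚ c)
              where
              nonneg : ∀ (y : Fin k → ℚ) c → 0ℚ ≤ c → (∀ l → Orb j l → y l ≡ c) → (∀ l → ¬ Orb j l → y l ≡ 0ℚ) → ∀ l → 0ℚ ≤ y l
              nonneg y c c≥0 on off l = pick (orb? j l)
                where
                pick : Dec (Orb j l) → 0ℚ ≤ y l
                pick (yes o) = subst (0ℚ ≤_) (sym (on l o)) c≥0
                pick (no o) = ℚP.≤-reflexive (sym (off l o))
              go : 0ℚ ≤ c ⊎ c ≤ 0ℚ → ∀ l → x l ≡ 0ℚ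
              go (inj₁ p) = zero-comb x (nonneg x c p on off) h
              go (inj₂ p) l = solve 1 (λ x → x := (:- con 1ℚ) :* (con 0ℚ :+ (:- con 1ℚ) :* x)) refl (x l) ∙ cong ((- 1ℚ) *_) (zero-comb y (nonneg y (- c) (≤0⇒ p) (λ l o → cong (λ t → 0ℚ + (- 1ℚ) * t) (on l o) ∙ solve 1 (λ c → con 0ℚ :+ (:- con 1ℚ) :* c := :- c) refl c) (λ l o → cong (λ t → 0ℚ + (- 1ℚ) * t) (off l o)))
                  (sumP-comb (λ _ → 0ℚ) (- 1ℚ) x ∙ cong₂ (λ a b → a +ᵥ ((- 1ℚ) ·ᵥ b)) sumP-0 h ∙ 0-+ᵥ ((- 1ℚ) ·ᵥ 0ᵥ) ∙ ·ᵥ-0ᵥ (- 1ℚ)) l) ∙ ℚP.*-zeroʳ (- 1ℚ)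
                where
                y : Fin k → ℚ
                y l = 0ℚ + (- 1ℚ) * x l

          In : V n → Fin k → Set
          In v j = j Sub.∈ supp v

          module Coeff (v : V n) (hv : Ups w v) where
            spec : Σ (Vec ℚ k) λ co → (sumV (λ j → co ! j ·ᵥ P ! j) ≡ v) × (Σ (Fin k) λ j₀ → ∀ j → co ! j ≢ 0ℚ → Conn P j₀ j) ×
                (∀ j → (j Sub.∈ supp v → co ! j ≢ 0ℚ) × (co ! j ≢ 0ℚ → j Sub.∈ supp v))
            spec = supp-spec v (rt-real (root hv)) (γ-D v ∙ D≡0 hv)

            co : Fin k → ℚ
            co = lookup (proj₁ spec)

            base : Fin k
            base = proj₁ (proj₁ (proj₂ (proj₂ spec)))

            abstract
              co-sum : sumP co ≡ v
              co-sum = proj₁ (proj₂ spec)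

              in-co : ∀ j → In v j → co j ≢ 0ℚ
              in-co j = proj₁ (proj₂ (proj₂ (proj₂ spec)) j)

              co-in : ∀ j → co j ≢ 0ℚ → In v j
              co-in j = proj₂ (proj₂ (proj₂ (proj₂ spec)) j)

              co-off : ∀ j → ¬ Orb base j → co j ≡ 0ℚ
              co-off j h = decidable-stable (co j ℚP.≟ 0ℚ) λ q → h (conn-orb (proj₂ (proj₁ (proj₂ (proj₂ spec))) j q))

              -- `SuppSpec` promises an expansion but no signs. Its difference from a nonnegative
              -- expansion x in the cone is a relation, constant on the base orbit and equal to x
              -- elsewhere. A positive constant would give a nontrivial nonnegative relation; so it
              -- is at most 0, and co is x minus it.
              co≥0 : ∀ j → 0ℚ ≤ co j
              co≥0 j = go (0ℚ ℚP.<? c)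
                where
                x D′ : Fin k → ℚ
                x = proj₁ (cone hv)
                D′ l = x l + (- 1ℚ) * co l
                x≥0 : ∀ l → 0ℚ ≤ x l
                x≥0 = proj₁ (proj₂ (cone hv))
                D′0 : sumP D′ ≡ 0ᵥ
                D′0 = diff0 x co (proj₂ (proj₂ (cone hv)) ∙ sym co-sum)
                c : ℚ
                c = D′ base
                on : ∀ l → Orb base l → D′ l ≡ c
                on l (s , refl) = co-const D′ D′0 base (Fin.toℕ s)
                go : Dec (0ℚ < c) → 0ℚ ≤ co j
                go (yes p) = ⊥-elim (>⇒≢ p (zero-comb D′ (λ l → nn l (orb? base l)) D′0 base))
                  where
                  nn : ∀ l → Dec (Orb base l) → 0ℚ ≤ D′ l
                  nn l (yes o) = subst (0ℚ ≤_) (sym (on l o)) (ℚP.<⇒≤ p)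
                  nn l (no o) = subst (0ℚ ≤_) (sym (cong (λ t → x l + (- 1ℚ) * t) (co-off l o) ∙ solve 1 (λ x → x :+ (:- con 1ℚ) :* con 0ℚ := x) refl (x l))) (x≥0 l)
                go (no p) = pick (orb? base j)
                  where
                  pick : Dec (Orb base j) → 0ℚ ≤ co j
                  pick (yes o) = subst (0ℚ ≤_) (cong (λ t → x j - t) (sym (on j o)) ∙ solve 2 (λ x c → x :- (x :+ (:- con 1ℚ) :* c) := c) refl (x j) (co j)) (0≤+ (x≥0 j) (≤0⇒ (ℚP.≮⇒≥ p)))
                  pick (no o) = ℚP.≤-reflexive (sym (co-off j o))

              E-v : ∀ j → E w v (P′ j) ≡ Nn j * (co j - co (π⁻ j))
              E-v j = cong (λ t → E w t (P′ j)) (sym co-sum) ∙ E-co co j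

              E-vv : E w v v ≡ norm½ hv
              E-vv = half-inj (E-double cw v ∙ norm (root hv))

              -- On one component the difference of the expansions is a relation constant on its
              -- cycle, hence 0. If the components were different, y would be constant along its
              -- cycle, and E(v, v) would vanish.
              unique-co : ∀ y j₁ → sumP y ≡ v → (∀ l → y l ≢ 0ℚ → Conn P j₁ l) → ∀ l → y l ≡ co l
              unique-co y j₁ ys yc l = go (orb? base j₁)
                where
                D′ : Fin k → ℚ
                D′ t = co t + (- 1ℚ) * y t
                D′0 : sumP D′ ≡ 0ᵥ
                D′0 = diff0 co y (co-sum ∙ sym ys)
                y-off : ∀ t → ¬ Orb j₁ t → y t ≡ 0ℚ
                y-off t h = decidable-stable (y t ℚP.≟ 0ℚ) λ q → h (conn-orb (yc t q))
                go : Dec (Orb base j₁) → y l ≡ co l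
                go (yes o) = solve 2 (λ c y → y := c :- (c :+ (:- con 1ℚ) :* y)) refl (co l) (y l) ∙ cong (λ t → co l - t) (const-zero D′ base (D′ base) D′0 (λ { t (s , refl) → co-const D′ D′0 base (Fin.toℕ s) })
                    (λ t h → cong₂ (λ a b → a + (- 1ℚ) * b) (co-off t h) (y-off t (λ o′ → h (conn-orb (orb-conn o ◅◅ orb-conn o′)))) ∙ refl) l) ∙ solve 1 (λ c → c :- con 0ℚ := c) refl (co l)
                go (no o) = ⊥-elim (N≢0 (root hv) (sym E-vv ∙ cong (E w v) (sym ys) ∙ sumP-F (E-linʳ w v) y ∙ sumQ-cong (λ t → cong (y t *_) (Ev0 t) ∙ ℚP.*-zeroʳ (y t)) ∙ sumQ-0 k))
                  where
                  co0 : ∀ t → Orb j₁ t → co t ≡ 0ℚ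
                  co0 t o′ = co-off t (λ o″ → o (conn-orb (orb-conn o″ ◅◅ conn-sym (orb-conn o′))))
                  y-step : ∀ t → y t - y (π⁻ t) ≡ 0ℚ
                  y-step t = pick (orb? j₁ t)
                    where
                    pick : Dec (Orb j₁ t) → y t - y (π⁻ t) ≡ 0ℚ
                    pick (yes o′) = solve 2 (λ a b → a :- b := (con 0ℚ :+ (:- con 1ℚ) :* b) :- (con 0ℚ :+ (:- con 1ℚ) :* a)) refl (y t) (y (π⁻ t)) ∙ cong₂ (λ a b → (a + (- 1ℚ) * y (π⁻ t)) - (b + (- 1ℚ) * y t)) (sym (co0 (π⁻ t) (conn-orb (orb-conn o′ ◅◅ conn-π⁻ t)))) (sym (co0 t o′)) ∙
                      cong (λ s → D′ (π⁻ t) - s) (cong D′ (sym (ππ⁻ t)) ∙ co-const D′ D′0 (π⁻ t) 1) ∙ ℚP.+-inverseʳ (D′ (π⁻ t))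
                    pick (no o′) = cong₂ _-_ (y-off t o′) (y-off (π⁻ t) (λ o″ → o′ (conn-orb (orb-conn o″ ◅◅ conn-sym (conn-π⁻ t)))))
                  Ev0 : ∀ t → E w v (P′ t) ≡ 0ℚ
                  Ev0 t = trans (cong (λ s → E w s (P′ t)) (sym ys)) (E-co y t ∙ cong (Nn t *_) (y-step t) ∙ ℚP.*-zeroʳ (Nn t))

          -- A tube root that is not component-full is the sum of the P_j along an arc x, π x, …, y of its orbit.
          record Arc (v : V n) (hv : Ups w v) : Set where
            open Coeff v hv
            field
              x y    : Fin k
              in-x   : In v x
              out-x  : ¬ In v (π⁻ x)
              in-y   : In v y
              out-y  : ¬ In v (π y)
              start  : ∀ j → ¬ In v (π⁻ j) → In v j → j ≡ x
              end    : ∀ j → In v j → ¬ In v (π j) → j ≡ y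
              orb-in : ∀ j → In v j → Orb x j
              co-1   : ∀ j → In v j → co j ≡ 1ℚ
              E-jump : ∀ j → E w v (P′ j) ≡ norm½ hv * (δδ x j - δδ (π y) j)

          abstract
            -- Let M and N be the half norms of v and of the elements of its cycle, and df the jumps
            -- of the coefficients. These are integral, N df = M z with z integral, and E(v, v) = M
            -- gives N Σ df² = 2M and M Σ z² = 2N, so Σ df² Σ z² = 4. The jumps sum to 0, so there
            -- are a rise and a fall, and both sums are at least 2. Hence both are 2, N = M, and the
            -- only jumps are 1 and -1. As some coefficient on the cycle is 0, the coefficients are
            -- 0 and 1.
            arc : ∀ v (hv : Ups w v) → ¬ CompFull P (supp v) → Arc v hv
            arc v hv nf = record
              -- The fall y₀ is the first element after the arc, so the arc ends one step earlier.
              { x = x₀ ; y = π⁻ y₀ ; in-x = co-in x₀ (λ q → >⇒≢ 0<1 (sym co-x ∙ q)) ; out-x = λ h → in-co (π⁻ x₀) h co-x⁻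
              ; in-y = co-in (π⁻ y₀) (λ q → >⇒≢ 0<1 (sym co-y⁻ ∙ q)) ; out-y = λ h → in-co (π (π⁻ y₀)) h (cong co (ππ⁻ y₀) ∙ co-y)
              ; start = λ j h h′ → jump⁺ j (subst (0ℚ <_) (sym (cong₂ _-_ (in1 j h′) (out0 (π⁻ j) h))) 0<1)
              ; end = λ j h h′ → sym (π⁻π j) ∙ cong π⁻ (jump⁻ (π j) (sub> (subst (0ℚ <_) (sym (cong (λ t → 0ℚ - t) (cong₂ _-_ (out0 (π j) h′) (cong co (π⁻π j) ∙ in1 j h) ∙ refl) ∙ refl)) 0<1)))
              ; orb-in = λ j h → orbx j (in-orb j (in-co j h)) ; co-1 = in1
              ; E-jump = λ j → E-v j ∙ NM j ∙ cong (λ t → norm½ hv * (δδ x₀ j - δδ t j)) (sym (ππ⁻ y₀)) }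
              where
              open Coeff v hv
              M N : ℚ
              M = norm½ hv
              N = Nn base
              M>0 : 0ℚ < M
              M>0 = N>0 (root hv)
              df : Fin k → ℚ
              df j = co j - co (π⁻ j)
              in-orb : ∀ j → co j ≢ 0ℚ → Orb base j
              in-orb j h = pick (orb? base j)
                where
                pick : Dec (Orb base j) → Orb base j
                pick (yes o) = o
                pick (no o) = ⊥-elim (h (co-off j o))
              N-const : ∀ s → Nn (π^ s base) ≡ N
              N-const zero = refl
              N-const (suc s) = Nn-π (π^ s base) ∙ N-const s
              df-off : ∀ j → ¬ Orb base j → df j ≡ 0ℚ
              df-off j o = cong₂ _-_ (co-off j o) (co-off (π⁻ j) (λ o′ → o (conn-orb (orb-conn o′ ◅◅ conn-sym (conn-π⁻ j)))))
              Ndf : ∀ j → Nn j * df j ≡ N * df j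
              Ndf j = pick (orb? base j)
                where
                pick : Dec (Orb base j) → Nn j * df j ≡ N * df j
                pick (yes (s , refl)) = cong (_* df (π^ (Fin.toℕ s) base)) (N-const (Fin.toℕ s))
                pick (no o) = cong (Nn j *_) (df-off j o) ∙ ℚP.*-zeroʳ (Nn j) ∙ sym (cong (N *_) (df-off j o) ∙ ℚP.*-zeroʳ N)
              dvM : ∀ j → M ∣ᵢ E w v (P′ j)
              dvM j = E-div w v (P′ j) (coint (root hv)) (int (root (P-ups j)))
              z : Fin k → ℚ
              z j = quo (dvM j)
              z-eq : ∀ j → N * df j ≡ M * z j
              z-eq j = sym (Ndf j) ∙ sym (E-v j) ∙ quo-eq (dvM j)
              df-int : ∀ j → Int (df j)
              df-int j = subst Int (*-cancelˡ (>⇒≢ (Nn>0 j)) (solve 2 (λ n q → n :* (:- q) := :- (n :* q)) refl (Nn j) (quo b) ∙ cong (λ t → - (t * quo b)) (sym (Nn-π⁻ j)) ∙ cong -_ (sym (quo-eq b)) ∙ sym (serre cw v (P′ (π⁻ j))) ∙ cong (E w v) (τP (π⁻ j) ∙ cong P′ (ππ⁻ j)) ∙ E-v j)) (int-neg (quo-int b))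
                where
                b : Nn (π⁻ j) ∣ᵢ E w (P′ (π⁻ j)) v
                b = E-div w (P′ (π⁻ j)) v (coint (root (P-ups (π⁻ j)))) (int (root hv))
              df-sum : sumQ df ≡ 0ℚ
              df-sum = sumQ-cong (λ j → solve 2 (λ a b → a :- b := a :+ (:- con 1ℚ) :* b) refl (co j) (co (π⁻ j))) ∙ sumQ-+ co (λ j → (- 1ℚ) * co (π⁻ j)) ∙ cong (sumQ co +_) (sumQ-* (- 1ℚ) (λ j → co (π⁻ j)) ∙ cong ((- 1ℚ) *_) (sumQ-permute π⁻ π π⁻π ππ⁻ co)) ∙
                solve 1 (λ s → s :+ (:- con 1ℚ) :* s := con 0ℚ) refl (sumQ co)
              sq : (Fin k → ℚ) → Fin k → ℚ
              sq f j = f j * f j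
              -- By (a - b)² = 2a(a - b) + b² - a²: the first part sums to 2E(v, v), and the squares
              -- cancel because π⁻ permutes Π_c and preserves half norms.
              NA : N * sumQ (sq df) ≡ M + M
              NA = sym (sumQ-* N (sq df)) ∙ sumQ-cong (λ j → sym (ℚP.*-assoc N (df j) (df j)) ∙ cong (_* df j) (sym (Ndf j)) ∙ solve 3 (λ n a b → n :* (a :- b) :* (a :- b) := con 2ℚ :* (a :* (n :* (a :- b))) :+ (n :* (b :* b) :+ (:- con 1ℚ) :* (n :* (a :* a)))) refl (Nn j) (co j) (co (π⁻ j))) ∙
                sumQ-+ (λ j → 2ℚ * (co j * (Nn j * df j))) (λ j → Nn j * (co (π⁻ j) * co (π⁻ j)) + (- 1ℚ) * (Nn j * (co j * co j))) ∙ cong₂ _+_ (sumQ-* 2ℚ (λ j → co j * (Nn j * df j)) ∙ cong (2ℚ *_) (sumQ-cong (λ j → cong (co j *_) (sym (E-v j))) ∙ sym (sumP-F (E-linʳ w v) co) ∙ cong (E w v) co-sum ∙ E-vv))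
                    (sumQ-+ (λ j → Nn j * (co (π⁻ j) * co (π⁻ j))) (λ j → (- 1ℚ) * (Nn j * (co j * co j))) ∙ cong₂ _+_ (sumQ-cong (λ j → cong (_* (co (π⁻ j) * co (π⁻ j))) (sym (Nn-π⁻ j))) ∙ sumQ-permute π⁻ π π⁻π ππ⁻ (λ j → Nn j * (co j * co j))) (sumQ-* (- 1ℚ) (λ j → Nn j * (co j * co j)))) ∙
                  solve 2 (λ m s → con 2ℚ :* m :+ (s :+ (:- con 1ℚ) :* s) := m :+ m) refl M (sumQ (λ j → Nn j * (co j * co j)))
              MB : M * sumQ (sq z) ≡ N + N
              MB = *-cancelˡ (>⇒≢ M>0) (sym (sumQ-* M (λ j → M * sq z j) ∙ cong (M *_) (sumQ-* M (sq z))) ∙ sumQ-cong (λ j → solve 2 (λ m z → m :* (m :* (z :* z)) := m :* z :* (m :* z)) refl M (z j) ∙ cong (λ t → t * t) (sym (z-eq j)) ∙ solve 2 (λ n x → n :* x :* (n :* x) := n :* (n :* (x :* x))) refl N (df j)) ∙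
                sumQ-* N (λ j → N * sq df j) ∙ cong (N *_) (sumQ-* N (sq df) ∙ NA) ∙ solve 2 (λ n m → n :* (m :+ m) := m :* (n :+ n)) refl N M)
              N>0′ : 0ℚ < N
              N>0′ = Nn>0 base
              AB : sumQ (sq df) * sumQ (sq z) ≡ toℚ (ℤ.+ 4)
              AB = *-cancelˡ {N * M} (>⇒≢ (0<* N>0′ M>0)) (solve 4 (λ n m a b → n :* m :* (a :* b) := n :* a :* (m :* b)) refl N M (sumQ (sq df)) (sumQ (sq z)) ∙ cong₂ _*_ NA MB ∙ solve 2 (λ n m → (m :+ m) :* (n :+ n) := n :* m :* con (toℚ (ℤ.+ 4))) refl N M)
              some : ∃ λ j → df j ≢ 0ℚ
              some = let (j , q) = sumQ≢0 {f = sq df} (λ e → >⇒≢ (0<+ M>0 (ℚP.<⇒≤ M>0)) (sym NA ∙ cong (N *_) e ∙ ℚP.*-zeroʳ N)) in j , λ e → q (cong (λ t → t * t) e)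
              rise : ∃ λ j → 0ℚ < df j
              rise = pick (FinP.any? (λ j → 0ℚ ℚP.<? df j))
                where
                pick : Dec (∃ λ j → 0ℚ < df j) → ∃ λ j → 0ℚ < df j
                pick (yes h) = h
                pick (no h) = ⊥-elim (proj₂ some (solve 1 (λ x → x := (:- con 1ℚ) :* ((:- con 1ℚ) :* x)) refl (df (proj₁ some)) ∙ cong ((- 1ℚ) *_) (sumQ≡0 {f = λ j → (- 1ℚ) * df j} (λ j → subst (0ℚ ≤_) (solve 1 (λ x → :- x := (:- con 1ℚ) :* x) refl (df j)) (≤0⇒ (ℚP.≮⇒≥ λ q → h (j , q))))
                  (sumQ-* (- 1ℚ) df ∙ cong ((- 1ℚ) *_) df-sum ∙ ℚP.*-zeroʳ (- 1ℚ)) (proj₁ some)) ∙ ℚP.*-zeroʳ (- 1ℚ)))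
              fall : ∃ λ j → df j < 0ℚ
              fall = pick (FinP.any? (λ j → df j ℚP.<? 0ℚ))
                where
                pick : Dec (∃ λ j → df j < 0ℚ) → ∃ λ j → df j < 0ℚ
                pick (yes h) = h
                pick (no h) = ⊥-elim (proj₂ some (sumQ≡0 {f = df} (λ j → ℚP.≮⇒≥ λ q → h (j , q)) df-sum (proj₁ some)))
              x₀ y₀ : Fin k
              x₀ = proj₁ rise
              y₀ = proj₁ fall
              x≢y : x₀ ≢ y₀
              x≢y h = ℚP.<-irrefl refl (ℚP.<-trans (proj₂ rise) (subst (λ t → df t < 0ℚ) (sym h) (proj₂ fall)))
              dx≥1 : 1ℚ ≤ df x₀
              dx≥1 = int≥1 (df-int x₀) (proj₂ rise)
              dy≥1 : 1ℚ ≤ - df y₀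
              dy≥1 = int≥1 (int-neg (df-int y₀)) (<0⇒ (proj₂ fall))
              sq≥1 : ∀ {t} → 1ℚ ≤ t → 1ℚ ≤ t * t
              sq≥1 {t} h = ℚP.≤-trans h (*-mono (ℚP.≤-trans 0≤1 h) h)
              negsq : ∀ t → (- t) * (- t) ≡ t * t
              negsq = solve 1 (λ t → (:- t) :* (:- t) := t :* t) refl
              dx² : 1ℚ ≤ sq df x₀
              dx² = sq≥1 dx≥1
              dy² : 1ℚ ≤ sq df y₀
              dy² = subst (1ℚ ≤_) (negsq (df y₀)) (sq≥1 dy≥1)
              sq≥0 : ∀ f j → 0ℚ ≤ sq f j
              sq≥0 f j = 0≤sq (f j)
              A≥2 : 2ℚ ≤ sumQ (sq df)
              A≥2 = ℚP.≤-trans (ℚP.+-mono-≤ dx² dy²) (sumQ-≥2 (sq df) (sq≥0 df) x≢y)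
              zpos : ∀ j t → 0ℚ < t → N * t ≡ M * z j → 1ℚ ≤ z j
              zpos j t h eq = int≥1 (quo-int (dvM j)) (pos-cancel M>0 (subst (0ℚ <_) eq (0<* N>0′ h)))
              B≥2 : 2ℚ ≤ sumQ (sq z)
              B≥2 = ℚP.≤-trans (ℚP.+-mono-≤ (sq≥1 (zpos x₀ (df x₀) (proj₂ rise) (z-eq x₀))) (subst (1ℚ ≤_) (negsq (z y₀)) (sq≥1 nz))) (sumQ-≥2 (sq z) (sq≥0 z) x≢y)
                where
                nz : 1ℚ ≤ - z y₀
                nz = int≥1 (int-neg (quo-int (dvM y₀))) (pos-cancel M>0 (subst (0ℚ <_) (solve 2 (λ n x → n :* (:- x) := :- (n :* x)) refl N (df y₀) ∙ cong -_ (z-eq y₀) ∙ solve 2 (λ n x → :- (n :* x) := n :* (:- x)) refl M (z y₀)) (0<* N>0′ (<0⇒ (proj₂ fall)))))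
              A≡2 : sumQ (sq df) ≡ 2ℚ
              A≡2 = two-two A≥2 B≥2 (ℚP.≤-reflexive AB)
              N≡M : N ≡ M
              N≡M = half-inj (solve 1 (λ n → n :+ n := n :* con 2ℚ) refl N ∙ cong (N *_) (sym A≡2) ∙ NA)
              others : ∀ l → l ≢ x₀ → l ≢ y₀ → df l ≡ 0ℚ
              others l p q = sq≡0 (ℚP.≤-reflexive (sumQ-only2 (sq df) (sq≥0 df) x≢y (ℚP.≤-trans (ℚP.≤-reflexive A≡2) (ℚP.+-mono-≤ dx² dy²)) l p q))
              two≤ : sq df x₀ + sq df y₀ ≤ 2ℚ
              two≤ = ℚP.≤-trans (sumQ-≥2 (sq df) (sq≥0 df) x≢y) (ℚP.≤-reflexive A≡2)
              one-of : ∀ {t s} → 1ℚ ≤ t → 1ℚ ≤ s → t * t + s ≤ 2ℚ → t ≡ 1ℚ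
              one-of {t} {s} ht hs h = ℚP.≤-antisym (ℚP.≤-trans (*-mono (ℚP.≤-trans 0≤1 ht) ht) (by≤ (2ℚ - (t * t + s) + (s - 1ℚ)) (0≤+ (≥sub h) (≥sub hs)) (solve 2 (λ t s → con 1ℚ :- t :* t := con 2ℚ :- (t :* t :+ s) :+ (s :- con 1ℚ)) refl t s))) ht
              dx : df x₀ ≡ 1ℚ
              dx = one-of dx≥1 dy² two≤
              dy : df y₀ ≡ - 1ℚ
              dy = solve 1 (λ x → x := :- (:- x)) refl (df y₀) ∙ cong -_ (one-of dy≥1 dx² (subst (_≤ 2ℚ) (ℚP.+-comm (sq df x₀) (sq df y₀) ∙ cong (_+ sq df x₀) (sym (negsq (df y₀)))) two≤))
              NM : ∀ j → Nn j * (co j - co (π⁻ j)) ≡ M * (δδ x₀ j - δδ y₀ j)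
              NM j = Ndf j ∙ cong₂ _*_ N≡M refl ∙ cong (M *_) (pick (x₀ Fin.≟ j) (y₀ Fin.≟ j))
                where
                pick : Dec (x₀ ≡ j) → Dec (y₀ ≡ j) → df j ≡ δδ x₀ j - δδ y₀ j
                pick (yes refl) _ = dx ∙ sym (cong₂ _-_ (δδ-refl x₀) (δδ-≢ (x≢y ∘ sym)))
                pick (no p) (yes refl) = dy ∙ sym (cong₂ _-_ (δδ-≢ p) (δδ-refl y₀))
                pick (no p) (no q) = others j (p ∘ sym) (q ∘ sym) ∙ sym (cong₂ _-_ (δδ-≢ p) (δδ-≢ q))
              jump⁺ : ∀ j → 0ℚ < df j → j ≡ x₀
              jump⁺ j h = pick (j Fin.≟ x₀) (j Fin.≟ y₀)
                where
                pick : Dec (j ≡ x₀) → Dec (j ≡ y₀) → j ≡ x₀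
                pick (yes p) _ = p
                pick (no _) (yes refl) = ⊥-elim (ℚP.<-irrefl refl (ℚP.<-trans h (proj₂ fall)))
                pick (no p) (no q) = ⊥-elim (>⇒≢ h (others j p q))
              jump⁻ : ∀ j → df j < 0ℚ → j ≡ y₀
              jump⁻ j h = pick (j Fin.≟ x₀) (j Fin.≟ y₀)
                where
                pick : Dec (j ≡ x₀) → Dec (j ≡ y₀) → j ≡ y₀
                pick _ (yes p) = p
                pick (yes refl) (no _) = ⊥-elim (ℚP.<-irrefl refl (ℚP.<-trans h (proj₂ rise)))
                pick (no p) (no q) = ⊥-elim (ℚP.<-irrefl (others j p q) h)
              df≤0 : ∀ j → j ≢ x₀ → df j ≤ 0ℚ
              df≤0 j h = ℚP.≮⇒≥ λ q → h (jump⁺ j q)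
              co-π : ∀ j → co (π j) ≡ co j + df (π j)
              co-π j = solve 2 (λ a b → a := b :+ (a :- b)) refl (co (π j)) (co (π⁻ (π j))) ∙ cong (λ t → co t + df (π j)) (π⁻π j)
              orb-x : Orb base x₀
              orb-x = pick (orb? base x₀)
                where
                pick : Dec (Orb base x₀) → Orb base x₀
                pick (yes o) = o
                pick (no o) = ⊥-elim (>⇒≢ (proj₂ rise) (df-off x₀ o))
              orbx : ∀ j → Orb base j → Orb x₀ j
              orbx j o = conn-orb (conn-sym (orb-conn orb-x) ◅◅ orb-conn o)
              empty : ∃ λ l → Orb base l × co l ≡ 0ℚ
              empty = pick (FinP.any? (λ l → orb? base l ×-dec (co l ℚP.≟ 0ℚ)))
                where
                pick : Dec (∃ λ l → Orb base l × co l ≡ 0ℚ) → ∃ λ l → Orb base l × co l ≡ 0ℚ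
                pick (yes h) = h
                pick (no h) = ⊥-elim (nf (base , λ j c → co-in j (λ q → h (j , conn-orb c , q))))
              π^-comm : ∀ s l → π^ s (π l) ≡ π (π^ s l)
              π^-comm zero l = refl
              π^-comm (suc s) l = cong π (π^-comm s l)
              -- Coefficients cannot rise on the way forward from l to the element before x₀, so a
              -- zero anywhere on the cycle makes the coefficient just before the rise 0.
              low : ∀ s l → π^ s l ≡ π⁻ x₀ → co (π⁻ x₀) ≤ co l
              low zero l refl = ℚP.≤-refl
              low (suc s) l h = pick (π l Fin.≟ x₀)
                where
                pick : Dec (π l ≡ x₀) → co (π⁻ x₀) ≤ co l
                pick (yes q) = ℚP.≤-reflexive (cong co (cong π⁻ (sym q) ∙ π⁻π l))
                pick (no q) = ℚP.≤-trans (low s (π l) (π^-comm s l ∙ h)) (by≤ (- df (π l)) (≤0⇒ (df≤0 (π l) q)) (cong (λ t → co l - t) (co-π l) ∙ solve 2 (λ a b → a :- (a :+ b) := :- b) refl (co l) (df (π l))))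
              co-x⁻ : co (π⁻ x₀) ≡ 0ℚ
              co-x⁻ = let (l , o , q) = empty ; (s , eq) = conn-orb (conn-sym (orb-conn o) ◅◅ (orb-conn orb-x ◅◅ conn-π⁻ x₀)) in ℚP.≤-antisym (ℚP.≤-trans (low (Fin.toℕ s) l eq) (ℚP.≤-reflexive q)) (co≥0 (π⁻ x₀))
              co-x : co x₀ ≡ 1ℚ
              co-x = solve 2 (λ a b → a := a :- b :+ b) refl (co x₀) (co (π⁻ x₀)) ∙ cong₂ _+_ dx co-x⁻
              01-step : ∀ {a b} → b ≤ 0ℚ → b ≡ 0ℚ ⊎ b ≡ - 1ℚ → 0ℚ ≤ a + b → a ≡ 0ℚ ⊎ a ≡ 1ℚ → a + b ≡ 0ℚ ⊎ a + b ≡ 1ℚ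
              01-step _ (inj₁ refl) _ (inj₁ refl) = inj₁ refl
              01-step _ (inj₁ refl) _ (inj₂ refl) = inj₂ refl
              01-step _ (inj₂ refl) h (inj₁ refl) = ⊥-elim (<⇒≱ (ℚP.negative⁻¹ (0ℚ + - 1ℚ)) h)
              01-step _ (inj₂ refl) _ (inj₂ refl) = inj₁ refl
              co-01 : ∀ s → co (π^ s x₀) ≡ 0ℚ ⊎ co (π^ s x₀) ≡ 1ℚ
              co-01 zero = inj₂ co-x
              co-01 (suc s) = pick (π (π^ s x₀) Fin.≟ x₀)
                where
                pick : Dec (π (π^ s x₀) ≡ x₀) → co (π (π^ s x₀)) ≡ 0ℚ ⊎ co (π (π^ s x₀)) ≡ 1ℚ
                pick (yes q) = inj₂ (cong co q ∙ co-x)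
                pick (no q) = subst (λ t → t ≡ 0ℚ ⊎ t ≡ 1ℚ) (sym (co-π (π^ s x₀))) (01-step (df≤0 (π (π^ s x₀)) q) (val (π (π^ s x₀) Fin.≟ y₀)) (subst (0ℚ ≤_) (co-π (π^ s x₀)) (co≥0 (π (π^ s x₀)))) (co-01 s))
                  where
                  val : Dec (π (π^ s x₀) ≡ y₀) → df (π (π^ s x₀)) ≡ 0ℚ ⊎ df (π (π^ s x₀)) ≡ - 1ℚ
                  val (yes r) = inj₂ (cong df r ∙ dy)
                  val (no r) = inj₁ (others (π (π^ s x₀)) q r)
              in1 : ∀ j → In v j → co j ≡ 1ℚ
              in1 j h = pick (orbx j (in-orb j (in-co j h)))
                where
                pick : Orb x₀ j → co j ≡ 1ℚ
                pick (s , refl) = go (co-01 (Fin.toℕ s))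
                  where
                  go : co (π^ (Fin.toℕ s) x₀) ≡ 0ℚ ⊎ co (π^ (Fin.toℕ s) x₀) ≡ 1ℚ → co (π^ (Fin.toℕ s) x₀) ≡ 1ℚ
                  go (inj₁ q) = ⊥-elim (in-co (π^ (Fin.toℕ s) x₀) h q)
                  go (inj₂ q) = q
              out0 : ∀ j → ¬ In v j → co j ≡ 0ℚ
              out0 j h = decidable-stable (co j ℚP.≟ 0ℚ) λ q → h (co-in j q)
              co-y⁻ : co (π⁻ y₀) ≡ 1ℚ
              co-y⁻ = in1 (π⁻ y₀) (co-in (π⁻ y₀) λ q → <⇒≱ (ℚP.negative⁻¹ (- 1ℚ)) (subst (0ℚ ≤_) (solve 1 (λ a → a := a :- con 0ℚ) refl (co y₀) ∙ cong (λ t → co y₀ - t) (sym q) ∙ dy) (co≥0 y₀)))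
              co-y : co y₀ ≡ 0ℚ
              co-y = solve 2 (λ a b → a := a :- b :+ b) refl (co y₀) (co (π⁻ y₀)) ∙ cong₂ _+_ dy co-y⁻

        open Arcs public

        -- Two arcs on a cycle.

        module Circle where
          open SpecialRoot (special cw) using () renaming (i to i⋆)

          orb-sym : ∀ {i j} → Orb i j → Orb j i
          orb-sym o = conn-orb (conn-sym (orb-conn o))

          orb-trans : ∀ {i j l} → Orb i j → Orb j l → Orb i l
          orb-trans o o′ = conn-orb (orb-conn o ◅◅ orb-conn o′)

          orb-π : ∀ j → Orb j (π j)
          orb-π j = orb-any 1 refl

          orb-π⁻ : ∀ j → Orb j (π⁻ j)
          orb-π⁻ j = conn-orb (conn-π⁻ j)

          forward : (Q : Fin k → Set) → ∀ {i} → Q i → (∀ j → Q j → Q (π j)) → ∀ j → Orb i j → Q j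
          forward Q {i} q step′ j (s , refl) = go (Fin.toℕ s)
            where
            go : ∀ s → Q (π^ s i)
            go zero    = q
            go (suc s) = step′ (π^ s i) (go s)

          backward : (Q : Fin k → Set) → ∀ {i} → Q i → (∀ j → Q (π j) → Q j) → ∀ j → Orb i j → Q j
          backward Q {i} q step′ j o = go (Fin.toℕ (proj₁ o′)) j (proj₂ o′)
            where
            o′ : Orb j i
            o′ = orb-sym o
            go : ∀ s j → π^ s j ≡ i → Q j
            go zero    j refl = q
            go (suc s) j e = step′ j (go s (π j) (sym (π^-+ s 1 j) ∙ cong (λ t → π^ t j) (ℕP.+-comm s 1) ∙ e))

          In? : ∀ v j → Dec (In v j)
          In? v j = j SubP.∈? supp v

          χ : ∀ {X : Set} → Dec X → ℚ
          χ (yes _) = 1ℚ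
          χ (no _)  = 0ℚ

          module Two {v u : V n} {hv : Ups w v} {hu : Ups w u} (Av : Arc v hv) (Au : Arc u hu) where
            open Arc Av
            open Arc Au renaming (x to x′; y to y′; in-x to in-x′; out-x to out-x′; in-y to in-y′; out-y to out-y′; start to start′; end to end′; orb-in to orb-in′; co-1 to co-1′) hiding (E-jump)
            private
              cv cu : Fin k → ℚ
              cv = Coeff.co v hv
              cu = Coeff.co u hu

            χ-co : ∀ j → cu j ≡ χ (In? u j)
            χ-co j = go (In? u j)
              where
              go : (D′ : Dec (In u j)) → cu j ≡ χ D′
              go (yes h) = co-1′ j h
              go (no h) = decidable-stable (cu j ℚP.≟ 0ℚ) λ q → h (Coeff.co-in u hu j q)

            orb-y : Orb x y
            orb-y = orb-in y in-y

            equal : (∀ j → In v j → In u j) → (∀ j → In u j → In v j) → v ≡ u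
            equal f g = sym (Coeff.co-sum v hv) ∙ (sumP-cong λ j → go j (In? v j)) ∙ Coeff.co-sum u hu
              where
              go : ∀ j → Dec (In v j) → cv j ≡ cu j
              go j (yes h) = co-1 j h ∙ sym (co-1′ j (f j h))
              go j (no h) = (decidable-stable (cv j ℚP.≟ 0ℚ) λ q → h (Coeff.co-in v hv j q)) ∙ sym (decidable-stable (cu j ℚP.≟ 0ℚ) λ q → h (g j (Coeff.co-in u hu j q)))

            sub-proper : v ≢ u → (∀ j → In v j → In u j) → supp v ⊂ supp u
            sub-proper ne f = (λ {j} → f j) , go (FinP.any? (λ j → In? u j ×-dec ¬? (In? v j)))
              where
              go : Dec (∃ λ j → In u j × ¬ In v j) → ∃ λ j → j Sub.∈ supp u × ¬ j Sub.∈ supp v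
              go (yes h) = h
              go (no h) = ⊥-elim (ne (equal f λ j q → decidable-stable (In? v j) λ r → h (j , q , r)))

            -- The ends of v are then a beginning and an end of u, and an arc has only one of each;
            -- membership agrees step by step around the cycle.
            same-ends : In u x → ¬ In u (π⁻ x) → In u y → ¬ In u (π y) → v ≡ u
            same-ends bx b⁻ by b⁺ = equal (λ j h → proj₁ (Q j (orb-in j h)) h) (λ j h → proj₂ (Q j (orb-trans (orb-sym (orb-in′ x bx)) (orb-in′ j h))) h)
              where
              x≡ : x ≡ x′
              x≡ = start′ x b⁻ bx
              y≡ : y ≡ y′
              y≡ = end′ y by b⁺
              Q : ∀ j → Orb x j → (In v j → In u j) × (In u j → In v j)
              Q = forward (λ j → (In v j → In u j) × (In u j → In v j)) ((λ _ → bx) , (λ _ → in-x)) λ j (f , g) →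
                (λ h → decidable-stable (In? u (π j)) λ r → ahead j f h r (In? v j)) , (λ h → decidable-stable (In? v (π j)) λ r → back j g h r (In? u j))
                where
                ahead : ∀ j → (In v j → In u j) → In v (π j) → ¬ In u (π j) → Dec (In v j) → ⊥
                ahead j f h r (yes q) = out-y (subst (In v) (cong π (end′ j (f q) r ∙ sym y≡)) h)
                ahead j f h r (no q) = r (subst (In u) (sym (start (π j) (λ q′ → q (subst (In v) (π⁻π j) q′)) h)) bx)
                back : ∀ j → (In u j → In v j) → In u (π j) → ¬ In v (π j) → Dec (In u j) → ⊥
                back j g h r (yes q) = b⁺ (subst (In u) (cong π (end j (g q) r)) h)
                back j g h r (no q) = r (subst (In v) (sym (start′ (π j) (λ q′ → q (subst (In u) (π⁻π j) q′)) h ∙ sym x≡)) in-x)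

            Everywhere : Set
            Everywhere = ∀ j → Orb x j → In v j ⊎ In u j

            orb-x⁻ : Orb x (π⁻ x)
            orb-x⁻ = orb-π⁻ x

            orb-y⁺ : Orb x (π y)
            orb-y⁺ = orb-trans orb-y (orb-π y)

            from-Q : (∀ j → Orb x j → In u j ⊎ ¬ In v j) → ∀ j → In v j → In u j
            from-Q Q j h = go (Q j (orb-in j h))
              where
              go : In u j ⊎ ¬ In v j → In u j
              go (inj₁ q) = q
              go (inj₂ q) = ⊥-elim (q h)

            -- Going backward through v from π y, the arc u can only be left at its beginning, which
            -- is x, the beginning of v.
            after : In u (π y) → ¬ In u (π⁻ x) → In u x → ∀ j → In v j → In u j
            after b⁺ b⁻ bx = from-Q λ j o → backward Q {π y} (inj₁ b⁺) (λ j q → stp j q (In? v j) (In? u j)) j (orb-trans (orb-sym orb-y⁺) o)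
              where
              Q : Fin k → Set
              Q j = In u j ⊎ ¬ In v j
              stp : ∀ j → Q (π j) → Dec (In v j) → Dec (In u j) → Q j
              stp j _ (no p) _ = inj₂ p
              stp j _ (yes _) (yes q) = inj₁ q
              stp j qq (yes p) (no q) = ⊥-elim (out-x (subst (In v) (sym (π⁻π j) ∙ cong π⁻ (start′ (π j) (λ r → q (subst (In u) (π⁻π j) r)) (bπ qq) ∙ sym (start′ x b⁻ bx))) p))
                where
                bπ : Q (π j) → In u (π j)
                bπ (inj₁ r) = r
                bπ (inj₂ r) = subst (In u) (cong π (sym (end j p r))) b⁺

            before : In u (π⁻ x) → ¬ In u (π y) → In u y → ∀ j → In v j → In u j
            before b⁻ b⁺ by = from-Q λ j o → forward Q {π⁻ x} (inj₁ b⁻) (λ j q → stp j q (In? v (π j)) (In? u (π j))) j (orb-trans (orb-sym orb-x⁻) o)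
              where
              Q : Fin k → Set
              Q j = In u j ⊎ ¬ In v j
              stp : ∀ j → Q j → Dec (In v (π j)) → Dec (In u (π j)) → Q (π j)
              stp j _ (no p) _ = inj₂ p
              stp j _ (yes _) (yes q) = inj₁ q
              stp j qq (yes p) (no q) = ⊥-elim (out-y (subst (In v) (cong π (end′ j (bj qq) q ∙ sym (end′ y by b⁺))) p))
                where
                bj : Q j → In u j
                bj (inj₁ r) = r
                bj (inj₂ r) = subst (In u) (cong π⁻ (sym (start (π j) (λ r′ → r (subst (In v) (π⁻π j) r′)) p)) ∙ π⁻π j) b⁻

            -- The complement of u is an arc that avoids both neighbours of v. It lies either inside
            -- v, and the union is everything, or outside v, and v is contained in u. The ends of v
            -- and the successor of the end of u decide which.
            both : In u (π⁻ x) → In u (π y) → Everywhere ⊎ (∀ j → In v j → In u j)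
            both b⁻ b⁺ = go (In? u x) (In? u y) (In? v (π y′))
              where
              go : Dec (In u x) → Dec (In u y) → Dec (In v (π y′)) → Everywhere ⊎ (∀ j → In v j → In u j)
              go (no bx) _ _ = inj₁ λ j o → forward (λ j → In v j ⊎ In u j) {π y} (inj₂ b⁺) (λ j q → stp j q (In? v (π j)) (In? u (π j))) j (orb-trans (orb-sym orb-y⁺) o)
                where
                stp : ∀ j → In v j ⊎ In u j → Dec (In v (π j)) → Dec (In u (π j)) → In v (π j) ⊎ In u (π j)
                stp j _ (yes p) _ = inj₁ p
                stp j _ _ (yes q) = inj₂ q
                stp j (inj₁ r) (no p) (no q) = ⊥-elim (q (subst (In u) (cong π (sym (end j r p))) b⁺))
                stp j (inj₂ r) (no p) (no q) = ⊥-elim (p (subst (In v) (sym (ππ⁻ x) ∙ cong π (end′ (π⁻ x) b⁻ (λ t → bx (subst (In u) (ππ⁻ x) t)) ∙ sym (end′ j r q))) in-x))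
              go (yes _) (no by) _ = inj₁ λ j o → backward (λ j → In v j ⊎ In u j) {π⁻ x} (inj₂ b⁻) (λ j q → stp j q (In? v j) (In? u j)) j (orb-trans (orb-sym orb-x⁻) o)
                where
                stp : ∀ j → In v (π j) ⊎ In u (π j) → Dec (In v j) → Dec (In u j) → In v j ⊎ In u j
                stp j _ (yes p) _ = inj₁ p
                stp j _ _ (yes q) = inj₂ q
                stp j (inj₁ r) (no p) (no q) = ⊥-elim (q (subst (In u) (cong π⁻ (sym (start (π j) (λ t → p (subst (In v) (π⁻π j) t)) r)) ∙ π⁻π j) b⁻))
                stp j (inj₂ r) (no p) (no q) = ⊥-elim (p (subst (In v) (π-inj (start′ (π y) (λ t → by (subst (In u) (π⁻π y) t)) b⁺ ∙ sym (start′ (π j) (λ t → q (subst (In u) (π⁻π j) t)) r))) in-y))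
              go (yes bx) (yes by) (yes a′) = inj₁ λ j o → forward (λ j → In v j ⊎ In u j) {x} (inj₂ bx) (λ j q → stp j q (In? v (π j)) (In? u (π j)) (In? u j)) j o
                where
                stp : ∀ j → In v j ⊎ In u j → Dec (In v (π j)) → Dec (In u (π j)) → Dec (In u j) → In v (π j) ⊎ In u (π j)
                stp j _ (yes p) _ _ = inj₁ p
                stp j _ _ (yes q) _ = inj₂ q
                stp j _ (no p) (no q) (yes r) = ⊥-elim (p (subst (In v) (cong π (sym (end′ j r q))) a′))
                stp j (inj₂ r) (no p) (no q) (no r′) = ⊥-elim (r′ r)
                stp j (inj₁ r) (no p) (no q) (no r′) = ⊥-elim (r′ (subst (In u) (sym (end j r p)) by))
              go (yes bx) (yes by) (no a′) = inj₂ (from-Q λ j o → forward (λ j → In u j ⊎ ¬ In v j) {x} (inj₁ bx) (λ j q → stp j q (In? v (π j)) (In? u (π j))) j o)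
                where
                stp : ∀ j → In u j ⊎ ¬ In v j → Dec (In v (π j)) → Dec (In u (π j)) → In u (π j) ⊎ ¬ In v (π j)
                stp j _ (no p) _ = inj₂ p
                stp j _ _ (yes q) = inj₁ q
                stp j (inj₁ r) (yes p) (no q) = ⊥-elim (a′ (subst (In v) (cong π (end′ j r q)) p))
                stp j (inj₂ r) (yes p) (no q) = ⊥-elim (q (subst (In u) (sym (start (π j) (λ t → r (subst (In v) (π⁻π j) t)) p)) bx))

            -- The full component has to be the cycle of v, since u alone would have to fill any
            -- other.
            full-everywhere : ¬ CompFull P (supp u) → CompFull P (supp v ∪ supp u) → Everywhere
            full-everywhere nu (j₀ , h) = go (orb? x j₀)
              where
              mem : ∀ j → Conn P j₀ j → In v j ⊎ In u j
              mem j c = SubP.x∈p∪q⁻ (supp v) (supp u) (h j c)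
              go : Dec (Orb x j₀) → Everywhere
              go (yes o) j o′ = mem j (orb-conn (orb-trans (orb-sym o) o′))
              go (no o) = ⊥-elim (nu (j₀ , λ j c → pick j c (mem j c)))
                where
                pick : ∀ j → Conn P j₀ j → In v j ⊎ In u j → In u j
                pick j c (inj₁ q) = ⊥-elim (o (orb-trans (orb-in j q) (orb-sym (conn-orb c))))
                pick j c (inj₂ q) = q

            everywhere-full : Everywhere → CompFull P (supp v ∪ supp u)
            everywhere-full ev = x , λ j c → SubP.x∈p∪q⁺ (ev j (conn-orb c))

            -- By `E-jump` the form sees u only at x and at π y. For the other order, `serre` shifts
            -- these two points to π⁻ x and y, see `E-uv`.
            E-vu : E w v u ≡ norm½ hv * (cu x - cu (π y))
            E-vu = cong (E w v) (sym (Coeff.co-sum u hu)) ∙ sumP-F (E-linʳ w v) cu ∙ sumQ-cong (λ j → cong (cu j *_) (E-jump j) ∙ solve 4 (λ c m a b → c :* (m :* (a :- b)) := m :* (a :* c) :+ (:- m) :* (b :* c)) refl (cu j) (norm½ hv) (δδ x j) (δδ (π y) j)) ∙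
              sumQ-+ (λ j → norm½ hv * (δδ x j * cu j)) (λ j → (- norm½ hv) * (δδ (π y) j * cu j)) ∙ cong₂ _+_ (sumQ-* (norm½ hv) (λ j → δδ x j * cu j) ∙ cong (norm½ hv *_) (sumQ-δ x cu)) (sumQ-* (- norm½ hv) (λ j → δδ (π y) j * cu j) ∙ cong ((- norm½ hv) *_) (sumQ-δ (π y) cu)) ∙
                solve 3 (λ m a b → m :* a :+ (:- m) :* b := m :* (a :- b)) refl (norm½ hv) (cu x) (cu (π y))

            δδ-π : ∀ z j → δδ z (π j) ≡ δδ (π⁻ z) j
            δδ-π z j = go (z Fin.≟ π j)
              where
              go : Dec (z ≡ π j) → δδ z (π j) ≡ δδ (π⁻ z) j
              go (yes refl) = δδ-refl (π j) ∙ sym (cong (λ t → δδ t j) (π⁻π j) ∙ δδ-refl j)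
              go (no p) = δδ-≢ p ∙ sym (δδ-≢ λ q → p (sym (ππ⁻ z) ∙ cong π q))

            E-uv : E w u v ≡ - (norm½ hv * (cu (π⁻ x) - cu y))
            E-uv = solve 1 (λ x → x := :- (:- x)) refl (E w u v) ∙ cong -_ (sym (serre cw v u) ∙ cong (λ t → E w v (τ w t)) (sym (Coeff.co-sum u hu)) ∙ cong (E w v) (Linear.sum (act-lin (reverse w)) (λ j → cu j ·ᵥ P′ j) ∙ sumV-cong (λ j → Linear.scale (act-lin (reverse w)) (cu j) (P′ j) ∙ cong (cu j ·ᵥ_) (τP j))) ∙
              Functional.comb (E-linʳ w v) cu (λ j → P′ (π j)) ∙ sumQ-cong (λ j → cong (cu j *_) (E-jump (π j) ∙ cong₂ (λ a b → norm½ hv * (a - b)) (δδ-π x j) (δδ-π (π y) j ∙ cong (λ t → δδ t j) (π⁻π y))) ∙ solve 4 (λ c m a b → c :* (m :* (a :- b)) := m :* (a :* c) :+ (:- m) :* (b :* c)) refl (cu j) (norm½ hv) (δδ (π⁻ x) j) (δδ y j)) ∙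
              sumQ-+ (λ j → norm½ hv * (δδ (π⁻ x) j * cu j)) (λ j → (- norm½ hv) * (δδ y j * cu j)) ∙ cong₂ _+_ (sumQ-* (norm½ hv) (λ j → δδ (π⁻ x) j * cu j) ∙ cong (norm½ hv *_) (sumQ-δ (π⁻ x) cu)) (sumQ-* (- norm½ hv) (λ j → δδ y j * cu j) ∙ cong ((- norm½ hv) *_) (sumQ-δ y cu)) ∙
                solve 3 (λ m a b → m :* a :+ (:- m) :* b := m :* (a :- b)) refl (norm½ hv) (cu (π⁻ x)) (cu y))

            value : ∀ {c lam} → Cor c v lam → lam * norm½ hv ≡ 1ℚ → compMax c u w ≡ (χ (In? u (π y)) - χ (In? u x)) ⊔ (χ (In? u (π⁻ x)) - χ (In? u y))
            value {c} {lam} C lM = Coroot.cm-pos c v lam (Cor.lam≥0 C) (Cor.c-eq C) cw (posi hv) u (posi hu) ∙ cong₂ _⊔_ l r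
              where
              l : - (lam * E w v u) ≡ χ (In? u (π y)) - χ (In? u x)
              l = cong (λ t → - (lam * t)) E-vu ∙ solve 4 (λ l m a b → :- (l :* (m :* (a :- b))) := (l :* m) :* (b :- a)) refl lam (norm½ hv) (cu x) (cu (π y)) ∙ cong (_* (cu (π y) - cu x)) lM ∙ ℚP.*-identityˡ (cu (π y) - cu x) ∙ cong₂ _-_ (χ-co (π y)) (χ-co x)
              r : - (lam * E w u v) ≡ χ (In? u (π⁻ x)) - χ (In? u y)
              r = trans (cong (λ t → - (lam * t)) E-uv) (solve 4 (λ l m a b → :- (l :* :- (m :* (a :- b))) := (l :* m) :* (a :- b)) refl lam (norm½ hv) (cu (π⁻ x)) (cu y) ∙ cong (_* (cu (π⁻ x) - cu y)) lM ∙ ℚP.*-identityˡ (cu (π⁻ x) - cu y) ∙ cong₂ _-_ (χ-co (π⁻ x)) (χ-co y))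

          -- The test for a nonnegative combination on one orbit to involve the whole orbit reads off the coefficient of α_{i⋆} along the τ-orbit.
          Full₁ : V n → Set
          Full₁ v = ∀ (s : Fin L) → τ^ w (Fin.toℕ s) v ! i⋆ ≢ 0ℚ

          abstract
            π^-swap : ∀ r s j → π^ r (π^ s j) ≡ π^ s (π^ r j)
            π^-swap r s j = sym (π^-+ r s j) ∙ cong (λ t → π^ t j) (ℕP.+-comm r s) ∙ π^-+ s r j

            τ^-sumP : ∀ x s → τ^ w s (sumP x) ! i⋆ ≡ sumQ (λ l → x l * P′ (π^ s l) ! i⋆)
            τ^-sumP x s = cong (λ t → t ! i⋆) (Linear.sum (τ^-lin w s) (λ j → x j ·ᵥ P′ j) ∙ sumV-cong (λ j → Linear.scale (τ^-lin w s) (x j) (P′ j) ∙ cong (x j ·ᵥ_) (τ^P s j))) ∙ lk-comb x (λ j → P′ (π^ s j)) i⋆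

            -- Rotate j to the position that involves i⋆. By `X-single` no other element of the
            -- orbit contributes to this coordinate, so x_j cannot vanish when the coordinate does
            -- not.
            full₁⇒ : ∀ x base → (∀ l → x l ≢ 0ℚ → Orb base l) → Full₁ (sumP x) → ∀ j → Orb base j → x j ≢ 0ℚ
            full₁⇒ x base sp full j o xj = proj₂ l₁′ (cong x l≡ ∙ xj)
              where
              s₁ : ℕ
              s₁ = Fin.toℕ (proj₁ (visits j))
              l₁ : ∃ λ l → x l ≢ 0ℚ × P′ (π^ s₁ l) ! i⋆ ≢ 0ℚ
              l₁ = sum-nz x (λ l → P′ (π^ s₁ l) ! i⋆) (λ q → full (proj₁ (visits j)) (τ^-sumP x s₁ ∙ q))
              l₁′ : ∃ λ l → x l ≢ 0ℚ
              l₁′ = proj₁ l₁ , proj₁ (proj₂ l₁)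
              l≡ : proj₁ l₁ ≡ j
              l≡ = π^-inj s₁ (X-single (conn-sym (conn-π^ s₁ (proj₁ l₁)) ◅◅ (orb-conn (orb-trans (orb-sym (sp (proj₁ l₁) (proj₁ (proj₂ l₁)))) o) ◅◅ conn-π^ s₁ j)) (proj₂ (proj₂ l₁)) (proj₂ (visits j)))

            ⇒full₁ : ∀ x base → (∀ l → 0ℚ ≤ x l) → (∀ j → Orb base j → x j ≢ 0ℚ) → Full₁ (sumP x)
            ⇒full₁ x base x≥0 h s q = nz (*≡0 (h j (r , refl)) (sumQ≡0 {f = λ l → x l * P′ (π^ (Fin.toℕ s) l) ! i⋆} (λ l → 0≤* (x≥0 l) (P-pos (π^ (Fin.toℕ s) l) i⋆)) (sym (τ^-sumP x (Fin.toℕ s)) ∙ q) j))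
              where
              v₀ : Σ (Fin L) λ s → P′ (π^ (Fin.toℕ s) base) ! i⋆ ≢ 0ℚ
              v₀ = visits base
              b : Fin k
              b = π^ (Fin.toℕ (proj₁ v₀)) base
              o : Orb (π^ (Fin.toℕ s) base) b
              o = conn-orb (conn-sym (conn-π^ (Fin.toℕ s) base) ◅◅ conn-π^ (Fin.toℕ (proj₁ v₀)) base)
              r : Fin L
              r = proj₁ o
              j : Fin k
              j = π^ (Fin.toℕ r) base
              nz : P′ (π^ (Fin.toℕ s) j) ! i⋆ ≢ 0ℚ
              nz = subst (λ t → P′ t ! i⋆ ≢ 0ℚ) (sym (π^-swap (Fin.toℕ s) (Fin.toℕ r) base ∙ proj₂ o)) (proj₂ v₀)

            full₁-iff : ∀ {v} (hv : Ups w v) → (Full₁ v → CompFull P (supp v)) × (CompFull P (supp v) → Full₁ v)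
            full₁-iff {v} hv = (λ f → base , λ j c → co-in j (full₁⇒ co base sp (subst Full₁ (sym co-sum) f) j (conn-orb c))) ,
                (λ { (j₀ , h) → subst Full₁ co-sum (⇒full₁ co j₀ co≥0 (λ j o → in-co j (h j (orb-conn o)))) })
              where
              open Coeff v hv
              sp : ∀ l → co l ≢ 0ℚ → Orb base l
              sp l q = decidable-stable (orb? base l) λ o → q (co-off l o)

            -- Rotating the expansion of v gives an expansion of τv on the same component, and such
            -- expansions are unique.
            shift-co : ∀ {v} (hv : Ups w v) j → Coeff.co (τ w v) (ups-τ cw hv) j ≡ Coeff.co v hv (π⁻ j)
            shift-co {v} hv j = sym (Coeff.unique-co (τ w v) (ups-τ cw hv) (λ l → co (π⁻ l)) base
                ((vec-ext λ r → lk-comb (λ l → co (π⁻ l)) P′ r ∙ sumQ-cong (λ l → cong (λ t → co (π⁻ l) * P′ t ! r) (sym (ππ⁻ l))) ∙ sumQ-permute π⁻ π π⁻π ππ⁻ (λ l → co l * P′ (π l) ! r) ∙ sym (lk-comb co (λ l → P′ (π l)) r)) ∙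
                  sumV-cong (λ l → cong (co l ·ᵥ_) (sym (τP l)) ∙ sym (Linear.scale (act-lin (reverse w)) (co l) (P′ l))) ∙ sym (Linear.sum (act-lin (reverse w)) (λ l → co l ·ᵥ P′ l)) ∙ cong (τ w) co-sum)
                (λ l q → orb-conn (orb-trans (decidable-stable (orb? base (π⁻ l)) λ o → q (co-off (π⁻ l) o)) (orb-sym (orb-π⁻ l)))) j)
              where open Coeff v hv

            In-τ : ∀ {v} (hv : Ups w v) j → (In (τ w v) j → In v (π⁻ j)) × (In v (π⁻ j) → In (τ w v) j)
            In-τ {v} hv j = (λ h → Coeff.co-in v hv (π⁻ j) (subst (_≢ 0ℚ) (shift-co hv j) (Coeff.in-co (τ w v) (ups-τ cw hv) j h))) ,
              (λ h → Coeff.co-in (τ w v) (ups-τ cw hv) j (subst (_≢ 0ℚ) (sym (shift-co hv j)) (Coeff.in-co v hv (π⁻ j) h)))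

            In-c : ∀ {v} (hv : Ups w v) j → (In (actW w v) j → In v (π j)) × (In v (π j) → In (actW w v) j)
            In-c {v} hv j = (λ h → subst (λ t → In t (π j)) (act-rev w v) (proj₂ (In-τ hc (π j)) (subst (In (actW w v)) (sym (π⁻π j)) h))) ,
                (λ h → subst (In (actW w v)) (π⁻π j) (proj₁ (In-τ hc (π j)) (subst (λ t → In t (π j)) (sym (act-rev w v)) h)))
              where
              hc : Ups w (actW w v)
              hc = ups-c cw hv

        open Circle public

        -- Degrees of pairs of tube roots.

        module TubeDegrees where
          open Tests cw using (FullT; SameTube; Tube; FullPair; degree; degree-yes; degree-no)

          NF : V n → Set
          NF v = ¬ CompFull P (supp v)

          module Pair {v u : V n} (hv : Ups w v) (hu : Ups w u) (nv : NF v) (nu : NF u) where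
            Av : Arc v hv
            Av = arc v hv nv
            Au : Arc u hu
            Au = arc u hu nu
            open Two Av Au
            open Arc Av
            open Arc Au using () renaming (x to x′; in-x to in-x′; out-x to out-x′; start to start′; orb-in to orb-in′; co-1 to co-1′)
            private
              p q : Fin k
              p = π⁻ x
              q = π y
              S : Subset k
              S = adjSet v ∩ supp u
              cv cu : Fin k → ℚ
              cv = Coeff.co v hv
              cu = Coeff.co u hu

            abstract
              -- Both c and its inverse shift an arc by one step, so they add only the element just
              -- before it or just after it.
              S⊆ : ∀ j → j Sub.∈ S → j ≡ p ⊎ j ≡ q
              S⊆ j h = go (SubP.x∈p∪q⁻ (supp (actW w v)) (supp (actW (reverse w) v)) (proj₁ (SubP.x∈p∩q⁻ (supp (actW w v) ∪ supp (actW (reverse w) v)) (∁ (supp v)) h′)))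
                where
                h′ : j Sub.∈ adjSet v
                h′ = proj₁ (SubP.x∈p∩q⁻ (adjSet v) (supp u) h)
                out : ¬ In v j
                out = SubP.x∈∁p⇒x∉p (proj₂ (SubP.x∈p∩q⁻ (supp (actW w v) ∪ supp (actW (reverse w) v)) (∁ (supp v)) h′))
                go : In (actW w v) j ⊎ In (τ w v) j → j ≡ p ⊎ j ≡ q
                go (inj₁ r) = inj₁ (sym (π⁻π j) ∙ cong π⁻ (start (π j) (λ t → out (subst (In v) (π⁻π j) t)) (proj₁ (In-c hv j) r)))
                go (inj₂ r) = inj₂ (sym (ππ⁻ j) ∙ cong π (end (π⁻ j) (proj₁ (In-τ hv j) r) (λ t → out (subst (In v) (ππ⁻ j) t))))

              p-S : In u p → p Sub.∈ S
              p-S h = SubP.x∈p∩q⁺ (SubP.x∈p∩q⁺ (SubP.x∈p∪q⁺ (inj₁ (proj₂ (In-c hv p) (subst (In v) (sym (ππ⁻ x)) in-x))) , SubP.x∉p⇒x∈∁p out-x) , h)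

              q-S : In u q → q Sub.∈ S
              q-S h = SubP.x∈p∩q⁺ (SubP.x∈p∩q⁺ (SubP.x∈p∪q⁺ (inj₂ (proj₂ (In-τ hv q) (subst (In v) (sym (π⁻π y)) in-y))) , SubP.x∉p⇒x∈∁p out-y) , h)

              S-u : ∀ {j} → j Sub.∈ S → In u j
              S-u h = proj₂ (SubP.x∈p∩q⁻ (adjSet v) (supp u) h)

              adj-eq : ∀ {c} → ∣ S ∣ ≡ c → adj v u ≡ toℚ (ℤ.+ c)
              adj-eq = cong (λ c → toℚ (ℤ.+ c))

              value′ : compMax (corootCoord v) u w ≡ (χ (In? u q) - χ (In? u x)) ⊔ (χ (In? u p) - χ (In? u y))
              value′ = value (cor-aff (root hv)) (ℚP.*-comm (inv (N≢0 (root hv))) (norm½ hv) ∙ inv-r (N≢0 (root hv)))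

              circ-sub : v ≢ u → (∀ j → In v j → In u j) → compMax (corootCoord v) u w ≡ 0ℚ
              circ-sub ne f = value′ ∙ go (In? u q) (In? u x) (In? u p) (In? u y)
                where
                go : (a : Dec (In u q)) (b : Dec (In u x)) (c : Dec (In u p)) (e : Dec (In u y)) → (χ a - χ b) ⊔ (χ c - χ e) ≡ 0ℚ
                go _ (no h) _ _ = ⊥-elim (h (f x in-x))
                go _ (yes _) _ (no h) = ⊥-elim (h (f y in-y))
                go (no a) (yes b) (no c) (yes e) = ⊥-elim (ne (same-ends b c e a))
                go (yes _) (yes _) (no _) (yes _) = refl
                go (yes _) (yes _) (yes _) (yes _) = refl
                go (no _) (yes _) (yes _) (yes _) = refl

              circ-sup : v ≢ u → (∀ j → In u j → In v j) → compMax (corootCoord v) u w ≡ 0ℚ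
              circ-sup ne f = value′ ∙ go (In? u q) (In? u x) (In? u p) (In? u y)
                where
                go : (a : Dec (In u q)) (b : Dec (In u x)) (c : Dec (In u p)) (e : Dec (In u y)) → (χ a - χ b) ⊔ (χ c - χ e) ≡ 0ℚ
                go (yes a) _ _ _ = ⊥-elim (out-y (f q a))
                go (no _) _ (yes c) _ = ⊥-elim (out-x (f p c))
                go (no a) (yes b) (no c) (yes e) = ⊥-elim (ne (same-ends b c e a))
                go (no _) (no _) (no _) (yes _) = refl
                go (no _) (no _) (no _) (no _) = refl
                go (no _) (yes _) (no _) (no _) = refl

              circ-self : v ≡ u → compMax (corootCoord v) u w ≡ - 1ℚ
              circ-self e≡ = value′ ∙ go (In? u q) (In? u x) (In? u p) (In? u y)
                where
                go : (a : Dec (In u q)) (b : Dec (In u x)) (c : Dec (In u p)) (e : Dec (In u y)) → (χ a - χ b) ⊔ (χ c - χ e) ≡ - 1ℚ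
                go (yes a) _ _ _ = ⊥-elim (out-y (subst (λ t → In t q) (sym e≡) a))
                go (no _) (no b) _ _ = ⊥-elim (b (subst (λ t → In t x) e≡ in-x))
                go (no _) (yes _) (yes c) _ = ⊥-elim (out-x (subst (λ t → In t p) (sym e≡) c))
                go (no _) (yes _) (no _) (no e) = ⊥-elim (e (subst (λ t → In t y) e≡ in-y))
                go (no _) (yes _) (no _) (yes _) = refl

              full-p : CompFull P (supp v ∪ supp u) → In u p
              full-p h = pick (full-everywhere nu h p orb-x⁻)
                where
                pick : In v p ⊎ In u p → In u p
                pick (inj₁ r) = ⊥-elim (out-x r)
                pick (inj₂ r) = r

              full-q : CompFull P (supp v ∪ supp u) → In u q
              full-q h = pick (full-everywhere nu h q orb-y⁺)
                where
                pick : In v q ⊎ In u q → In u q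
                pick (inj₁ r) = ⊥-elim (out-y r)
                pick (inj₂ r) = r

              -- The cases are the neighbours of v contained in u. With both, the union is full by
              -- `both`, as v is not contained in u. With one or none it is not full, and the arrow
              -- expressions give the number of neighbours, because `same-ends`, `after` and
              -- `before` rule out the configurations with other values.
              circ-cross : ∀ {r} → v ≢ u → ¬ (supp v ⊂ supp u ⊎ supp u ⊂ supp v) → (CompFull P (supp v ∪ supp u) → r ≡ adj v u) →
                (¬ CompFull P (supp v ∪ supp u) → r ≡ compMax (corootCoord v) u w) → r ≡ adj v u
              circ-cross {r} ne nn full notfull = go (In? u p) (In? u q)
                where
                bad : (∀ j → In v j → In u j) → ⊥
                bad f = nn (inj₁ (sub-proper ne f))
                val : ∀ {c} → ¬ CompFull P (supp v ∪ supp u) → adj v u ≡ c → ((a : Dec (In u q)) (b : Dec (In u x)) (c′ : Dec (In u p)) (e : Dec (In u y)) → (χ a - χ b) ⊔ (χ c′ - χ e) ≡ c) → r ≡ adj v u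
                val nf ae f = notfull nf ∙ value′ ∙ f (In? u q) (In? u x) (In? u p) (In? u y) ∙ sym ae
                go : Dec (In u p) → Dec (In u q) → r ≡ adj v u
                go (yes hp) (yes hq) = pick (both hp hq)
                  where
                  pick : Everywhere ⊎ (∀ j → In v j → In u j) → r ≡ adj v u
                  pick (inj₁ ev) = full (everywhere-full ev)
                  pick (inj₂ f) = ⊥-elim (bad f)
                go (no hp) (no hq) = val (hp ∘ full-p) (adj-eq (card-0 S⊆ (hp ∘ S-u) (hq ∘ S-u))) f
                  where
                  f : (a : Dec (In u q)) (b : Dec (In u x)) (c′ : Dec (In u p)) (e : Dec (In u y)) → (χ a - χ b) ⊔ (χ c′ - χ e) ≡ 0ℚ
                  f (yes a) _ _ _ = ⊥-elim (hq a)
                  f (no _) _ (yes c) _ = ⊥-elim (hp c)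
                  f (no a) (yes b) (no c) (yes e) = ⊥-elim (ne (same-ends b c e a))
                  f (no _) (no _) (no _) (yes _) = refl
                  f (no _) (no _) (no _) (no _) = refl
                  f (no _) (yes _) (no _) (no _) = refl
                go (no hp) (yes hq) = val (hp ∘ full-p) (adj-eq (card-p (λ j h → swap (S⊆ j h)) (q-S hq) (inj₂ (hp ∘ S-u)))) f
                  where
                  swap : ∀ {j} → j ≡ p ⊎ j ≡ q → j ≡ q ⊎ j ≡ p
                  swap (inj₁ a) = inj₂ a
                  swap (inj₂ a) = inj₁ a
                  f : (a : Dec (In u q)) (b : Dec (In u x)) (c′ : Dec (In u p)) (e : Dec (In u y)) → (χ a - χ b) ⊔ (χ c′ - χ e) ≡ 1ℚ
                  f (no a) _ _ _ = ⊥-elim (a hq)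
                  f (yes _) (yes b) _ _ = ⊥-elim (bad (after hq hp b))
                  f (yes _) (no _) (yes c) _ = ⊥-elim (hp c)
                  f (yes _) (no _) (no _) (yes _) = refl
                  f (yes _) (no _) (no _) (no _) = refl
                go (yes hp) (no hq) = val (hq ∘ full-q) (adj-eq (card-p S⊆ (p-S hp) (inj₂ (hq ∘ S-u)))) f
                  where
                  f : (a : Dec (In u q)) (b : Dec (In u x)) (c′ : Dec (In u p)) (e : Dec (In u y)) → (χ a - χ b) ⊔ (χ c′ - χ e) ≡ 1ℚ
                  f (yes a) _ _ _ = ⊥-elim (hq a)
                  f (no _) _ (no c) _ = ⊥-elim (c hp)
                  f (no _) _ (yes _) (yes e) = ⊥-elim (bad (before hp hq e))
                  f (no _) (yes _) (yes _) (no _) = refl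
                  f (no _) (no _) (yes _) (no _) = refl

              sum-co : sumP (λ l → cv l + 1ℚ * cu l) ≡ v +ᵥ u
              sum-co = sumP-comb cv 1ℚ cu ∙ cong₂ _+ᵥ_ (Coeff.co-sum v hv) (1·ᵥ (sumP cu) ∙ Coeff.co-sum u hu)

              E-shift : ∀ s {l₁ l₂} → π^ s l₁ ≡ x → π^ s l₂ ≡ q → E w v (τ^ w s u) ≡ norm½ hv * (cu l₁ - cu l₂)
              E-shift s {l₁} {l₂} e₁ e₂ = cong (λ t → E w v (τ^ w s t)) (sym (Coeff.co-sum u hu)) ∙ cong (E w v) (Linear.sum (τ^-lin w s) (λ j → cu j ·ᵥ P′ j) ∙ sumV-cong (λ j → Linear.scale (τ^-lin w s) (cu j) (P′ j) ∙ cong (cu j ·ᵥ_) (τ^P s j))) ∙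
                Functional.comb (E-linʳ w v) cu (λ j → P′ (π^ s j)) ∙ sumQ-cong (λ j → cong (cu j *_) (E-jump (π^ s j) ∙ cong₂ (λ a b → norm½ hv * (a - b)) (at e₁ j) (at e₂ j)) ∙ solve 4 (λ c m a b → c :* (m :* (a :- b)) := m :* (a :* c) :+ (:- m) :* (b :* c)) refl (cu j) (norm½ hv) (δδ l₁ j) (δδ l₂ j)) ∙
                sumQ-+ (λ j → norm½ hv * (δδ l₁ j * cu j)) (λ j → (- norm½ hv) * (δδ l₂ j * cu j)) ∙ cong₂ _+_ (sumQ-* (norm½ hv) (λ j → δδ l₁ j * cu j) ∙ cong (norm½ hv *_) (sumQ-δ l₁ cu)) (sumQ-* (- norm½ hv) (λ j → δδ l₂ j * cu j) ∙ cong ((- norm½ hv) *_) (sumQ-δ l₂ cu)) ∙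
                  solve 3 (λ m a b → m :* a :+ (:- m) :* b := m :* (a :- b)) refl (norm½ hv) (cu l₁) (cu l₂)
                where
                at : ∀ {l z} → π^ s l ≡ z → ∀ j → δδ z (π^ s j) ≡ δδ l j
                at {l} refl j = go (l Fin.≟ j)
                  where
                  go : Dec (l ≡ j) → δδ (π^ s l) (π^ s j) ≡ δδ l j
                  go (yes refl) = δδ-refl (π^ s l) ∙ sym (δδ-refl l)
                  go (no h) = trans (δδ-≢ (h ∘ π^-inj s)) (sym (δδ-≢ h))

              -- Otherwise u would be invariant under the rotation taking x to π y.
              same-tube : Orb x x′ → SameTube v u
              same-tube o = go (FinP.any? (λ s → ¬? (E w v (τ^ w (Fin.toℕ s) u) ℚP.≟ 0ℚ)))
                where
                go : Dec (SameTube v u) → SameTube v u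
                go (yes h) = h
                go (no h) = ⊥-elim (out-y (subst (In v) (sym (proj₂ o₁) ∙ cong (π^ s₁) (sym l₂≡) ∙ e₂) in-x))
                  where
                  zero′ : ∀ (s : Fin L) → E w v (τ^ w (Fin.toℕ s) u) ≡ 0ℚ
                  zero′ s = decidable-stable (E w v (τ^ w (Fin.toℕ s) u) ℚP.≟ 0ℚ) λ ne → h (s , ne)
                  o₁ : Orb x′ x
                  o₁ = orb-sym o
                  o₂ : Orb (π⁻ x′) x
                  o₂ = orb-trans (orb-sym (orb-π⁻ x′)) o₁
                  s₁ s₂ r : ℕ
                  s₁ = Fin.toℕ (proj₁ o₁)
                  s₂ = Fin.toℕ (proj₁ o₂)
                  r = Fin.toℕ (proj₁ orb-y⁺)
                  l₂ : Fin k
                  l₂ = π^ r x′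
                  e₂ : π^ s₁ l₂ ≡ q
                  e₂ = π^-swap s₁ r x′ ∙ cong (π^ r) (proj₂ o₁) ∙ proj₂ orb-y⁺
                  e₂′ : π^ s₂ (π^ r (π⁻ x′)) ≡ q
                  e₂′ = π^-swap s₂ r (π⁻ x′) ∙ cong (π^ r) (proj₂ o₂) ∙ proj₂ orb-y⁺
                  eq : ∀ s {l₁ l₂} → E w v (τ^ w s u) ≡ 0ℚ → π^ s l₁ ≡ x → π^ s l₂ ≡ q → cu l₁ ≡ cu l₂
                  eq s {l₁} {l₂} z a b = solve 2 (λ a b → a := a :- b :+ b) refl (cu l₁) (cu l₂) ∙ cong (_+ cu l₂) (*≡0 (N≢0 (root hv)) (sym (E-shift s a b) ∙ z)) ∙ ℚP.+-identityˡ (cu l₂)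
                  l₂′ : π^ r (π⁻ x′) ≡ π⁻ l₂
                  l₂′ = sym (π⁻π (π^ r (π⁻ x′))) ∙ cong π⁻ (π^-swap 1 r (π⁻ x′) ∙ cong (π^ r) (ππ⁻ x′))
                  in-l₂ : In u l₂
                  in-l₂ = Coeff.co-in u hu l₂ (subst (_≢ 0ℚ) (eq s₁ (zero′ (proj₁ o₁)) (proj₂ o₁) e₂) (Coeff.in-co u hu x′ in-x′))
                  out-l₂ : ¬ In u (π⁻ l₂)
                  out-l₂ h′ = Coeff.in-co u hu (π⁻ l₂) h′ (cong cu (sym l₂′) ∙ sym (eq s₂ (zero′ (proj₁ o₂)) (proj₂ o₂) e₂′) ∙ (decidable-stable (cu (π⁻ x′) ℚP.≟ 0ℚ) λ ne → out-x′ (Coeff.co-in u hu (π⁻ x′) ne)))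
                  l₂≡ : l₂ ≡ x′
                  l₂≡ = start′ l₂ out-l₂ in-l₂

              tube-same : SameTube v u → Orb x x′
              tube-same (s , ne) = pick (x Fin.≟ π^ s′ l) (q Fin.≟ π^ s′ l)
                where
                s′ : ℕ
                s′ = Fin.toℕ s
                nz : ∃ λ l → cu l ≢ 0ℚ × E w v (P′ (π^ s′ l)) ≢ 0ℚ
                nz = sum-nz cu (λ l → E w v (P′ (π^ s′ l))) (λ z → ne (cong (λ t → E w v (τ^ w s′ t)) (sym (Coeff.co-sum u hu)) ∙ cong (E w v) (Linear.sum (τ^-lin w s′) (λ j → cu j ·ᵥ P′ j) ∙ sumV-cong (λ j → Linear.scale (τ^-lin w s′) (cu j) (P′ j) ∙ cong (cu j ·ᵥ_) (τ^P s′ j))) ∙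
                  Functional.comb (E-linʳ w v) cu (λ j → P′ (π^ s′ j)) ∙ z))
                l : Fin k
                l = proj₁ nz
                back : Orb x′ (π^ s′ l)
                back = orb-trans (orb-in′ l (Coeff.co-in u hu l (proj₁ (proj₂ nz)))) (orb-any s′ refl)
                pick : Dec (x ≡ π^ s′ l) → Dec (q ≡ π^ s′ l) → Orb x x′
                pick (yes a) _ = orb-sym (subst (Orb x′) (sym a) back)
                pick (no _) (yes b) = orb-trans orb-y⁺ (orb-sym (subst (Orb x′) (sym b) back))
                pick (no a) (no b) = ⊥-elim (proj₂ (proj₂ nz) (E-jump (π^ s′ l) ∙ cong₂ (λ a b → norm½ hv * (a - b)) (δδ-≢ a) (δδ-≢ b) ∙ solve 1 (λ m → m :* (con 0ℚ :- con 0ℚ) := con 0ℚ) refl (norm½ hv)))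

              nz-sum : ∀ {a b} → 0ℚ ≤ a → 0ℚ ≤ b → a ≢ 0ℚ ⊎ b ≢ 0ℚ → a + 1ℚ * b ≢ 0ℚ
              nz-sum {a} {b} ha hb (inj₁ h) z = h (sum≡0ˡ ha hb (cong (a +_) (sym (ℚP.*-identityˡ b)) ∙ z))
              nz-sum {a} {b} ha hb (inj₂ h) z = h (sum≡0ʳ ha hb (cong (a +_) (sym (ℚP.*-identityˡ b)) ∙ z))

              sum-nz′ : ∀ {a b} → a + 1ℚ * b ≢ 0ℚ → a ≢ 0ℚ ⊎ b ≢ 0ℚ
              sum-nz′ {a} {b} h = go (a ℚP.≟ 0ℚ)
                where
                go : Dec (a ≡ 0ℚ) → a ≢ 0ℚ ⊎ b ≢ 0ℚ
                go (no q) = inj₁ q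
                go (yes q) = inj₂ λ r → h (cong₂ (λ s t → s + 1ℚ * t) q r ∙ refl)

              in-or : ∀ {j} → cv j ≢ 0ℚ ⊎ cu j ≢ 0ℚ → In v j ⊎ In u j
              in-or {j} (inj₁ h) = inj₁ (Coeff.co-in v hv j h)
              in-or {j} (inj₂ h) = inj₂ (Coeff.co-in u hu j h)

              or-in : ∀ {j} → In v j ⊎ In u j → cv j ≢ 0ℚ ⊎ cu j ≢ 0ℚ
              or-in {j} (inj₁ h) = inj₁ (Coeff.in-co v hv j h)
              or-in {j} (inj₂ h) = inj₂ (Coeff.in-co u hu j h)

              test⇒ : Orb x x′ → FullT (v +ᵥ u) → Everywhere
              test⇒ o f j oj = in-or (sum-nz′ (full₁⇒ (λ l → cv l + 1ℚ * cu l) x (λ l h → pick (in-or (sum-nz′ h))) (subst Full₁ (sym sum-co) f) j oj))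
                where
                pick : ∀ {l} → In v l ⊎ In u l → Orb x l
                pick {l} (inj₁ h) = orb-in l h
                pick {l} (inj₂ h) = orb-trans o (orb-in′ l h)

              ⇒test : Everywhere → FullT (v +ᵥ u)
              ⇒test ev = subst Full₁ sum-co (⇒full₁ (λ l → cv l + 1ℚ * cu l) x (λ l → 0≤+ (Coeff.co≥0 v hv l) (0≤* 0≤1 (Coeff.co≥0 u hu l))) (λ j o → nz-sum (Coeff.co≥0 v hv j) (Coeff.co≥0 u hu j) (or-in (ev j o))))

              pair⇒ : SameTube v u × FullT (v +ᵥ u) → CompFull P (supp v ∪ supp u)
              pair⇒ (st , f) = everywhere-full (test⇒ (tube-same st) f)

              ⇒pair : CompFull P (supp v ∪ supp u) → SameTube v u × FullT (v +ᵥ u)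
              ⇒pair h = same-tube (orb-trans orb-x⁻ (orb-sym (orb-in′ p (full-p h)))) , ⇒test (full-everywhere nu h)

              -- When the union is full, u contains both neighbours of v, so only their coincidence
              -- matters.
              adj-full : CompFull P (supp v ∪ supp u) → (p ≡ q → adj v u ≡ 1ℚ) × (p ≢ q → adj v u ≡ 2ℚ)
              adj-full h = (λ e → adj-eq (card-p S⊆ (p-S (full-p h)) (inj₁ (sym e)))) , (λ ne → adj-eq (card-2 S⊆ (p-S (full-p h)) (q-S (full-q h)) ne))

          abstract
            -- v ∪ τv is everything precisely when the complement of v is a single element.
            gap : ∀ {v} (hv : Ups w v) (nv : NF v) → (FullT (v +ᵥ τ w v) → π⁻ (Arc.x (arc v hv nv)) ≡ π (Arc.y (arc v hv nv))) × (π⁻ (Arc.x (arc v hv nv)) ≡ π (Arc.y (arc v hv nv)) → FullT (v +ᵥ τ w v))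
            gap {v} hv nv = to , from
              where
              open Arc (arc v hv nv)
              co c : Fin k → ℚ
              co = Coeff.co v hv
              c l = co l + 1ℚ * Coeff.co (τ w v) (ups-τ cw hv) l
              open Pair hv hv nv nv using (nz-sum; sum-nz′)
              c-sum : sumP c ≡ v +ᵥ τ w v
              c-sum = sumP-comb co 1ℚ (Coeff.co (τ w v) (ups-τ cw hv)) ∙ cong₂ _+ᵥ_ (Coeff.co-sum v hv) (1·ᵥ (sumP (Coeff.co (τ w v) (ups-τ cw hv))) ∙ Coeff.co-sum (τ w v) (ups-τ cw hv))
              tau-in : ∀ j → Coeff.co (τ w v) (ups-τ cw hv) j ≢ 0ℚ → In v (π⁻ j)
              tau-in j h = Coeff.co-in v hv (π⁻ j) (subst (_≢ 0ℚ) (shift-co hv j) h)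
              to : FullT (v +ᵥ τ w v) → π⁻ x ≡ π y
              to f = pick (sum-nz′ (full₁⇒ c x sp (subst Full₁ (sym c-sum) f) (π⁻ x) (orb-π⁻ x)))
                where
                sp : ∀ l → c l ≢ 0ℚ → Orb x l
                sp l h = go (sum-nz′ h)
                  where
                  go : co l ≢ 0ℚ ⊎ Coeff.co (τ w v) (ups-τ cw hv) l ≢ 0ℚ → Orb x l
                  go (inj₁ q) = orb-in l (Coeff.co-in v hv l q)
                  go (inj₂ q) = orb-trans (orb-in (π⁻ l) (tau-in l q)) (orb-sym (orb-π⁻ l))
                pick : co (π⁻ x) ≢ 0ℚ ⊎ Coeff.co (τ w v) (ups-τ cw hv) (π⁻ x) ≢ 0ℚ → π⁻ x ≡ π y
                pick (inj₁ q) = ⊥-elim (out-x (Coeff.co-in v hv (π⁻ x) q))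
                pick (inj₂ q) = sym (ππ⁻ (π⁻ x)) ∙ cong π (end (π⁻ (π⁻ x)) (tau-in (π⁻ x) q) (λ h → out-x (subst (In v) (ππ⁻ (π⁻ x)) h)))
              from : π⁻ x ≡ π y → FullT (v +ᵥ τ w v)
              from e′ = subst Full₁ c-sum (⇒full₁ c x (λ l → 0≤+ (Coeff.co≥0 v hv l) (0≤* 0≤1 (Coeff.co≥0 (τ w v) (ups-τ cw hv) l))) (λ j o → nz-sum (Coeff.co≥0 v hv j) (Coeff.co≥0 (τ w v) (ups-τ cw hv) j) (fin j (Q j o))))
                where
                Q : ∀ j → Orb x j → In v j ⊎ j ≡ π y
                Q = forward (λ j → In v j ⊎ j ≡ π y) (inj₁ in-x) λ j h → stp j h (In? v (π j))
                  where
                  stp : ∀ j → In v j ⊎ j ≡ π y → Dec (In v (π j)) → In v (π j) ⊎ π j ≡ π y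
                  stp j _ (yes r) = inj₁ r
                  stp j (inj₁ q) (no r) = inj₂ (cong π (end j q r))
                  stp j (inj₂ q) (no r) = ⊥-elim (r (subst (In v) (sym (cong π (q ∙ sym e′) ∙ ππ⁻ x)) in-x))
                fin : ∀ j → In v j ⊎ j ≡ π y → co j ≢ 0ℚ ⊎ Coeff.co (τ w v) (ups-τ cw hv) j ≢ 0ℚ
                fin j (inj₁ q) = inj₁ (Coeff.in-co v hv j q)
                fin j (inj₂ refl) = inj₂ (subst (_≢ 0ℚ) (sym (shift-co hv (π y))) (Coeff.in-co v hv (π⁻ (π y)) (subst (In v) (sym (π⁻π y)) in-y)))

            tre-ups : ∀ {v} → TRe v → Ups w v
            tre-ups {v} (r , p , h , _) = ups (proj₂ (real-rt r)) p (sym (γ-D v) ∙ h)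

            tre-tube : ∀ {v} → TRe v → Tube v
            tre-tube {v} t@(r , p , h , nf) = (real-rt r , p , sym (γ-D v) ∙ h) , λ f → nf (proj₁ (full₁-iff (tre-ups t)) f)

            tube-ups : ∀ {v} → Tube v → Ups w v
            tube-ups (((_ , r) , p , h) , _) = ups r p h

            tube-nf : ∀ {v} → Tube v → NF v
            tube-nf t h = proj₂ t (proj₂ (full₁-iff (tube-ups t)) h)

            tube-tre : ∀ {v} → Tube v → TRe v
            tube-tre {v} t = rt-real (root (tube-ups t)) , posi (tube-ups t) , γ-D v ∙ D≡0 (tube-ups t) , tube-nf t

            pair-full : ∀ {v u} → FullPair v u → TRe v × TRe u × CompFull P (supp v ∪ supp u)
            pair-full (tv , tu , st) = tube-tre tv , tube-tre tu , Pair.pair⇒ (tube-ups tv) (tube-ups tu) (tube-nf tv) (tube-nf tu) st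

            full-pair : ∀ {v u} → TRe v × TRe u × CompFull P (supp v ∪ supp u) → FullPair v u
            full-pair (tv@(_ , _ , _ , nv) , tu@(_ , _ , _ , nu) , h) = tre-tube tv , tre-tube tu , Pair.⇒pair (tre-ups tv) (tre-ups tu) nv nu h

            degree-full : ∀ {v u} → TRe v × TRe u × CompFull P (supp v ∪ supp u) → degree v u ≡ adj v u
            degree-full {v} {u} c@(tv , tu , h) = degree-yes (full-pair c)
                (λ f → proj₁ af (proj₁ (gap (tre-ups tv) nv) f)) (λ f → proj₂ af (λ e → f (proj₂ (gap (tre-ups tv) nv) e)))
              where
              nv : NF v
              nv = proj₂ (proj₂ (proj₂ tv))
              nu : NF u
              nu = proj₂ (proj₂ (proj₂ tu))
              af : (π⁻ (Arc.x (arc v (tre-ups tv) nv)) ≡ π (Arc.y (arc v (tre-ups tv) nv)) → adj v u ≡ 1ℚ) × (π⁻ (Arc.x (arc v (tre-ups tv) nv)) ≢ π (Arc.y (arc v (tre-ups tv) nv)) → adj v u ≡ 2ℚ)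
              af = Pair.adj-full (tre-ups tv) (tre-ups tu) nv nu h

            -- Nested or equal supports cannot have a full union, since neither is full alone; there
            -- the arrow expressions give 0 or -1. This is (P3).
            compat-circ : ∀ {v u r} → TRe v → TRe u → CompatIs v u r → CircIs v u r
            compat-circ {v} {u} tv tu (f , g) =
                (λ e → g (λ { (_ , _ , h) → nu (subst (CompFull P) (cong (λ t → supp t ∪ supp u) e ∙ SubP.∪-idem (supp u)) h) }) ∙ circ-self e) ,
                (λ { ne (inj₁ (s , _)) → g (λ { (_ , _ , (j , h)) → nu (j , λ i c → sub s (SubP.x∈p∪q⁻ (supp v) (supp u) (h i c))) }) ∙ circ-sub ne (λ j → s {j})
                   ; ne (inj₂ (s , _)) → g (λ { (_ , _ , (j , h)) → nv (j , λ i c → sup s (SubP.x∈p∪q⁻ (supp v) (supp u) (h i c))) }) ∙ circ-sup ne (λ j → s {j}) }) ,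
                (λ ne nn → circ-cross ne nn (λ h → f (tv , tu , h)) (λ nf → g (λ { (_ , _ , h) → nf h })))
              where
              nv : NF v
              nv = proj₂ (proj₂ (proj₂ tv))
              nu : NF u
              nu = proj₂ (proj₂ (proj₂ tu))
              open Pair (tre-ups tv) (tre-ups tu) nv nu
              sub : ∀ {i} → supp v Sub.⊆ supp u → In v i ⊎ In u i → In u i
              sub s (inj₁ q) = s q
              sub s (inj₂ q) = q
              sup : ∀ {i} → supp u Sub.⊆ supp v → In v i ⊎ In u i → In v i
              sup s (inj₁ q) = q
              sup s (inj₂ q) = s q

        open TubeDegrees public

    -- The degree in affine type as a function of the Coxeter element.

    module AffineTheorem where
      open AffData

      degree : ∀ {w} → Cox w → V n → V n → ℚ
      degree = Tests.degree

      Full : ∀ {w} → AffData w → V n → V n → Set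
      Full T v u = TRe T v × TRe T u × CompFull (P T) (supp T v ∪ supp T u)

      abstract
        tre-ups : ∀ {w} (cw : Cox w) (T : AffData w) {v} → TRe T v → Ups w v
        tre-ups cw T {v} (r , p , h , _) = ups (proj₂ (real-rt r)) p (sym (Tubes.γ-D cw T v) ∙ h)

        -- The vectors are arbitrary, so the root that `OneTube` asks for is taken from the test in
        -- one direction and from the membership in `TRe` in the other.
        full? : ∀ {w} (cw : Cox w) (T : AffData w) v u → Dec (Full T v u)
        full? cw T v u = map′ (λ { h@((((_ , r) , p , z) , _) , _) → Tubes.OneTube.pair-full cw T v (ups r p z) h }) (λ h → Tubes.OneTube.full-pair cw T v (tre-ups cw T (proj₁ h)) h) (Tests.fullPair? cw v u)

        compat : ∀ {w} (cw : Cox w) (T : AffData w) v u → CompatIs T v u (degree cw v u)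
        compat cw T v u = (λ h → Tubes.OneTube.degree-full cw T v (tre-ups cw T (proj₁ h)) h) ,
          λ nh → Tests.degree-no cw λ { h@((((_ , r) , p , z) , _) , _) → nh (Tubes.OneTube.pair-full cw T v (ups r p z) h) }

        -- The value has a different formula on full pairs, so invariance is needed separately for
        -- fullness, for `adj` on full pairs and for the arrow expressions.
        degree-≡ : ∀ {w w′} (cw : Cox w) (cw′ : Cox w′) (T : AffData w) (T′ : AffData w′) {v u v′ u′} →
          (Full T v u → Full T′ v′ u′ × adj T v u ≡ adj T′ v′ u′) → (Full T′ v′ u′ → Full T v u) →
          compMax (corootCoord v) u w ≡ compMax (corootCoord v′) u′ w′ → degree cw v u ≡ degree cw′ v′ u′
        degree-≡ cw cw′ T T′ {v} {u} {v′} {u′} f g eq = go (full? cw T v u)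
          where
          go : Dec (Full T v u) → degree cw v u ≡ degree cw′ v′ u′
          go (yes h) = proj₁ (compat cw T v u) h ∙ proj₂ (f h) ∙ sym (proj₁ (compat cw′ T′ v′ u′) (proj₁ (f h)))
          go (no h) = proj₂ (compat cw T v u) h ∙ eq ∙ sym (proj₂ (compat cw′ T′ v′ u′) (h ∘ g))

        cor-δ : Cor (corootCoord δQ) δQ κ
        cor-δ = record { lam≥0 = ℚP.<⇒≤ κ>0 ; c-eq = λ i → coord i ∙ m-κ i
          ; unit-e = λ { j (inj₁ q) → ⊥-elim (δ-norm (d j , subst (IsRt (d j)) (sym q) (rt-e j))) ; j (inj₂ q) → ⊥-elim (δ-norm (d j , subst (IsRt (d j)) (sym q) (rt-ns j))) } }
          where
          coord : ∀ i → corootCoord δQ i ≡ m′ i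
          coord i = corootCoord-≡ refl refl

        imag-K : ∀ γ {v} → Imag v → K γ v ≡ 0ℚ
        imag-K γ (k , _ , refl) = Functional.scale (K-linʳ γ) (toℚ k) δQ ∙ cong (toℚ k *_) (K-δ γ) ∙ ℚP.*-zeroʳ (toℚ k)

        phi-root : ∀ {w} (T : AffData w) {v} → PhiC T v → (∃ λ N → IsRt N v) ⊎ v ≡ δQ
        phi-root T (inj₁ (i , refl)) = inj₁ (d i , rt-ns i)
        phi-root T (inj₂ (inj₁ (inj₁ r , _))) = inj₁ (real-rt r)
        phi-root T (inj₂ (inj₁ (inj₂ im , _ , h))) = ⊥-elim (h (imag-K (γ T) im))
        phi-root T (inj₂ (inj₂ (inj₁ (r , _)))) = inj₁ (real-rt r)
        phi-root T (inj₂ (inj₂ (inj₂ q))) = inj₂ q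

        phi-kind : ∀ {w} (T : AffData w) {v} → PhiC T v → Kind v
        phi-kind T (inj₁ (i , q)) = isNeg i q
        phi-kind T (inj₂ (inj₁ (_ , p , _))) = isPos p
        phi-kind T (inj₂ (inj₂ (inj₁ (_ , p , _)))) = isPos p
        phi-kind T (inj₂ (inj₂ (inj₂ refl))) = isPos δ-pos

        s-δ : ∀ i → s i δQ ≡ δQ
        s-δ i = s-null i δQ (δ-null i)

        phi-typ : ∀ {w} (T : AffData w) {v} i → PhiC T v → Typ i v (σ i v)
        phi-typ T {v} i φ = go (phi-root T φ) (phi-kind T φ)
          where
          go : (∃ λ N → IsRt N v) ⊎ v ≡ δQ → Kind v → Typ i v (σ i v)
          go _ (isNeg j refl) = σ-typ-neg i j
          go (inj₁ (_ , r)) (isPos p) = σ-typ-rt i r p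
          go (inj₂ refl) _ = σ-typ-pos i δ-pos (subst Pos (sym (s-δ i)) δ-pos)

        cor-typ : ∀ {i v v′} → (∃ λ N → IsRt N v) ⊎ v ≡ δQ → Typ i v v′ → ∃ λ lam → Cor (corootCoord v) v lam × Cor (corootCoord v′) v′ lam
        cor-typ {i} {v} {v′} (inj₁ (N , r)) t = inv (N≢0 r) , cor-aff r , subst (Cor (corootCoord v′) v′) (inv-irr (N≢0 r′) (N≢0 r)) (cor-aff r′)
          where
          r′ : IsRt N v′
          r′ = rt-typ r t
        cor-typ (inj₂ q) t = κ , subst (λ x → Cor (corootCoord x) x κ) (sym q) cor-δ , subst (λ x → Cor (corootCoord x) x κ) (sym (δ-typ q t)) cor-δ
          where
          δ-typ : ∀ {i v v′} → v ≡ δQ → Typ i v v′ → v′ ≡ δQ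
          δ-typ q (fixed j _) = q
          δ-typ {i} q up = ⊥-elim (δ-norm (d i , subst (IsRt (d i)) q (rt-ns i)))
          δ-typ {i} q down = ⊥-elim (δ-norm (d i , subst (IsRt (d i)) q (rt-e i)))
          δ-typ {i} q (move _ _) = cong (s i) q ∙ s-δ i

        phi-cor : ∀ {w} (T : AffData w) {v} → PhiC T v → ∃ (Cor (corootCoord v) v)
        phi-cor T {v} φ = go (phi-root T φ)
          where
          go : (∃ λ N → IsRt N v) ⊎ v ≡ δQ → ∃ (Cor (corootCoord v) v)
          go (inj₁ (N , r)) = inv (N≢0 r) , cor-aff r
          go (inj₂ refl) = κ , cor-δ

        neg-tre : ∀ {w} (T : AffData w) {j} → ¬ TRe T (negSimple j)
        neg-tre T {j} (_ , p , _) = pos≢neg j p refl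

      -- The word enters the data only through its action on γ, which depends on the element c
      -- alone.
      reword : ∀ {w w′} → matOf w ≡ matOf w′ → AffData w → AffData w′
      reword {w} {w′} eq T = record { γ = γ T ; γ-eq = cong (_-ᵥ γ T) (sym (mat-act {w} {w′} eq (γ T))) ∙ γ-eq T ; k = k T ; P = P T ; P-spec = P-spec T ; supp = supp T ; supp-spec = supp-spec T }

      abstract
        degree-word : ∀ {w w′ v u} (cw : Cox w) (cw′ : Cox w′) → matOf w ≡ matOf w′ → (T : AffData w) → PhiC T v → PhiC T u → degree cw v u ≡ degree cw′ v u
        degree-word {w} {w′} {v} {u} cw cw′ eq T φ ψ = degree-≡ cw cw′ T (reword {w} {w′} eq T) (λ h → h , adj-eq) (λ h → h)
            (cm-word {w} {w′} cw cw′ eq (phi-kind T φ) (phi-kind T ψ) (proj₂ (phi-cor T φ)))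
          where
          adj-eq : adj T v u ≡ adj (reword {w} {w′} eq T) v u
          adj-eq = cong₂ (λ a b → toℚ (ℤ.+ ∣ ((supp T a ∪ supp T b) ∩ ∁ (supp T v)) ∩ supp T u ∣)) (mat-act {w} {w′} eq v) (rev-eq {w} {w′} (mat-act {w} {w′} eq) v)

      fun : Mat → V n → V n → ℚ
      fun M v u = pick (findWord M)
        module Fun where
        pick : Dec (∃ λ w → Cox w × matOf w ≡ M) → ℚ
        pick (yes (_ , cw , _)) = degree cw v u
        pick (no _)             = 0ℚ

      fun-val : ∀ {w v u} (cw : Cox w) (T : AffData w) → PhiC T v → PhiC T u → fun (matOf w) v u ≡ degree cw v u
      fun-val {w} {v} {u} cw T φ ψ = go (findWord (matOf w))
        where
        go : (x : Dec (∃ λ w′ → Cox w′ × matOf w′ ≡ matOf w)) → Fun.pick (matOf w) v u x ≡ degree cw v u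
        go (yes (w′ , cw′ , eq)) = sym (degree-word {w} {w′} cw cw′ (sym eq) T φ ψ)
        go (no q) = ⊥-elim (q (w , cw , refl))

      data Move (i : Fin n) : List (Fin n) → List (Fin n) → Set where
        front : ∀ {u} → Cox (i ∷ u) → Move i (i ∷ u) (u ++ i ∷ [])
        back  : ∀ {u} → Cox (i ∷ u) → Move i (u ++ i ∷ []) (i ∷ u)

      abstract
        move-cox : ∀ {i w w′} → Move i w w′ → Cox w
        move-cox (front c) = c
        move-cox (back {u} c) = cox-↭ (snoc↭ _ u) c

        move-cox′ : ∀ {i w w′} → Move i w w′ → Cox w′
        move-cox′ (front {u} c) = cox-↭ (snoc↭ _ u) c
        move-cox′ (back c) = c

        move-conj : ∀ {i w w′} → Move i w w′ → conj i (matOf w) ≡ matOf w′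
        move-conj {i} (front {u} _) = conj-front i u
        move-conj {i} (back {u} _) = conj-back i u

        move-end : ∀ {i w w′} → Move i w w′ → Initial i (matOf w) ⊎ Final i (matOf w)
        move-end (front c) = inj₁ (word-initial c)
        move-end {i} (back {u} c) = inj₂ (word-final {i} {u} (cox-↭ (snoc↭ i u) c))

        end-move : ∀ {i w} → Cox w → Initial i (matOf w) ⊎ Final i (matOf w) → ∃₂ λ x x′ → Move i x x′ × matOf x ≡ matOf w
        end-move cw (inj₁ h) = let (u , c , eq) = initial-word cw h in _ , _ , front c , eq
        end-move {i} cw (inj₂ h) = let (u , c , eq) = final-word cw h in u ++ i ∷ [] , i ∷ u , back (cox-↭ (↭-sym (snoc↭ i u)) c) , eq

        move-act : ∀ {i w w′} → Move i w w′ → ∀ v → actW w′ (s i v) ≡ s i (actW w v)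
        move-act {i} (front {u} _) v = act-++ u (i ∷ []) (s i v) ∙ cong (actW u) (s-invol i v) ∙ sym (s-invol i (actW u v))
        move-act {i} (back {u} _) v = cong (s i) (sym (act-++ u (i ∷ []) v))

        move-rev : ∀ {i w w′} → Move i w w′ → ∀ v → actW (reverse w′) (s i v) ≡ s i (actW (reverse w) v)
        move-rev {i} (front {u} _) v = act-rev-snoc i u (s i v) ∙ cong (s i) (sym (act-rev-∷ i u v))
        move-rev {i} (back {u} _) v = act-rev-∷ i u (s i v) ∙ cong (actW (reverse u)) (s-invol i v) ∙ sym (s-invol i (actW (reverse u) v)) ∙ cong (s i) (sym (act-rev-snoc i u v))

        -- An initial letter has defect d_i δ_i, a final one the negative of this. So α_i is not in
        -- U_c, and s_i keeps the positive roots of U_c positive.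
        move-D : ∀ {i w w′} → Move i w w′ → D w (e i) ≢ 0ℚ
        move-D {i} (front c) = >⇒≢ (subst (0ℚ <_) (sym (D-head c)) (0<* (d>0 i) (δ>0 i)))
        move-D {i} (back {u} c) h = >⇒≢ (subst (0ℚ <_) (sym (D-head c)) (0<* (d>0 i) (δ>0 i))) (solve 1 (λ x → x := :- (:- x)) refl (D (i ∷ u) (e i)) ∙
          cong -_ (sym (Functional.neg (E-linˡ (i ∷ u) δQ) (e i)) ∙ cong (D (i ∷ u)) (sym (neg-simple i)) ∙ sym (D-rot c (negSimple i)) ∙ cong (D (u ++ i ∷ [])) (s-neg i) ∙ h))

        move-cm : ∀ {i w w′ v v′ u u′ c c′ lam} → Move i w w′ → Typ i v v′ → Typ i u u′ → Cor c v lam → Cor c′ v′ lam → compMax c u w ≡ compMax c′ u′ w′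
        move-cm (front cw) t t′ C C′ = cm-inv cw t t′ C C′
        move-cm (back cw) t t′ C C′ = sym (cm-inv cw (typ-sym t) (typ-sym t′) C′ C)

      -- Transport of the affine data by a simple reflection.

      module _ {i : Fin n} where
        Sᵢ : ∀ {l} → Vec (V n) l → Vec (V n) l
        Sᵢ = Vec.map (s i)

        abstract
          lk-S : ∀ {l} (Q : Vec (V n) l) j → Sᵢ Q ! j ≡ s i (Q ! j)
          lk-S Q j = VecP.lookup-map j (s i) Q

          s-inj : ∀ {x y} → s i x ≡ s i y → x ≡ y
          s-inj {x} {y} h = sym (s-invol i x) ∙ cong (s i) h ∙ s-invol i y

          comb-S : ∀ {l} (Q : Vec (V n) l) co → sumV (λ j → co ! j ·ᵥ Sᵢ Q ! j) ≡ s i (sumV (λ j → co ! j ·ᵥ Q ! j))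
          comb-S Q co = sumV-cong (λ j → cong (lookup co j ·ᵥ_) (lk-S Q j) ∙ sym (Linear.scale (s-lin i) (co ! j) (Q ! j))) ∙ sym (Linear.sum (s-lin i) (λ j → co ! j ·ᵥ Q ! j))

          K-S : ∀ {l} (Q : Vec (V n) l) a b → K (Sᵢ Q ! a) (Sᵢ Q ! b) ≡ K (Q ! a) (Q ! b)
          K-S Q a b = cong₂ K (lk-S Q a) (lk-S Q b) ∙ K-s i (Q ! a) (Q ! b)

          conn⇒ : ∀ {l} (Q : Vec (V n) l) {a b} → Conn Q a b → Conn (Sᵢ Q) a b
          conn⇒ Q ε = ε
          conn⇒ Q {a} (_◅_ {j = b} h c) = (λ z → h (sym (K-S Q a b) ∙ z)) ◅ conn⇒ Q c

          conn⇐ : ∀ {l} (Q : Vec (V n) l) {a b} → Conn (Sᵢ Q) a b → Conn Q a b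
          conn⇐ Q ε = ε
          conn⇐ Q {a} (_◅_ {j = b} h c) = (λ z → h (K-S Q a b ∙ z)) ◅ conn⇐ Q c

          real-s : ∀ {v} → RealRoot v → RealRoot (s i v)
          real-s (w , j , q) = i ∷ w , j , cong (s i) q

          K-e-s : ∀ {γ} → K γ (e i) ≢ 0ℚ → K (s i γ) (e i) ≢ 0ℚ
          K-e-s {γ} ne z = ne (solve 1 (λ x → x := :- (:- x)) refl (K γ (e i)) ∙ cong -_ (sym (Functional.neg (K-linʳ γ) (e i)) ∙ cong (K γ) (sym (neg-simple i) ∙ sym (s-e i)) ∙
            sym (K-s i γ (s i (e i))) ∙ cong (K (s i γ)) (s-invol i (e i)) ∙ z))

          ups-s : ∀ {γ v} → K γ (e i) ≢ 0ℚ → UpsPos γ v → UpsPos (s i γ) (s i v)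
          ups-s {γ} {v} ne (inj₁ r , p , h) = inj₁ (real-s r) , pos-s i (proj₂ (real-rt r)) p (λ q → ne (cong (K γ) (sym q) ∙ h)) , K-s i γ v ∙ h
          ups-s {γ} {v} ne (inj₂ (z , z≢0 , q) , p , h) = inj₂ (z , z≢0 , same ∙ q) , subst Pos (sym same) p , K-s i γ v ∙ h
            where
            same : s i v ≡ v
            same = cong (s i) q ∙ Linear.scale (s-lin i) (toℚ z) δQ ∙ cong (toℚ z ·ᵥ_) (s-δ i) ∙ sym q

          ups-s⁻ : ∀ {γ v} → K γ (e i) ≢ 0ℚ → UpsPos (s i γ) v → UpsPos γ (s i v)
          ups-s⁻ {γ} {v} ne h = subst (λ g → UpsPos g (s i v)) (s-invol i γ) (ups-s {s i γ} {v} (K-e-s {γ} ne) h)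

          span⇒ : ∀ {γ γ′ l} (Q : Vec (V n) l) {S v} → NonnegSpan γ Q S v → NonnegSpan γ′ (Sᵢ Q) S (s i v)
          span⇒ Q (co , p , q , eq) = co , p , q , comb-S Q co ∙ cong (s i) eq

          span⇐ : ∀ {γ γ′ l} (Q : Vec (V n) l) {S v} → NonnegSpan γ′ (Sᵢ Q) S (s i v) → NonnegSpan γ Q S v
          span⇐ Q (co , p , q , eq) = co , p , q , s-inj (sym (comb-S Q co) ∙ eq)

      module Moved {i : Fin n} {w w′ : List (Fin n)} (mv : Move i w w′) (T : AffData w) where
        abstract
          K-e≢0 : K (γ T) (e i) ≢ 0ℚ
          K-e≢0 h = move-D mv (sym (Tubes.γ-D (move-cox mv) T (e i)) ∙ h)

          K-e≢0′ : K (s i (γ T)) (e i) ≢ 0ℚ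
          K-e≢0′ = K-e-s {γ = γ T} K-e≢0

          K-flip : ∀ v → K (γ T) (s i v) ≡ K (s i (γ T)) v
          K-flip v = sym (K-s i (γ T) (s i v)) ∙ cong (K (s i (γ T))) (s-invol i v)

          piC : IsPiC (s i (γ T)) (Sᵢ {i} (P T))
          piC = (λ j → subst (UpsPos (s i (γ T))) (sym (lk-S (P T) j)) (ups-s {γ = γ T} {v = P T ! j} K-e≢0 (proj₁ (P-spec T) j))) ,
            (λ a b q → proj₁ (proj₂ (P-spec T)) a b (s-inj (sym (lk-S (P T) a) ∙ q ∙ lk-S (P T) b))) ,
            (λ v h → subst (NonnegSpan (s i (γ T)) (Sᵢ {i} (P T)) ⊤) (s-invol i v) (span⇒ {γ = γ T} {γ′ = s i (γ T)} (P T) (proj₁ (proj₂ (proj₂ (P-spec T))) (s i v) (ups-s⁻ {γ = γ T} {v = v} K-e≢0 h)))) ,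
            λ S ne all → proj₂ (proj₂ (proj₂ (P-spec T))) S ne (λ v h → span⇐ {γ = γ T} {γ′ = s i (γ T)} (P T) (all (s i v) (ups-s {γ = γ T} {v = v} K-e≢0 h)))

        -- Supports are pulled back along s_i and the elements of Π_c keep their indices, so
        -- coefficients, components and fullness are literally the same before and after the move.
        T′ : AffData w′
        T′ = record
          { γ = s i (γ T)
          ; γ-eq = cong (_-ᵥ s i (γ T)) (move-act mv (γ T)) ∙ sym (Linear.sub (s-lin i) (actW w (γ T)) (γ T)) ∙ cong (s i) (γ-eq T) ∙ s-δ i
          ; k = k T
          ; P = Sᵢ {i} (P T)
          ; P-spec = piC
          ; supp = λ v → supp T (s i v)
          ; supp-spec = λ v r h → let (co , eq , (j₀ , cn) , sp) = supp-spec T (s i v) (real-s r) (K-flip v ∙ h) in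
              co , comb-S (P T) co ∙ cong (s i) eq ∙ s-invol i v , (j₀ , λ j ne → conn⇒ (P T) (cn j ne)) , sp }

        abstract
          full⇒ : ∀ {S S′} → S ≡ S′ → CompFull (P T) S → CompFull (P T′) S′
          full⇒ refl (j , h) = j , λ l c → h l (conn⇐ (P T) c)

          full⇐ : ∀ {S S′} → S ≡ S′ → CompFull (P T′) S′ → CompFull (P T) S
          full⇐ refl (j , h) = j , λ l c → h l (conn⇒ (P T) c)

          supp-moved : ∀ v → supp T v ≡ supp T′ (s i v)
          supp-moved v = cong (supp T) (sym (s-invol i v))

          tre-s : ∀ {v} → TRe T v → TRe T′ (s i v)
          tre-s {v} (r , p , h , nf) = real-s r , pos-s i (proj₂ (real-rt r)) p (λ q → K-e≢0 (cong (K (γ T)) (sym q) ∙ h)) , K-s i (γ T) v ∙ h , nf ∘ full⇐ (supp-moved v)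

          tre-typ : ∀ {v v′} → Typ i v v′ → TRe T v → v′ ≡ s i v
          tre-typ (fixed j _) t = ⊥-elim (neg-tre T t)
          tre-typ up t = ⊥-elim (neg-tre T t)
          tre-typ down (_ , _ , h , _) = ⊥-elim (K-e≢0 h)
          tre-typ (move _ _) t = refl

          tre⇒ : ∀ {v v′} → Typ i v v′ → TRe T v → TRe T′ v′
          tre⇒ t h = subst (TRe T′) (sym (tre-typ t h)) (tre-s h)

          tre⇐ : ∀ {v v′} → Typ i v v′ → TRe T′ v′ → TRe T v × v′ ≡ s i v
          tre⇐ (fixed j _) h = ⊥-elim (neg-tre T′ h)
          tre⇐ up (_ , _ , h , _) = ⊥-elim (K-e≢0′ h)
          tre⇐ down h = ⊥-elim (neg-tre T′ h)
          tre⇐ (move {v} p _) (r , _ , h , nf) = (subst RealRoot (s-invol i v) (real-s r) , p , sym (K-s i (γ T) v) ∙ h , nf ∘ full⇒ (supp-moved v)) , refl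

          supp-∪ : ∀ {v v′ u u′} → v′ ≡ s i v → u′ ≡ s i u → supp T v ∪ supp T u ≡ supp T′ v′ ∪ supp T′ u′
          supp-∪ {v} {u = u} refl refl = cong₂ _∪_ (supp-moved v) (supp-moved u)

          adj-s : ∀ {v v′ u u′} → v′ ≡ s i v → u′ ≡ s i u → adj T v u ≡ adj T′ v′ u′
          adj-s {v} {u = u} refl refl = cong (λ S → toℚ (ℤ.+ ∣ S ∣)) (cong₂ _∩_ (cong₂ _∩_ (cong₂ _∪_ (supp-moved (actW w v) ∙ cong (supp T′) (sym (move-act mv v))) (supp-moved (actW (reverse w) v) ∙ cong (supp T′) (sym (move-rev mv v)))) (cong ∁ (supp-moved v))) (supp-moved u))

          phi-s : ∀ {v} → PhiC T v → PhiC T′ (σ i v)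
          phi-s {v} φ = go φ (phi-typ T i φ)
            where
            go : ∀ {v′} → PhiC T v → Typ i v v′ → PhiC T′ v′
            go _ (fixed j _) = inj₁ (j , refl)
            go _ up = inj₂ (inj₁ (inj₁ ([] , i , refl) , e-nonneg i , K-e≢0′))
            go _ down = inj₁ (i , refl)
            go (inj₁ (j , refl)) (move p _) = ⊥-elim (pos≢neg j p refl)
            go (inj₂ (inj₁ (inj₁ r , _ , h))) (move _ q) = inj₂ (inj₁ (inj₁ (real-s r) , q , λ z → h (sym (K-s i (γ T) v) ∙ z)))
            go (inj₂ (inj₁ (inj₂ im , _ , h))) _ = ⊥-elim (h (imag-K (γ T) im))
            go (inj₂ (inj₂ (inj₁ t))) (move _ _) = inj₂ (inj₂ (inj₁ (tre-s t)))
            go (inj₂ (inj₂ (inj₂ refl))) (move _ _) = inj₂ (inj₂ (inj₂ (s-δ i)))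

          degree-move : ∀ {v u} → PhiC T v → PhiC T u → degree (move-cox mv) v u ≡ degree (move-cox′ mv) (σ i v) (σ i u)
          degree-move {v} {u} φ ψ = degree-≡ (move-cox mv) (move-cox′ mv) T T′
              (λ { (hv , hu , f) → (tre⇒ tv hv , tre⇒ tu hu , full⇒ (supp-∪ (tre-typ tv hv) (tre-typ tu hu)) f) , adj-s (tre-typ tv hv) (tre-typ tu hu) })
              (λ { (hv , hu , f) → proj₁ (tre⇐ tv hv) , proj₁ (tre⇐ tu hu) , full⇐ (supp-∪ (proj₂ (tre⇐ tv hv)) (proj₂ (tre⇐ tu hu))) f })
              (let (_ , C , C′) = cor-typ (phi-root T φ) tv in move-cm mv tv tu C C′)
            where
            tv : Typ i v (σ i v)
            tv = phi-typ T i φ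
            tu : Typ i u (σ i u)
            tu = phi-typ T i ψ

      open Moved using (T′; phi-s; degree-move)

      abstract
        -- The special root is found from a splitting of w chosen through the proof of `Cox w`, so
        -- `degree` could depend on that proof; the data T show that it does not.
        degree-irr : ∀ {w v u} (cw cw′ : Cox w) (T : AffData w) → PhiC T v → PhiC T u → degree cw v u ≡ degree cw′ v u
        degree-irr {w} cw cw′ T φ ψ = degree-word {w} {w} cw cw′ refl T φ ψ

        degree-negˡ : ∀ {w} (cw : Cox w) (T : AffData w) i u → degree cw (negSimple i) u ≡ u ! i
        degree-negˡ {w} cw T i u = proj₂ (compat cw T (negSimple i) u) (λ h → neg-tre T (proj₁ h)) ∙ cm-negˡ (corootCoord (negSimple i)) i u w (cor-neg i (cor-aff (rt-ns i)))

        degree-negʳ : ∀ {w} (cw : Cox w) (T : AffData w) v i → degree cw v (negSimple i) ≡ corootCoord v i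
        degree-negʳ {w} cw T v i = proj₂ (compat cw T v (negSimple i)) (λ h → neg-tre T (proj₁ (proj₂ h))) ∙ cm-negʳ (corootCoord v) i w

        δ-tre : ∀ {w} (T : AffData w) → ¬ TRe T δQ
        δ-tre T (r , _) = δ-norm (real-rt r)

        compMax-0 : ∀ {w c v u lam} → Cox w → Cor c v lam → Pos v → Pos u → E w v u ≡ 0ℚ → E w u v ≡ 0ℚ → compMax c u w ≡ 0ℚ
        compMax-0 {w} {c} {v} {u} {lam} cw C p q z z′ = Coroot.cm-pos c v lam (Cor.lam≥0 C) (Cor.c-eq C) cw p u q ∙ cong₂ (λ x y → (- (lam * x)) ⊔ (- (lam * y))) z z′ ∙
          ℚP.⊔-idem (- (lam * 0ℚ)) ∙ solve 1 (λ l → :- (l :* con 0ℚ) := con 0ℚ) refl lam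

        -- Pairing with δ in either order is the defect up to sign, and tube roots and δ have defect
        -- 0. This is (P4).
        degree-δ : ∀ {w} (cw : Cox w) (T : AffData w) {v} → TRe T v ⊎ v ≡ δQ → degree cw δQ v ≡ 0ℚ × degree cw v δQ ≡ 0ℚ
        degree-δ {w} cw T {v} h = proj₂ (compat cw T δQ v) (λ f → δ-tre T (proj₁ f)) ∙ compMax-0 cw cor-δ δ-pos (pos h) Eδ (D0 h) ,
            proj₂ (compat cw T v δQ) (λ f → δ-tre T (proj₁ (proj₂ f))) ∙ compMax-0 cw (cor h) (pos h) δ-pos (D0 h) Eδ
          where
          pos : TRe T v ⊎ v ≡ δQ → Pos v
          pos (inj₁ (_ , p , _)) = p
          pos (inj₂ refl) = δ-pos
          D0 : TRe T v ⊎ v ≡ δQ → D w v ≡ 0ℚ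
          D0 (inj₁ t) = D≡0 (tre-ups cw T t)
          D0 (inj₂ refl) = D-δ cw
          Eδ : E w δQ v ≡ 0ℚ
          Eδ = E-δ cw v ∙ cong -_ (D0 h)
          cor : (h : TRe T v ⊎ v ≡ δQ) → Cor (corootCoord v) v (proj₁ (phi-cor T (inj₂ (inj₂ h))))
          cor h = proj₂ (phi-cor T (inj₂ (inj₂ h)))

        degree-circ : ∀ {w} (cw : Cox w) (T : AffData w) {v u} → TRe T v → TRe T u → CircIs T v u (degree cw v u)
        degree-circ cw T {v} {u} t t′ = Tubes.OneTube.compat-circ cw T v (tre-ups cw T t) t t′ (compat cw T v u)

        fun-props : Props fun
        fun-props =
          (λ w ow T i u φ → fun-val (cox-ordering ow) T (inj₁ (i , refl)) φ ∙ degree-negˡ (cox-ordering ow) T i u) ,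
          (λ w ow T i v φ → fun-val (cox-ordering ow) T φ (inj₁ (i , refl)) ∙ degree-negʳ (cox-ordering ow) T v i) ,
          (λ w ow T v u t t′ → subst (CircIs T v u) (sym (fun-val (cox-ordering ow) T (inj₂ (inj₂ (inj₁ t))) (inj₂ (inj₂ (inj₁ t′))))) (degree-circ (cox-ordering ow) T t t′)) ,
          (λ w ow T v h → let (a , b) = degree-δ (cox-ordering ow) T h in
            fun-val (cox-ordering ow) T (inj₂ (inj₂ (inj₂ refl))) (inj₂ (inj₂ h)) ∙ a , fun-val (cox-ordering ow) T (inj₂ (inj₂ h)) (inj₂ (inj₂ (inj₂ refl))) ∙ b) ,
          λ w ow T i h v u φ ψ → let (x , x′ , mv , eq) = end-move (cox-ordering ow) h in moved {w} {x} {x′} {i} T mv eq v u φ ψ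
          where
          moved : ∀ {w x x′ i} (T : AffData w) → Move i x x′ → matOf x ≡ matOf w → ∀ v u → PhiC T v → PhiC T u → fun (matOf w) v u ≡ fun (conj i (matOf w)) (σ i v) (σ i u)
          moved {w} {x} {x′} {i} T mv eq v u φ ψ = cong (λ M → fun M v u) (sym eq) ∙ fun-val (move-cox mv) Tx φ ψ ∙ degree-move mv Tx φ ψ ∙
              sym (fun-val (move-cox′ mv) (T′ mv Tx) (phi-s mv Tx φ) (phi-s mv Tx ψ)) ∙ cong (λ M → fun M (σ i v) (σ i u)) (sym (move-conj mv) ∙ cong (conj i) eq)
            where
            Tx : AffData x
            Tx = reword {w} {x} (sym eq) T

      -- Walks in both directions and uniqueness in affine type.

      data Walk : List (Fin n) → V n → Set where
        stop : ∀ {i w w′} → Move i w w′ → Walk w (e i)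
        step : ∀ {i w w′ v} → Move i w w′ → v ≢ e i → Walk w′ (s i v) → Walk w v

      abstract
        fwd-walk : ∀ {w v} → Cox w → Fwd w v → Walk w v
        fwd-walk cw (stop {i} {u}) = stop (front cw)
        fwd-walk cw (step {i} {u} ne f) = step (front cw) ne (fwd-walk (cox-↭ (snoc↭ i u) cw) f)

        -- Moving the first letter of w to its end means, for the reversed word, moving the last
        -- letter to the front. So a forward walk along w is a walk by final letters along
        -- `reverse w`.
        bwd-walk : ∀ {w v} → Cox w → Fwd w v → Walk (reverse w) v
        bwd-walk {i ∷ u} {v} cw f = subst (λ x → Walk x v) (sym (rev-∷ i u)) (go f)
          where
          cw′ : Cox (i ∷ reverse u)
          cw′ = cox-↭ (Perm.prep i (↭-sym (PermP.↭-reverse u))) cw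
          go : ∀ {v} → Fwd (i ∷ u) v → Walk (reverse u ++ i ∷ []) v
          go stop = stop (back cw′)
          go (step {v = v} ne f) = step (back cw′) ne (subst (λ x → Walk x (s i v)) (ListP.reverse-++ u (i ∷ [])) (bwd-walk (cox-↭ (snoc↭ i u) cw) f))

        -- The sign of the defect selects the direction: reversing the word changes it, and the
        -- forward walk along the reversed word is turned into a walk by final letters of w.
        walk : ∀ {w N v} → Cox w → IsRt N v → Pos v → D w v ≢ 0ℚ → Walk w v
        walk {w} {N} {v} cw r p ne = go (ℚP.<-cmp 0ℚ (D w v))
          where
          go : Tri (0ℚ < D w v) (0ℚ ≡ D w v) (D w v < 0ℚ) → Walk w v
          go (tri< h _ _) = fwd-walk cw (fwd-affine cw r p h)
          go (tri≈ _ h _) = ⊥-elim (ne (sym h))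
          go (tri> _ _ h) = subst (λ x → Walk x v) (ListP.reverse-involutive w) (bwd-walk (cox-rev cw) (fwd-affine (cox-rev cw) r p (subst (0ℚ <_) (sym (D-rev cw v)) (<0⇒ h))))

      module Uniqueness (f : Mat → V n → V n → ℚ) (fp : Props f) where
        Agree : ∀ {w} → Cox w → V n → V n → Set
        Agree {w} cw v u = f (matOf w) v u ≡ degree cw v u

        abstract
          agree-move : ∀ {i w w′} (mv : Move i w w′) (T : AffData w) {v u} → PhiC T v → PhiC T u → Agree (move-cox′ mv) (σ i v) (σ i u) → Agree (move-cox mv) v u
          agree-move {i} {w} mv T {v} {u} φ ψ h = proj₂ (proj₂ (proj₂ (proj₂ fp))) w (ordering-cox (move-cox mv)) T i (move-end mv) v u φ ψ ∙
            cong (λ M → f M (σ i v) (σ i u)) (move-conj mv) ∙ h ∙ sym (degree-move mv T φ ψ)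

          agreeˡ : ∀ {w} (cw : Cox w) (T : AffData w) i {u} → PhiC T u → Agree cw (negSimple i) u
          agreeˡ {w} cw T i {u} ψ = proj₁ fp w (ordering-cox cw) T i u ψ ∙ sym (degree-negˡ cw T i u)

          agreeʳ : ∀ {w} (cw : Cox w) (T : AffData w) i {v} → PhiC T v → Agree cw v (negSimple i)
          agreeʳ {w} cw T i {v} φ = proj₁ (proj₂ fp) w (ordering-cox cw) T i v φ ∙ sym (degree-negʳ cw T v i)

          σ-e : ∀ i → σ i (e i) ≡ negSimple i
          σ-e i = σ-else i (e i) (λ l _ → pos≢neg l (e-nonneg i)) ∙ s-e i

          σ-walk : ∀ {i v} {w w′} (mv : Move i w w′) (T : AffData w) → (r : ∃ λ N → IsRt N v) → Pos v → K (γ T) v ≢ 0ℚ → v ≢ e i →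
            s i v ≡ σ i v × (∃ λ N → IsRt N (s i v)) × Pos (s i v) × K (γ (T′ mv T)) (s i v) ≢ 0ℚ
          σ-walk {i} {v} mv T (N , r) p h ne = sym (σ-else i v (λ l _ → pos≢neg l p)) , (N , rt-s i r) , pos-s i r p ne , λ z → h (sym (K-s i (γ T) v) ∙ z)

          real-phi : ∀ {w} (T : AffData w) {v} → (∃ λ N → IsRt N v) → Pos v → K (γ T) v ≢ 0ℚ → PhiC T v
          real-phi T (_ , r) p h = inj₂ (inj₁ (inj₁ (rt-real r) , p , h))

          -- The data are transported along the walk, so the induction runs over all words and data
          -- at once. At its end the first argument is a negative simple root and (P1) decides; in
          -- `walkʳ` it is the second argument, and (P2).
          walkˡ : ∀ {w v u} (cw : Cox w) (T : AffData w) → Walk w v → (∃ λ N → IsRt N v) → Pos v → K (γ T) v ≢ 0ℚ → PhiC T u → Agree cw v u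
          walkˡ {u = u} cw T (stop {i} mv) r p h ψ = agree-move mv T (real-phi T r p h) ψ (subst (λ t → Agree (move-cox′ mv) t (σ i u)) (sym (σ-e i)) (agreeˡ (move-cox′ mv) (T′ mv T) i (phi-s mv T ψ))) ∙
            degree-irr (move-cox mv) cw T (real-phi T r p h) ψ
          walkˡ {v = v} {u} cw T (step {i} mv ne wk) r p h ψ = let (eq , r′ , p′ , h′) = σ-walk mv T r p h ne in
            agree-move mv T (real-phi T r p h) ψ (subst (λ t → Agree (move-cox′ mv) t (σ i u)) eq (walkˡ (move-cox′ mv) (T′ mv T) wk r′ p′ h′ (phi-s mv T ψ))) ∙
            degree-irr (move-cox mv) cw T (real-phi T r p h) ψ

          walkʳ : ∀ {w v u} (cw : Cox w) (T : AffData w) → Walk w u → (∃ λ N → IsRt N u) → Pos u → K (γ T) u ≢ 0ℚ → PhiC T v → Agree cw v u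
          walkʳ {v = v} cw T (stop {i} mv) r p h φ = agree-move mv T φ (real-phi T r p h) (subst (Agree (move-cox′ mv) (σ i v)) (sym (σ-e i)) (agreeʳ (move-cox′ mv) (T′ mv T) i (phi-s mv T φ))) ∙
            degree-irr (move-cox mv) cw T φ (real-phi T r p h)
          walkʳ {v = v} {u} cw T (step {i} mv ne wk) r p h φ = let (eq , r′ , p′ , h′) = σ-walk mv T r p h ne in
            agree-move mv T φ (real-phi T r p h) (subst (Agree (move-cox′ mv) (σ i v)) eq (walkʳ (move-cox′ mv) (T′ mv T) wk r′ p′ h′ (phi-s mv T φ))) ∙
            degree-irr (move-cox mv) cw T φ (real-phi T r p h)

          walks : ∀ {w v} (cw : Cox w) (T : AffData w) → (∃ λ N → IsRt N v) → Pos v → K (γ T) v ≢ 0ℚ → Walk w v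
          walks {v = v} cw T (_ , r) p h = walk cw r p (λ z → h (Tubes.γ-D cw T v ∙ z))

          circ-unique : ∀ {w} (T : AffData w) {v u q r} → CircIs T v u q → CircIs T v u r → q ≡ r
          circ-unique T {v} {u} {q} {r} (a , b , c) (a′ , b′ , c′) = go (v ≟ᵥ u) ((supp T v SubP.⊂? supp T u) ⊎-dec (supp T u SubP.⊂? supp T v))
            where
            go : Dec (v ≡ u) → Dec (supp T v ⊂ supp T u ⊎ supp T u ⊂ supp T v) → q ≡ r
            go (yes h) _ = a h ∙ sym (a′ h)
            go (no h) (yes z) = b h z ∙ sym (b′ h z)
            go (no h) (no z) = c h z ∙ sym (c′ h z)

          agree : ∀ {w v u} (cw : Cox w) (T : AffData w) → PhiC T v → PhiC T u → Agree cw v u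
          agree cw T (inj₁ (i , refl)) ψ = agreeˡ cw T i ψ
          agree cw T (inj₂ (inj₁ (inj₁ r , p , h))) ψ = walkˡ cw T (walks cw T (real-rt r) p h) (real-rt r) p h ψ
          agree cw T (inj₂ (inj₁ (inj₂ im , _ , h))) _ = ⊥-elim (h (imag-K (γ T) im))
          agree cw T φ@(inj₂ (inj₂ _)) (inj₁ (i , refl)) = agreeʳ cw T i φ
          agree cw T φ@(inj₂ (inj₂ _)) (inj₂ (inj₁ (inj₁ r , p , h))) = walkʳ cw T (walks cw T (real-rt r) p h) (real-rt r) p h φ
          agree cw T (inj₂ (inj₂ _)) (inj₂ (inj₁ (inj₂ im , _ , h))) = ⊥-elim (h (imag-K (γ T) im))
          agree {w} cw T (inj₂ (inj₂ (inj₁ t))) (inj₂ (inj₂ (inj₁ t′))) = circ-unique T (proj₁ (proj₂ (proj₂ fp)) w (ordering-cox cw) T _ _ t t′) (degree-circ cw T t t′)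
          agree {w} {u = u} cw T (inj₂ (inj₂ (inj₂ refl))) (inj₂ (inj₂ h)) = proj₁ (proj₁ (proj₂ (proj₂ (proj₂ fp))) w (ordering-cox cw) T u h) ∙ sym (proj₁ (degree-δ cw T h))
          agree {w} {v} cw T (inj₂ (inj₂ (inj₁ t))) (inj₂ (inj₂ (inj₂ refl))) = proj₂ (proj₁ (proj₂ (proj₂ (proj₂ fp))) w (ordering-cox cw) T v (inj₁ t)) ∙ sym (proj₂ (degree-δ cw T (inj₁ t)))

      conclusion : Conclusion
      conclusion = (fun , fun-props) , λ f fp w ow T v u φ ψ → subst (CompatIs T v u) (sym (Uniqueness.agree f fp (cox-ordering ow) T φ ψ)) (compat (cox-ordering ow) T v u)

theorem4p5 : ∀ {n} (A : CartanMatrix n) (d : Fin n → ℚ) → IsCartan A → IsSymmetrizer A d →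
      (Roots.FiniteType A d → Roots.FiniteCase.Conclusion A d) ×
      (∀ δ m → Roots.AffineType A d → Roots.IsDelta A d δ → Roots.IsDeltaVee A d m →
        Roots.AffineCase.Conclusion A d δ m)
theorem4p5 A d cart symm =
  (λ fin → Theory.FiniteTheorem.conclusion (datum A d cart symm) fin) ,
  (λ δ m aff isδ ism → Theory.AffineTheory.AffineTheorem.conclusion (datum A d cart symm) (datum δ m aff isδ ism))
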